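{- Let $H$ be the $3$-graph with seven vertices $a,b,c,d,e,f,g$ and the nine edges $abc$, $ade$, $bcd$, $bcf$, $cde$, $def$, $abg$, $cdg$, $efg$. Then the uniform Tur\'an density of $H$ is equal to $1/27$.
   Context: A $3$-graph is a $3$-uniform hypergraph; $xyz$ denotes the edge $\{x,y,z\}$. A $3$-graph $G$ on $n$ vertices is $(d,\varepsilon)$-dense if every subset $W$ of its vertices induces at least $d\binom{|W|}{3}-\varepsilon n^3$ edges. The uniform Tur\'an density of a $3$-graph $H_0$ is the supremum of all $d\in[0,1]$ such that for every $\varepsilon>0$ there exist arbitrarily large $(d,\varepsilon)$-dense $3$-graphs not containing $H_0$ as a (not necessarily induced) subhypergraph. -}

module Defs where

open import Data.Bool using (Bool; true; false; _∧_)
open import Data.Nat using (ℕ; zero; suc; _≥_; _^_)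
open import Data.Nat.Combinatorics using (_C_)
open import Data.Integer using (+_)
open import Data.Fin using (Fin; #_)
open import Data.Fin.Subset using (Subset; _⊆_; ⁅_⁆; _∪_; ∣_∣; inside; outside)
open import Data.Fin.Subset.Properties using (_⊆?_)
open import Data.List using (List; []; _∷_; _++_; map; filter; length)
open import Data.List.Relation.Unary.All using (All)
open import Data.Vec using (Vec; []; _∷_)
open import Data.Product using (Σ; _×_; ∃; ∃-syntax; _,_)
open import Data.Rational using (ℚ; _/_; _≤_; _<_; _*_; _-_; 0ℚ; 1ℚ)
open import Relation.Nullary using (¬_; _×-dec_)
open import Relation.Nullary.Decidable using (does)
open import Relation.Binary.PropositionalEquality using (_≡_)
open import Function.Definitions using (Injective)
import Data.Nat as ℕ

-- A 3-graph on the vertex set Fin n: a Boolean marking of subsets of Fin n.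
-- Only 3-element subsets count: S is an edge iff ∣ S ∣ ≡ 3 and G S ≡ true.
ThreeGraph : ℕ → Set
ThreeGraph n = Subset n → Bool

IsEdge : ∀ {n} → ThreeGraph n → Subset n → Set
IsEdge G S = (∣ S ∣ ≡ 3) × (G S ≡ true)

triple : ∀ {n} → Fin n → Fin n → Fin n → Subset n
triple x y z = ⁅ x ⁆ ∪ (⁅ y ⁆ ∪ ⁅ z ⁆)

allSubsets : (n : ℕ) → List (Subset n)
allSubsets zero = [] ∷ []
allSubsets (suc n) = map (outside ∷_) (allSubsets n) ++ map (inside ∷_) (allSubsets n)

edgesIn : ∀ {n} → ThreeGraph n → Subset n → ℕ
edgesIn {n} G W =
  length (filter (λ S → (S ⊆? W) ×-dec (∣ S ∣ ℕ.≟ 3)) (Data.List.filter (λ S → G S Data.Bool.≟ true) (allSubsets n)))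
  where import Data.List; import Data.Bool

ℕtoℚ : ℕ → ℚ
ℕtoℚ m = (+ m) / 1

Dense : ∀ {n} → ℚ → ℚ → ThreeGraph n → Set
Dense {n} d ε G = (W : Subset n) →
  d * ℕtoℚ (∣ W ∣ C 3) - ε * ℕtoℚ (n ^ 3) ≤ ℕtoℚ (edgesIn G W)

a b c d e f g : Fin 7
a = # 0
b = # 1
c = # 2
d = # 3
e = # 4
f = # 5
g = # 6

edgesH : List (Vec (Fin 7) 3)
edgesH = (a ∷ b ∷ c ∷ []) ∷ (a ∷ d ∷ e ∷ []) ∷ (b ∷ c ∷ d ∷ []) ∷ (b ∷ c ∷ f ∷ [])
       ∷ (c ∷ d ∷ e ∷ []) ∷ (d ∷ e ∷ f ∷ []) ∷ (a ∷ b ∷ g ∷ []) ∷ (c ∷ d ∷ g ∷ [])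
       ∷ (e ∷ f ∷ g ∷ []) ∷ []

ContainsH : ∀ {n} → ThreeGraph n → Set
ContainsH {n} G = Σ (Fin 7 → Fin n) λ φ → Injective _≡_ _≡_ φ ×
  All (λ { (x ∷ y ∷ z ∷ []) → IsEdge G (triple (φ x) (φ y) (φ z)) }) edgesH

Achievable : ℚ → Set
Achievable δ = (0ℚ ≤ δ) × (δ ≤ 1ℚ) ×
  ((ε : ℚ) → 0ℚ < ε → (N : ℕ) →
    ∃[ n ] (n ≥ N) × Σ (ThreeGraph n) (λ G → Dense δ ε G × ¬ ContainsH G))

UniformTuranDensityH≡ : ℚ → Set
UniformTuranDensityH≡ r =
  ((δ : ℚ) → Achievable δ → δ ≤ r) ×
  ((t : ℚ) → t < r → ∃[ δ ] Achievable δ × (t < δ))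

{-# OPTIONS --safe #-}
-- Lower bound.  Order the vertices, give the pairs random colours 0, 1, 2, and let x < y < z be an edge if
-- xy, yz, xz have colours 0, 1, 2.  The colour of a pair then tells whether the third vertex of each of its edges
-- lies to the right, to the left or in between, and no order of the vertices of H is compatible with that.
-- In place of randomness, a vertex consists of a block, a point p and a function f from points to colours, and the
-- colour of x < y is f_y(p_x): second moments over all functions give the density 1/27 on every set.
--
-- Upper bound.  Let the density exceed 1/27 on all sets.  An energy increment yields vertex sets V_0, …, V_N whose
-- degree functions deg_k(x, y) = #{z ∈ V_k : xyz ∈ G} on V_i × V_j are insensitive to passing to a subset of V_k.
-- If all inner products of deg_k and deg_l with V_k, V_l on different sides of V_i, V_j (both right, left or
-- between counting as the same side) were negligible, the pairs on which deg_k is not small would split into three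
-- classes L, R, T, and nearly every edge would span a triangle with one pair of each class; by AM–GM a positive
-- measure of triples would have edge density at most 1/27.  So some inner product of two different types is large,
-- and by Ramsey's theorem it is large for all positions of the same kind.  Ramsey's theorem also makes the inner
-- products nearly constant, so that unions of consecutive V_k have degree functions that depend, up to a small
-- error in L², only on the side.  Seven such unions, ordered C A F D B G E (or a variant), are the places for the
-- vertices of H: along the spine a b c d e f the edges are counted one at a time, the side decides which degree
-- functions can be exchanged, and the large inner product of deg_C and deg_G over A × B starts the count.
module Submission where

open import Data.Bool using (Bool; true; false; _∧_; not; T)
open import Data.Bool.ListAction using (any)
open import Data.Bool.Properties using (∧-zeroʳ)
open import Data.Empty using (⊥; ⊥-elim)
import Data.Fin as Fin
open import Data.Fin using (Fin; zero; suc; toℕ)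
import Data.Fin.Properties as Fin
import Data.Fin.Subset as Subset
open import Data.Fin.Subset using (Subset; ⁅_⁆; _∪_; inside; outside) renaming (∣_∣ to card; ⊥ to ∅)
open import Data.Fin.Subset.Properties using (_⊆?_; ∪-comm; ∪-assoc; ∪-idem; ∪-identityˡ; ∣⁅x⁆∣≡1; x∈p∪q⁻; x∈p∪q⁺; x∈⁅y⁆⇒x≡y; x∈⁅x⁆)
import Data.Integer as ℤ hiding (+_)
open import Data.Integer using (-[1+_]) renaming (+_ to pos)
import Data.Integer.Properties as ℤ
import Data.List as List
open import Data.List using (List; []; _∷_; _++_; map; length; filterᵇ; take; drop; upTo; concatMap; applyUpTo; filter)
open import Data.List.Membership.Propositional using (_∈_)
open import Data.List.Membership.Propositional.Properties using (∈-++⁺ˡ; ∈-++⁺ʳ; ∈-upTo⁻; ∈-applyUpTo⁻; ∈-map⁺; ∈-upTo⁺)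
open import Data.List.Properties using (++-assoc; map-∘; drop-drop; length-++; length-map; length-upTo; length-take; length-drop; length-applyUpTo)
open import Data.List.Relation.Binary.Sublist.Propositional using (_⊆_; []; _∷_; _∷ʳ_; ⊆-trans; minimum)
open import Data.List.Relation.Binary.Sublist.Propositional.Properties using (take-⊆)
import Data.List.Relation.Unary.All as All
open import Data.List.Relation.Unary.All using (All; []; _∷_)
import Data.List.Relation.Unary.All.Properties as All
open import Data.List.Relation.Unary.AllPairs using (AllPairs; []; _∷_)
import Data.List.Relation.Unary.AllPairs.Properties as AllPairs
open import Data.List.Relation.Unary.Any using (here; there)
open import Data.Nat using (ℕ; zero; suc; _+_; _*_; _∸_; _^_; _≤_; _<_; z≤n; s≤s; z<s; ∣_-_∣; NonZero; _≟_; _≤?_; _<?_; _≤ᵇ_; _/_; _%_; _⊔_)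
open import Data.Nat.Combinatorics using (nC1≡n; nCk+nC[k+1]≡[n+1]C[k+1]) renaming (_C_ to _choose_)
open import Data.Nat.Coprimality using (Coprime; 1-coprimeTo)
open import Data.Nat.DivMod using (m<n⇒m%n≡m; m≥n⇒m/n>0; m≡m%n+[m/n]*n; m%n<n; m/n*n≤m; /-monoˡ-≤; m*n/n≡m)
open import Data.Nat.Properties
open import Data.Nat.Tactic.RingSolver using (solve-∀)
open import Data.Product using (Σ; ∃-syntax; _×_; _,_; proj₁; proj₂)
import Data.Rational as ℚ
open import Data.Rational using (ℚ; mkℚ; 0ℚ; 1ℚ)
import Data.Rational.Properties as ℚ
import Data.Rational.Unnormalised as ℚᵘ
import Data.Rational.Unnormalised.Properties as ℚᵘ
open import Data.Sum using (_⊎_; inj₁; inj₂; [_,_]′)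
open import Data.Unit using (⊤; tt)
import Data.Vec as Vec
import Data.Vec.Properties as Vec
open import Defs hiding (a; b; c; d; e; f; g)
open import Function using (_∘_; id; case_of_)
open import Relation.Binary.Definitions using (tri<; tri≈; tri>)
open import Relation.Binary.PropositionalEquality using (_≡_; _≢_; refl; sym; trans; cong; cong₂; subst; subst₂; module ≡-Reasoning)
open import Relation.Nullary using (_×-dec_; ¬_; Dec; yes; no; does; toSum)
open import Relation.Nullary.Decidable using (decidable-stable; from-yes; _→-dec_)
open import Relation.Nullary.Negation using (contradiction)
open import Relation.Unary using (Decidable)

-- All estimates are carried out in ℕ: an inequality between averages is multiplied by its
-- denominators, and an error `1 / K` appears as a factor `K` on the other side. A probability
-- measure is a list with repetitions; cutting one block and repeating the others keeps all lengths
-- equal, so that nothing has to be renormalised. The price is that the argument ends with measures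
-- while density is assumed for sets; the edge count is multi-affine, which bridges this. Two
-- regularisations are nested. The one for edge degrees provides the blocks on which the colour
-- classes are defined; the one for the colour classes takes place inside these blocks and serves
-- only to count triangles. The constants of the inner one come before those of the outer one,
-- because they decide how large an overlap must be to count as large. Regularity in a single vertex
-- set is weak. It suffices because, along the spine of `H`, every other edge can be inserted at one
-- of its vertices while the remaining weight is free of that vertex.

infixr 5 ∑

-- Finite sums over lists.

∑ : {A : Set} → List A → (A → ℕ) → ℕ
∑ []       f = 0
∑ (x ∷ xs) f = f x + ∑ xs f

syntax ∑ xs (λ x → e) = ∑[ x ← xs ] e

𝟙 : Bool → ℕ
𝟙 true  = 1
𝟙 false = 0

module _ {A : Set} where

  ∑-cong : (xs : List A) {f g : A → ℕ} → (∀ x → f x ≡ g x) → ∑ xs f ≡ ∑ xs g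
  ∑-cong []       h = refl
  ∑-cong (x ∷ xs) h = cong₂ _+_ (h x) (∑-cong xs h)

  ∑-mono : (xs : List A) {f g : A → ℕ} → (∀ x → f x ≤ g x) → ∑ xs f ≤ ∑ xs g
  ∑-mono []       h = z≤n
  ∑-mono (x ∷ xs) h = +-mono-≤ (h x) (∑-mono xs h)

  ∑-+ : (xs : List A) (f g : A → ℕ) → (∑[ x ← xs ] f x + g x) ≡ ∑ xs f + ∑ xs g
  ∑-+ []       f g = refl
  ∑-+ (x ∷ xs) f g = trans (cong (f x + g x +_) (∑-+ xs f g)) (+-interchange (f x) (g x) (∑ xs f) (∑ xs g))
    where
    +-interchange : ∀ m n o p → m + n + (o + p) ≡ m + o + (n + p)
    +-interchange = solve-∀

  ∑-* : (c : ℕ) (xs : List A) (f : A → ℕ) → (∑[ x ← xs ] c * f x) ≡ c * ∑ xs f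
  ∑-* c []       f = sym (*-zeroʳ c)
  ∑-* c (x ∷ xs) f = trans (cong (c * f x +_) (∑-* c xs f)) (sym (*-distribˡ-+ c (f x) (∑ xs f)))

  ∑-*ʳ : (c : ℕ) (xs : List A) (f : A → ℕ) → (∑[ x ← xs ] f x * c) ≡ ∑ xs f * c
  ∑-*ʳ c xs f = trans (∑-cong xs (λ x → *-comm (f x) c)) (trans (∑-* c xs f) (*-comm c (∑ xs f)))

  ∑-const : (xs : List A) (c : ℕ) → (∑[ x ← xs ] c) ≡ length xs * c
  ∑-const []       c = refl
  ∑-const (x ∷ xs) c = cong (c +_) (∑-const xs c)

  ∑-≤ : (xs : List A) {f : A → ℕ} {c : ℕ} → (∀ x → f x ≤ c) → ∑ xs f ≤ length xs * c
  ∑-≤ xs {c = c} h = ≤-trans (∑-mono xs h) (≤-reflexive (∑-const xs c))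

  ∑-zero : (xs : List A) → (∑[ x ← xs ] 0) ≡ 0
  ∑-zero []       = refl
  ∑-zero (x ∷ xs) = ∑-zero xs

  ∑-++ : (xs ys : List A) (f : A → ℕ) → ∑ (xs ++ ys) f ≡ ∑ xs f + ∑ ys f
  ∑-++ []       ys f = refl
  ∑-++ (x ∷ xs) ys f = trans (cong (f x +_) (∑-++ xs ys f)) (sym (+-assoc (f x) (∑ xs f) (∑ ys f)))

  ∑-∈ : {xs : List A} {x : A} (f : A → ℕ) → x ∈ xs → f x ≤ ∑ xs f
  ∑-∈ f (here refl) = m≤m+n _ _
  ∑-∈ f (there {x = y} p) = ≤-trans (∑-∈ f p) (m≤n+m _ (f y))

  ∑>0 : (xs : List A) {f : A → ℕ} → 0 < ∑ xs f → ∃[ x ] x ∈ xs × 0 < f x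
  ∑>0 (x ∷ xs) {f} p with f x in eq
  ... | zero  = let y , y∈ , q = ∑>0 xs p in y , there y∈ , q
  ... | suc _ = x , here refl , subst (0 <_) (sym eq) z<s

  length-filterᵇ : (u : A → Bool) (xs : List A) → length (filterᵇ u xs) ≡ ∑[ x ← xs ] 𝟙 (u x)
  length-filterᵇ u []       = refl
  length-filterᵇ u (x ∷ xs) with u x
  ... | true  = cong suc (length-filterᵇ u xs)
  ... | false = length-filterᵇ u xs

  ∑-filterᵇ : (u : A → Bool) (xs : List A) (f : A → ℕ) → ∑ (filterᵇ u xs) f ≡ ∑[ x ← xs ] 𝟙 (u x) * f x
  ∑-filterᵇ u []       f = refl
  ∑-filterᵇ u (x ∷ xs) f with u x
  ... | true  = cong₂ _+_ (sym (+-identityʳ (f x))) (∑-filterᵇ u xs f)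
  ... | false = ∑-filterᵇ u xs f

  ∑-split : (u : A → Bool) (xs : List A) (f : A → ℕ) → ∑ xs f ≡ ∑ (filterᵇ u xs) f + ∑ (filterᵇ (not ∘ u) xs) f
  ∑-split u []       f = refl
  ∑-split u (x ∷ xs) f with u x
  ... | true  = trans (cong (f x +_) (∑-split u xs f)) (sym (+-assoc (f x) _ _))
  ... | false = trans (cong (f x +_) (∑-split u xs f)) (trans (sym (+-assoc (f x) s t)) (trans (cong (_+ t) (+-comm (f x) s)) (+-assoc s (f x) t)))
    where
    s = ∑ (filterᵇ u xs) f
    t = ∑ (filterᵇ (not ∘ u) xs) f

  length-split : (u : A → Bool) (xs : List A) → length xs ≡ length (filterᵇ u xs) + length (filterᵇ (not ∘ u) xs)
  length-split u xs = begin
    length xs ≡⟨ sym (ones xs) ⟩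
    (∑[ x ← xs ] 1) ≡⟨ ∑-split u xs (λ _ → 1) ⟩
    (∑[ x ← filterᵇ u xs ] 1) + (∑[ x ← filterᵇ (not ∘ u) xs ] 1) ≡⟨ cong₂ _+_ (ones (filterᵇ u xs)) (ones (filterᵇ (not ∘ u) xs)) ⟩
    length (filterᵇ u xs) + length (filterᵇ (not ∘ u) xs) ∎
    where
    open ≡-Reasoning
    ones : (ys : List A) → (∑[ y ← ys ] 1) ≡ length ys
    ones ys = trans (∑-const ys 1) (*-identityʳ (length ys))

  ∑-filterᵇ-≤ : (u : A → Bool) (xs : List A) (f : A → ℕ) → ∑ (filterᵇ u xs) f ≤ ∑ xs f
  ∑-filterᵇ-≤ u xs f = ≤-trans (m≤m+n _ _) (≤-reflexive (sym (∑-split u xs f)))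

  rep : ℕ → List A → List A
  rep zero    xs = []
  rep (suc c) xs = xs ++ rep c xs

  ∑-rep : (c : ℕ) (xs : List A) (f : A → ℕ) → ∑ (rep c xs) f ≡ c * ∑ xs f
  ∑-rep zero    xs f = refl
  ∑-rep (suc c) xs f = trans (∑-++ xs (rep c xs) f) (cong (∑ xs f +_) (∑-rep c xs f))

  length-rep : (c : ℕ) (xs : List A) → length (rep c xs) ≡ c * length xs
  length-rep zero    xs = refl
  length-rep (suc c) xs = trans (length-++ xs) (cong (length xs +_) (length-rep c xs))

∑-map : {A B : Set} (h : A → B) (xs : List A) (f : B → ℕ) → ∑ (map h xs) f ≡ ∑ xs (f ∘ h)
∑-map h []       f = refl
∑-map h (x ∷ xs) f = cong (f (h x) +_) (∑-map h xs f)

∑-swap : {A B : Set} (xs : List A) (ys : List B) (f : A → B → ℕ) →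
  (∑[ x ← xs ] ∑[ y ← ys ] f x y) ≡ (∑[ y ← ys ] ∑[ x ← xs ] f x y)
∑-swap []       ys f = sym (∑-zero ys)
∑-swap (x ∷ xs) ys f = trans (cong (∑ ys (f x) +_) (∑-swap xs ys f)) (sym (∑-+ ys (f x) (λ y → ∑ xs (λ x → f x y))))

∑-concatMap : {A B : Set} (h : A → List B) (xs : List A) (f : B → ℕ) → ∑ (concatMap h xs) f ≡ ∑[ x ← xs ] ∑ (h x) f
∑-concatMap h []       f = refl
∑-concatMap h (x ∷ xs) f = trans (∑-++ (h x) (concatMap h xs) f) (cong (∑ (h x) f +_) (∑-concatMap h xs f))

infixr 6 _⊗_
_⊗_ : {A B : Set} → List A → List B → List (A × B)
xs ⊗ ys = concatMap (λ x → map (x ,_) ys) xs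

module _ {A B : Set} (xs : List A) (ys : List B) where

  ∑-⊗ : (f : A × B → ℕ) → ∑ (xs ⊗ ys) f ≡ ∑[ x ← xs ] ∑[ y ← ys ] f (x , y)
  ∑-⊗ f = trans (∑-concatMap (λ x → map (x ,_) ys) xs f) (∑-cong xs (λ x → ∑-map (x ,_) ys f))

  ∑₂-cong : {f g : A → B → ℕ} → (∀ x y → f x y ≡ g x y) → (∑[ x ← xs ] ∑[ y ← ys ] f x y) ≡ (∑[ x ← xs ] ∑[ y ← ys ] g x y)
  ∑₂-cong h = ∑-cong xs (λ x → ∑-cong ys (h x))

  ∑₂-mono : {f g : A → B → ℕ} → (∀ x y → f x y ≤ g x y) → (∑[ x ← xs ] ∑[ y ← ys ] f x y) ≤ (∑[ x ← xs ] ∑[ y ← ys ] g x y)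
  ∑₂-mono h = ∑-mono xs (λ x → ∑-mono ys (h x))

  ∑₂-+ : (f g : A → B → ℕ) → (∑[ x ← xs ] ∑[ y ← ys ] f x y + g x y) ≡ (∑[ x ← xs ] ∑[ y ← ys ] f x y) + (∑[ x ← xs ] ∑[ y ← ys ] g x y)
  ∑₂-+ f g = trans (∑-cong xs (λ x → ∑-+ ys (f x) (g x))) (∑-+ xs (λ x → ∑ ys (f x)) (λ x → ∑ ys (g x)))

  ∑₂-* : (c : ℕ) (f : A → B → ℕ) → (∑[ x ← xs ] ∑[ y ← ys ] c * f x y) ≡ c * (∑[ x ← xs ] ∑[ y ← ys ] f x y)
  ∑₂-* c f = trans (∑-cong xs (λ x → ∑-* c ys (f x))) (∑-* c xs (λ x → ∑ ys (f x)))

  ∑₂-≤ : {f : A → B → ℕ} {c : ℕ} → (∀ x y → f x y ≤ c) → (∑[ x ← xs ] ∑[ y ← ys ] f x y) ≤ length xs * (length ys * c)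
  ∑₂-≤ h = ∑-≤ xs (λ x → ∑-≤ ys (h x))

length-⊗ : {A B : Set} (xs : List A) (ys : List B) → length (xs ⊗ ys) ≡ length xs * length ys
length-⊗ []       ys = refl
length-⊗ (x ∷ xs) ys = trans (length-++ (map (x ,_) ys)) (cong₂ _+_ (length-map (x ,_) ys) (length-⊗ xs ys))

𝟙≤1 : ∀ b → 𝟙 b ≤ 1
𝟙≤1 true  = ≤-refl
𝟙≤1 false = z≤n

𝟙-∧ : ∀ b c → 𝟙 (b ∧ c) ≡ 𝟙 b * 𝟙 c
𝟙-∧ true  c = sym (+-identityʳ (𝟙 c))
𝟙-∧ false c = refl

𝟙>0 : ∀ {b} → 0 < 𝟙 b → b ≡ true
𝟙>0 {true} _ = refl

-- The mixed product stands on the left so that nothing is subtracted. All variance computations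
-- below rest on this form.
∣-∣² : ∀ a b → ∣ a - b ∣ * ∣ a - b ∣ + 2 * (a * b) ≡ a * a + b * b
∣-∣² a b = [ (λ a≤b → ordered a b (b ∸ a) (sym (m+[n∸m]≡n a≤b))) , flipped ]′ (≤-total a b)
  where
  expand : ∀ a k → k * k + 2 * (a * (a + k)) ≡ a * a + (a + k) * (a + k)
  expand = solve-∀
  ordered : ∀ a b k → b ≡ a + k → ∣ a - b ∣ * ∣ a - b ∣ + 2 * (a * b) ≡ a * a + b * b
  ordered a b k refl rewrite ∣m-m+n∣≡n a k = expand a k
  flipped : b ≤ a → ∣ a - b ∣ * ∣ a - b ∣ + 2 * (a * b) ≡ a * a + b * b
  flipped b≤a = trans (cong₂ (λ d p → d * d + 2 * p) (∣-∣-comm a b) (*-comm a b))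
    (trans (ordered b a (a ∸ b) (sym (m+[n∸m]≡n b≤a))) (+-comm (b * b) (a * a)))

2ab≤a²+b² : ∀ a b → 2 * (a * b) ≤ a * a + b * b
2ab≤a²+b² a b = ≤-trans (m≤n+m _ (∣ a - b ∣ * ∣ a - b ∣)) (≤-reflexive (∣-∣² a b))

-- Induction on the list: in the square of the longer sum every new mixed term `2 * (f x * f y)` is
-- at most `f x * f x + f y * f y`.
cauchy : {A : Set} (xs : List A) (f : A → ℕ) → ∑ xs f * ∑ xs f ≤ length xs * (∑[ x ← xs ] f x * f x)
cauchy []       f = z≤n
cauchy (x ∷ xs) f = begin
  (f x + S) * (f x + S)                           ≡⟨ expand (f x) S ⟩
  f x * f x + (2 * (f x * S) + S * S)              ≤⟨ +-monoʳ-≤ (f x * f x) (+-mono-≤ cross (cauchy xs f)) ⟩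
  f x * f x + (length xs * (f x * f x) + Q + length xs * Q) ≡⟨ collect (f x) Q (length xs) ⟩
  suc (length xs) * (f x * f x + Q)                ∎
  where
  open ≤-Reasoning
  S = ∑ xs f
  Q = ∑[ y ← xs ] f y * f y
  expand : ∀ a s → (a + s) * (a + s) ≡ a * a + (2 * (a * s) + s * s)
  expand = solve-∀
  collect : ∀ a q m → a * a + (m * (a * a) + q + m * q) ≡ suc m * (a * a + q)
  collect = solve-∀
  cross : 2 * (f x * S) ≤ length xs * (f x * f x) + Q
  cross = begin
    2 * (f x * S)                          ≡⟨ cong (2 *_) (sym (∑-* (f x) xs f)) ⟩
    2 * (∑[ y ← xs ] f x * f y)            ≡⟨ sym (∑-* 2 xs (λ y → f x * f y)) ⟩
    (∑[ y ← xs ] 2 * (f x * f y))          ≤⟨ ∑-mono xs (λ y → 2ab≤a²+b² (f x) (f y)) ⟩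
    (∑[ y ← xs ] f x * f x + f y * f y)    ≡⟨ ∑-+ xs (λ _ → f x * f x) (λ y → f y * f y) ⟩
    (∑[ y ← xs ] f x * f x) + Q            ≡⟨ cong (_+ Q) (∑-const xs (f x * f x)) ⟩
    length xs * (f x * f x) + Q            ∎

m²≤n²⇒m≤n : ∀ {m n} → m * m ≤ n * n → m ≤ n
m²≤n²⇒m≤n {m} {n} h with m ≤? n
... | yes p = p
... | no ¬p = contradiction h (<⇒≱ (*-mono-< (≰⇒> ¬p) (≰⇒> ¬p)))

-- Ramsey's theorem for sublists of fixed length.

Homogeneous : {A B : Set} → ℕ → (List A → B) → B → List A → Set
Homogeneous r c b ys = ∀ zs → zs ⊆ ys → length zs ≡ r → c zs ≡ b

-- For positive `r` a target of zero elements costs nothing, since the empty list has no sublist of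
-- length `r`. In the last clause the sum of two bounds stands for their maximum, and the extra
-- element is the vertex whose link is made homogeneous.
ramseyBound : ℕ → ℕ → ℕ → ℕ
ramseyBound zero    p       q       = p + q
ramseyBound (suc r) zero    q       = 0
ramseyBound (suc r) (suc p) zero    = 0
ramseyBound (suc r) (suc p) (suc q) =
  suc (ramseyBound r (ramseyBound (suc r) p (suc q) + ramseyBound (suc r) (suc p) q)
                     (ramseyBound (suc r) p (suc q) + ramseyBound (suc r) (suc p) q))

RamseySublist : {A : Set} → ℕ → ℕ → ℕ → (List A → Bool) → List A → Set
RamseySublist r p q c xs =
  ∃[ ys ] ys ⊆ xs × ((length ys ≡ p × Homogeneous r c true ys) ⊎ (length ys ≡ q × Homogeneous r c false ys))

module _ {A : Set} where

  homogeneous-∷ : ∀ {r b} {c : List A → Bool} {x ys} →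
    Homogeneous r (λ zs → c (x ∷ zs)) b ys → Homogeneous (suc r) c b ys → Homogeneous (suc r) c b (x ∷ ys)
  homogeneous-∷ hx hys zs       (_ ∷ʳ s)   eq = hys zs s eq
  homogeneous-∷ hx hys (x ∷ zs) (refl ∷ s) eq = hx zs s (suc-injective eq)

  homogeneous-⊆ : ∀ {r} {B : Set} {b : B} {c : List A → B} {ys zs} → zs ⊆ ys → Homogeneous r c b ys → Homogeneous r c b zs
  homogeneous-⊆ s h zs t eq = h zs (⊆-trans t s) eq

  -- The link of `x` is homogeneous on `ys`. Inside `ys` a target smaller by one in the colour of
  -- the link is sought; if that colour comes out, `x` completes it, and otherwise the target of the
  -- other colour is already met.
  ramsey-step : ∀ {r p q m₁ m₂} {c : List A → Bool} {x xs} →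
    RamseySublist r (m₁ + m₂) (m₁ + m₂) (λ zs → c (x ∷ zs)) xs →
    (∀ ys → m₁ ≤ length ys → RamseySublist (suc r) p (suc q) c ys) →
    (∀ ys → m₂ ≤ length ys → RamseySublist (suc r) (suc p) q c ys) →
    RamseySublist (suc r) (suc p) (suc q) c (x ∷ xs)
  ramsey-step {m₁ = m₁} {m₂} {x = x} (ys , ys⊆ , inj₁ (len , hx)) recTrue _ =
    case recTrue ys (≤-trans (m≤m+n m₁ m₂) (≤-reflexive (sym len))) of λ where
      (zs , zs⊆ , inj₁ (len′ , h)) → x ∷ zs , refl ∷ ⊆-trans zs⊆ ys⊆ , inj₁ (cong suc len′ , homogeneous-∷ (homogeneous-⊆ zs⊆ hx) h)
      (zs , zs⊆ , inj₂ h)          → zs , x ∷ʳ ⊆-trans zs⊆ ys⊆ , inj₂ h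
  ramsey-step {m₁ = m₁} {m₂} {x = x} (ys , ys⊆ , inj₂ (len , hx)) _ recFalse =
    case recFalse ys (≤-trans (m≤n+m m₂ m₁) (≤-reflexive (sym len))) of λ where
      (zs , zs⊆ , inj₁ h)          → zs , x ∷ʳ ⊆-trans zs⊆ ys⊆ , inj₁ h
      (zs , zs⊆ , inj₂ (len′ , h)) → x ∷ zs , refl ∷ ⊆-trans zs⊆ ys⊆ , inj₂ (cong suc len′ , homogeneous-∷ (homogeneous-⊆ zs⊆ hx) h)

  ramsey : ∀ r p q (c : List A → Bool) (xs : List A) → ramseyBound r p q ≤ length xs → RamseySublist r p q c xs
  ramsey zero p q c xs le with c [] in eq
  ... | true  = take p xs , take-⊆ p xs , inj₁ (trans (length-take p xs) (m≤n⇒m⊓n≡m (≤-trans (m≤m+n p q) le)) , λ { [] _ _ → eq })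
  ... | false = take q xs , take-⊆ q xs , inj₂ (trans (length-take q xs) (m≤n⇒m⊓n≡m (≤-trans (m≤n+m q p) le)) , λ { [] _ _ → eq })
  ramsey (suc r) zero    q       c xs le = [] , minimum xs , inj₁ (refl , λ { [] _ () ; (_ ∷ _) () })
  ramsey (suc r) (suc p) zero    c xs le = [] , minimum xs , inj₂ (refl , λ { [] _ () ; (_ ∷ _) () })
  ramsey (suc r) (suc p) (suc q) c (x ∷ xs) (s≤s le) =
    ramsey-step (ramsey r _ _ (λ zs → c (x ∷ zs)) xs le)
      (λ ys → ramsey (suc r) p (suc q) c ys) (λ ys → ramsey (suc r) (suc p) q c ys)

  ramseysBound : ℕ → ℕ → ℕ → ℕ
  ramseysBound r zero    m = m
  ramseysBound r (suc h) m = ramseyBound r (ramseysBound r h m) (ramseysBound r h m)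

  -- Homogeneity survives the passage to sublists, so the colourings are treated one after another.
  -- Each has its own colour in the end.
  ramseys : ∀ r m (cs : List (List A → Bool)) (xs : List A) → ramseysBound r (length cs) m ≤ length xs →
    ∃[ ys ] ys ⊆ xs × length ys ≡ m × All (λ c → ∃[ b ] Homogeneous r c b ys) cs
  ramseys r m []       xs le = take m xs , take-⊆ m xs , trans (length-take m xs) (m≤n⇒m⊓n≡m le) , []
  ramseys r m (c ∷ cs) xs le = continue (ramsey r n n c xs le)
    where
    n = ramseysBound r (length cs) m
    Goal : Set
    Goal = ∃[ ys ] ys ⊆ xs × length ys ≡ m × All (λ c → ∃[ b ] Homogeneous r c b ys) (c ∷ cs)
    finish : ∀ b {ys} → ys ⊆ xs → length ys ≡ n → Homogeneous r c b ys → Goal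
    finish b ys⊆ len h with ramseys r m cs _ (≤-reflexive (sym len))
    ... | zs , zs⊆ , len′ , hs = zs , ⊆-trans zs⊆ ys⊆ , len′ , (b , homogeneous-⊆ zs⊆ h) ∷ hs
    continue : RamseySublist r n n c xs → Goal
    continue (ys , ys⊆ , inj₁ (len , h)) = finish true ys⊆ len h
    continue (ys , ys⊆ , inj₂ (len , h)) = finish false ys⊆ len h

-- Ramsey's theorem for bounded integer functions.

module _ {A : Set} where

  thresholds : ℕ → ℕ → List (List A → ℕ) → List (List A → Bool)
  thresholds κ S fs = concatMap (λ f → map (λ t zs → t * S ≤ᵇ κ * f zs) (upTo (suc κ))) fs

  NearlyConstant : ℕ → ℕ → ℕ → (List A → ℕ) → List A → Set
  NearlyConstant r κ S f ys = ∀ zs zs′ → zs ⊆ ys → zs′ ⊆ ys → length zs ≡ r → length zs′ ≡ r → κ * f zs ≤ κ * f zs′ + S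

  length-thresholds : ∀ κ S fs → length (thresholds κ S fs) ≡ length fs * suc κ
  length-thresholds κ S []       = refl
  length-thresholds κ S (f ∷ fs) = trans (length-++ (map (λ t zs → t * S ≤ᵇ κ * f zs) (upTo (suc κ))))
    (cong₂ _+_ (trans (length-map _ (upTo (suc κ))) (length-upTo (suc κ))) (length-thresholds κ S fs))

  -- Homogeneity of all thresholds t S ≤ κ f, t ≤ κ, pins κ f down up to S.
  nearlyConstant : ∀ {r κ S f ys} .{{_ : NonZero S}} → (∀ zs → f zs ≤ S) →
    All (λ t → ∃[ b ] Homogeneous r (λ zs → t * S ≤ᵇ κ * f zs) b ys) (upTo (suc κ)) → NearlyConstant r κ S f ys
  nearlyConstant {r} {κ} {S} {f} {ys} f≤S hs zs zs′ zs⊆ zs′⊆ len len′ = begin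
    κ * f zs                                 ≡⟨ m≡m%n+[m/n]*n (κ * f zs) S ⟩
    κ * f zs % S + t * S                     ≤⟨ +-mono-≤ (<⇒≤ (m%n<n (κ * f zs) S)) same ⟩
    S + κ * f zs′                            ≡⟨ +-comm S (κ * f zs′) ⟩
    κ * f zs′ + S                            ∎
    where
    open ≤-Reasoning
    t = κ * f zs / S
    t≤κ : t < suc κ
    t≤κ = s≤s (≤-trans (/-monoˡ-≤ S (*-monoʳ-≤ κ (f≤S zs))) (≤-reflexive (m*n/n≡m κ S)))
    same : t * S ≤ κ * f zs′
    same with All.lookup hs (∈-upTo⁺ t≤κ)
    ... | b , h = ≤ᵇ⇒≤ (t * S) (κ * f zs′) (subst T (trans (h zs zs⊆ len) (sym (h zs′ zs′⊆ len′))) (≤⇒≤ᵇ (m/n*n≤m (κ * f zs) S)))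

  ramsey-nearlyConstant : ∀ r m κ S .{{_ : NonZero S}} (fs : List (List A → ℕ)) (xs : List A) →
    All (λ f → ∀ zs → f zs ≤ S) fs → ramseysBound {A} r (length fs * suc κ) m ≤ length xs →
    ∃[ ys ] ys ⊆ xs × length ys ≡ m × All (λ f → NearlyConstant r κ S f ys) fs
  ramsey-nearlyConstant r m κ S fs xs bounded le
    with ramseys r m (thresholds κ S fs) xs (subst (λ l → ramseysBound {A} r l m ≤ length xs) (sym (length-thresholds κ S fs)) le)
  ... | ys , ys⊆ , len , hs = ys , ys⊆ , len , pin fs bounded hs
    where
    pin : ∀ fs → All (λ f → ∀ zs → f zs ≤ S) fs → All (λ c → ∃[ b ] Homogeneous r c b ys) (thresholds κ S fs) →
      All (λ f → NearlyConstant r κ S f ys) fs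
    pin []       []       hs = []
    pin (f ∷ fs) (b ∷ bs) hs = nearlyConstant {κ = κ} {f = f} b (All.map⁻ (All.++⁻ˡ (map (λ t zs → t * S ≤ᵇ κ * f zs) (upTo (suc κ))) hs)) ∷ pin fs bs (All.++⁻ʳ (map (λ t zs → t * S ≤ᵇ κ * f zs) (upTo (suc κ))) hs)

-- Sublists selected by increasing positions.

nth : List ℕ → ℕ → ℕ
nth []       p       = 0
nth (y ∷ ys) zero    = y
nth (y ∷ ys) (suc p) = nth ys p

Increasing : ℕ → ℕ → List ℕ → Set
Increasing lo hi []       = ⊤
Increasing lo hi (p ∷ ps) = lo ≤ p × p < hi × Increasing (suc p) hi ps

nths : ℕ → List ℕ → List ℕ → List ℕ
nths lo ys ps = map (λ p → nth ys (p ∸ lo)) ps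

nths-∷ : ∀ y ys lo {h} ps → Increasing (suc lo) h ps → nths (suc lo) ys ps ≡ nths lo (y ∷ ys) ps
nths-∷ y ys lo []           _              = refl
nths-∷ y ys lo {h} (p ∷ ps) (lo<p , _ , i) = cong₂ _∷_ (sym (cong (nth (y ∷ ys)) (∸-suc lo<p))) (nths-∷ y ys lo ps (weaken ps i))
  where
  ∸-suc : ∀ {m n} → m < n → n ∸ m ≡ suc (n ∸ suc m)
  ∸-suc {zero}  (s≤s _) = refl
  ∸-suc {suc m} (s≤s l) = ∸-suc l
  weaken : ∀ qs → Increasing (suc p) h qs → Increasing (suc lo) h qs
  weaken []       _           = tt
  weaken (q ∷ qs) (a , b , c) = ≤-trans lo<p (<⇒≤ a) , b , c

-- Positions are counted from `lo`, so that removing the head of `ys` raises `lo` by one and leaves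
-- `ps` as it is; the induction needs this form.
nths-⊆ : ∀ ys lo ps → Increasing lo (lo + length ys) ps → nths lo ys ps ⊆ ys
nths-⊆ ys       lo []       _ = minimum ys
nths-⊆ []       lo (p ∷ ps) (lo≤p , p< , _) = contradiction (≤-trans p< (≤-reflexive (+-identityʳ lo))) (≤⇒≯ lo≤p)
nths-⊆ (y ∷ ys) lo (p ∷ ps) (lo≤p , p< , inc) = [ later , now ]′ (m≤n⇒m<n∨m≡n lo≤p)
  where
  hi-suc : lo + suc (length ys) ≡ suc lo + length ys
  hi-suc = +-suc lo (length ys)
  inc′ : Increasing (suc p) (suc lo + length ys) ps
  inc′ = subst (λ h → Increasing (suc p) h ps) hi-suc inc
  later : lo < p → nths lo (y ∷ ys) (p ∷ ps) ⊆ y ∷ ys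
  later lo<p = y ∷ʳ subst (_⊆ ys) (nths-∷ y ys lo (p ∷ ps) i) (nths-⊆ ys (suc lo) (p ∷ ps) i)
    where
    i : Increasing (suc lo) (suc lo + length ys) (p ∷ ps)
    i = lo<p , subst (p <_) hi-suc p< , inc′
  now : lo ≡ p → nths lo (y ∷ ys) (p ∷ ps) ⊆ y ∷ ys
  now refl = cong (nth (y ∷ ys)) (n∸n≡0 lo) ∷ subst (_⊆ ys) (nths-∷ y ys lo ps inc′) (nths-⊆ ys (suc lo) ps inc′)

increasing-⊆-upTo : ∀ {N x y} → x ∷ y ∷ [] ⊆ upTo N → x < y
increasing-⊆-upTo {N} s = ordered (AllPairs.applyUpTo⁺₁ id N (λ i<j _ → i<j)) s
  where
  first : ∀ {P : ℕ → Set} {x zs} → All P zs → x ∷ [] ⊆ zs → P x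
  first (_ ∷ ps) (_ ∷ʳ s)   = first ps s
  first (p ∷ _)  (refl ∷ _) = p
  ordered : ∀ {x y zs} → AllPairs _<_ zs → x ∷ y ∷ [] ⊆ zs → x < y
  ordered (_ ∷ ps) (_ ∷ʳ s)   = ordered ps s
  ordered (p ∷ _)  (refl ∷ s) = first p s

bounded-⊆-upTo : ∀ {N x} → x ∷ [] ⊆ upTo N → x < N
bounded-⊆-upTo {N} s = first (All.applyUpTo⁺₁ id N id) s
  where
  first : ∀ {P : ℕ → Set} {x zs} → All P zs → x ∷ [] ⊆ zs → P x
  first (_ ∷ ps) (_ ∷ʳ s)   = first ps s
  first (p ∷ _)  (refl ∷ _) = p

-- Degree functions, energy and regular blocks.

infix 8 _⁴
_⁴ : ℕ → ℕ
n ⁴ = n * n * (n * n)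

module _ {V : Set} where

  deg : (V → V → V → Bool) → List V → V → V → ℕ
  deg R Z x y = ∑[ z ← Z ] 𝟙 (R x y z)

  deg≤length : ∀ R Z x y → deg R Z x y ≤ length Z
  deg≤length R Z x y = ≤-trans (∑-≤ Z (λ z → 𝟙≤1 (R x y z))) (≤-reflexive (*-identityʳ (length Z)))

  energy : (V → V → V → Bool) → List V → List V → List V → ℕ
  energy R X Y Z = ∑[ x ← X ] ∑[ y ← Y ] deg R Z x y * deg R Z x y

  -- The difference between the relative degrees into `Z` and into its part `filterᵇ u Z`,
  -- multiplied by both lengths. A small part therefore contributes little, and regularity can be
  -- demanded for every `u`.
  gap : (V → V → V → Bool) → List V → (V → Bool) → V → V → ℕ
  gap R Z u x y = ∣ length (filterᵇ u Z) * deg R Z x y - length Z * deg R (filterᵇ u Z) x y ∣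

  discrepancy variance : (V → V → V → Bool) → List V → List V → List V → (V → Bool) → ℕ
  discrepancy R X Y Z u = ∑[ x ← X ] ∑[ y ← Y ] gap R Z u x y
  variance    R X Y Z u = ∑[ x ← X ] ∑[ y ← Y ] gap R Z u x y * gap R Z u x y

  -- The energy has degree one in either block of the pair and degree two in the third block, four
  -- in all. This is why it is always compared with the fourth power of the block length.
  energy-rep : ∀ R a X b Y c Z → energy R (rep a X) (rep b Y) (rep c Z) ≡ a * (b * (c * c * energy R X Y Z))
  energy-rep R a X b Y c Z = begin
    energy R (rep a X) (rep b Y) (rep c Z)
      ≡⟨ ∑-rep a X _ ⟩
    a * (∑[ x ← X ] ∑[ y ← rep b Y ] deg R (rep c Z) x y * deg R (rep c Z) x y)
      ≡⟨ cong (a *_) (∑-cong X (λ x → ∑-rep b Y _)) ⟩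
    a * (∑[ x ← X ] b * (∑[ y ← Y ] deg R (rep c Z) x y * deg R (rep c Z) x y))
      ≡⟨ cong (a *_) (∑-* b X _) ⟩
    a * (b * (∑[ x ← X ] ∑[ y ← Y ] deg R (rep c Z) x y * deg R (rep c Z) x y))
      ≡⟨ cong (λ e → a * (b * e)) (∑₂-cong X Y (λ x y → trans (cong (λ d → d * d) (∑-rep c Z _)) ([m*n]*[o*p]≡[m*o]*[n*p] c _ c _))) ⟩
    a * (b * (∑[ x ← X ] ∑[ y ← Y ] c * c * (deg R Z x y * deg R Z x y)))
      ≡⟨ cong (λ e → a * (b * e)) (∑₂-* X Y (c * c) _) ⟩
    a * (b * (c * c * energy R X Y Z)) ∎
    where open ≡-Reasoning

  energy-splitˣ : ∀ R u X Y Z → energy R X Y Z ≡ energy R (filterᵇ u X) Y Z + energy R (filterᵇ (not ∘ u) X) Y Z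
  energy-splitˣ R u X Y Z = ∑-split u X _

  energy-splitʸ : ∀ R u X Y Z → energy R X Y Z ≡ energy R X (filterᵇ u Y) Z + energy R X (filterᵇ (not ∘ u) Y) Z
  energy-splitʸ R u X Y Z = trans (∑-cong X (λ x → ∑-split u Y _)) (∑-+ X _ _)

  -- For d = p + p′ and s = m + m′ the gap is ∣ m p′ − m′ p ∣.
  gap-split : ∀ R Z u x y → gap R Z u x y ≡
    ∣ length (filterᵇ u Z) * deg R (filterᵇ (not ∘ u) Z) x y - length (filterᵇ (not ∘ u) Z) * deg R (filterᵇ u Z) x y ∣
  gap-split R Z u x y = trans (cong₂ ∣_-_∣ eq₁ eq₂) (∣m+n-m+o∣≡∣n-o∣ (m * p) _ _)
    where
    m = length (filterᵇ u Z)
    m′ = length (filterᵇ (not ∘ u) Z)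
    p = deg R (filterᵇ u Z) x y
    p′ = deg R (filterᵇ (not ∘ u) Z) x y
    eq₁ : m * deg R Z x y ≡ m * p + m * p′
    eq₁ = trans (cong (m *_) (∑-split u Z _)) (*-distribˡ-+ m p p′)
    eq₂ : length Z * p ≡ m * p + m′ * p
    eq₂ = trans (cong (_* p) (length-split u Z)) (*-distribʳ-+ p m m′)

  gap-≤ : ∀ R Z u x y → gap R Z u x y ≤ length (filterᵇ u Z) * length (filterᵇ (not ∘ u) Z)
  gap-≤ R Z u x y = begin
    gap R Z u x y          ≡⟨ gap-split R Z u x y ⟩
    ∣ m * p′ - m′ * p ∣     ≤⟨ ∣m-n∣≤m⊔n (m * p′) (m′ * p) ⟩
    m * p′ ⊔ m′ * p        ≤⟨ ⊔-lub (*-monoʳ-≤ m (deg≤length R (filterᵇ (not ∘ u) Z) x y)) (≤-trans (*-monoʳ-≤ m′ (deg≤length R (filterᵇ u Z) x y)) (≤-reflexive (*-comm m′ m))) ⟩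
    m * m′                 ∎
    where
    open ≤-Reasoning
    m = length (filterᵇ u Z)
    m′ = length (filterᵇ (not ∘ u) Z)
    p = deg R (filterᵇ u Z) x y
    p′ = deg R (filterᵇ (not ∘ u) Z) x y

  -- The defect form of the Cauchy-Schwarz inequality. Divided by `m * m′` and by the squared length
  -- of `Z`, it says that the energies relative to the squared third length, averaged over the two
  -- parts in proportion to their lengths, exceed that of `Z` by a multiple of the variance.
  energy-splitᶻ : ∀ R u X Y Z → let m = length (filterᵇ u Z); m′ = length (filterᵇ (not ∘ u) Z) in
    length Z * (m′ * energy R X Y (filterᵇ u Z) + m * energy R X Y (filterᵇ (not ∘ u) Z)) ≡
    m * m′ * energy R X Y Z + variance R X Y Z u
  energy-splitᶻ R u X Y Z = begin
    length Z * (m′ * energy R X Y U + m * energy R X Y U′)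
      ≡⟨ cong (length Z *_) (cong₂ _+_ (sym (∑₂-* X Y m′ _)) (sym (∑₂-* X Y m _))) ⟩
    length Z * ((∑[ x ← X ] ∑[ y ← Y ] m′ * (p x y * p x y)) + (∑[ x ← X ] ∑[ y ← Y ] m * (p′ x y * p′ x y)))
      ≡⟨ cong (length Z *_) (sym (∑₂-+ X Y _ _)) ⟩
    length Z * (∑[ x ← X ] ∑[ y ← Y ] m′ * (p x y * p x y) + m * (p′ x y * p′ x y))
      ≡⟨ sym (∑₂-* X Y (length Z) _) ⟩
    (∑[ x ← X ] ∑[ y ← Y ] length Z * (m′ * (p x y * p x y) + m * (p′ x y * p′ x y)))
      ≡⟨ ∑₂-cong X Y pointwise ⟩
    (∑[ x ← X ] ∑[ y ← Y ] m * m′ * (deg R Z x y * deg R Z x y) + gap R Z u x y * gap R Z u x y)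
      ≡⟨ ∑₂-+ X Y _ _ ⟩
    (∑[ x ← X ] ∑[ y ← Y ] m * m′ * (deg R Z x y * deg R Z x y)) + variance R X Y Z u
      ≡⟨ cong (_+ variance R X Y Z u) (∑₂-* X Y (m * m′) _) ⟩
    m * m′ * energy R X Y Z + variance R X Y Z u ∎
    where
    open ≡-Reasoning
    U = filterᵇ u Z
    U′ = filterᵇ (not ∘ u) Z
    m = length U
    m′ = length U′
    p p′ : V → V → ℕ
    p = deg R U
    p′ = deg R U′
    expand : ∀ m m′ p p′ → (m + m′) * (m′ * (p * p) + m * (p′ * p′)) + 2 * (m * p′ * (m′ * p)) ≡
      m * m′ * ((p + p′) * (p + p′)) + (m * p′ * (m * p′) + m′ * p * (m′ * p))
    expand = solve-∀
    pointwise : ∀ x y → length Z * (m′ * (p x y * p x y) + m * (p′ x y * p′ x y)) ≡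
      m * m′ * (deg R Z x y * deg R Z x y) + gap R Z u x y * gap R Z u x y
    pointwise x y = trans (cong (_* (m′ * (p x y * p x y) + m * (p′ x y * p′ x y))) (length-split u Z))
      (trans (+-cancelʳ-≡ (2 * (m * p′ x y * (m′ * p x y))) _ _
        (trans (expand m m′ (p x y) (p′ x y))
          (trans (cong (m * m′ * ((p x y + p′ x y) * (p x y + p′ x y)) +_) (sym (∣-∣² (m * p′ x y) (m′ * p x y))))
            (sym (+-assoc (m * m′ * ((p x y + p′ x y) * (p x y + p′ x y))) _ _)))))
        (cong₂ (λ d g → m * m′ * (d * d) + g * g) (sym (∑-split u Z _)) (sym (gap-split R Z u x y))))

  -- Three blocks with a relation to be regularised, `k` being the block whose subsets are tested.
  -- As the blocks are distinct, a cut splits at most one argument of the energy.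
  record Task : Set where
    constructor task
    field
      i j k : ℕ
      rel   : V → V → V → Bool
      i≢j   : i ≢ j
      i≢k   : i ≢ k
      j≢k   : j ≢ k

  Regular : ℕ → ℕ → (ℕ → List V) → Task → Set
  Regular K s B τ = ∀ u → K * discrepancy rel (B i) (B j) (B k) u ≤ s ⁴
    where open Task τ

  taskEnergy : (ℕ → List V) → Task → ℕ
  taskEnergy B τ = energy rel (B i) (B j) (B k)
    where open Task τ

  -- W and Q have lengths w and s: the uniform measure on W is at most F times that on Q.
  Dominated : ℕ → ℕ → ℕ → List V → List V → Set
  Dominated F s w W Q = ∀ φ → s * ∑ W φ ≤ F * (w * ∑ Q φ)

  dominated-trans : ∀ F G s t w (W P Q : List V) → 0 < t → Dominated F s t P Q → Dominated G t w W P → Dominated (F * G) s w W Q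
  dominated-trans F G s (suc t-1) w W P Q _ h g φ = *-cancelˡ-≤ t (begin
    t * (s * ∑ W φ)             ≡⟨ x∙yz≈y∙xz t s (∑ W φ) ⟩
    s * (t * ∑ W φ)             ≤⟨ *-monoʳ-≤ s (g φ) ⟩
    s * (G * (w * ∑ P φ))       ≡⟨ e₁ s G w (∑ P φ) ⟩
    G * (w * (s * ∑ P φ))       ≤⟨ *-monoʳ-≤ G (*-monoʳ-≤ w (h φ)) ⟩
    G * (w * (F * (t * ∑ Q φ))) ≡⟨ e₂ G w F t (∑ Q φ) ⟩
    t * (F * G * (w * ∑ Q φ))   ∎)
    where
    t = suc t-1
    open ≤-Reasoning
    x∙yz≈y∙xz : ∀ x y z → x * (y * z) ≡ y * (x * z)
    x∙yz≈y∙xz = solve-∀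
    e₁ : ∀ s G w p → s * (G * (w * p)) ≡ G * (w * (s * p))
    e₁ = solve-∀
    e₂ : ∀ G w F t q → G * (w * (F * (t * q))) ≡ t * (F * G * (w * q))
    e₂ = solve-∀

  dominated-refl : ∀ F s (Q : List V) → 1 ≤ F → Dominated F s s Q Q
  dominated-refl F s Q 1≤F φ = ≤-trans (≤-reflexive (sym (*-identityˡ (s * ∑ Q φ)))) (*-monoˡ-≤ (s * ∑ Q φ) 1≤F)

module _ {V : Set} (B : ℕ → List V) (n : ℕ) (u : V → Bool) where

  -- Block n is cut down to u; the repetitions keep all lengths equal.
  cut : ℕ → List V
  cut l with l ≟ n
  ... | yes _ = rep (length (B n)) (filterᵇ u (B n))
  ... | no  _ = rep (length (filterᵇ u (B n))) (B l)

  cut-≡ : cut n ≡ rep (length (B n)) (filterᵇ u (B n))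
  cut-≡ with n ≟ n
  ... | yes _   = refl
  ... | no n≢n  = contradiction refl n≢n

  cut-≢ : ∀ {l} → l ≢ n → cut l ≡ rep (length (filterᵇ u (B n))) (B l)
  cut-≢ {l} l≢n with l ≟ n
  ... | yes l≡n = contradiction l≡n l≢n
  ... | no _    = refl

  length-cut : ∀ {s} → (∀ l → length (B l) ≡ s) → ∀ l → length (cut l) ≡ s * length (filterᵇ u (B n))
  length-cut {s} len l with l ≟ n
  ... | yes _ = trans (length-rep (length (B n)) _) (cong (_* length (filterᵇ u (B n))) (len n))
  ... | no  _ = trans (length-rep (length (filterᵇ u (B n))) (B l)) (trans (cong (length (filterᵇ u (B n)) *_) (len l)) (*-comm _ s))

  -- Only block `n` changes as a measure, and its part retains at least the share `1 / K`; the other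
  -- blocks are merely repeated.
  dominated-cut : ∀ {s K} → (∀ l → length (B l) ≡ s) → 1 ≤ K → s ≤ K * length (filterᵇ u (B n)) →
    ∀ l → Dominated K s (s * length (filterᵇ u (B n))) (cut l) (B l)
  dominated-cut {s} {K} len 1≤K s≤ l φ with l ≟ n
  ... | yes refl = begin
    s * ∑ (rep (length (B n)) U) φ ≡⟨ cong (s *_) (∑-rep (length (B n)) U φ) ⟩
    s * (length (B n) * ∑ U φ)     ≡⟨ cong (λ t → s * (t * ∑ U φ)) (len n) ⟩
    s * (s * ∑ U φ)                ≤⟨ *-monoʳ-≤ s (*-mono-≤ s≤ (∑-filterᵇ-≤ u (B n) φ)) ⟩
    s * (K * length U * ∑ (B n) φ) ≡⟨ e s K (length U) (∑ (B n) φ) ⟩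
    K * (s * length U * ∑ (B n) φ) ∎
    where
    open ≤-Reasoning
    U = filterᵇ u (B n)
    e : ∀ s K m q → s * (K * m * q) ≡ K * (s * m * q)
    e = solve-∀
  ... | no _ = begin
    s * ∑ (rep (length U) (B l)) φ ≡⟨ cong (s *_) (∑-rep (length U) (B l) φ) ⟩
    s * (length U * ∑ (B l) φ)     ≡⟨ sym (*-assoc s (length U) _) ⟩
    s * length U * ∑ (B l) φ       ≡⟨ sym (*-identityˡ _) ⟩
    1 * (s * length U * ∑ (B l) φ) ≤⟨ *-monoˡ-≤ _ 1≤K ⟩
    K * (s * length U * ∑ (B l) φ) ∎
    where
    open ≤-Reasoning
    U = filterᵇ u (B n)

module _ {V : Set} (B : ℕ → List V) (n : ℕ) (u : V → Bool) where

  private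
    s = length (B n)
    U = filterᵇ u (B n)
    U′ = filterᵇ (not ∘ u) (B n)
    m = length U
    m′ = length U′
    C = cut B n u
    C′ = cut B n (not ∘ u)

  gain : Task {V} → ℕ
  gain (task i j k R _ _ _) with k ≟ n
  ... | yes _ = variance R (B i) (B j) (B k) u
  ... | no  _ = 0

  gain-≡ : ∀ τ → Task.k τ ≡ n → gain τ ≡ variance (Task.rel τ) (B (Task.i τ)) (B (Task.j τ)) (B (Task.k τ)) u
  gain-≡ (task i j k R _ _ _) k≡n with k ≟ n
  ... | yes _  = refl
  ... | no k≢n = contradiction k≡n k≢n

  gain-≢ : ∀ τ → Task.k τ ≢ n → gain τ ≡ 0
  gain-≢ (task i j k R _ _ _) k≢n with k ≟ n
  ... | yes k≡n = contradiction k≡n k≢n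
  ... | no _    = refl

  -- With energies divided by the fourth power of the block length, the average of the two cuts with
  -- weights `m / s` and `m′ / s` is the old value plus `g / (s ⁴ * m * m′)`. Here this is
  -- multiplied by `s ^ 5 * m ^ 3 * m′ ^ 3`.
  EnergyCut : Task {V} → ℕ → Set
  EnergyCut τ g = m′ * m′ * m′ * taskEnergy C τ + m * m * m * taskEnergy C′ τ ≡
    s * (m * m * m) * (m′ * m′ * m′) * taskEnergy B τ + s * (m * m) * (m′ * m′) * g

  energy-cut-≡ : ∀ τ → Task.k τ ≡ n → EnergyCut τ (variance (Task.rel τ) (B (Task.i τ)) (B (Task.j τ)) (B n) u)
  energy-cut-≡ (task i j k R i≢j i≢k j≢k) refl = begin
    m′ * m′ * m′ * energy R (C i) (C j) (C k) + m * m * m * energy R (C′ i) (C′ j) (C′ k)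
      ≡⟨ cong₂ (λ a b → m′ * m′ * m′ * a + m * m * m * b)
           (trans (cong₃ (cut-≢ B n u i≢k) (cut-≢ B n u j≢k) (cut-≡ B n u)) (energy-rep R m (B i) m (B j) s U))
           (trans (cong₃ (cut-≢ B n (not ∘ u) i≢k) (cut-≢ B n (not ∘ u) j≢k) (cut-≡ B n (not ∘ u))) (energy-rep R m′ (B i) m′ (B j) s U′)) ⟩
    m′ * m′ * m′ * (m * (m * (s * s * e))) + m * m * m * (m′ * (m′ * (s * s * e′)))
      ≡⟨ e₁ m m′ s e e′ ⟩
    s * (m * m) * (m′ * m′) * (s * (m′ * e + m * e′))
      ≡⟨ cong (s * (m * m) * (m′ * m′) *_) (energy-splitᶻ R u (B i) (B j) (B n)) ⟩
    s * (m * m) * (m′ * m′) * (m * m′ * energy R (B i) (B j) (B n) + variance R (B i) (B j) (B n) u)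
      ≡⟨ e₂ m m′ s (energy R (B i) (B j) (B n)) (variance R (B i) (B j) (B n) u) ⟩
    s * (m * m * m) * (m′ * m′ * m′) * energy R (B i) (B j) (B k) + s * (m * m) * (m′ * m′) * variance R (B i) (B j) (B n) u ∎
    where
    open ≡-Reasoning
    e = energy R (B i) (B j) U
    e′ = energy R (B i) (B j) U′
    cong₃ : ∀ {X X′ Y Y′ Z Z′ : List V} → X ≡ X′ → Y ≡ Y′ → Z ≡ Z′ → energy R X Y Z ≡ energy R X′ Y′ Z′
    cong₃ refl refl refl = refl
    e₁ : ∀ m m′ s e e′ → m′ * m′ * m′ * (m * (m * (s * s * e))) + m * m * m * (m′ * (m′ * (s * s * e′))) ≡
      s * (m * m) * (m′ * m′) * (s * (m′ * e + m * e′))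
    e₁ = solve-∀
    e₂ : ∀ m m′ s a v → s * (m * m) * (m′ * m′) * (m * m′ * a + v) ≡ s * (m * m * m) * (m′ * m′ * m′) * a + s * (m * m) * (m′ * m′) * v
    e₂ = solve-∀

  -- If block `n` belongs to the pair, the energy is additive over its two parts; if it does not
  -- occur in the task, both cuts only repeat. Either way the average stays the same.
  energy-cut-≢ : ∀ τ → Task.k τ ≢ n → EnergyCut τ 0
  energy-cut-≢ (task i j k R i≢j i≢k j≢k) k≢n = trans (cases (i ≟ n) (j ≟ n)) (e₀ (s * (m * m * m) * (m′ * m′ * m′) * energy R (B i) (B j) (B k)) (s * (m * m) * (m′ * m′)))
    where
    cong₃ : ∀ {X X′ Y Y′ Z Z′ : List V} → X ≡ X′ → Y ≡ Y′ → Z ≡ Z′ → energy R X Y Z ≡ energy R X′ Y′ Z′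
    cong₃ refl refl refl = refl
    e₀ : ∀ a b → a ≡ a + b * 0
    e₀ a b = sym (trans (cong (a +_) (*-zeroʳ b)) (+-identityʳ a))
    eˣ : ∀ m m′ s e e′ → m′ * m′ * m′ * (s * (m * (m * m * e))) + m * m * m * (s * (m′ * (m′ * m′ * e′))) ≡ s * (m * m * m) * (m′ * m′ * m′) * (e + e′)
    eˣ = solve-∀
    eʸ : ∀ m m′ s e e′ → m′ * m′ * m′ * (m * (s * (m * m * e))) + m * m * m * (m′ * (s * (m′ * m′ * e′))) ≡ s * (m * m * m) * (m′ * m′ * m′) * (e + e′)
    eʸ = solve-∀
    eᵒ : ∀ m m′ e → m′ * m′ * m′ * (m * (m * (m * m * e))) + m * m * m * (m′ * (m′ * (m′ * m′ * e))) ≡ (m + m′) * (m * m * m) * (m′ * m′ * m′) * e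
    eᵒ = solve-∀
    ck : C k ≡ rep m (B k)
    ck = cut-≢ B n u k≢n
    ck′ : C′ k ≡ rep m′ (B k)
    ck′ = cut-≢ B n (not ∘ u) k≢n
    cases : Dec (i ≡ n) → Dec (j ≡ n) → m′ * m′ * m′ * energy R (C i) (C j) (C k) + m * m * m * energy R (C′ i) (C′ j) (C′ k) ≡
      s * (m * m * m) * (m′ * m′ * m′) * energy R (B i) (B j) (B k)
    cases (yes refl) (yes j≡n)  = contradiction (sym j≡n) i≢j
    cases (yes refl) (no j≢n) = trans
      (cong₂ (λ a b → m′ * m′ * m′ * a + m * m * m * b)
        (trans (cong₃ (cut-≡ B n u) (cut-≢ B n u j≢n) ck) (energy-rep R s U m (B j) m (B k)))
        (trans (cong₃ (cut-≡ B n (not ∘ u)) (cut-≢ B n (not ∘ u) j≢n) ck′) (energy-rep R s U′ m′ (B j) m′ (B k))))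
      (trans (eˣ m m′ s (energy R U (B j) (B k)) (energy R U′ (B j) (B k)))
        (cong (s * (m * m * m) * (m′ * m′ * m′) *_) (sym (energy-splitˣ R u (B n) (B j) (B k)))))
    cases (no i≢n) (yes refl) = trans
      (cong₂ (λ a b → m′ * m′ * m′ * a + m * m * m * b)
        (trans (cong₃ (cut-≢ B n u i≢n) (cut-≡ B n u) ck) (energy-rep R m (B i) s U m (B k)))
        (trans (cong₃ (cut-≢ B n (not ∘ u) i≢n) (cut-≡ B n (not ∘ u)) ck′) (energy-rep R m′ (B i) s U′ m′ (B k))))
      (trans (eʸ m m′ s (energy R (B i) U (B k)) (energy R (B i) U′ (B k)))
        (cong (s * (m * m * m) * (m′ * m′ * m′) *_) (sym (energy-splitʸ R u (B i) (B n) (B k)))))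
    cases (no i≢n) (no j≢n) = trans
      (cong₂ (λ a b → m′ * m′ * m′ * a + m * m * m * b)
        (trans (cong₃ (cut-≢ B n u i≢n) (cut-≢ B n u j≢n) ck) (energy-rep R m (B i) m (B j) m (B k)))
        (trans (cong₃ (cut-≢ B n (not ∘ u) i≢n) (cut-≢ B n (not ∘ u) j≢n) ck′) (energy-rep R m′ (B i) m′ (B j) m′ (B k))))
      (trans (eᵒ m m′ (energy R (B i) (B j) (B k)))
        (cong (λ t → t * (m * m * m) * (m′ * m′ * m′) * energy R (B i) (B j) (B k)) (sym (length-split u (B n)))))

  energy-cut : ∀ τ → EnergyCut τ (gain τ)
  energy-cut τ = [ (λ k≡n → subst (EnergyCut τ) (trans (cong (λ l → variance (Task.rel τ) (B (Task.i τ)) (B (Task.j τ)) (B l) u) (sym k≡n)) (sym (gain-≡ τ k≡n))) (energy-cut-≡ τ k≡n))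
    , (λ k≢n → subst (EnergyCut τ) (sym (gain-≢ τ k≢n)) (energy-cut-≢ τ k≢n)) ]′ (toSum (Task.k τ ≟ n))

  totalEnergy-cut : ∀ T → m′ * m′ * m′ * ∑ T (taskEnergy C) + m * m * m * ∑ T (taskEnergy C′) ≡
    s * (m * m * m) * (m′ * m′ * m′) * ∑ T (taskEnergy B) + s * (m * m) * (m′ * m′) * ∑ T gain
  totalEnergy-cut T = begin
    p′ * ∑ T (taskEnergy C) + p * ∑ T (taskEnergy C′)
      ≡⟨ cong₂ _+_ (sym (∑-* p′ T _)) (sym (∑-* p T _)) ⟩
    (∑[ τ ← T ] p′ * taskEnergy C τ) + (∑[ τ ← T ] p * taskEnergy C′ τ)
      ≡⟨ sym (∑-+ T _ _) ⟩
    (∑[ τ ← T ] p′ * taskEnergy C τ + p * taskEnergy C′ τ)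
      ≡⟨ ∑-cong T energy-cut ⟩
    (∑[ τ ← T ] a * taskEnergy B τ + b * gain τ)
      ≡⟨ ∑-+ T _ _ ⟩
    (∑[ τ ← T ] a * taskEnergy B τ) + (∑[ τ ← T ] b * gain τ)
      ≡⟨ cong₂ _+_ (∑-* a T _) (∑-* b T _) ⟩
    a * ∑ T (taskEnergy B) + b * ∑ T gain ∎
    where
    open ≡-Reasoning
    p = m * m * m
    p′ = m′ * m′ * m′
    a = s * p * p′
    b = s * (m * m) * (m′ * m′)

-- If both cuts stayed below the level `suc l / L`, so would their weighted average. But this
-- average is at least `l / L` plus the gain `X / (s ⁴ * m * m′)`, which is at least `1 / L` because
-- `m * m′ ≤ s * s`.
energy-increment : ∀ s m m′ L l Φ X B B′ → s ≡ m + m′ → m * m′ ≤ s * s → 0 < m → 0 < m′ →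
  l * s ⁴ ≤ L * Φ → s * s * s ⁴ ≤ L * X →
  m′ * m′ * m′ * B + m * m * m * B′ ≡ s * (m * m * m) * (m′ * m′ * m′) * Φ + s * (m * m) * (m′ * m′) * X →
  L * B < suc l * (s * m) ⁴ → L * B′ < suc l * (s * m′) ⁴ → ⊥
energy-increment s m@(suc _) m′@(suc _) L l Φ X B B′ s≡ mm′≤ _ _ hΦ hX eq hB hB′ = <-irrefl refl (begin-strict
  suc l * (s * s ⁴ * (p * p′))                                  ≡⟨ e₁ l s (s ⁴) m m′ ⟩
  s * p * p′ * (l * s ⁴) + s * (m * m) * (m′ * m′) * (m * m′ * s ⁴)
    ≤⟨ +-mono-≤ (*-monoʳ-≤ (s * p * p′) hΦ) (*-monoʳ-≤ (s * (m * m) * (m′ * m′)) (≤-trans (*-monoˡ-≤ (s ⁴) mm′≤) hX)) ⟩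
  s * p * p′ * (L * Φ) + s * (m * m) * (m′ * m′) * (L * X)      ≡⟨ e₂ L (s * p * p′) Φ (s * (m * m) * (m′ * m′)) X ⟩
  L * (s * p * p′ * Φ + s * (m * m) * (m′ * m′) * X)            ≡⟨ cong (L *_) (sym eq) ⟩
  L * (p′ * B + p * B′)                                         ≡⟨ e₃ L p′ B p B′ ⟩
  p′ * (L * B) + p * (L * B′)                                   <⟨ +-mono-< (*-monoʳ-< p′ hB) (*-monoʳ-< p hB′) ⟩
  p′ * (suc l * (s * m) ⁴) + p * (suc l * (s * m′) ⁴)           ≡⟨ e₄ (suc l) s m m′ ⟩
  suc l * ((m + m′) * s ⁴ * (p * p′))                           ≡⟨ cong (λ t → suc l * (t * s ⁴ * (p * p′))) (sym s≡) ⟩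
  suc l * (s * s ⁴ * (p * p′))                                  ∎)
  where
  open ≤-Reasoning
  p = m * m * m
  p′ = m′ * m′ * m′
  e₁ : ∀ l s t m m′ → suc l * (s * t * (m * m * m * (m′ * m′ * m′))) ≡
    s * (m * m * m) * (m′ * m′ * m′) * (l * t) + s * (m * m) * (m′ * m′) * (m * m′ * t)
  e₁ = solve-∀
  e₂ : ∀ L a Φ b X → a * (L * Φ) + b * (L * X) ≡ L * (a * Φ + b * X)
  e₂ = solve-∀
  e₃ : ∀ L p′ B p B′ → L * (p′ * B + p * B′) ≡ p′ * (L * B) + p * (L * B′)
  e₃ = solve-∀
  e₄ : ∀ l s m m′ → m′ * m′ * m′ * (l * (s * m * (s * m) * (s * m * (s * m)))) + m * m * m * (l * (s * m′ * (s * m′) * (s * m′ * (s * m′)))) ≡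
    l * ((m + m′) * (s * s * (s * s)) * (m * m * m * (m′ * m′ * m′)))
  e₄ = solve-∀

module _ {V : Set} where

  totalEnergy-≤ : ∀ {s} (B : ℕ → List V) (T : List Task) → (∀ l → length (B l) ≡ s) → ∑ T (taskEnergy B) ≤ length T * s ⁴
  totalEnergy-≤ {s} B T len = ∑-≤ T (λ τ → bound τ)
    where
    open ≤-Reasoning
    bound : ∀ τ → taskEnergy B τ ≤ s ⁴
    bound (task i j k R _ _ _) = begin
      energy R (B i) (B j) (B k)
        ≤⟨ ∑₂-≤ (B i) (B j) (λ x y → *-mono-≤ (deg≤ x y) (deg≤ x y)) ⟩
      length (B i) * (length (B j) * (s * s)) ≡⟨ cong₂ (λ a b → a * (b * (s * s))) (len i) (len j) ⟩
      s * (s * (s * s)) ≡⟨ sym (*-assoc s s (s * s)) ⟩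
      s ⁴ ∎
      where
      deg≤ : ∀ x y → deg R (B k) x y ≤ s
      deg≤ x y = ≤-trans (deg≤length R (B k) x y) (≤-reflexive (len k))

  discrepancy-≤ : ∀ {s} R (X Y Z : List V) u → length X ≡ s → length Y ≡ s →
    discrepancy R X Y Z u ≤ s * (s * (length (filterᵇ u Z) * length (filterᵇ (not ∘ u) Z)))
  discrepancy-≤ R X Y Z u refl eqY = ≤-trans (∑₂-≤ X Y (gap-≤ R Z u)) (≤-reflexive (cong (λ t → length X * (t * _)) eqY))

  discrepancy²-≤ : ∀ {s} R (X Y Z : List V) u → length X ≡ s → length Y ≡ s →
    discrepancy R X Y Z u * discrepancy R X Y Z u ≤ s * s * variance R X Y Z u
  discrepancy²-≤ {s} R X Y Z u lenX lenY = begin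
    discrepancy R X Y Z u * discrepancy R X Y Z u ≡⟨ cong₂ _*_ (sym (∑-⊗ X Y _)) (sym (∑-⊗ X Y _)) ⟩
    ∑ (X ⊗ Y) f * ∑ (X ⊗ Y) f ≤⟨ cauchy (X ⊗ Y) f ⟩
    length (X ⊗ Y) * (∑[ p ← X ⊗ Y ] f p * f p) ≡⟨ cong₂ _*_ (trans (length-⊗ X Y) (cong₂ _*_ lenX lenY)) (∑-⊗ X Y _) ⟩
    s * s * variance R X Y Z u ∎
    where
    open ≤-Reasoning
    f : V × V → ℕ
    f (x , y) = gap R Z u x y

  module _ (K : ℕ) (1≤K : 1 ≤ K) (T : List (Task {V})) where

    -- The existence of a regular dominated family is expressed by elimination into `⊥`. The final
    -- goal is a refutation, so a subset that violates regularity never has to be searched for.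
    Regularised : ℕ → (ℕ → List V) → ℕ → Set
    Regularised F B s = ∀ W w → 0 < w → (∀ l → length (W l) ≡ w) → (∀ l → Dominated F s w (W l) (B l)) →
      (∀ {τ} → τ ∈ T → Regular K w W τ) → ⊥

    module _ (B : ℕ → List V) (s l : ℕ) (len : ∀ l → length (B l) ≡ s) (hl : l * s ⁴ ≤ K * K * ∑ T (taskEnergy B)) where

      Better : (V → Bool) → ℕ → Set
      Better u n = let m = length (filterᵇ u (B n)) in
        0 < m × s ≤ K * m × suc l * (s * m) ⁴ ≤ K * K * ∑ T (taskEnergy (cut B n u))

      improve : ∀ {τ} → τ ∈ T → ∀ u → s ⁴ < K * discrepancy (Task.rel τ) (B (Task.i τ)) (B (Task.j τ)) (B (Task.k τ)) u →
        Better u (Task.k τ) ⊎ Better (not ∘ u) (Task.k τ)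
      improve {τ@(task i j k R _ _ _)} τ∈T u viol = decide (suc l * (s * m) ⁴ ≤? K * K * ∑ T (taskEnergy (cut B k u)))
        where
        open ≤-Reasoning
        m = length (filterᵇ u (B k))
        m′ = length (filterᵇ (not ∘ u) (B k))
        D = discrepancy R (B i) (B j) (B k) u
        s≡ : s ≡ m + m′
        s≡ = trans (sym (len k)) (length-split u (B k))
        m≤s : m ≤ s
        m≤s = ≤-trans (m≤m+n m m′) (≤-reflexive (sym s≡))
        m′≤s : m′ ≤ s
        m′≤s = ≤-trans (m≤n+m m′ m) (≤-reflexive (sym s≡))
        -- Pointwise the gap is at most `m * m′`, so a violation forces both parts to have at least
        -- the share `1 / K` of the block.
        s²<Kmm′ : s * s < K * (m * m′)
        s²<Kmm′ = *-cancelˡ-< (s * s) (s * s) (K * (m * m′)) (<-≤-trans viol (begin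
          K * D                       ≤⟨ *-monoʳ-≤ K (discrepancy-≤ R (B i) (B j) (B k) u (len i) (len j)) ⟩
          K * (s * (s * (m * m′)))    ≡⟨ e K s (m * m′) ⟩
          s * s * (K * (m * m′))      ∎))
          where
          e : ∀ K s q → K * (s * (s * q)) ≡ s * s * (K * q)
          e = solve-∀
        positive : ∀ {a b c d} → a < b * (c * d) → 0 < c × 0 < d
        positive {a} {b} {zero}          h = contradiction (subst (a <_) (*-zeroʳ b) h) (λ ())
        positive {a} {b} {suc c} {zero}  h = contradiction (subst (a <_) (trans (cong (b *_) (*-zeroʳ c)) (*-zeroʳ b)) h) (λ ())
        positive {a} {b} {suc c} {suc d} h = z<s , z<s
        0<m : 0 < m
        0<m = proj₁ (positive {b = K} {m} {m′} s²<Kmm′)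
        0<m′ : 0 < m′
        0<m′ = proj₂ (positive {b = K} {m} {m′} s²<Kmm′)
        share : ∀ {a b} → s * s < K * (a * b) → b ≤ s → s ≤ K * a
        share {a} {b} h b≤s = ≮⇒≥ λ Ka<s → <⇒≱ h (begin
          K * (a * b) ≡⟨ sym (*-assoc K a b) ⟩
          K * a * b   ≤⟨ *-mono-≤ (<⇒≤ Ka<s) b≤s ⟩
          s * s       ∎)
        hX : s * s * s ⁴ ≤ K * K * ∑ T (gain B k u)
        hX = begin
          s * s * s ⁴ ≤⟨ cancel s (∑ T (gain B k u)) (begin-strict
            s ⁴ * s ⁴               <⟨ *-mono-< viol viol ⟩
            K * D * (K * D)         ≡⟨ [m*n]*[o*p]≡[m*o]*[n*p] K D K D ⟩
            K * K * (D * D)         ≤⟨ *-monoʳ-≤ (K * K) (discrepancy²-≤ R (B i) (B j) (B k) u (len i) (len j)) ⟩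
            K * K * (s * s * variance R (B i) (B j) (B k) u) ≡⟨ cong (λ g → K * K * (s * s * g)) (sym (gain-≡ B k u τ refl)) ⟩
            K * K * (s * s * gain B k u τ) ≤⟨ *-monoʳ-≤ (K * K) (*-monoʳ-≤ (s * s) (∑-∈ (gain B k u) τ∈T)) ⟩
            K * K * (s * s * ∑ T (gain B k u)) ∎) ⟩
          K * K * ∑ T (gain B k u) ∎
          where
          e : ∀ s → s * s * (s * s) * (s * s * (s * s)) ≡ s * s * (s * s * (s * s * (s * s)))
          e = solve-∀
          e′ : ∀ k s x → k * (s * s * x) ≡ s * s * (k * x)
          e′ = solve-∀
          cancel : ∀ s x → s ⁴ * s ⁴ < K * K * (s * s * x) → s * s * s ⁴ ≤ K * K * x
          cancel s x h = <⇒≤ (*-cancelˡ-< (s * s) (s * s * s ⁴) (K * K * x) (subst₂ _<_ (e s) (e′ (K * K) s x) h))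
        balance : m′ * m′ * m′ * ∑ T (taskEnergy (cut B k u)) + m * m * m * ∑ T (taskEnergy (cut B k (not ∘ u))) ≡
          s * (m * m * m) * (m′ * m′ * m′) * ∑ T (taskEnergy B) + s * (m * m) * (m′ * m′) * ∑ T (gain B k u)
        balance = trans (totalEnergy-cut B k u T)
          (cong (λ t → t * (m * m * m) * (m′ * m′ * m′) * ∑ T (taskEnergy B) + t * (m * m) * (m′ * m′) * ∑ T (gain B k u)) (len k))
        decide : Dec (suc l * (s * m) ⁴ ≤ K * K * ∑ T (taskEnergy (cut B k u))) → Better u k ⊎ Better (not ∘ u) k
        decide (yes h) = inj₁ (0<m , share {m} {m′} s²<Kmm′ m′≤s , h)
        decide (no ¬h) = inj₂ (0<m′ , share {m′} {m} (subst (λ t → s * s < K * t) (*-comm m m′) s²<Kmm′) m≤s ,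
          ≮⇒≥ (λ lt → energy-increment s m m′ (K * K) l _ _ _ _ s≡ (*-mono-≤ m≤s m′≤s) 0<m 0<m′ hl hX balance (≰⇒> ¬h) lt))

    1≤K^ : ∀ h → 1 ≤ K ^ h
    1≤K^ zero    = ≤-refl
    1≤K^ (suc h) = *-mono-≤ 1≤K (1≤K^ h)

    -- The number `l` measures the normalised total energy in units of `1 / K ^ 2`. This energy is
    -- at most `length T`, which bounds the number of cuts, and each cut costs a factor `K` of
    -- domination. Regularity is only ever refuted for the particular `u` in question, which is the
    -- one to cut with.
    regularise-from : ∀ h l B s → 0 < s → (∀ l → length (B l) ≡ s) → l * s ⁴ ≤ K * K * ∑ T (taskEnergy B) →
      suc (K * K * length T) ≤ l + h → Regularised (K ^ h) B s → ⊥
    regularise-from zero l B s@(suc _) 0<s len hl fuel goal = <-irrefl refl (begin-strict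
      K * K * length T * s ⁴        <⟨ *-monoˡ-< (s ⁴) (≤-trans fuel (≤-reflexive (+-identityʳ l))) ⟩
      l * s ⁴                       ≤⟨ hl ⟩
      K * K * ∑ T (taskEnergy B)    ≤⟨ *-monoʳ-≤ (K * K) (totalEnergy-≤ B T len) ⟩
      K * K * (length T * s ⁴)      ≡⟨ sym (*-assoc (K * K) (length T) (s ⁴)) ⟩
      K * K * length T * s ⁴        ∎)
      where open ≤-Reasoning
    regularise-from (suc h) l B s 0<s len hl fuel goal =
      goal B s 0<s len (λ i → dominated-refl (K ^ suc h) s (B i) (1≤K^ (suc h))) λ {τ} τ∈T u →
        decidable-stable (K * discrepancy (Task.rel τ) (B (Task.i τ)) (B (Task.j τ)) (B (Task.k τ)) u ≤? s ⁴)
          (λ ¬reg → [ recurse u (Task.k τ) , recurse (not ∘ u) (Task.k τ) ]′ (improve B s l len hl τ∈T u (≰⇒> ¬reg)))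
      where
      recurse : ∀ u n → Better B s l len hl u n → ⊥
      recurse u n (0<m , s≤Km , hl′) = regularise-from h (suc l) (cut B n u) (s * length (filterᵇ u (B n)))
        (*-mono-≤ 0<s 0<m) (length-cut B n u len) hl′ (≤-trans fuel (≤-reflexive (+-suc l h)))
        (λ W w 0<w lenW dom → goal W w 0<w lenW
          (λ i → dominated-trans K (K ^ h) s _ w (W i) (cut B n u i) (B i) (*-mono-≤ 0<s 0<m) (dominated-cut B n u len 1≤K s≤Km i) (dom i)))

-- Exchange of degree functions and insertion of edges.

module _ {A : Set} where

  pull₂ : ∀ (X Y Z : List A) (f : A → A → A → ℕ) →
    (∑[ x ← X ] ∑[ y ← Y ] ∑[ z ← Z ] f x y z) ≡ (∑[ y ← Y ] ∑[ z ← Z ] ∑[ x ← X ] f x y z)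
  pull₂ X Y Z f = trans (∑-swap X Y _) (∑-cong Y (λ y → ∑-swap X Z (λ x → f x y)))

  pull₃ : ∀ (X Y Z W : List A) (f : A → A → A → A → ℕ) →
    (∑[ x ← X ] ∑[ y ← Y ] ∑[ z ← Z ] ∑[ w ← W ] f x y z w) ≡ (∑[ y ← Y ] ∑[ z ← Z ] ∑[ w ← W ] ∑[ x ← X ] f x y z w)
  pull₃ X Y Z W f = trans (∑-swap X Y _) (∑-cong Y (λ y → pull₂ X Z W (λ x → f x y)))

  pull₄ : ∀ (X Y Z W U : List A) (f : A → A → A → A → A → ℕ) →
    (∑[ x ← X ] ∑[ y ← Y ] ∑[ z ← Z ] ∑[ w ← W ] ∑[ u ← U ] f x y z w u) ≡
    (∑[ y ← Y ] ∑[ z ← Z ] ∑[ w ← W ] ∑[ u ← U ] ∑[ x ← X ] f x y z w u)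
  pull₄ X Y Z W U f = trans (∑-swap X Y _) (∑-cong Y (λ y → pull₃ X Z W U (λ x → f x y)))

  pull₅ : ∀ (X Y Z W U T : List A) (f : A → A → A → A → A → A → ℕ) →
    (∑[ x ← X ] ∑[ y ← Y ] ∑[ z ← Z ] ∑[ w ← W ] ∑[ u ← U ] ∑[ t ← T ] f x y z w u t) ≡
    (∑[ y ← Y ] ∑[ z ← Z ] ∑[ w ← W ] ∑[ u ← U ] ∑[ t ← T ] ∑[ x ← X ] f x y z w u t)
  pull₅ X Y Z W U T f = trans (∑-swap X Y _) (∑-cong Y (λ y → pull₄ X Z W U T (λ x → f x y)))

-- The loss `2 * (r * r * r)` of `chain-step` at its cut-off `r = 2 * k`.
nextScale : ℕ → ℕ
nextScale k = 16 * (k * k * k)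

module _ {V : Set} (R : V → V → V → Bool) (q : ℕ) where

  Spread : ℕ → List V → List V → List V → Set
  Spread K X Y Z = ∀ u → K * discrepancy R X Y Z u ≤ q ⁴

  -- One-sided, because counting copies only needs lower bounds for the degrees that replace others.
  Close : ℕ → List V → List V → List V → List V → Set
  Close K X Y P N = K * (∑[ x ← X ] ∑[ y ← Y ] (deg R P x y ∸ deg R N x y)) ≤ q * q * q

  -- For given `x` and `y`, the vertices of `Z` satisfying `u` see the relative degree of all of `Z`
  -- up to the gap. So a degree factor can be traded for the indicator of the edge x y z, and an
  -- edge is inserted at a vertex `z` that has been counted before.
  spread-restrict : ∀ {K} X Y Z → length Z ≡ q → Spread K X Y Z →
    (u : V → Bool) (ω : V → V → ℕ) (Ω : ℕ) → (∀ x y → ω x y ≤ Ω) →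
    K * (∑[ x ← X ] ∑[ y ← Y ] ∑[ z ← Z ] ω x y * (𝟙 (u z) * deg R Z x y)) ≤
    K * (q * (∑[ x ← X ] ∑[ y ← Y ] ∑[ z ← Z ] ω x y * (𝟙 (u z) * 𝟙 (R x y z)))) + Ω * q ⁴
  spread-restrict {K} X Y Z refl spread u ω Ω ω≤ = begin
    K * (∑[ x ← X ] ∑[ y ← Y ] ∑[ z ← Z ] ω x y * (𝟙 (u z) * deg R Z x y))
      ≤⟨ *-monoʳ-≤ K (∑₂-mono X Y pointwise) ⟩
    K * (∑[ x ← X ] ∑[ y ← Y ] length Z * h x y + Ω * gap R Z u x y)
      ≡⟨ cong (K *_) (trans (∑₂-+ X Y _ _) (cong₂ _+_ (∑₂-* X Y (length Z) h) (∑₂-* X Y Ω _))) ⟩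
    K * (length Z * (∑[ x ← X ] ∑[ y ← Y ] h x y) + Ω * discrepancy R X Y Z u)
      ≡⟨ distribute K _ Ω (discrepancy R X Y Z u) ⟩
    K * (length Z * (∑[ x ← X ] ∑[ y ← Y ] h x y)) + Ω * (K * discrepancy R X Y Z u)
      ≤⟨ +-monoʳ-≤ _ (*-monoʳ-≤ Ω (spread u)) ⟩
    K * (length Z * (∑[ x ← X ] ∑[ y ← Y ] h x y)) + Ω * length Z ⁴ ∎
    where
    open ≤-Reasoning
    h : V → V → ℕ
    h x y = ∑[ z ← Z ] ω x y * (𝟙 (u z) * 𝟙 (R x y z))
    U = filterᵇ u Z
    distribute : ∀ K a Ω d → K * (a + Ω * d) ≡ K * a + Ω * (K * d)
    distribute = solve-∀
    e₁ : ∀ ω m d → ω * (m * d) ≡ ω * m * d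
    e₁ = solve-∀
    e₂ : ∀ ω s p g → ω * (s * p + g) ≡ s * (ω * p) + ω * g
    e₂ = solve-∀
    pointwise : ∀ x y → (∑[ z ← Z ] ω x y * (𝟙 (u z) * deg R Z x y)) ≤ length Z * h x y + Ω * gap R Z u x y
    pointwise x y = begin
      (∑[ z ← Z ] ω x y * (𝟙 (u z) * deg R Z x y))
        ≡⟨ trans (∑-* (ω x y) Z _) (cong (ω x y *_) (trans (∑-*ʳ (deg R Z x y) Z _) (cong (_* deg R Z x y) (sym (length-filterᵇ u Z))))) ⟩
      ω x y * (length U * deg R Z x y)
        ≤⟨ *-monoʳ-≤ (ω x y) (m≤n+∣m-n∣ (length U * deg R Z x y) (length Z * deg R U x y)) ⟩
      ω x y * (length Z * deg R U x y + gap R Z u x y)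
        ≡⟨ e₂ (ω x y) (length Z) (deg R U x y) (gap R Z u x y) ⟩
      length Z * (ω x y * deg R U x y) + ω x y * gap R Z u x y
        ≤⟨ +-mono-≤ (≤-reflexive (cong (length Z *_) (trans (cong (ω x y *_) (∑-filterᵇ u Z _)) (sym (∑-* (ω x y) Z _))))) (*-monoˡ-≤ (gap R Z u x y) (ω≤ x y)) ⟩
      length Z * h x y + Ω * gap R Z u x y ∎

  ∑-lift : ∀ {K e} (X : List V) {φ ψ : V → ℕ} → length X ≡ q → (∀ x → K * φ x ≤ K * (q * ψ x) + e) →
    K * ∑ X φ ≤ K * (q * ∑ X ψ) + q * e
  ∑-lift {K} {e} X {φ} {ψ} refl h = begin
    K * ∑ X φ                             ≡⟨ sym (∑-* K X φ) ⟩
    (∑[ x ← X ] K * φ x)                  ≤⟨ ∑-mono X h ⟩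
    (∑[ x ← X ] K * (length X * ψ x) + e) ≡⟨ ∑-+ X _ _ ⟩
    (∑[ x ← X ] K * (length X * ψ x)) + (∑[ x ← X ] e)
      ≡⟨ cong₂ _+_ (trans (∑-* K X _) (cong (K *_) (∑-* (length X) X ψ))) (∑-const X e) ⟩
    K * (length X * ∑ X ψ) + length X * e ∎
    where open ≤-Reasoning

  -- The predicate on `z` may vary with the four outer vertices, because `Spread` covers every `u`.
  spread-restrict₄ : ∀ {K} A₁ A₂ A₃ A₄ X Y Z → length A₁ ≡ q → length A₂ ≡ q → length A₃ ≡ q → length A₄ ≡ q → length Z ≡ q →
    Spread K X Y Z → (u : V → V → V → V → V → Bool) (ω : V → V → V → V → V → V → ℕ) (Ω : ℕ) →
    (∀ a b c d x y → ω a b c d x y ≤ Ω) →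
    K * (∑[ a ← A₁ ] ∑[ b ← A₂ ] ∑[ c ← A₃ ] ∑[ d ← A₄ ] ∑[ x ← X ] ∑[ y ← Y ] ∑[ z ← Z ] ω a b c d x y * (𝟙 (u a b c d z) * deg R Z x y)) ≤
    K * (q * (∑[ a ← A₁ ] ∑[ b ← A₂ ] ∑[ c ← A₃ ] ∑[ d ← A₄ ] ∑[ x ← X ] ∑[ y ← Y ] ∑[ z ← Z ] ω a b c d x y * (𝟙 (u a b c d z) * 𝟙 (R x y z)))) +
    q * (q * (q * (q * (Ω * q ⁴))))
  spread-restrict₄ {K} A₁ A₂ A₃ A₄ X Y Z l₁ l₂ l₃ l₄ lZ spread u ω Ω ω≤ =
    ∑-lift {K} A₁ l₁ λ a → ∑-lift {K} A₂ l₂ λ b → ∑-lift {K} A₃ l₃ λ c → ∑-lift {K} A₄ l₄ λ d →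
      spread-restrict {K} X Y Z lZ spread (u a b c d) (ω a b c d) Ω (ω≤ a b c d)

  -- For weights h ≤ M deg P of total mass ≥ M q³ / k, a second and third factor deg P cost only a constant:
  -- with r = 2k, either r deg P ≥ q or h ≤ M q / r.
  chain-step : ∀ {K} X Y P N O k M (h : V → V → ℕ) → length X ≡ q → length Y ≡ q → length P ≡ q → length O ≡ q →
    Close K X Y P N → Close K X Y P O → 2 * nextScale k ≤ K → (∀ x y → h x y ≤ M * deg R P x y) →
    M * (q * q * q) ≤ k * (∑[ x ← X ] ∑[ y ← Y ] h x y) →
    M * (q * q) * (q * q * q) ≤ nextScale k * (∑[ x ← X ] ∑[ y ← Y ] deg R N x y * (deg R O x y * h x y))
  chain-step {K} X Y P N O k M h lenX lenY lenP lenO closeN closeO scale≤K h≤ mass = conclude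
    where
    open ≤-Reasoning
    H = ∑[ x ← X ] ∑[ y ← Y ] h x y
    DDh = ∑[ x ← X ] ∑[ y ← Y ] deg R P x y * (deg R P x y * h x y)
    NOh = ∑[ x ← X ] ∑[ y ← Y ] deg R N x y * (deg R O x y * h x y)
    δN = ∑[ x ← X ] ∑[ y ← Y ] (deg R P x y ∸ deg R N x y)
    δO = ∑[ x ← X ] ∑[ y ← Y ] (deg R P x y ∸ deg R O x y)
    r = 2 * k
    cubic : ∀ D h → h ≤ M * D → r * (q * q) * h ≤ r * r * r * (D * (D * h)) + M * (q * q * q)
    cubic D h h≤MD with q ≤? r * D
    ... | yes q≤rD = begin
      r * (q * q) * h             ≤⟨ *-monoˡ-≤ h (*-monoʳ-≤ r (*-mono-≤ q≤rD q≤rD)) ⟩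
      r * (r * D * (r * D)) * h   ≡⟨ e r D h ⟩
      r * r * r * (D * (D * h))   ≤⟨ m≤m+n _ _ ⟩
      r * r * r * (D * (D * h)) + M * (q * q * q) ∎
      where
      e : ∀ r D h → r * (r * D * (r * D)) * h ≡ r * r * r * (D * (D * h))
      e = solve-∀
    ... | no q≰rD = begin
      r * (q * q) * h             ≤⟨ *-monoʳ-≤ (r * (q * q)) h≤MD ⟩
      r * (q * q) * (M * D)       ≡⟨ e r q M D ⟩
      M * (q * q * (r * D))       ≤⟨ *-monoʳ-≤ M (*-monoʳ-≤ (q * q) (<⇒≤ (≰⇒> q≰rD))) ⟩
      M * (q * q * q)             ≤⟨ m≤n+m _ _ ⟩
      r * r * r * (D * (D * h)) + M * (q * q * q) ∎
      where
      e : ∀ r q M D → r * (q * q) * (M * D) ≡ M * (q * q * (r * D))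
      e = solve-∀
    summed : r * (q * q) * H ≤ r * r * r * DDh + q * (q * (M * (q * q * q)))
    summed = begin
      r * (q * q) * H ≡⟨ sym (∑₂-* X Y (r * (q * q)) h) ⟩
      (∑[ x ← X ] ∑[ y ← Y ] r * (q * q) * h x y) ≤⟨ ∑₂-mono X Y (λ x y → cubic (deg R P x y) (h x y) (h≤ x y)) ⟩
      (∑[ x ← X ] ∑[ y ← Y ] r * r * r * (deg R P x y * (deg R P x y * h x y)) + M * (q * q * q)) ≡⟨ ∑₂-+ X Y _ _ ⟩
      (∑[ x ← X ] ∑[ y ← Y ] r * r * r * (deg R P x y * (deg R P x y * h x y))) + (∑[ x ← X ] ∑[ y ← Y ] M * (q * q * q))
        ≤⟨ +-mono-≤ (≤-reflexive (∑₂-* X Y (r * r * r) _)) (≤-trans (∑₂-≤ X Y (λ _ _ → ≤-refl)) (≤-reflexive (cong₂ (λ a b → a * (b * (M * (q * q * q)))) lenX lenY))) ⟩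
      r * r * r * DDh + q * (q * (M * (q * q * q))) ∎
    lower : M * (q * q) * (q * q * q) ≤ r * r * r * DDh
    lower = +-cancelʳ-≤ (M * (q * q) * (q * q * q)) _ _ (begin
      M * (q * q) * (q * q * q) + M * (q * q) * (q * q * q) ≡⟨ e₁ M q ⟩
      2 * (q * q) * (M * (q * q * q))      ≤⟨ *-monoʳ-≤ (2 * (q * q)) mass ⟩
      2 * (q * q) * (k * H)                ≡⟨ e₂ q k H ⟩
      r * (q * q) * H                      ≤⟨ summed ⟩
      r * r * r * DDh + q * (q * (M * (q * q * q))) ≡⟨ cong (r * r * r * DDh +_) (e₃ q M) ⟩
      r * r * r * DDh + M * (q * q) * (q * q * q) ∎)
      where
      e₁ : ∀ M q → M * (q * q) * (q * q * q) + M * (q * q) * (q * q * q) ≡ 2 * (q * q) * (M * (q * q * q))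
      e₁ = solve-∀
      e₂ : ∀ q k H → 2 * (q * q) * (k * H) ≡ 2 * k * (q * q) * H
      e₂ = solve-∀
      e₃ : ∀ q M → q * (q * (M * (q * q * q))) ≡ M * (q * q) * (q * q * q)
      e₃ = solve-∀
    replace : ∀ D n o h → D ≤ q → o ≤ q → h ≤ M * q → D * (D * h) ≤ n * (o * h) + M * (q * q) * ((D ∸ n) + (D ∸ o))
    replace D n o h D≤q o≤q h≤Mq = begin
      D * (D * h)                                    ≤⟨ *-monoʳ-≤ D (*-monoˡ-≤ h (m≤n+m∸n D o)) ⟩
      D * ((o + (D ∸ o)) * h)                        ≡⟨ e₁ D o (D ∸ o) h ⟩
      D * (o * h) + D * ((D ∸ o) * h)                ≤⟨ +-mono-≤ (*-monoˡ-≤ (o * h) (m≤n+m∸n D n)) (*-mono-≤ D≤q (*-monoʳ-≤ (D ∸ o) h≤Mq)) ⟩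
      (n + (D ∸ n)) * (o * h) + q * ((D ∸ o) * (M * q)) ≡⟨ e₂ n (D ∸ n) o h (q * ((D ∸ o) * (M * q))) ⟩
      n * (o * h) + ((D ∸ n) * (o * h) + q * ((D ∸ o) * (M * q))) ≤⟨ +-monoʳ-≤ (n * (o * h)) (+-monoˡ-≤ _ (*-monoʳ-≤ (D ∸ n) (*-mono-≤ o≤q h≤Mq))) ⟩
      n * (o * h) + ((D ∸ n) * (q * (M * q)) + q * ((D ∸ o) * (M * q))) ≡⟨ e₃ (n * (o * h)) (D ∸ n) (D ∸ o) q M ⟩
      n * (o * h) + M * (q * q) * ((D ∸ n) + (D ∸ o)) ∎
      where
      e₁ : ∀ D o d h → D * ((o + d) * h) ≡ D * (o * h) + D * (d * h)
      e₁ = solve-∀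
      e₂ : ∀ n d o h r → (n + d) * (o * h) + r ≡ n * (o * h) + (d * (o * h) + r)
      e₂ = solve-∀
      e₃ : ∀ t d d′ q M → t + (d * (q * (M * q)) + q * (d′ * (M * q))) ≡ t + M * (q * q) * (d + d′)
      e₃ = solve-∀
    upper : DDh ≤ NOh + M * (q * q) * (δN + δO)
    upper = begin
      DDh ≤⟨ ∑₂-mono X Y (λ x y → replace (deg R P x y) (deg R N x y) (deg R O x y) (h x y) (D≤q x y) (O≤q x y) (≤-trans (h≤ x y) (*-monoʳ-≤ M (D≤q x y)))) ⟩
      (∑[ x ← X ] ∑[ y ← Y ] deg R N x y * (deg R O x y * h x y) + M * (q * q) * ((deg R P x y ∸ deg R N x y) + (deg R P x y ∸ deg R O x y)))
        ≡⟨ trans (∑₂-+ X Y _ _) (cong (NOh +_) (trans (∑₂-* X Y (M * (q * q)) _) (cong (M * (q * q) *_) (∑₂-+ X Y _ _)))) ⟩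
      NOh + M * (q * q) * (δN + δO) ∎
      where
      D≤q : ∀ x y → deg R P x y ≤ q
      D≤q x y = ≤-trans (deg≤length R P x y) (≤-reflexive lenP)
      O≤q : ∀ x y → deg R O x y ≤ q
      O≤q x y = ≤-trans (deg≤length R O x y) (≤-reflexive lenO)
    errors : 2 * (r * r * r) * (δN + δO) ≤ q * q * q
    errors = *-cancelˡ-≤ 2 (begin
      2 * (2 * (r * r * r) * (δN + δO))      ≡⟨ e k (δN + δO) ⟩
      2 * nextScale k * (δN + δO)            ≤⟨ *-monoˡ-≤ (δN + δO) scale≤K ⟩
      K * (δN + δO)                          ≡⟨ *-distribˡ-+ K δN δO ⟩
      K * δN + K * δO                        ≤⟨ +-mono-≤ closeN closeO ⟩
      q * q * q + q * q * q                  ≡⟨ cong (q * q * q +_) (sym (+-identityʳ _)) ⟩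
      2 * (q * q * q)                        ∎)
      where
      e : ∀ k d → 2 * (2 * (2 * k * (2 * k) * (2 * k)) * d) ≡ 2 * (16 * (k * k * k)) * d
      e = solve-∀
    conclude : M * (q * q) * (q * q * q) ≤ nextScale k * NOh
    conclude = +-cancelʳ-≤ (M * (q * q) * (q * q * q)) _ _ (begin
      M * (q * q) * (q * q * q) + M * (q * q) * (q * q * q) ≡⟨ cong (M * (q * q) * (q * q * q) +_) (sym (+-identityʳ _)) ⟩
      2 * (M * (q * q) * (q * q * q))        ≤⟨ *-monoʳ-≤ 2 (≤-trans lower (*-monoʳ-≤ (r * r * r) upper)) ⟩
      2 * (r * r * r * (NOh + M * (q * q) * (δN + δO))) ≡⟨ e k NOh (M * (q * q)) (δN + δO) ⟩
      nextScale k * NOh + M * (q * q) * (2 * (r * r * r) * (δN + δO)) ≤⟨ +-monoʳ-≤ (nextScale k * NOh) (*-monoʳ-≤ (M * (q * q)) errors) ⟩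
      nextScale k * NOh + M * (q * q) * (q * q * q) ∎)
      where
      e : ∀ k n a d → 2 * (2 * k * (2 * k) * (2 * k) * (n + a * d)) ≡ 16 * (k * k * k) * n + a * (2 * (2 * k * (2 * k) * (2 * k)) * d)
      e = solve-∀

-- Counting copies of `H` in seven lists.

module _ {A : Set} where

  push₂ : ∀ k (X Y : List A) (f : A → A → ℕ) → k * (∑[ x ← X ] ∑[ y ← Y ] f x y) ≡ (∑[ x ← X ] ∑[ y ← Y ] k * f x y)
  push₂ k X Y f = sym (∑₂-* X Y k f)

  push₃ : ∀ k (X Y Z : List A) (f : A → A → A → ℕ) →
    k * (∑[ x ← X ] ∑[ y ← Y ] ∑[ z ← Z ] f x y z) ≡ (∑[ x ← X ] ∑[ y ← Y ] ∑[ z ← Z ] k * f x y z)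
  push₃ k X Y Z f = trans (sym (∑-* k X _)) (∑-cong X (λ x → push₂ k Y Z (f x)))

  push₄ : ∀ k (X Y Z W : List A) (f : A → A → A → A → ℕ) →
    k * (∑[ x ← X ] ∑[ y ← Y ] ∑[ z ← Z ] ∑[ w ← W ] f x y z w) ≡ (∑[ x ← X ] ∑[ y ← Y ] ∑[ z ← Z ] ∑[ w ← W ] k * f x y z w)
  push₄ k X Y Z W f = trans (sym (∑-* k X _)) (∑-cong X (λ x → push₃ k Y Z W (f x)))

  push₅ : ∀ k (X Y Z W U : List A) (f : A → A → A → A → A → ℕ) →
    k * (∑[ x ← X ] ∑[ y ← Y ] ∑[ z ← Z ] ∑[ w ← W ] ∑[ u ← U ] f x y z w u) ≡
    (∑[ x ← X ] ∑[ y ← Y ] ∑[ z ← Z ] ∑[ w ← W ] ∑[ u ← U ] k * f x y z w u)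
  push₅ k X Y Z W U f = trans (sym (∑-* k X _)) (∑-cong X (λ x → push₄ k Y Z W U (f x)))

positive-* : ∀ m {n} → 0 < m * n → 0 < m × 0 < n
positive-* zero    ()
positive-* (suc m) {zero}  h = contradiction (subst (0 <_) (*-zeroʳ m) h) (λ ())
positive-* (suc m) {suc n} h = z<s , z<s

find : {V : Set} (E F D C B A G : List V) (t : V → V → V → V → V → V → V → ℕ) →
  0 < (∑[ e ← E ] ∑[ f ← F ] ∑[ d ← D ] ∑[ c ← C ] ∑[ b ← B ] ∑[ a ← A ] ∑[ g ← G ] t e f d c b a g) →
  ∃[ e ] ∃[ f ] ∃[ d ] ∃[ c ] ∃[ b ] ∃[ a ] ∃[ g ] ((e ∈ E × f ∈ F × d ∈ D × c ∈ C × b ∈ B × a ∈ A × g ∈ G) × 0 < t e f d c b a g)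
find E F D C B A G t p =
  let e , e∈ , p = ∑>0 E p
      f , f∈ , p = ∑>0 F p
      d , d∈ , p = ∑>0 D p
      c , c∈ , p = ∑>0 C p
      b , b∈ , p = ∑>0 B p
      a , a∈ , p = ∑>0 A p
      g , g∈ , p = ∑>0 G p
  in e , f , d , c , b , a , g , (e∈ , f∈ , d∈ , c∈ , b∈ , a∈ , g∈) , p

record Copy {V : Set} (R : V → V → V → Bool) (A B C D E F G : List V) : Set where
  field
    {a b c d e f g} : V
    a∈ : a ∈ A
    b∈ : b ∈ B
    c∈ : c ∈ C
    d∈ : d ∈ D
    e∈ : e ∈ E
    f∈ : f ∈ F
    g∈ : g ∈ G
    abc : R a b c ≡ true
    bcd : R b c d ≡ true
    cde : R c d e ≡ true
    def : R d e f ≡ true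
    abg : R a b g ≡ true
    cdg : R c d g ≡ true
    efg : R e f g ≡ true
    dea : R d e a ≡ true
    bcf : R b c f ≡ true

-- One scale for each use of `chain-step`. The factor 5 beats the four insertion errors, and the sum
-- simply dominates every single scale.
scale₂ scale₃ scale₄ scale₅ embeddingPrecision : ℕ → ℕ
scale₂ k = nextScale k
scale₃ k = nextScale (scale₂ k)
scale₄ k = nextScale (scale₃ k)
scale₅ k = nextScale (scale₄ k)
embeddingPrecision k = 5 * (scale₂ k + scale₃ k + scale₄ k + scale₅ k)

module Embedding {V : Set} (R : V → V → V → Bool) (rotate : ∀ x y z → R x y z ≡ R y z x) (q : ℕ) (0<q : 0 < q)
  (K : ℕ) (A B C D E F G : List V)
  (lenA : length A ≡ q) (lenB : length B ≡ q) (lenC : length C ≡ q) (lenD : length D ≡ q)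
  (lenE : length E ≡ q) (lenF : length F ≡ q) (lenG : length G ≡ q)
  (spreadCDG : Spread R q K C D G) (spreadEFG : Spread R q K E F G)
  (spreadDEA : Spread R q K D E A) (spreadBCF : Spread R q K B C F)
  (closeBCAD : Close R q K B C A D) (closeBCAF : Close R q K B C A F)
  (closeCDBE : Close R q K C D B E) (closeCDBG : Close R q K C D B G)
  (closeDECF : Close R q K D E C F) (closeDECA : Close R q K D E C A)
  (closeEFDG : Close R q K E F D G)
  (k : ℕ) (precise : embeddingPrecision k ≤ K)
  (heavy : q ⁴ ≤ k * (∑[ a ← A ] ∑[ b ← B ] deg R C a b * deg R G a b))
  where

  private
    ι : V → V → V → ℕ
    ι x y z = 𝟙 (R x y z)

    ι≤1 : ∀ x y z → ι x y z ≤ 1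
    ι≤1 x y z = 𝟙≤1 (R x y z)

    deg≤q : ∀ Z → length Z ≡ q → ∀ x y → deg R Z x y ≤ q
    deg≤q Z lenZ x y = ≤-trans (deg≤length R Z x y) (≤-reflexive lenZ)

    -- Weighted counts of the part of the spine that ends in the given pair. The degree factors are
    -- placeholders: `deg R G a b`, `deg R F b c`, `deg R G c d`, `deg R A d e` and, in `S`,
    -- `deg R G e f` stand for the edges abg, bcf, cdg, dea and efg.
    h₁ h₂ h₃ h₄ : V → V → ℕ
    h₁ b c = ∑[ a ← A ] ι a b c * deg R G a b
    h₂ c d = ∑[ b ← B ] ι b c d * (deg R F b c * h₁ b c)
    h₃ d e = ∑[ c ← C ] ι c d e * (deg R G c d * h₂ c d)
    h₄ e f = ∑[ d ← D ] ι d e f * (deg R A d e * h₃ d e)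

    S : ℕ
    S = ∑[ e ← E ] ∑[ f ← F ] deg R G e f * h₄ e f

    advance : ∀ X Y Z (w : V → V → ℕ) → (∑[ y ← Y ] ∑[ z ← Z ] ∑[ x ← X ] ι x y z * w x y) ≡ (∑[ x ← X ] ∑[ y ← Y ] deg R Z x y * w x y)
    advance X Y Z w = trans (sym (pull₂ X Y Z (λ x y z → ι x y z * w x y))) (∑₂-cong X Y (λ x y → ∑-*ʳ (w x y) Z _))

    -- After a rotation of the edge, the sum over the vertex just left behind becomes a degree into
    -- its block. This is the bound that `chain-step` asks of its weight.
    bound : ∀ M X (w : V → V → ℕ) → (∀ x y → w x y ≤ M) → ∀ y z → (∑[ x ← X ] ι x y z * w x y) ≤ M * deg R X y z
    bound M X w w≤ y z = begin
      (∑[ x ← X ] ι x y z * w x y) ≤⟨ ∑-mono X (λ x → *-monoʳ-≤ (ι x y z) (w≤ x y)) ⟩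
      (∑[ x ← X ] ι x y z * M)     ≡⟨ ∑-*ʳ M X _ ⟩
      (∑[ x ← X ] ι x y z) * M     ≡⟨ cong (_* M) (∑-cong X (λ x → cong 𝟙 (rotate x y z))) ⟩
      deg R X y z * M              ≡⟨ *-comm _ M ⟩
      M * deg R X y z              ∎
      where open ≤-Reasoning

    M₂ M₃ M₄ : ℕ
    M₂ = q * (q * q)
    M₃ = M₂ * (q * q)
    M₄ = M₃ * (q * q)

    next-bound : ∀ M (Y : List V) X (w : V → V → ℕ) → length X ≡ q → length Y ≡ q → (∀ x y → w x y ≤ M * deg R Y x y) →
      ∀ x y → deg R X x y * w x y ≤ M * (q * q)
    next-bound M Y X w lenX lenY w≤ x y = ≤-trans (*-mono-≤ (deg≤q X lenX x y) (≤-trans (w≤ x y) (*-monoʳ-≤ M (deg≤q Y lenY x y)))) (≤-reflexive (e q M))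
      where
      e : ∀ q M → q * (M * q) ≡ M * (q * q)
      e = solve-∀

    h₁≤ : ∀ b c → h₁ b c ≤ q * deg R A b c
    h₁≤ = bound q A (deg R G) (deg≤q G lenG)
    h₂≤ : ∀ c d → h₂ c d ≤ M₂ * deg R B c d
    h₂≤ = bound M₂ B (λ b c → deg R F b c * h₁ b c) (next-bound q A F h₁ lenF lenA h₁≤)
    h₃≤ : ∀ d e → h₃ d e ≤ M₃ * deg R C d e
    h₃≤ = bound M₃ C (λ c d → deg R G c d * h₂ c d) (next-bound M₂ B G h₂ lenG lenB h₂≤)
    h₄≤ : ∀ e f → h₄ e f ≤ M₄ * deg R D e f
    h₄≤ = bound M₄ D (λ d e → deg R A d e * h₃ d e) (next-bound M₃ C A h₃ lenA lenC h₃≤)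

    s₂ = scale₂ k
    s₃ = scale₃ k
    s₄ = scale₄ k
    s₅ = scale₅ k

    split₅ : 2 * s₂ ≤ K × 2 * s₃ ≤ K × 2 * s₄ ≤ K × 2 * s₅ ≤ K × 5 * s₅ ≤ K
    split₅ = part s₂ 2 (s≤s (s≤s z≤n)) (s₃ + s₄ + s₅) (e₁ s₂ s₃ s₄ s₅) , part s₃ 2 (s≤s (s≤s z≤n)) (s₂ + s₄ + s₅) (e₂ s₂ s₃ s₄ s₅) ,
      part s₄ 2 (s≤s (s≤s z≤n)) (s₂ + s₃ + s₅) (e₃ s₂ s₃ s₄ s₅) , part s₅ 2 (s≤s (s≤s z≤n)) (s₂ + s₃ + s₄) (e₄ s₂ s₃ s₄ s₅) ,
      part s₅ 5 ≤-refl (s₂ + s₃ + s₄) (e₄ s₂ s₃ s₄ s₅)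
      where
      part : ∀ s n → n ≤ 5 → ∀ r → s + r ≡ s₂ + s₃ + s₄ + s₅ → n * s ≤ K
      part s n n≤5 r eq = ≤-trans (*-mono-≤ n≤5 (≤-trans (m≤m+n s r) (≤-reflexive eq))) precise
      e₁ : ∀ a b c d → a + (b + c + d) ≡ a + b + c + d
      e₁ = solve-∀
      e₂ : ∀ a b c d → b + (a + c + d) ≡ a + b + c + d
      e₂ = solve-∀
      e₃ : ∀ a b c d → c + (a + b + d) ≡ a + b + c + d
      e₃ = solve-∀
      e₄ : ∀ a b c d → d + (a + b + c) ≡ a + b + c + d
      e₄ = solve-∀

    mass₁ : q * (q * q * q) ≤ k * (∑[ b ← B ] ∑[ c ← C ] h₁ b c)
    mass₁ = ≤-trans (≤-reflexive (e q)) (≤-trans heavy (≤-reflexive (cong (k *_) (sym (advance A B C (deg R G))))))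
      where
      e : ∀ q → q * (q * q * q) ≡ q * q * (q * q)
      e = solve-∀

    mass₂ : M₂ * (q * q * q) ≤ s₂ * (∑[ c ← C ] ∑[ d ← D ] h₂ c d)
    mass₂ = ≤-trans (chain-step R q B C A D F k q h₁ lenB lenC lenA lenF closeBCAD closeBCAF (proj₁ split₅) h₁≤ mass₁)
      (≤-reflexive (cong (s₂ *_) (sym (advance B C D (λ b c → deg R F b c * h₁ b c)))))

    mass₃ : M₃ * (q * q * q) ≤ s₃ * (∑[ d ← D ] ∑[ e ← E ] h₃ d e)
    mass₃ = ≤-trans (chain-step R q C D B E G s₂ M₂ h₂ lenC lenD lenB lenG closeCDBE closeCDBG (proj₁ (proj₂ split₅)) h₂≤ mass₂)
      (≤-reflexive (cong (s₃ *_) (sym (advance C D E (λ c d → deg R G c d * h₂ c d)))))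

    mass₄ : M₄ * (q * q * q) ≤ s₄ * (∑[ e ← E ] ∑[ f ← F ] h₄ e f)
    mass₄ = ≤-trans (chain-step R q D E C F A s₃ M₃ h₃ lenD lenE lenC lenA closeDECF closeDECA (proj₁ (proj₂ (proj₂ split₅))) h₃≤ mass₃)
      (≤-reflexive (cong (s₄ *_) (sym (advance D E F (λ d e → deg R A d e * h₃ d e)))))

    q¹¹ : ℕ
    q¹¹ = q ⁴ * q ⁴ * (q * q * q)

    massS : q¹¹ ≤ s₅ * S
    massS = cancel q 0<q (begin
      q * q¹¹                              ≡⟨ e₁ q ⟩
      -- The spine ends at `f`, so `G` takes both places of `chain-step`; the surplus degree into
      -- `G` is estimated by `q`.
      M₄ * (q * q) * (q * q * q)           ≤⟨ chain-step R q E F D G G s₄ M₄ h₄ lenE lenF lenD lenG closeEFDG closeEFDG (proj₁ (proj₂ (proj₂ (proj₂ split₅)))) h₄≤ mass₄ ⟩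
      s₅ * (∑[ e ← E ] ∑[ f ← F ] deg R G e f * (deg R G e f * h₄ e f))
        ≤⟨ *-monoʳ-≤ s₅ (∑₂-mono E F (λ e f → *-monoˡ-≤ (deg R G e f * h₄ e f) (deg≤q G lenG e f))) ⟩
      s₅ * (∑[ e ← E ] ∑[ f ← F ] q * (deg R G e f * h₄ e f)) ≡⟨ cong (s₅ *_) (∑₂-* E F q _) ⟩
      s₅ * (q * S)                         ≡⟨ e₂ s₅ q S ⟩
      q * (s₅ * S)                         ∎)
      where
      open ≤-Reasoning
      cancel : ∀ q {a b} → 0 < q → q * a ≤ q * b → a ≤ b
      cancel (suc q) _ = *-cancelˡ-≤ (suc q)
      e₁ : ∀ q → q * (q * q * (q * q) * (q * q * (q * q)) * (q * q * q)) ≡ q * (q * q) * (q * q) * (q * q) * (q * q) * (q * q * q)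
      e₁ = solve-∀
      e₂ : ∀ s q S → s * (q * S) ≡ q * (s * S)
      e₂ = solve-∀

    Flat : (V → V → V → V → V → V → V → ℕ) → ℕ
    Flat t = ∑[ e ← E ] ∑[ f ← F ] ∑[ d ← D ] ∑[ c ← C ] ∑[ b ← B ] ∑[ a ← A ] ∑[ g ← G ] t e f d c b a g

    -- The summands after zero to four insertions. Inserting an edge at a vertex requires a weight
    -- free of that vertex, so all indicators containing it go into the predicate. This works for
    -- cdg and efg at `g`, dea at `a` and bcf at `f`, while the placeholders of later insertions
    -- remain in the weights.
    t₁ t₂ t₃ t₄ t₅ : V → V → V → V → V → V → V → ℕ
    ω₁ ω₂ ω₃ ω₄ : V → V → V → V → V → V → ℕ
    t₁ e f d c b a g = deg R G e f * (ι d e f * (deg R A d e * (ι c d e * (deg R G c d * (ι b c d * (deg R F b c * (ι a b c * ι a b g)))))))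
    ω₁ e f b a c d = deg R G e f * (ι d e f * (deg R A d e * (ι c d e * (ι b c d * (deg R F b c * ι a b c)))))
    t₂ e f d c b a g = ω₁ e f b a c d * (ι a b g * ι c d g)
    ω₂ d c b a e f = ι d e f * (deg R A d e * (ι c d e * (ι b c d * (deg R F b c * ι a b c))))
    t₃ e f d c b a g = ω₂ d c b a e f * (𝟙 (R a b g ∧ R c d g) * ι e f g)
    ω₃ f c b g d e = ι d e f * (ι c d e * (ι b c d * (deg R F b c * (ι c d g * ι e f g))))
    t₄ e f d c b a g = ω₃ f c b g d e * (𝟙 (R a b c ∧ R a b g) * ι d e a)
    ω₄ e d a g b c = ι c d e * (ι b c d * (ι a b c * (ι a b g * (ι c d g * ι d e a))))
    t₅ e f d c b a g = ω₄ e d a g b c * (𝟙 (R d e f ∧ R e f g) * ι b c f)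

    flat₁ : S ≡ Flat t₁
    flat₁ = ∑₂-cong E F λ e f → trans (cong (deg R G e f *_) (p₄ e f)) (push₅ (deg R G e f) D C B A G _)
      where
      p₁ : ∀ b c → h₁ b c ≡ (∑[ a ← A ] ∑[ g ← G ] ι a b c * ι a b g)
      p₁ b c = ∑-cong A (λ a → sym (∑-* (ι a b c) G _))
      p₂ : ∀ c d → h₂ c d ≡ (∑[ b ← B ] ∑[ a ← A ] ∑[ g ← G ] ι b c d * (deg R F b c * (ι a b c * ι a b g)))
      p₂ c d = ∑-cong B (λ b → trans (cong (ι b c d *_) (trans (cong (deg R F b c *_) (p₁ b c)) (push₂ (deg R F b c) A G _))) (push₂ (ι b c d) A G _))
      p₃ : ∀ d e → h₃ d e ≡ (∑[ c ← C ] ∑[ b ← B ] ∑[ a ← A ] ∑[ g ← G ] ι c d e * (deg R G c d * (ι b c d * (deg R F b c * (ι a b c * ι a b g)))))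
      p₃ d e = ∑-cong C (λ c → trans (cong (ι c d e *_) (trans (cong (deg R G c d *_) (p₂ c d)) (push₃ (deg R G c d) B A G _))) (push₃ (ι c d e) B A G _))
      p₄ : ∀ e f → h₄ e f ≡ (∑[ d ← D ] ∑[ c ← C ] ∑[ b ← B ] ∑[ a ← A ] ∑[ g ← G ] ι d e f * (deg R A d e * (ι c d e * (deg R G c d * (ι b c d * (deg R F b c * (ι a b c * ι a b g)))))))
      p₄ e f = ∑-cong D (λ d → trans (cong (ι d e f *_) (trans (cong (deg R A d e *_) (p₃ d e)) (push₄ (deg R A d e) C B A G _))) (push₄ (ι d e f) C B A G _))

    Flat-cong : ∀ {t t′} → (∀ e f d c b a g → t e f d c b a g ≡ t′ e f d c b a g) → Flat t ≡ Flat t′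
    Flat-cong h = ∑₂-cong E F λ e f → ∑₂-cong D C λ d c → ∑₂-cong B A λ b a → ∑-cong G (h e f d c b a)

    order₁ : ∀ t → Flat t ≡ (∑[ e ← E ] ∑[ f ← F ] ∑[ b ← B ] ∑[ a ← A ] ∑[ c ← C ] ∑[ d ← D ] ∑[ g ← G ] t e f d c b a g)
    order₁ t = ∑₂-cong E F λ e f → trans (pull₃ D C B A _) (pull₂ C B A _)

    order₂ : ∀ t → Flat t ≡ (∑[ d ← D ] ∑[ c ← C ] ∑[ b ← B ] ∑[ a ← A ] ∑[ e ← E ] ∑[ f ← F ] ∑[ g ← G ] t e f d c b a g)
    order₂ t = trans (pull₅ E F D C B A _) (pull₅ F D C B A E _)

    order₃ : ∀ t → Flat t ≡ (∑[ f ← F ] ∑[ c ← C ] ∑[ b ← B ] ∑[ g ← G ] ∑[ d ← D ] ∑[ e ← E ] ∑[ a ← A ] t e f d c b a g)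
    order₃ t = trans (∑₂-cong E F λ e f → ∑₂-cong D C λ d c → ∑-cong B λ b → ∑-swap A G _)
      (trans (pull₅ E F D C B G _) (∑-cong F λ f → pull₃ D C B G _))

    order₄ : ∀ t → Flat t ≡ (∑[ e ← E ] ∑[ d ← D ] ∑[ a ← A ] ∑[ g ← G ] ∑[ b ← B ] ∑[ c ← C ] ∑[ f ← F ] t e f d c b a g)
    order₄ t = ∑-cong E λ e → trans (pull₅ F D C B A G _) (∑-cong D λ d → trans (pull₃ C B A G _) (pull₂ B A G _))

    Ω₁ Ω₂ Ω₃ Ω₄ : ℕ
    Ω₁ = q * (1 * (q * (1 * (1 * (q * 1)))))
    Ω₂ = 1 * (q * (1 * (1 * (q * 1))))
    Ω₃ = 1 * (1 * (1 * (q * (1 * 1))))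
    Ω₄ = 1

    error : ℕ → ℕ
    error Ω = q * (q * (q * (q * (Ω * q ⁴))))

    insert-cdg : K * Flat t₁ ≤ K * (q * Flat t₂) + error Ω₁
    insert-cdg = begin
      K * Flat t₁ ≡⟨ cong (K *_) (trans (Flat-cong λ e f d c b a g → e₁ (deg R G e f) (ι d e f) (deg R A d e) (ι c d e) (deg R G c d) (ι b c d) (deg R F b c) (ι a b c) (ι a b g)) (order₁ _)) ⟩
      _ ≤⟨ spread-restrict₄ R q {K} E F B A C D G lenE lenF lenB lenA lenG spreadCDG (λ e f b a g → R a b g) ω₁ Ω₁ ω≤ ⟩
      _ ≡⟨ cong (λ s → K * (q * s) + error Ω₁) (sym (order₁ t₂)) ⟩
      K * (q * Flat t₂) + error Ω₁ ∎
      where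
      open ≤-Reasoning
      ω≤ : ∀ e f b a c d → ω₁ e f b a c d ≤ Ω₁
      ω≤ e f b a c d = *-mono-≤ (deg≤q G lenG e f) (*-mono-≤ (ι≤1 d e f) (*-mono-≤ (deg≤q A lenA d e) (*-mono-≤ (ι≤1 c d e) (*-mono-≤ (ι≤1 b c d) (*-mono-≤ (deg≤q F lenF b c) (ι≤1 a b c))))))
      e₁ : ∀ Gef def Ade cde Gcd bcd Fbc abc abg →
        Gef * (def * (Ade * (cde * (Gcd * (bcd * (Fbc * (abc * abg))))))) ≡ Gef * (def * (Ade * (cde * (bcd * (Fbc * abc))))) * (abg * Gcd)
      e₁ = solve-∀

    insert-efg : K * Flat t₂ ≤ K * (q * Flat t₃) + error Ω₂
    insert-efg = begin
      K * Flat t₂ ≡⟨ cong (K *_) (trans (Flat-cong λ e f d c b a g → trans (e₁ (deg R G e f) (ω₂ d c b a e f) (ι a b g * ι c d g))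
         (cong (λ t → ω₂ d c b a e f * (t * deg R G e f)) (sym (𝟙-∧ (R a b g) (R c d g))))) (order₂ _)) ⟩
      _ ≤⟨ spread-restrict₄ R q {K} D C B A E F G lenD lenC lenB lenA lenG spreadEFG (λ d c b a g → R a b g ∧ R c d g) ω₂ Ω₂ ω≤ ⟩
      _ ≡⟨ cong (λ s → K * (q * s) + error Ω₂) (sym (order₂ t₃)) ⟩
      K * (q * Flat t₃) + error Ω₂ ∎
      where
      open ≤-Reasoning
      ω≤ : ∀ d c b a e f → ω₂ d c b a e f ≤ Ω₂
      ω≤ d c b a e f = *-mono-≤ (ι≤1 d e f) (*-mono-≤ (deg≤q A lenA d e) (*-mono-≤ (ι≤1 c d e) (*-mono-≤ (ι≤1 b c d) (*-mono-≤ (deg≤q F lenF b c) (ι≤1 a b c)))))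
      e₁ : ∀ Gef ω u → Gef * ω * u ≡ ω * (u * Gef)
      e₁ = solve-∀

    insert-dea : K * Flat t₃ ≤ K * (q * Flat t₄) + error Ω₃
    insert-dea = begin
      K * Flat t₃ ≡⟨ cong (K *_) (trans (Flat-cong λ e f d c b a g → trans
         (cong (λ t → ω₂ d c b a e f * (t * ι e f g)) (𝟙-∧ (R a b g) (R c d g)))
         (trans (e₁ (ι d e f) (deg R A d e) (ι c d e) (ι b c d) (deg R F b c) (ι a b c) (ι a b g) (ι c d g) (ι e f g))
         (cong (λ t → ω₃ f c b g d e * (t * deg R A d e)) (sym (𝟙-∧ (R a b c) (R a b g)))))) (order₃ _)) ⟩
      _ ≤⟨ spread-restrict₄ R q {K} F C B G D E A lenF lenC lenB lenG lenA spreadDEA (λ f c b g a → R a b c ∧ R a b g) ω₃ Ω₃ ω≤ ⟩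
      _ ≡⟨ cong (λ s → K * (q * s) + error Ω₃) (sym (order₃ t₄)) ⟩
      K * (q * Flat t₄) + error Ω₃ ∎
      where
      open ≤-Reasoning
      ω≤ : ∀ f c b g d e → ω₃ f c b g d e ≤ Ω₃
      ω≤ f c b g d e = *-mono-≤ (ι≤1 d e f) (*-mono-≤ (ι≤1 c d e) (*-mono-≤ (ι≤1 b c d) (*-mono-≤ (deg≤q F lenF b c) (*-mono-≤ (ι≤1 c d g) (ι≤1 e f g)))))
      e₁ : ∀ def Ade cde bcd Fbc abc abg cdg efg → def * (Ade * (cde * (bcd * (Fbc * abc)))) * ((abg * cdg) * efg) ≡
        def * (cde * (bcd * (Fbc * (cdg * efg)))) * ((abc * abg) * Ade)
      e₁ = solve-∀

    insert-bcf : K * Flat t₄ ≤ K * (q * Flat t₅) + error Ω₄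
    insert-bcf = begin
      K * Flat t₄ ≡⟨ cong (K *_) (trans (Flat-cong λ e f d c b a g → trans
         (cong (λ t → ω₃ f c b g d e * (t * ι d e a)) (𝟙-∧ (R a b c) (R a b g)))
         (trans (e₁ (ι d e f) (ι c d e) (ι b c d) (deg R F b c) (ι c d g) (ι e f g) (ι a b c) (ι a b g) (ι d e a))
         (cong (λ t → ω₄ e d a g b c * (t * deg R F b c)) (sym (𝟙-∧ (R d e f) (R e f g)))))) (order₄ _)) ⟩
      _ ≤⟨ spread-restrict₄ R q {K} E D A G B C F lenE lenD lenA lenG lenF spreadBCF (λ e d a g f → R d e f ∧ R e f g) ω₄ Ω₄ ω≤ ⟩
      _ ≡⟨ cong (λ s → K * (q * s) + error Ω₄) (sym (order₄ t₅)) ⟩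
      K * (q * Flat t₅) + error Ω₄ ∎
      where
      open ≤-Reasoning
      ω≤ : ∀ e d a g b c → ω₄ e d a g b c ≤ Ω₄
      ω≤ e d a g b c = *-mono-≤ (ι≤1 c d e) (*-mono-≤ (ι≤1 b c d) (*-mono-≤ (ι≤1 a b c) (*-mono-≤ (ι≤1 a b g) (*-mono-≤ (ι≤1 c d g) (ι≤1 d e a)))))
      e₁ : ∀ def cde bcd Fbc cdg efg abc abg dea → def * (cde * (bcd * (Fbc * (cdg * efg)))) * ((abc * abg) * dea) ≡
        cde * (bcd * (abc * (abg * (cdg * dea)))) * ((def * efg) * Fbc)
      e₁ = solve-∀

  -- Otherwise the four insertions bound K S by 4 q¹¹.
  positive : 0 < Flat t₅
  positive = n≢0⇒n>0 λ t₅≡0 → contradiction (total t₅≡0) (<⇒≱ small)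
    where
    open ≤-Reasoning
    x∙yz≈y∙xz : ∀ x y z → x * (y * z) ≡ y * (x * z)
    x∙yz≈y∙xz = solve-∀
    x∙yz≈yx∙z : ∀ x y z → x * (y * z) ≡ y * x * z
    x∙yz≈yx∙z = solve-∀
    grow : ∀ t {e} → K * t ≤ e → K * (q * t) ≤ q * e
    grow t h = ≤-trans (≤-reflexive (x∙yz≈y∙xz K q t)) (*-monoʳ-≤ q h)
    zeroed : ∀ t {e} → t ≡ 0 → K * (q * t) + e ≡ e
    zeroed t {e} refl = cong (_+ e) (trans (cong (K *_) (*-zeroʳ q)) (*-zeroʳ K))
    e : ∀ q → q * (q * (q * (q * (q * (q * (q * (1 * (q * q * (q * q))))))) + q * (q * (q * (q * (1 * (1 * (1 * (q * (1 * 1)))) * (q * q * (q * q)))))))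
        + q * (q * (q * (q * (1 * (q * (1 * (1 * (q * 1)))) * (q * q * (q * q)))))))
        + q * (q * (q * (q * (q * (1 * (q * (1 * (1 * (q * 1))))) * (q * q * (q * q)))))) ≡
      4 * (q * q * (q * q) * (q * q * (q * q)) * (q * q * q))
    e = solve-∀
    0<q¹¹ : 0 < q¹¹
    0<q¹¹ = *-mono-≤ (*-mono-≤ 0<q⁴ 0<q⁴) (*-mono-≤ (*-mono-≤ 0<q 0<q) 0<q)
      where
      0<q⁴ : 0 < q ⁴
      0<q⁴ = *-mono-≤ (*-mono-≤ 0<q 0<q) (*-mono-≤ 0<q 0<q)
    total : Flat t₅ ≡ 0 → 5 * s₅ * q¹¹ ≤ 4 * s₅ * q¹¹
    total t₅≡0 = begin
      5 * s₅ * q¹¹       ≤⟨ *-monoˡ-≤ q¹¹ (proj₂ (proj₂ (proj₂ (proj₂ split₅)))) ⟩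
      K * q¹¹            ≤⟨ *-monoʳ-≤ K massS ⟩
      K * (s₅ * S)       ≡⟨ x∙yz≈y∙xz K s₅ S ⟩
      s₅ * (K * S)       ≡⟨ cong (λ s → s₅ * (K * s)) flat₁ ⟩
      s₅ * (K * Flat t₁) ≤⟨ *-monoʳ-≤ s₅ b₁ ⟩
      s₅ * (q * (q * (q * error Ω₄ + error Ω₃) + error Ω₂) + error Ω₁) ≡⟨ cong (s₅ *_) (e q) ⟩
      s₅ * (4 * q¹¹)     ≡⟨ x∙yz≈yx∙z s₅ 4 q¹¹ ⟩
      4 * s₅ * q¹¹       ∎
      where
      b₄ : K * Flat t₄ ≤ error Ω₄
      b₄ = ≤-trans insert-bcf (≤-reflexive (zeroed (Flat t₅) t₅≡0))
      b₃ : K * Flat t₃ ≤ q * error Ω₄ + error Ω₃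
      b₃ = ≤-trans insert-dea (+-monoˡ-≤ (error Ω₃) (grow (Flat t₄) b₄))
      b₂ : K * Flat t₂ ≤ q * (q * error Ω₄ + error Ω₃) + error Ω₂
      b₂ = ≤-trans insert-efg (+-monoˡ-≤ (error Ω₂) (grow (Flat t₃) b₃))
      b₁ : K * Flat t₁ ≤ q * (q * (q * error Ω₄ + error Ω₃) + error Ω₂) + error Ω₁
      b₁ = ≤-trans insert-cdg (+-monoˡ-≤ (error Ω₁) (grow (Flat t₂) b₂))
    small : 4 * s₅ * q¹¹ < 5 * s₅ * q¹¹
    small = ≤-trans (+-monoˡ-≤ (4 * s₅ * q¹¹) (≤-trans 0<q¹¹ massS′)) (≤-reflexive (e′ s₅ q¹¹))
      where
      0<s₅ : 0 < s₅
      0<s₅ = proj₁ (positive-* s₅ {S} (≤-trans 0<q¹¹ massS))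
      massS′ : q¹¹ ≤ s₅ * q¹¹
      massS′ = ≤-trans (≤-reflexive (sym (*-identityˡ q¹¹))) (*-monoˡ-≤ q¹¹ 0<s₅)
      e′ : ∀ s t → s * t + 4 * s * t ≡ 5 * s * t
      e′ = solve-∀

  copy : Copy R A B C D E F G
  copy = build (find E F D C B A G t₅ positive)
    where
    build : (∃[ e ] ∃[ f ] ∃[ d ] ∃[ c ] ∃[ b ] ∃[ a ] ∃[ g ] ((e ∈ E × f ∈ F × d ∈ D × c ∈ C × b ∈ B × a ∈ A × g ∈ G) × 0 < t₅ e f d c b a g)) → Copy R A B C D E F G
    build (e , f , d , c , b , a , g , (e∈ , f∈ , d∈ , c∈ , b∈ , a∈ , g∈) , p) = record
      { a∈ = a∈ ; b∈ = b∈ ; c∈ = c∈ ; d∈ = d∈ ; e∈ = e∈ ; f∈ = f∈ ; g∈ = g∈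
      ; cde = 𝟙>0 (proj₁ (positive-* (ι c d e) l₁))
      ; bcd = 𝟙>0 (proj₁ (positive-* (ι b c d) l₂))
      ; abc = 𝟙>0 (proj₁ (positive-* (ι a b c) l₃))
      ; abg = 𝟙>0 (proj₁ (positive-* (ι a b g) l₄))
      ; cdg = 𝟙>0 (proj₁ (positive-* (ι c d g) l₅))
      ; dea = 𝟙>0 (proj₂ (positive-* (ι c d g) l₅))
      ; def = 𝟙>0 (proj₁ (positive-* (ι d e f) r₂))
      ; efg = 𝟙>0 (proj₂ (positive-* (ι d e f) r₂))
      ; bcf = 𝟙>0 (proj₂ (positive-* (𝟙 (R d e f ∧ R e f g)) r₁))
      }
      where
      l₁ = proj₁ (positive-* (ω₄ e d a g b c) p)
      l₂ = proj₂ (positive-* (ι c d e) l₁)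
      l₃ = proj₂ (positive-* (ι b c d) l₂)
      l₄ = proj₂ (positive-* (ι a b c) l₃)
      l₅ = proj₂ (positive-* (ι a b g) l₄)
      r₁ = proj₂ (positive-* (ω₄ e d a g b c) p)
      r₂ = subst (0 <_) (𝟙-∧ (R d e f) (R e f g)) (proj₁ (positive-* (𝟙 (R d e f ∧ R e f g)) r₁))

-- Combinations of vectors with nearly constant inner products.

∑-mono-∈ : {A : Set} (xs : List A) {f g : A → ℕ} → (∀ {x} → x ∈ xs → f x ≤ g x) → ∑ xs f ≤ ∑ xs g
∑-mono-∈ []       h = z≤n
∑-mono-∈ (x ∷ xs) h = +-mono-≤ (h (here refl)) (∑-mono-∈ xs (h ∘ there))

∣∑-∑∣≤ : {A : Set} (xs : List A) (f g : A → ℕ) → ∣ ∑ xs f - ∑ xs g ∣ ≤ ∑[ x ← xs ] ∣ f x - g x ∣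
∣∑-∑∣≤ []       f g = z≤n
∣∑-∑∣≤ (x ∷ xs) f g = ≤-trans (∣-∣-+ (f x) (∑ xs f) (g x) (∑ xs g)) (+-monoʳ-≤ ∣ f x - g x ∣ (∣∑-∑∣≤ xs f g))
  where
  ∣-∣-+ : ∀ a b c d → ∣ a + b - c + d ∣ ≤ ∣ a - c ∣ + ∣ b - d ∣
  ∣-∣-+ a b c d = ≤-trans (∣-∣-triangle (a + b) (c + b) (c + d))
    (≤-reflexive (cong₂ _+_ (trans (cong₂ ∣_-_∣ (+-comm a b) (+-comm c b)) (∣m+n-m+o∣≡∣n-o∣ b a c)) (∣m+n-m+o∣≡∣n-o∣ c b d)))

same : ℕ → ℕ → ℕ
same k l = 𝟙 (k Data.Nat.≡ᵇ l)

module _ {P : Set} (Ps : List P) (φ : ℕ → P → ℕ) (κ N c : ℕ) where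

  inner : ℕ → ℕ → ℕ
  inner k l = ∑[ x ← Ps ] φ k x * φ l x

  -- All inner products are c up to N / κ, those of a vector with itself up to N more.
  Level : List ℕ → List ℕ → Set
  Level ks ls = ∀ {k l} → k ∈ ks → l ∈ ls →
    κ * inner k l ≤ κ * c + N + κ * (N * same k l) × κ * c ≤ κ * inner k l + N + κ * (N * same k l)

  combination : List ℕ → (ℕ → ℕ) → P → ℕ
  combination ks p x = ∑[ k ← ks ] p k * φ k x

  form : List ℕ → (ℕ → ℕ) → List ℕ → (ℕ → ℕ) → ℕ
  form ks p ls r = ∑[ x ← Ps ] combination ks p x * combination ls r x

  form-inner : ∀ ks p ls r → form ks p ls r ≡ (∑[ k ← ks ] ∑[ l ← ls ] p k * (r l * inner k l))
  form-inner ks p ls r = begin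
    (∑[ x ← Ps ] combination ks p x * combination ls r x)
      ≡⟨ ∑-cong Ps (λ x → sym (∑-*ʳ (combination ls r x) ks _)) ⟩
    (∑[ x ← Ps ] ∑[ k ← ks ] p k * φ k x * combination ls r x)
      ≡⟨ ∑-swap Ps ks _ ⟩
    (∑[ k ← ks ] ∑[ x ← Ps ] p k * φ k x * combination ls r x)
      ≡⟨ ∑₂-cong ks Ps (λ k x → sym (∑-* (p k * φ k x) ls _)) ⟩
    (∑[ k ← ks ] ∑[ x ← Ps ] ∑[ l ← ls ] p k * φ k x * (r l * φ l x))
      ≡⟨ ∑-cong ks (λ k → ∑-swap Ps ls _) ⟩
    (∑[ k ← ks ] ∑[ l ← ls ] ∑[ x ← Ps ] p k * φ k x * (r l * φ l x))
      ≡⟨ ∑₂-cong ks ls (λ k l → trans (∑-cong Ps (λ x → e (p k) (φ k x) (r l) (φ l x))) (trans (∑-* (p k) Ps _) (cong (p k *_) (∑-* (r l) Ps _)))) ⟩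
    (∑[ k ← ks ] ∑[ l ← ls ] p k * (r l * inner k l)) ∎
    where
    open ≡-Reasoning
    e : ∀ p f r g → p * f * (r * g) ≡ p * (r * (f * g))
    e = solve-∀

  module _ (ks ls : List ℕ) (p r : ℕ → ℕ) (m w : ℕ) (level : Level ks ls)
    (massp : ∑ ks p ≡ w) (massr : ∑ ls r ≡ w) (few : ∀ k → (∑[ l ← ls ] same k l * r l) ≤ m) where

    private
      main rest : ℕ → ℕ → ℕ
      main k l = p k * (r l * (κ * inner k l))
      rest k l = p k * (r l * (N + κ * (N * same k l)))

      ∑main : (∑[ k ← ks ] ∑[ l ← ls ] main k l) ≡ κ * form ks p ls r
      ∑main = trans (∑₂-cong ks ls (λ k l → e (p k) (r l) κ (inner k l))) (trans (∑₂-* ks ls κ _) (cong (κ *_) (sym (form-inner ks p ls r))))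
        where
        e : ∀ p r κ i → p * (r * (κ * i)) ≡ κ * (p * (r * i))
        e = solve-∀

      ∑level : (∑[ k ← ks ] ∑[ l ← ls ] p k * (r l * (κ * c))) ≡ κ * c * (w * w)
      ∑level = begin
        (∑[ k ← ks ] ∑[ l ← ls ] p k * (r l * (κ * c))) ≡⟨ ∑-cong ks (λ k → trans (∑-* (p k) ls _) (cong (p k *_) (trans (∑-*ʳ (κ * c) ls r) (cong (_* (κ * c)) massr)))) ⟩
        (∑[ k ← ks ] p k * (w * (κ * c)))               ≡⟨ trans (∑-*ʳ (w * (κ * c)) ks p) (cong (_* (w * (κ * c))) massp) ⟩
        w * (w * (κ * c))                               ≡⟨ e w (κ * c) ⟩
        κ * c * (w * w)                                 ∎
        where
        open ≡-Reasoning
        e : ∀ w a → w * (w * a) ≡ a * (w * w)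
        e = solve-∀

      ∑rest : (∑[ k ← ks ] ∑[ l ← ls ] rest k l) ≤ N * (w * w) + κ * N * (m * w)
      ∑rest = begin
        (∑[ k ← ks ] ∑[ l ← ls ] rest k l)
          ≡⟨ ∑-cong ks (λ k → trans (∑-cong ls (λ l → e₁ (p k) (r l) N κ (same k l))) (trans (∑-+ ls _ _) (cong₂ _+_ (trans (∑-* (N * p k) ls r) (cong (N * p k *_) massr)) (∑-* (κ * N * p k) ls _)))) ⟩
        (∑[ k ← ks ] N * p k * w + κ * N * p k * (∑[ l ← ls ] same k l * r l))
          ≤⟨ ∑-mono ks (λ k → +-monoʳ-≤ (N * p k * w) (*-monoʳ-≤ (κ * N * p k) (few k))) ⟩
        (∑[ k ← ks ] N * p k * w + κ * N * p k * m) ≡⟨ ∑-cong ks (λ k → e₂ N (p k) w κ m) ⟩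
        (∑[ k ← ks ] (N * w + κ * N * m) * p k)     ≡⟨ trans (∑-* (N * w + κ * N * m) ks p) (cong ((N * w + κ * N * m) *_) massp) ⟩
        (N * w + κ * N * m) * w                     ≡⟨ e₃ N w κ m ⟩
        N * (w * w) + κ * N * (m * w)               ∎
        where
        open ≤-Reasoning
        e₁ : ∀ p r N κ d → p * (r * (N + κ * (N * d))) ≡ N * p * r + κ * N * p * (d * r)
        e₁ = solve-∀
        e₂ : ∀ N p w κ m → N * p * w + κ * N * p * m ≡ (N * w + κ * N * m) * p
        e₂ = solve-∀
        e₃ : ∀ N w κ m → (N * w + κ * N * m) * w ≡ N * (w * w) + κ * N * (m * w)
        e₃ = solve-∀

      spreadOut : ∀ p r a b d → p * (r * (a + b + d)) ≡ p * (r * a) + p * (r * (b + d))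
      spreadOut = solve-∀

    -- Every pair of indices contributes an error `N / κ`. On the diagonal the inner product is
    -- known only up to a further `N`, but an index meets a weight of at most `m` there; hence the
    -- second error term, which is harmless once the weight is spread over at least `κ` indices.
    form-≤ : κ * form ks p ls r ≤ κ * c * (w * w) + (N * (w * w) + κ * N * (m * w))
    form-≤ = begin
      κ * form ks p ls r ≡⟨ sym ∑main ⟩
      (∑[ k ← ks ] ∑[ l ← ls ] main k l)
        ≤⟨ ∑-mono-∈ ks (λ {k} k∈ → ∑-mono-∈ ls (λ {l} l∈ → ≤-trans (*-monoʳ-≤ (p k) (*-monoʳ-≤ (r l) (proj₁ (level k∈ l∈))))
             (≤-reflexive (spreadOut (p k) (r l) (κ * c) N (κ * (N * same k l)))))) ⟩
      (∑[ k ← ks ] ∑[ l ← ls ] p k * (r l * (κ * c)) + rest k l) ≡⟨ ∑₂-+ ks ls _ _ ⟩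
      (∑[ k ← ks ] ∑[ l ← ls ] p k * (r l * (κ * c))) + (∑[ k ← ks ] ∑[ l ← ls ] rest k l) ≤⟨ +-mono-≤ (≤-reflexive ∑level) ∑rest ⟩
      κ * c * (w * w) + (N * (w * w) + κ * N * (m * w)) ∎
      where open ≤-Reasoning

    form-≥ : κ * c * (w * w) ≤ κ * form ks p ls r + (N * (w * w) + κ * N * (m * w))
    form-≥ = begin
      κ * c * (w * w) ≡⟨ sym ∑level ⟩
      (∑[ k ← ks ] ∑[ l ← ls ] p k * (r l * (κ * c)))
        ≤⟨ ∑-mono-∈ ks (λ {k} k∈ → ∑-mono-∈ ls (λ {l} l∈ → ≤-trans (*-monoʳ-≤ (p k) (*-monoʳ-≤ (r l) (proj₂ (level k∈ l∈))))
             (≤-reflexive (spreadOut (p k) (r l) (κ * inner k l) N (κ * (N * same k l)))))) ⟩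
      (∑[ k ← ks ] ∑[ l ← ls ] main k l + rest k l) ≡⟨ ∑₂-+ ks ls _ _ ⟩
      (∑[ k ← ks ] ∑[ l ← ls ] main k l) + (∑[ k ← ks ] ∑[ l ← ls ] rest k l) ≤⟨ +-mono-≤ (≤-reflexive ∑main) ∑rest ⟩
      κ * form ks p ls r + (N * (w * w) + κ * N * (m * w)) ∎
      where open ≤-Reasoning

  -- Combinations of equal total weight nearly agree: in the square of the difference the main terms c w² cancel.
  exchange² : ∀ ks ls p r m w t → Level ks ks → Level ls ls → Level ks ls → ∑ ks p ≡ w → ∑ ls r ≡ w →
    (∀ k → (∑[ l ← ks ] same k l * p l) ≤ m) → (∀ k → (∑[ l ← ls ] same k l * r l) ≤ m) → w ≤ m * t → κ ≤ t →
    κ * (∑[ x ← Ps ] ∣ combination ks p x - combination ls r x ∣ * ∣ combination ks p x - combination ls r x ∣) ≤ 8 * N * (m * t * (m * t))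
  exchange² ks ls p r m w t lkk lll lkl massp massr fewp fewr w≤mt κ≤t = ≤-trans (cancel _ _ _ (κ * c * (w * w)) _ (κ * form ks p ls r) identity form-pp form-rr form-pr) errors
    where
    open ≤-Reasoning
    D = ∑[ x ← Ps ] ∣ combination ks p x - combination ls r x ∣ * ∣ combination ks p x - combination ls r x ∣
    err = N * (w * w) + κ * N * (m * w)
    form-pp = form-≤ ks ks p p m w lkk massp massp fewp
    form-rr = form-≤ ls ls r r m w lll massr massr fewr
    form-pr = form-≥ ks ls p r m w lkl massp massr fewr
    identity : κ * D + 2 * (κ * form ks p ls r) ≡ κ * form ks p ks p + κ * form ls r ls r
    identity = begin-equality
      κ * D + 2 * (κ * form ks p ls r) ≡⟨ e κ D (form ks p ls r) ⟩
      κ * (D + 2 * form ks p ls r) ≡⟨ cong (κ *_) (trans (cong (D +_) (sym (∑-* 2 Ps _))) (sym (∑-+ Ps _ _))) ⟩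
      κ * (∑[ x ← Ps ] ∣ combination ks p x - combination ls r x ∣ * ∣ combination ks p x - combination ls r x ∣ + 2 * (combination ks p x * combination ls r x))
        ≡⟨ cong (κ *_) (trans (∑-cong Ps (λ x → ∣-∣² (combination ks p x) (combination ls r x))) (∑-+ Ps _ _)) ⟩
      κ * (form ks p ks p + form ls r ls r) ≡⟨ *-distribˡ-+ κ _ _ ⟩
      κ * form ks p ks p + κ * form ls r ls r ∎
      where
      e : ∀ κ D f → κ * D + 2 * (κ * f) ≡ κ * (D + 2 * f)
      e = solve-∀
    cancel : ∀ d a b u err f → d + 2 * f ≡ a + b → a ≤ u + err → b ≤ u + err → u ≤ f + err → d ≤ 4 * err
    cancel d a b u err f eq ha hb hf = +-cancelʳ-≤ (2 * f) d (4 * err) (begin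
      d + 2 * f                 ≡⟨ eq ⟩
      a + b                     ≤⟨ +-mono-≤ ha hb ⟩
      u + err + (u + err)       ≤⟨ +-mono-≤ (+-monoˡ-≤ err hf) (+-monoˡ-≤ err hf) ⟩
      f + err + err + (f + err + err) ≡⟨ e f err ⟩
      4 * err + 2 * f           ∎)
      where
      e : ∀ f r → f + r + r + (f + r + r) ≡ 4 * r + 2 * f
      e = solve-∀
    errors : 4 * err ≤ 8 * N * (m * t * (m * t))
    errors = begin
      4 * (N * (w * w) + κ * N * (m * w))
        ≤⟨ *-monoʳ-≤ 4 (+-mono-≤ (*-monoʳ-≤ N (*-mono-≤ w≤mt w≤mt)) (*-mono-≤ (*-monoˡ-≤ N κ≤t) (*-monoʳ-≤ m w≤mt))) ⟩
      4 * (N * (m * t * (m * t)) + t * N * (m * (m * t))) ≡⟨ e N m t ⟩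
      8 * N * (m * t * (m * t)) ∎
      where
      e : ∀ N m t → 4 * (N * (m * t * (m * t)) + t * N * (m * (m * t))) ≡ 8 * N * (m * t * (m * t))
      e = solve-∀

  -- The Cauchy-Schwarz inequality turns the mean square into a mean; the 8 is the constant of
  -- `exchange²`.
  exchange : ∀ {L s} ks ls p r m w t → length Ps ≡ s * s → N ≡ s ⁴ → 8 * (L * L) ≤ κ →
    Level ks ks → Level ls ls → Level ks ls → ∑ ks p ≡ w → ∑ ls r ≡ w →
    (∀ k → (∑[ l ← ks ] same k l * p l) ≤ m) → (∀ k → (∑[ l ← ls ] same k l * r l) ≤ m) → w ≤ m * t → κ ≤ t →
    L * (∑[ x ← Ps ] ∣ combination ks p x - combination ls r x ∣) ≤ s * s * s * (m * t)
  exchange {L} {s} ks ls p r m w t len refl big lkk lll lkl massp massr fewp fewr w≤mt κ≤t = m²≤n²⇒m≤n (*-cancelˡ-≤ 8 (begin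
    8 * (L * D * (L * D))                ≡⟨ e₁ L D ⟩
    8 * (L * L) * (D * D)                ≤⟨ *-monoˡ-≤ (D * D) big ⟩
    κ * (D * D)                          ≤⟨ *-monoʳ-≤ κ (cauchy Ps _) ⟩
    κ * (length Ps * D²)                 ≡⟨ cong (λ l → κ * (l * D²)) len ⟩
    κ * (s * s * D²)                     ≡⟨ e₂ κ (s * s) D² ⟩
    s * s * (κ * D²)                     ≤⟨ *-monoʳ-≤ (s * s) (exchange² ks ls p r m w t lkk lll lkl massp massr fewp fewr w≤mt κ≤t) ⟩
    s * s * (8 * s ⁴ * (m * t * (m * t))) ≡⟨ e₃ s (m * t) ⟩
    8 * (s * s * s * (m * t) * (s * s * s * (m * t))) ∎))
    where
    open ≤-Reasoning
    D = ∑[ x ← Ps ] ∣ combination ks p x - combination ls r x ∣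
    D² = ∑[ x ← Ps ] ∣ combination ks p x - combination ls r x ∣ * ∣ combination ks p x - combination ls r x ∣
    e₁ : ∀ L D → 8 * (L * D * (L * D)) ≡ 8 * (L * L) * (D * D)
    e₁ = solve-∀
    e₂ : ∀ κ q D → κ * (q * D) ≡ q * (κ * D)
    e₂ = solve-∀
    e₃ : ∀ s n → s * s * (8 * (s * s * (s * s)) * (n * n)) ≡ 8 * (s * s * s * n * (s * s * s * n))
    e₃ = solve-∀

-- Unions of blocks.

module Merging {V : Set} (R : V → V → V → Bool) (W : ℕ → List V) (s : ℕ) (lenW : ∀ k → length (W k) ≡ s)
  (κ t : ℕ) (κ≤t : κ ≤ t) where

  merge : List ℕ → List V
  merge ks = concatMap W ks

  blockDeg : ℕ → V × V → ℕ
  blockDeg k (x , y) = deg R (W k) x y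

  pairs : ℕ → ℕ → List (V × V)
  pairs i j = W i ⊗ W j

  blockInner : ℕ → ℕ → ℕ → ℕ → ℕ
  blockInner i j = inner (pairs i j) blockDeg κ (s ⁴) 0

  BlockLevel : ℕ → ℕ → ℕ → List ℕ → List ℕ → Set
  BlockLevel c i j = Level (pairs i j) blockDeg κ (s ⁴) c

  AtMostOnce : List ℕ → Set
  AtMostOnce ks = ∀ k → ∑ ks (same k) ≤ 1

  length-pairs : ∀ i j → length (pairs i j) ≡ s * s
  length-pairs i j = trans (length-⊗ (W i) (W j)) (cong₂ _*_ (lenW i) (lenW j))

  length-merge : ∀ {t} ks → length ks ≡ t → length (merge ks) ≡ t * s
  length-merge []       refl = refl
  length-merge (k ∷ ks) refl = trans (length-++ (W k)) (cong₂ _+_ (lenW k) (length-merge ks refl))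

  ∑-merge₂ : ∀ is js (f : V → V → ℕ) → (∑[ x ← merge is ] ∑[ y ← merge js ] f x y) ≡ (∑[ i ← is ] ∑[ j ← js ] ∑[ p ← pairs i j ] f (proj₁ p) (proj₂ p))
  ∑-merge₂ is js f = begin
    (∑[ x ← merge is ] ∑[ y ← merge js ] f x y)             ≡⟨ ∑-concatMap W is _ ⟩
    (∑[ i ← is ] ∑[ x ← W i ] ∑[ y ← merge js ] f x y)      ≡⟨ ∑-cong is (λ i → ∑-cong (W i) (λ x → ∑-concatMap W js _)) ⟩
    (∑[ i ← is ] ∑[ x ← W i ] ∑[ j ← js ] ∑[ y ← W j ] f x y) ≡⟨ ∑-cong is (λ i → ∑-swap (W i) js _) ⟩
    (∑[ i ← is ] ∑[ j ← js ] ∑[ x ← W i ] ∑[ y ← W j ] f x y) ≡⟨ ∑₂-cong is js (λ i j → sym (∑-⊗ (W i) (W j) _)) ⟩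
    (∑[ i ← is ] ∑[ j ← js ] ∑[ p ← pairs i j ] f (proj₁ p) (proj₂ p)) ∎
    where open ≡-Reasoning

  ∑-merge₂-≤ : ∀ {K c} is js (f : V → V → ℕ) → length is ≡ t → length js ≡ t →
    (∀ {i j} → i ∈ is → j ∈ js → K * (∑[ p ← pairs i j ] f (proj₁ p) (proj₂ p)) ≤ c) →
    K * (∑[ x ← merge is ] ∑[ y ← merge js ] f x y) ≤ t * (t * c)
  ∑-merge₂-≤ {K} {c} is js f leni lenj h = begin
    K * (∑[ x ← merge is ] ∑[ y ← merge js ] f x y) ≡⟨ trans (cong (K *_) (∑-merge₂ is js f)) (sym (∑₂-* is js K _)) ⟩
    (∑[ i ← is ] ∑[ j ← js ] K * (∑[ p ← pairs i j ] f (proj₁ p) (proj₂ p))) ≤⟨ ∑-mono-∈ is (λ i∈ → ∑-mono-∈ js (λ j∈ → h i∈ j∈)) ⟩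
    (∑[ i ← is ] ∑[ j ← js ] c) ≤⟨ ∑₂-≤ is js (λ _ _ → ≤-refl) ⟩
    length is * (length js * c) ≡⟨ cong₂ (λ a b → a * (b * c)) leni lenj ⟩
    t * (t * c) ∎
    where open ≤-Reasoning

  -- The degree into a union is the combination of the block degrees with all weights 1, and two
  -- unions of `t` blocks have the same total weight.
  merge-close : ∀ {K c} is js ks ls → length is ≡ t → length js ≡ t → length ks ≡ t → length ls ≡ t → 8 * (K * K) ≤ κ →
    AtMostOnce ks → AtMostOnce ls →
    (∀ {i j} → i ∈ is → j ∈ js → BlockLevel c i j ks ks × BlockLevel c i j ls ls × BlockLevel c i j ks ls) →
    Close R (t * s) K (merge is) (merge js) (merge ks) (merge ls)
  merge-close {K} {c} is js ks ls leni lenj lenk lenl big oncek oncel levels =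
    ≤-trans (∑-merge₂-≤ {K} is js _ leni lenj bound) (≤-reflexive (e t s))
    where
    open ≤-Reasoning
    e : ∀ t s → t * (t * (s * s * s * (1 * t))) ≡ t * s * (t * s) * (t * s)
    e = solve-∀
    one : ℕ → ℕ
    one _ = 1
    comb : ∀ i j ks (p : V × V) → deg R (merge ks) (proj₁ p) (proj₂ p) ≡ combination (pairs i j) blockDeg κ (s ⁴) c ks one p
    comb i j ks p = trans (∑-concatMap W ks _) (∑-cong ks (λ k → sym (*-identityˡ _)))
    once : ∀ ks → AtMostOnce ks → ∀ k → (∑[ l ← ks ] same k l * 1) ≤ 1
    once ks h k = ≤-trans (≤-reflexive (∑-cong ks (λ l → *-identityʳ _))) (h k)
    mass : ∀ ks → length ks ≡ t → (∑[ l ← ks ] 1) ≡ t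
    mass ks len = trans (∑-const ks 1) (trans (*-identityʳ _) len)
    bound : ∀ {i j} → i ∈ is → j ∈ js →
      K * (∑[ p ← pairs i j ] (deg R (merge ks) (proj₁ p) (proj₂ p) ∸ deg R (merge ls) (proj₁ p) (proj₂ p))) ≤ s * s * s * (1 * t)
    bound {i} {j} i∈ j∈ = ≤-trans
      (*-monoʳ-≤ K (∑-mono (pairs i j) (λ p → ≤-trans (m∸n≤∣m-n∣ (deg R (merge ks) (proj₁ p) (proj₂ p)) (deg R (merge ls) (proj₁ p) (proj₂ p))) (≤-reflexive (cong₂ ∣_-_∣ (comb i j ks p) (comb i j ls p))))))
      (exchange (pairs i j) blockDeg κ (s ⁴) c {K} {s} ks ls one one 1 t t (length-pairs i j) refl big
        (proj₁ (levels i∈ j∈)) (proj₁ (proj₂ (levels i∈ j∈))) (proj₂ (proj₂ (levels i∈ j∈)))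
        (mass ks lenk) (mass ls lenl) (once ks oncek) (once ls oncel) (≤-reflexive (sym (+-identityʳ t))) κ≤t)

  -- The set given by `u` may be distributed unevenly over the blocks. By `exchange` the even
  -- weights `U` can be replaced by `t * size k`, after which every block is compared with its own
  -- part. The two errors share the budget equally, whence `2 * K`.
  merge-spread : ∀ {K c} is js ks → length is ≡ t → length js ≡ t → length ks ≡ t → 8 * (2 * K * (2 * K)) ≤ κ → AtMostOnce ks →
    (∀ {i j} → i ∈ is → j ∈ js → BlockLevel c i j ks ks) →
    (∀ {i j k} → i ∈ is → j ∈ js → k ∈ ks → ∀ u → 2 * K * discrepancy R (W i) (W j) (W k) u ≤ s ⁴) →
    Spread R (t * s) K (merge is) (merge js) (merge ks)
  merge-spread {K} {c} is js ks leni lenj lenk big once level spread u =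
    ≤-trans (∑-merge₂-≤ {K} is js _ leni lenj (λ i∈ j∈ → *-cancelˡ-≤ 2 (bound i∈ j∈))) (≤-reflexive (e t s))
    where
    open ≤-Reasoning
    e : ∀ t s → t * (t * (t * t * (s * s * (s * s)))) ≡ t * s * (t * s) * (t * s * (t * s))
    e = solve-∀
    Z = merge ks
    size : ℕ → ℕ
    size k = length (filterᵇ u (W k))
    U = ∑ ks size
    size≤ : ∀ k → size k ≤ s
    size≤ k = ≤-trans (m≤m+n _ _) (≤-trans (≤-reflexive (sym (length-split u (W k)))) (≤-reflexive (lenW k)))
    U≤ : U ≤ t * s
    U≤ = ≤-trans (∑-≤ ks size≤) (≤-reflexive (cong (_* s) lenk))
    lenU : length (filterᵇ u Z) ≡ U
    lenU = trans (length-filterᵇ u Z) (trans (∑-concatMap W ks _) (∑-cong ks (λ k → sym (length-filterᵇ u (W k)))))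
    degU : ∀ x y → deg R (filterᵇ u Z) x y ≡ (∑[ k ← ks ] deg R (filterᵇ u (W k)) x y)
    degU x y = trans (∑-filterᵇ u Z _) (trans (∑-concatMap W ks _) (∑-cong ks (λ k → sym (∑-filterᵇ u (W k) _))))
    spread-weight even-weight : ℕ → ℕ
    spread-weight k = t * size k
    even-weight _ = U
    comb : ℕ → ℕ → (ℕ → ℕ) → V × V → ℕ
    comb i j w = combination (pairs i j) blockDeg κ (s ⁴) c ks w
    gap≤ : ∀ i j x y → gap R Z u x y ≤ ∣ comb i j spread-weight (x , y) - comb i j even-weight (x , y) ∣ + t * (∑[ k ← ks ] gap R (W k) u x y)
    gap≤ i j x y = begin
      gap R Z u x y
        ≡⟨ cong₂ ∣_-_∣ (trans (cong (_* deg R Z x y) lenU) (trans (cong (U *_) (∑-concatMap W ks _)) (sym (∑-* U ks _)))) (cong₂ _*_ (length-merge ks lenk) (degU x y)) ⟩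
      ∣ comb i j even-weight (x , y) - t * s * dU ∣
        ≤⟨ ∣-∣-triangle (comb i j even-weight (x , y)) (comb i j spread-weight (x , y)) (t * s * dU) ⟩
      ∣ comb i j even-weight (x , y) - comb i j spread-weight (x , y) ∣ + ∣ comb i j spread-weight (x , y) - t * s * dU ∣
        ≤⟨ +-mono-≤ (≤-reflexive (∣-∣-comm (comb i j even-weight (x , y)) (comb i j spread-weight (x , y)))) second ⟩
      ∣ comb i j spread-weight (x , y) - comb i j even-weight (x , y) ∣ + t * (∑[ k ← ks ] gap R (W k) u x y) ∎
      where
      dU = ∑[ k ← ks ] deg R (filterᵇ u (W k)) x y
      second : ∣ comb i j spread-weight (x , y) - t * s * dU ∣ ≤ t * (∑[ k ← ks ] gap R (W k) u x y)
      second = begin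
        ∣ comb i j spread-weight (x , y) - t * s * dU ∣
          ≡⟨ cong₂ ∣_-_∣ (trans (∑-cong ks (λ k → *-assoc t (size k) _)) (∑-* t ks _))
               (trans (*-assoc t s dU) (cong (t *_) (trans (sym (∑-* s ks _)) (∑-cong ks (λ k → cong (_* deg R (filterᵇ u (W k)) x y) (sym (lenW k))))))) ⟩
        ∣ t * (∑[ k ← ks ] size k * deg R (W k) x y) - t * (∑[ k ← ks ] length (W k) * deg R (filterᵇ u (W k)) x y) ∣
          ≡⟨ sym (*-distribˡ-∣-∣ t _ _) ⟩
        t * ∣ (∑[ k ← ks ] size k * deg R (W k) x y) - (∑[ k ← ks ] length (W k) * deg R (filterᵇ u (W k)) x y) ∣
          ≤⟨ *-monoʳ-≤ t (∣∑-∑∣≤ ks _ _) ⟩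
        t * (∑[ k ← ks ] gap R (W k) u x y) ∎
    bound : ∀ {i j} → i ∈ is → j ∈ js → 2 * (K * (∑[ p ← pairs i j ] gap R Z u (proj₁ p) (proj₂ p))) ≤ 2 * (t * t * s ⁴)
    bound {i} {j} i∈ j∈ = begin
      2 * (K * (∑[ p ← pairs i j ] gap R Z u (proj₁ p) (proj₂ p)))
        ≤⟨ *-monoʳ-≤ 2 (*-monoʳ-≤ K (≤-trans (∑-mono (pairs i j) (λ p → gap≤ i j (proj₁ p) (proj₂ p)))
             (≤-reflexive (trans (∑-+ (pairs i j) _ _) (cong (X +_) (∑-* t (pairs i j) _)))))) ⟩
      2 * (K * (X + t * Y)) ≡⟨ e₁ K X t Y ⟩
      2 * K * X + t * (2 * K * Y) ≤⟨ +-mono-≤ first (*-monoʳ-≤ t rest) ⟩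
      s * s * s * (t * s * t) + t * (t * s ⁴) ≡⟨ e₂ s t ⟩
      2 * (t * t * s ⁴) ∎
      where
      X = ∑[ p ← pairs i j ] ∣ comb i j spread-weight p - comb i j even-weight p ∣
      Y = ∑[ p ← pairs i j ] ∑[ k ← ks ] gap R (W k) u (proj₁ p) (proj₂ p)
      e₁ : ∀ K X t Y → 2 * (K * (X + t * Y)) ≡ 2 * K * X + t * (2 * K * Y)
      e₁ = solve-∀
      e₂ : ∀ s t → s * s * s * (t * s * t) + t * (t * (s * s * (s * s))) ≡ 2 * (t * t * (s * s * (s * s)))
      e₂ = solve-∀
      rest : 2 * K * Y ≤ t * s ⁴
      rest = begin
        2 * K * Y ≡⟨ cong (2 * K *_) (trans (∑-swap (pairs i j) ks _) (∑-cong ks (λ k → ∑-⊗ (W i) (W j) _))) ⟩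
        2 * K * (∑[ k ← ks ] discrepancy R (W i) (W j) (W k) u) ≡⟨ sym (∑-* (2 * K) ks _) ⟩
        (∑[ k ← ks ] 2 * K * discrepancy R (W i) (W j) (W k) u) ≤⟨ ∑-mono-∈ ks (λ k∈ → spread i∈ j∈ k∈ u) ⟩
        (∑[ k ← ks ] s ⁴) ≡⟨ trans (∑-const ks (s ⁴)) (cong (_* s ⁴) lenk) ⟩
        t * s ⁴ ∎
      few : ∀ (w : ℕ → ℕ) → (∀ k → w k ≤ t * s) → ∀ k → (∑[ l ← ks ] same k l * w l) ≤ t * s
      few w w≤ k = begin
        (∑[ l ← ks ] same k l * w l)   ≤⟨ ∑-mono ks (λ l → *-monoʳ-≤ (same k l) (w≤ l)) ⟩
        (∑[ l ← ks ] same k l * (t * s)) ≡⟨ ∑-*ʳ (t * s) ks _ ⟩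
        ∑ ks (same k) * (t * s)        ≤⟨ *-monoˡ-≤ (t * s) (once k) ⟩
        1 * (t * s)                    ≡⟨ *-identityˡ (t * s) ⟩
        t * s                          ∎
      first : 2 * K * X ≤ s * s * s * (t * s * t)
      first = exchange (pairs i j) blockDeg κ (s ⁴) c {2 * K} {s} ks ks spread-weight even-weight (t * s) (t * U) t (length-pairs i j) refl big
        (level i∈ j∈) (level i∈ j∈) (level i∈ j∈) (∑-* t ks size) (trans (∑-const ks U) (cong (_* U) lenk))
        (few spread-weight (λ k → *-monoʳ-≤ t (size≤ k))) (few even-weight (λ _ → U≤))
        (≤-trans (*-monoʳ-≤ t U≤) (≤-reflexive (*-comm t (t * s)))) κ≤t

  merge-overlap : ∀ {k₀} is js ks ls → length is ≡ t → length js ≡ t → length ks ≡ t → length ls ≡ t →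
    (∀ {i j k l} → i ∈ is → j ∈ js → k ∈ ks → l ∈ ls → s ⁴ ≤ k₀ * blockInner i j k l) →
    (t * s) ⁴ ≤ k₀ * (∑[ x ← merge is ] ∑[ y ← merge js ] deg R (merge ks) x y * deg R (merge ls) x y)
  merge-overlap {k₀} is js ks ls leni lenj lenk lenl h = begin
    (t * s) ⁴ ≡⟨ e t (s) ⟩
    t * (t * (t * (t * s ⁴)))
      ≡⟨ sym (trans (∑-const is _) (cong₂ _*_ leni (trans (∑-const js _) (cong₂ _*_ lenj (trans (∑-const ks _) (cong₂ _*_ lenk (trans (∑-const ls _) (cong (_* s ⁴) lenl)))))))) ⟩
    (∑[ i ← is ] ∑[ j ← js ] ∑[ k ← ks ] ∑[ l ← ls ] s ⁴)
      ≤⟨ ∑-mono-∈ is (λ i∈ → ∑-mono-∈ js (λ j∈ → ∑-mono-∈ ks (λ k∈ → ∑-mono-∈ ls (λ l∈ → h i∈ j∈ k∈ l∈)))) ⟩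
    (∑[ i ← is ] ∑[ j ← js ] ∑[ k ← ks ] ∑[ l ← ls ] k₀ * blockInner i j k l)
      ≡⟨ trans (∑₂-cong is js (λ i j → ∑₂-* ks ls k₀ _)) (∑₂-* is js k₀ _) ⟩
    k₀ * (∑[ i ← is ] ∑[ j ← js ] ∑[ k ← ks ] ∑[ l ← ls ] blockInner i j k l)
      ≡⟨ cong (k₀ *_) (sym (trans (∑-merge₂ is js _) (∑₂-cong is js expand))) ⟩
    k₀ * (∑[ x ← merge is ] ∑[ y ← merge js ] deg R (merge ks) x y * deg R (merge ls) x y) ∎
    where
    open ≤-Reasoning
    e : ∀ t s → t * s * (t * s) * (t * s * (t * s)) ≡ t * (t * (t * (t * (s * s * (s * s)))))
    e = solve-∀
    expand : ∀ i j → (∑[ p ← pairs i j ] deg R (merge ks) (proj₁ p) (proj₂ p) * deg R (merge ls) (proj₁ p) (proj₂ p)) ≡ (∑[ k ← ks ] ∑[ l ← ls ] blockInner i j k l)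
    expand i j = begin-equality
      (∑[ p ← pairs i j ] deg R (merge ks) (proj₁ p) (proj₂ p) * deg R (merge ls) (proj₁ p) (proj₂ p))
        ≡⟨ ∑-cong (pairs i j) (λ p → cong₂ _*_ (∑-concatMap W ks _) (∑-concatMap W ls _)) ⟩
      (∑[ p ← pairs i j ] (∑[ k ← ks ] blockDeg k p) * (∑[ l ← ls ] blockDeg l p))
        ≡⟨ ∑-cong (pairs i j) (λ p → trans (sym (∑-*ʳ _ ks _)) (∑-cong ks (λ k → sym (∑-* (blockDeg k p) ls _)))) ⟩
      (∑[ p ← pairs i j ] ∑[ k ← ks ] ∑[ l ← ls ] blockDeg k p * blockDeg l p)
        ≡⟨ trans (∑-swap (pairs i j) ks _) (∑-cong ks (λ k → ∑-swap (pairs i j) ls _)) ⟩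
      (∑[ k ← ks ] ∑[ l ← ls ] blockInner i j k l) ∎

-- Twice the cube of the sum is twice the three cubes plus 6 times `mixed` plus `12 * (a * b * c)`.
-- The cubes provide a seventh `mixed`, and `mixed` is at least `6 * (a * b * c)`; finally 7 * 6 +
-- 12 = 2 * 27.
27abc≤[a+b+c]³ : ∀ a b c → 27 * (a * b * c) ≤ (a + b + c) * (a + b + c) * (a + b + c)
27abc≤[a+b+c]³ a b c = *-cancelˡ-≤ 2 (begin
  2 * (27 * (a * b * c)) ≡⟨ e₁ a b c ⟩
  7 * (a * (2 * (b * c)) + b * (2 * (a * c)) + c * (2 * (a * b))) + 12 * (a * b * c)
    ≤⟨ +-monoˡ-≤ (12 * (a * b * c)) (*-monoʳ-≤ 7 (+-mono-≤ (+-mono-≤ (*-monoʳ-≤ a (2ab≤a²+b² b c)) (*-monoʳ-≤ b (2ab≤a²+b² a c))) (*-monoʳ-≤ c (2ab≤a²+b² a b)))) ⟩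
  7 * mixed + 12 * (a * b * c)            ≡⟨ e₂ a b c ⟩
  (cross a b + cross a c + cross b c) + 6 * mixed + 12 * (a * b * c)
    ≤⟨ +-monoˡ-≤ (12 * (a * b * c)) (+-monoˡ-≤ (6 * mixed) (+-mono-≤ (+-mono-≤ (cubes a b) (cubes a c)) (cubes b c))) ⟩
  (a * a * a + b * b * b + (a * a * a + c * c * c) + (b * b * b + c * c * c)) + 6 * mixed + 12 * (a * b * c) ≡⟨ e₃ a b c ⟩
  2 * ((a + b + c) * (a + b + c) * (a + b + c)) ∎)
  where
  open ≤-Reasoning
  mixed = a * (b * b + c * c) + b * (a * a + c * c) + c * (a * a + b * b)
  cross : ℕ → ℕ → ℕ
  cross a b = a * a * b + a * b * b
  cubes : ∀ a b → cross a b ≤ a * a * a + b * b * b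
  cubes a b = +-cancelʳ-≤ (cross a b) _ _ (begin
    cross a b + cross a b            ≡⟨ d₁ a b ⟩
    (a + b) * (2 * (a * b))          ≤⟨ *-monoʳ-≤ (a + b) (2ab≤a²+b² a b) ⟩
    (a + b) * (a * a + b * b)        ≡⟨ d₂ a b ⟩
    a * a * a + b * b * b + cross a b ∎)
    where
    d₁ : ∀ a b → a * a * b + a * b * b + (a * a * b + a * b * b) ≡ (a + b) * (2 * (a * b))
    d₁ = solve-∀
    d₂ : ∀ a b → (a + b) * (a * a + b * b) ≡ a * a * a + b * b * b + (a * a * b + a * b * b)
    d₂ = solve-∀
  e₁ : ∀ a b c → 2 * (27 * (a * b * c)) ≡ 7 * (a * (2 * (b * c)) + b * (2 * (a * c)) + c * (2 * (a * b))) + 12 * (a * b * c)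
  e₁ = solve-∀
  e₂ : ∀ a b c → 7 * (a * (b * b + c * c) + b * (a * a + c * c) + c * (a * a + b * b)) + 12 * (a * b * c) ≡
    (a * a * b + a * b * b + (a * a * c + a * c * c) + (b * b * c + b * c * c)) + 6 * (a * (b * b + c * c) + b * (a * a + c * c) + c * (a * a + b * b)) + 12 * (a * b * c)
  e₂ = solve-∀
  e₃ : ∀ a b c → (a * a * a + b * b * b + (a * a * a + c * c * c) + (b * b * b + c * c * c)) + 6 * (a * (b * b + c * c) + b * (a * a + c * c) + c * (a * a + b * b)) + 12 * (a * b * c) ≡
    2 * ((a + b + c) * (a + b + c) * (a + b + c))
  e₃ = solve-∀

-- Triangles in regular tripartite graphs.

module _ {V : Set} where

  deg₂ : (V → V → Bool) → List V → V → ℕ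
  deg₂ S Y x = ∑[ y ← Y ] 𝟙 (S x y)

  gap₂ : ℕ → (V → V → Bool) → List V → (V → Bool) → V → ℕ
  gap₂ w S Y u x = ∣ length (filterᵇ u Y) * deg₂ S Y x - w * deg₂ S (filterᵇ u Y) x ∣

  PairSpread : ℕ → ℕ → List V → List V → (V → V → Bool) → Set
  PairSpread K w X Y S = ∀ u → K * ∑ X (gap₂ w S Y u) ≤ w * w * w

  pairs₂ : List V → List V → (V → V → Bool) → ℕ
  pairs₂ X Y S = ∑[ x ← X ] ∑[ y ← Y ] 𝟙 (S x y)

  -- A relation between two blocks is treated as a relation of three blocks that ignores the middle
  -- one; the sum over the middle block only multiplies by `w`.
  regular-pairSpread : ∀ {K w} X Y Z (S : V → V → Bool) → length Y ≡ w → length Z ≡ w → 0 < w →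
    (∀ u → K * discrepancy (λ x _ z → S x z) X Y Z u ≤ w ⁴) → PairSpread K w X Z S
  regular-pairSpread {K} {w@(suc _)} X Y Z S lenY lenZ _ reg u = *-cancelˡ-≤ w (begin
    w * (K * ∑ X (gap₂ w S Z u))   ≡⟨ e₁ w K _ ⟩
    K * (w * ∑ X (gap₂ w S Z u))   ≡⟨ cong (K *_) (sym (∑-* w X _)) ⟩
    K * (∑[ x ← X ] w * gap₂ w S Z u x)
      ≡⟨ cong (K *_) (∑-cong X (λ x → trans (cong (_* gap₂ w S Z u x) (sym lenY)) (trans (sym (∑-const Y _)) (∑-cong Y (λ y → cong (λ l → ∣ length (filterᵇ u Z) * deg₂ S Z x - l * deg₂ S (filterᵇ u Z) x ∣) (sym lenZ)))))) ⟩
    K * discrepancy (λ x _ z → S x z) X Y Z u ≤⟨ reg u ⟩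
    w ⁴                            ≡⟨ *-assoc w w (w * w) ⟩
    w * (w * (w * w))              ≡⟨ cong (w *_) (sym (*-assoc w w w)) ⟩
    w * (w * w * w)                ∎)
    where
    open ≤-Reasoning
    e₁ : ∀ w K g → w * (K * g) ≡ K * (w * g)
    e₁ = solve-∀

  module _ (K w : ℕ) (X Y : List V) (S : V → V → Bool) (spread : PairSpread K w X Y S) where

    pairSpread-weighted : ∀ u (m : V → ℕ) → (∀ x → m x ≤ 1) →
      K * (w * (∑[ x ← X ] m x * deg₂ S (filterᵇ u Y) x)) ≤ K * (length (filterᵇ u Y) * (∑[ x ← X ] m x * deg₂ S Y x)) + w * w * w
    pairSpread-weighted u m m≤1 = begin
      K * (w * (∑[ x ← X ] m x * deg₂ S U x)) ≡⟨ cong (K *_) (sym (∑-* w X _)) ⟩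
      K * (∑[ x ← X ] w * (m x * deg₂ S U x)) ≤⟨ *-monoʳ-≤ K (∑-mono X pointwise) ⟩
      K * (∑[ x ← X ] length U * (m x * deg₂ S Y x) + gap₂ w S Y u x) ≡⟨ cong (K *_) (trans (∑-+ X _ _) (cong (_+ ∑ X (gap₂ w S Y u)) (∑-* (length U) X _))) ⟩
      K * (length U * (∑[ x ← X ] m x * deg₂ S Y x) + ∑ X (gap₂ w S Y u)) ≡⟨ *-distribˡ-+ K _ _ ⟩
      K * (length U * (∑[ x ← X ] m x * deg₂ S Y x)) + K * ∑ X (gap₂ w S Y u) ≤⟨ +-monoʳ-≤ _ (spread u) ⟩
      K * (length U * (∑[ x ← X ] m x * deg₂ S Y x)) + w * w * w ∎
      where
      open ≤-Reasoning
      U = filterᵇ u Y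
      e₁ : ∀ w m d → w * (m * d) ≡ m * (w * d)
      e₁ = solve-∀
      e₂ : ∀ m l d g → m * (l * d + g) ≡ l * (m * d) + m * g
      e₂ = solve-∀
      pointwise : ∀ x → w * (m x * deg₂ S U x) ≤ length U * (m x * deg₂ S Y x) + gap₂ w S Y u x
      pointwise x = begin
        w * (m x * deg₂ S U x)                       ≡⟨ e₁ w (m x) _ ⟩
        m x * (w * deg₂ S U x)                       ≤⟨ *-monoʳ-≤ (m x) (m≤n+∣n-m∣ (w * deg₂ S U x) (length U * deg₂ S Y x)) ⟩
        m x * (length U * deg₂ S Y x + gap₂ w S Y u x) ≡⟨ e₂ (m x) (length U) _ _ ⟩
        length U * (m x * deg₂ S Y x) + m x * gap₂ w S Y u x ≤⟨ +-monoʳ-≤ _ (≤-trans (*-monoˡ-≤ (gap₂ w S Y u x) (m≤1 x)) (≤-reflexive (*-identityˡ _))) ⟩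
        length U * (m x * deg₂ S Y x) + gap₂ w S Y u x ∎

  module _ (K w : ℕ) (X Y Z : List V) (lenX : length X ≡ w) (lenY : length Y ≡ w) (lenZ : length Z ≡ w) (0<w : 0 < w)
    (L R T : V → V → Bool) (spreadYZ : PairSpread K w Y Z R) (spreadZY : PairSpread K w Z Y (λ z y → R y z))
    (spreadYX : PairSpread K w Y X (λ y x → L x y)) where

    triangles : ℕ
    triangles = ∑[ x ← X ] ∑[ y ← Y ] ∑[ z ← Z ] 𝟙 (L x y) * (𝟙 (R y z) * 𝟙 (T x z))

    private
      eL = pairs₂ X Y L
      eR = pairs₂ Y Z R
      eT = pairs₂ X Z T

      deg₂≤ : ∀ S Y → length Y ≡ w → ∀ x → deg₂ S Y x ≤ w
      deg₂≤ S Y len x = ≤-trans (∑-≤ Y (λ y → 𝟙≤1 (S x y))) (≤-reflexive (trans (*-identityʳ _) len))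

      swapped : ∀ X Y (S : V → V → Bool) → (∑[ y ← Y ] deg₂ (λ y x → S x y) X y) ≡ pairs₂ X Y S
      swapped X Y S = ∑-swap Y X _

    -- Between the neighbourhoods of `x` the relation `R` has its overall density. One end at a time
    -- is released, from the `L`-neighbours to all of `Y` and from the `T`-neighbours to all of `Z`,
    -- and each release costs `w ⁴`.
    perVertex : ∀ x → K * (w * w * (∑[ y ← Y ] ∑[ z ← Z ] 𝟙 (L x y) * (𝟙 (R y z) * 𝟙 (T x z)))) ≤
      K * (eR * (deg₂ L Y x * deg₂ T Z x)) + 2 * w ⁴
    perVertex x = begin
      K * (w * w * (∑[ y ← Y ] ∑[ z ← Z ] 𝟙 (L x y) * (𝟙 (R y z) * 𝟙 (T x z)))) ≡⟨ cong (λ s → K * (w * w * s)) regroup ⟩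
      K * (w * w * N)                       ≡⟨ e₁ K w N ⟩
      w * (K * (w * N))                     ≤⟨ *-monoʳ-≤ w (pairSpread-weighted K w Z Y (λ z y → R y z) spreadZY (L x) (λ z → 𝟙 (T x z)) (λ z → 𝟙≤1 (T x z))) ⟩
      w * (K * (length Y′ * M) + w * w * w) ≡⟨ cong (λ l → w * (K * (l * M) + w * w * w)) (length-filterᵇ (L x) Y) ⟩
      w * (K * (nL * M) + w * w * w)        ≡⟨ e₂ w K nL M ⟩
      nL * (K * (w * M)) + w ⁴              ≡⟨ cong (λ s → nL * (K * (w * s)) + w ⁴) regroup′ ⟩
      nL * (K * (w * M′)) + w ⁴             ≤⟨ +-monoˡ-≤ (w ⁴) (*-monoʳ-≤ nL (pairSpread-weighted K w Y Z R spreadYZ (T x) (λ _ → 1) (λ _ → ≤-refl))) ⟩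
      nL * (K * (length Z′ * (∑[ y ← Y ] 1 * deg₂ R Z y)) + w * w * w) + w ⁴
        ≡⟨ cong₂ (λ l s → nL * (K * (l * s) + w * w * w) + w ⁴) (length-filterᵇ (T x) Z) (∑-cong Y (λ y → *-identityˡ _)) ⟩
      nL * (K * (nT * eR) + w * w * w) + w ⁴ ≡⟨ cong (_+ w ⁴) (*-distribˡ-+ nL _ _) ⟩
      nL * (K * (nT * eR)) + nL * (w * w * w) + w ⁴ ≤⟨ +-monoˡ-≤ (w ⁴) (+-monoʳ-≤ (nL * (K * (nT * eR))) (*-monoˡ-≤ (w * w * w) (deg₂≤ L Y lenY x))) ⟩
      nL * (K * (nT * eR)) + w * (w * w * w) + w ⁴ ≡⟨ e₃ nL K nT eR w ⟩
      K * (eR * (nL * nT)) + 2 * w ⁴ ∎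
      where
      open ≤-Reasoning
      Y′ = filterᵇ (L x) Y
      Z′ = filterᵇ (T x) Z
      nL = deg₂ L Y x
      nT = deg₂ T Z x
      N = ∑[ z ← Z ] 𝟙 (T x z) * deg₂ (λ z y → R y z) Y′ z
      M = ∑[ z ← Z ] 𝟙 (T x z) * deg₂ (λ z y → R y z) Y z
      M′ = ∑[ y ← Y ] 1 * deg₂ R Z′ y
      e₀ : ∀ l r t → l * (r * t) ≡ t * (l * r)
      e₀ = solve-∀
      regroup : (∑[ y ← Y ] ∑[ z ← Z ] 𝟙 (L x y) * (𝟙 (R y z) * 𝟙 (T x z))) ≡ N
      regroup = trans (∑-swap Y Z _) (∑-cong Z (λ z → trans (∑-cong Y (λ y → e₀ (𝟙 (L x y)) (𝟙 (R y z)) (𝟙 (T x z))))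
        (trans (∑-* (𝟙 (T x z)) Y _) (cong (𝟙 (T x z) *_) (sym (∑-filterᵇ (L x) Y _))))))
      regroup′ : M ≡ M′
      regroup′ = trans (∑-cong Z (λ z → sym (∑-* (𝟙 (T x z)) Y _))) (trans (∑-swap Z Y _)
        (∑-cong Y (λ y → trans (sym (∑-filterᵇ (T x) Z _)) (sym (*-identityˡ _)))))
      e₁ : ∀ K w N → K * (w * w * N) ≡ w * (K * (w * N))
      e₁ = solve-∀
      e₂ : ∀ w K l M → w * (K * (l * M) + w * w * w) ≡ l * (K * (w * M)) + w * w * (w * w)
      e₂ = solve-∀
      e₃ : ∀ l K t r w → l * (K * (t * r)) + w * (w * w * w) + w * w * (w * w) ≡ K * (r * (l * t)) + 2 * (w * w * (w * w))
      e₃ = solve-∀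

    -- Regularity of `L`, tested on the set of vertices of at least average degree, makes the total
    -- excess over the average small. Hence the degree can be replaced by its average under the
    -- weights `deg₂ T Z x`, which are at most `w`.
    degreeProduct : K * (w * (∑[ x ← X ] deg₂ L Y x * deg₂ T Z x)) ≤ K * (eL * eT) + w ⁴
    degreeProduct = +-cancelʳ-≤ (K * (w * (length U * eL))) _ _ (begin
      K * (w * (∑[ x ← X ] nL x * nT x)) + K * (w * (length U * eL)) ≡⟨ e₁ K w _ _ ⟩
      K * (w * (∑[ x ← X ] nL x * nT x) + length U * eL * w)
        ≡⟨ cong (K *_) (trans (cong₂ _+_ (sym (∑-* w X _)) (trans (cong (λ l → l * eL * w) (length-filterᵇ u X)) (trans (cong (_* w) (sym (∑-*ʳ eL X _))) (sym (∑-*ʳ w X _))))) (sym (∑-+ X _ _))) ⟩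
      K * (∑[ x ← X ] w * (nL x * nT x) + 𝟙 (u x) * eL * w) ≤⟨ *-monoʳ-≤ K (∑-mono X pointwise) ⟩
      K * (∑[ x ← X ] eL * nT x + w * (w * (𝟙 (u x) * nL x))) ≡⟨ cong (K *_) (trans (∑-+ X _ _) (cong₂ _+_ (∑-* eL X _) (trans (∑-* w X _) (cong (w *_) (∑-* w X _))))) ⟩
      K * (eL * eT + w * (w * (∑[ x ← X ] 𝟙 (u x) * nL x))) ≡⟨ e₂ K (eL * eT) w _ ⟩
      K * (eL * eT) + w * (K * (w * (∑[ x ← X ] 𝟙 (u x) * nL x))) ≡⟨ cong (λ s → K * (eL * eT) + w * (K * (w * s))) regroup ⟩
      K * (eL * eT) + w * (K * (w * (∑[ y ← Y ] 1 * deg₂ (λ y x → L x y) U y)))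
        ≤⟨ +-monoʳ-≤ (K * (eL * eT)) (*-monoʳ-≤ w (pairSpread-weighted K w Y X (λ y x → L x y) spreadYX u (λ _ → 1) (λ _ → ≤-refl))) ⟩
      K * (eL * eT) + w * (K * (length U * (∑[ y ← Y ] 1 * deg₂ (λ y x → L x y) X y)) + w * w * w)
        ≡⟨ cong (λ s → K * (eL * eT) + w * (K * (length U * s) + w * w * w)) (trans (∑-cong Y (λ y → *-identityˡ _)) (swapped X Y L)) ⟩
      K * (eL * eT) + w * (K * (length U * eL) + w * w * w) ≡⟨ e₃ (K * (eL * eT)) w K (length U * eL) ⟩
      K * (eL * eT) + w ⁴ + K * (w * (length U * eL)) ∎)
      where
      open ≤-Reasoning
      nL nT : V → ℕ
      nL = deg₂ L Y
      nT = deg₂ T Z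
      u : V → Bool
      u x = eL ≤ᵇ w * nL x
      U = filterᵇ u X
      e₁ : ∀ K w a b → K * (w * a) + K * (w * b) ≡ K * (w * a + b * w)
      e₁ = solve-∀
      e₂ : ∀ K a w b → K * (a + w * (w * b)) ≡ K * a + w * (K * (w * b))
      e₂ = solve-∀
      e₃ : ∀ a w K b → a + w * (K * b + w * w * w) ≡ a + w * w * (w * w) + K * (w * b)
      e₃ = solve-∀
      regroup : (∑[ x ← X ] 𝟙 (u x) * nL x) ≡ (∑[ y ← Y ] 1 * deg₂ (λ y x → L x y) U y)
      regroup = trans (sym (∑-filterᵇ u X nL)) (trans (∑-swap U Y _) (∑-cong Y (λ y → sym (*-identityˡ _))))
      rearrange : ∀ a b c d → b ≤ a → d ≤ c → a * d + b * c ≤ b * d + a * c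
      rearrange a b c d b≤a d≤c = subst₂ (λ a c → a * d + b * c ≤ b * d + a * c) (m+[n∸m]≡n b≤a) (m+[n∸m]≡n d≤c)
        (≤-trans (m≤m+n _ ((a ∸ b) * (c ∸ d))) (≤-reflexive (e b (a ∸ b) d (c ∸ d))))
        where
        e : ∀ b p d q → (b + p) * d + b * (d + q) + p * q ≡ b * d + (b + p) * (d + q)
        e = solve-∀
      pointwise : ∀ x → w * (nL x * nT x) + 𝟙 (u x) * eL * w ≤ eL * nT x + w * (w * (𝟙 (u x) * nL x))
      pointwise x with eL ≤ᵇ w * nL x in eq
      ... | true  = ≤-trans (≤-reflexive (d₁ w (nL x) (nT x) eL)) (≤-trans (rearrange (w * nL x) eL w (nT x) (≤ᵇ⇒≤ eL (w * nL x) (subst T′ (sym eq) tt)) (deg₂≤ T Z lenZ x)) (≤-reflexive (d₂ w (nL x) (nT x) eL)))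
        where
        T′ = Data.Bool.T
        d₁ : ∀ w l t e → w * (l * t) + (e + 0) * w ≡ w * l * t + e * w
        d₁ = solve-∀
        d₂ : ∀ w l t e → e * t + w * l * w ≡ e * t + w * (w * (l + 0))
        d₂ = solve-∀
      ... | false = ≤-trans (≤-reflexive (d₁ w (nL x) (nT x))) (≤-trans (*-monoˡ-≤ (nT x) (<⇒≤ (≰⇒> {eL} {w * nL x} (λ le → subst Data.Bool.T eq (≤⇒≤ᵇ le))))) (m≤m+n _ _))
        where
        d₁ : ∀ w l t → w * (l * t) + 0 ≡ w * l * t
        d₁ = solve-∀

    triangles-≤ : K * (w * w * w * triangles) ≤ K * (eL * eR * eT) + 3 * (w * w * w * (w * w * w))
    triangles-≤ = begin
      K * (w * w * w * triangles) ≡⟨ e₁ K w triangles ⟩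
      w * (K * (w * w * triangles)) ≡⟨ cong (w *_) (trans (cong (K *_) (sym (∑-* (w * w) X _))) (sym (∑-* K X _))) ⟩
      w * (∑[ x ← X ] K * (w * w * (∑[ y ← Y ] ∑[ z ← Z ] 𝟙 (L x y) * (𝟙 (R y z) * 𝟙 (T x z))))) ≤⟨ *-monoʳ-≤ w (∑-mono X perVertex) ⟩
      w * (∑[ x ← X ] K * (eR * (deg₂ L Y x * deg₂ T Z x)) + 2 * w ⁴)
        ≡⟨ cong (w *_) (trans (∑-+ X _ _) (cong₂ _+_ (trans (∑-* K X _) (cong (K *_) (∑-* eR X _))) (trans (∑-const X _) (cong (_* (2 * w ⁴)) lenX)))) ⟩
      w * (K * (eR * P) + w * (2 * w ⁴)) ≡⟨ e₂ w K eR P ⟩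
      eR * (K * (w * P)) + 2 * (w * w * w * (w * w * w)) ≤⟨ +-monoˡ-≤ (2 * (w * w * w * (w * w * w))) (*-monoʳ-≤ eR degreeProduct) ⟩
      eR * (K * (eL * eT) + w ⁴) + 2 * (w * w * w * (w * w * w)) ≡⟨ cong (_+ 2 * (w * w * w * (w * w * w))) (*-distribˡ-+ eR _ _) ⟩
      eR * (K * (eL * eT)) + eR * w ⁴ + 2 * (w * w * w * (w * w * w))
        ≤⟨ +-monoˡ-≤ (2 * (w * w * w * (w * w * w))) (+-monoʳ-≤ (eR * (K * (eL * eT))) (*-monoˡ-≤ (w ⁴) (≤-trans (∑-≤ Y (deg₂≤ R Z lenZ)) (≤-reflexive (cong (_* w) lenY))))) ⟩
      eR * (K * (eL * eT)) + w * w * w ⁴ + 2 * (w * w * w * (w * w * w)) ≡⟨ e₃ eR K eL eT w ⟩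
      K * (eL * eR * eT) + 3 * (w * w * w * (w * w * w)) ∎
      where
      open ≤-Reasoning
      P = ∑[ x ← X ] deg₂ L Y x * deg₂ T Z x
      e₁ : ∀ K w t → K * (w * w * w * t) ≡ w * (K * (w * w * t))
      e₁ = solve-∀
      e₂ : ∀ w K r P → w * (K * (r * P) + w * (2 * (w * w * (w * w)))) ≡ r * (K * (w * P)) + 2 * (w * w * w * (w * w * w))
      e₂ = solve-∀
      e₃ : ∀ r K l t w → r * (K * (l * t)) + w * w * (w * w * (w * w)) + 2 * (w * w * w * (w * w * w)) ≡ K * (l * r * t) + 3 * (w * w * w * (w * w * w))
      e₃ = solve-∀

-- Colours of pairs and the edges they explain.

any-true : {A : Set} {p : A → Bool} {xs : List A} {x : A} → x ∈ xs → p x ≡ true → any p xs ≡ true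
any-true {p = p} (here refl) eq rewrite eq = refl
any-true {p = p} (there {x = y} x∈) eq with p y
... | true  = refl
... | false = any-true x∈ eq

𝟙-any : {A : Set} (p : A → Bool) (xs : List A) → 𝟙 (any p xs) ≤ ∑[ x ← xs ] 𝟙 (p x)
𝟙-any p []       = z≤n
𝟙-any p (x ∷ xs) with p x
... | true  = s≤s z≤n
... | false = 𝟙-any p xs

∈-concatMap : {A B : Set} {f : A → List B} {xs : List A} {x : A} {y : B} → x ∈ xs → y ∈ f x → y ∈ concatMap f xs
∈-concatMap         (here refl) y∈ = ∈-++⁺ˡ y∈
∈-concatMap {f = f} (there {x = z} x∈) y∈ = ∈-++⁺ʳ (f z) (∈-concatMap x∈ y∈)

length-concatMap-≤ : {A B : Set} (f : A → List B) {c : ℕ} (xs : List A) → (∀ x → length (f x) ≤ c) → length (concatMap f xs) ≤ length xs * c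
length-concatMap-≤ f []       h = z≤n
length-concatMap-≤ f (x ∷ xs) h = ≤-trans (≤-reflexive (length-++ (f x))) (+-mono-≤ (h x) (length-concatMap-≤ f xs h))

<ᵇ-true : ∀ {m n} → m < n → (m Data.Nat.<ᵇ n) ≡ true
<ᵇ-true {m} {n} m<n with m Data.Nat.<ᵇ n in eq
... | true  = refl
... | false = ⊥-elim (subst Data.Bool.T eq (<⇒<ᵇ m<n))

module _ {V : Set} where

  triples : (V → V → V → Bool) → List V → List V → List V → ℕ
  triples R X Y Z = ∑[ x ← X ] ∑[ y ← Y ] ∑[ z ← Z ] 𝟙 (R x y z)

  innerDeg : (V → V → V → Bool) → List V → List V → List V → List V → ℕ
  innerDeg R X Y Z Z′ = ∑[ x ← X ] ∑[ y ← Y ] deg R Z x y * deg R Z′ x y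

  module _ (F s w : ℕ) where

    dominated₂ : ∀ X Y X′ Y′ → Dominated F s w X′ X → Dominated F s w Y′ Y → ∀ (φ : V → V → ℕ) →
      s * s * (∑[ x ← X′ ] ∑[ y ← Y′ ] φ x y) ≤ F * F * (w * w) * (∑[ x ← X ] ∑[ y ← Y ] φ x y)
    dominated₂ X Y X′ Y′ domX domY φ = begin
      s * s * (∑[ x ← X′ ] ∑[ y ← Y′ ] φ x y)       ≡⟨ trans (*-assoc s s _) (cong (s *_) (sym (∑-* s X′ _))) ⟩
      s * (∑[ x ← X′ ] s * (∑[ y ← Y′ ] φ x y))     ≤⟨ domX (λ x → s * (∑[ y ← Y′ ] φ x y)) ⟩
      F * (w * (∑[ x ← X ] s * (∑[ y ← Y′ ] φ x y))) ≤⟨ *-monoʳ-≤ F (*-monoʳ-≤ w (∑-mono X (λ x → domY (φ x)))) ⟩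
      F * (w * (∑[ x ← X ] F * (w * (∑[ y ← Y ] φ x y)))) ≡⟨ cong (λ t → F * (w * t)) (trans (∑-* F X _) (cong (F *_) (∑-* w X _))) ⟩
      F * (w * (F * (w * (∑[ x ← X ] ∑[ y ← Y ] φ x y)))) ≡⟨ e F w _ ⟩
      F * F * (w * w) * (∑[ x ← X ] ∑[ y ← Y ] φ x y) ∎
      where
      open ≤-Reasoning
      e : ∀ F w a → F * (w * (F * (w * a))) ≡ F * F * (w * w) * a
      e = solve-∀

    dominated₃ : ∀ X Y Z X′ Y′ Z′ → Dominated F s w X′ X → Dominated F s w Y′ Y → Dominated F s w Z′ Z → ∀ (φ : V → V → V → ℕ) →
      s * s * s * (∑[ x ← X′ ] ∑[ y ← Y′ ] ∑[ z ← Z′ ] φ x y z) ≤ F * F * F * (w * w * w) * (∑[ x ← X ] ∑[ y ← Y ] ∑[ z ← Z ] φ x y z)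
    dominated₃ X Y Z X′ Y′ Z′ domX domY domZ φ = begin
      s * s * s * (∑[ x ← X′ ] ∑[ y ← Y′ ] ∑[ z ← Z′ ] φ x y z)
        ≡⟨ trans (e₁ s _) (cong (s *_) (sym (∑-* (s * s) X′ _))) ⟩
      s * (∑[ x ← X′ ] s * s * (∑[ y ← Y′ ] ∑[ z ← Z′ ] φ x y z)) ≤⟨ domX (λ x → s * s * (∑[ y ← Y′ ] ∑[ z ← Z′ ] φ x y z)) ⟩
      F * (w * (∑[ x ← X ] s * s * (∑[ y ← Y′ ] ∑[ z ← Z′ ] φ x y z))) ≤⟨ *-monoʳ-≤ F (*-monoʳ-≤ w (∑-mono X (λ x → dominated₂ Y Z Y′ Z′ domY domZ (φ x)))) ⟩
      F * (w * (∑[ x ← X ] F * F * (w * w) * (∑[ y ← Y ] ∑[ z ← Z ] φ x y z))) ≡⟨ cong (λ t → F * (w * t)) (∑-* (F * F * (w * w)) X _) ⟩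
      F * (w * (F * F * (w * w) * (∑[ x ← X ] ∑[ y ← Y ] ∑[ z ← Z ] φ x y z))) ≡⟨ e₂ F w _ ⟩
      F * F * F * (w * w * w) * (∑[ x ← X ] ∑[ y ← Y ] ∑[ z ← Z ] φ x y z) ∎
      where
      open ≤-Reasoning
      e₁ : ∀ s a → s * s * s * a ≡ s * (s * s * a)
      e₁ = solve-∀
      e₂ : ∀ F w a → F * (w * (F * F * (w * w) * a)) ≡ F * F * F * (w * w * w) * a
      e₂ = solve-∀

cancel-* : ∀ c {a b} → 0 < c → c * a ≤ c * b → a ≤ b
cancel-* (suc c) _ = *-cancelˡ-≤ (suc c)

-- Pairs are coloured by the position of the blocks on which they are dense.  If hardly any pair
-- qualifies for two colours, then nearly every edge spans a triangle with pairs coloured L, R, T.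
module Colours {V : Set} (R : V → V → V → Bool) (rotate : ∀ x y z → R x y z ≡ R y z x) (flip : ∀ x y z → R x y z ≡ R x z y)
  (M₀ F K k₀ θ : ℕ) (B : ℕ → List V) (s : ℕ) (0<s : 0 < s) (lenB : ∀ k → length (B k) ≡ s)
  (0<F : 0 < F) (0<K : 0 < K) (0<M₀ : 0 < M₀)
  (K-large : θ * 3 * (F * F * F) ≤ K) (k₀-large : θ * 3 * (M₀ * (F * F * (K * K))) ≤ k₀)
  where

  dense : ℕ → V → V → Bool
  dense k x y = s ≤ᵇ K * deg R (B k) x y

  -- Left takes precedence over right, and top is also given to pairs that are dense on no block at
  -- all; thus the three colours always form a partition, even where pairs qualify for several of
  -- them.
  isL isR colL colR colT : ℕ → ℕ → V → V → Bool
  isL i j x y = any (λ k → (j Data.Nat.<ᵇ k) ∧ dense k x y) (upTo M₀)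
  isR i j x y = any (λ k → (k Data.Nat.<ᵇ i) ∧ dense k x y) (upTo M₀)
  colL = isL
  colR i j x y = not (isL i j x y) ∧ isR i j x y
  colT i j x y = not (isL i j x y) ∧ not (isR i j x y)

  colours-partition : ∀ i j x y → 𝟙 (colL i j x y) + 𝟙 (colR i j x y) + 𝟙 (colT i j x y) ≡ 1
  colours-partition i j x y with isL i j x y | isR i j x y
  ... | true  | _     = refl
  ... | false | true  = refl
  ... | false | false = refl

  private
    s³ : 0 < s * s * s
    s³ = *-mono-≤ (*-mono-≤ 0<s 0<s) 0<s

    s𝟙dense : ∀ k x y → s * 𝟙 (dense k x y) ≤ K * deg R (B k) x y
    s𝟙dense k x y with s ≤ᵇ K * deg R (B k) x y in eq
    ... | true  = ≤-trans (≤-reflexive (*-identityʳ s)) (≤ᵇ⇒≤ s _ (subst Data.Bool.T (sym eq) tt))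
    ... | false = ≤-trans (≤-reflexive (*-zeroʳ s)) z≤n

    sparse : ∀ k x y → K * (deg R (B k) x y * 𝟙 (not (dense k x y))) ≤ s
    sparse k x y with s ≤ᵇ K * deg R (B k) x y in eq
    ... | true  = ≤-trans (≤-reflexive (trans (cong (K *_) (*-zeroʳ (deg R (B k) x y))) (*-zeroʳ K))) z≤n
    ... | false = ≤-trans (≤-reflexive (cong (K *_) (*-identityʳ _))) (<⇒≤ (≰⇒> (λ le → subst Data.Bool.T eq (≤⇒≤ᵇ le))))

  sparse-edges : ∀ i j k → K * (∑[ x ← B i ] ∑[ y ← B j ] ∑[ z ← B k ] 𝟙 (R x y z) * 𝟙 (not (dense k x y))) ≤ s * s * s
  sparse-edges i j k = begin
    K * (∑[ x ← B i ] ∑[ y ← B j ] ∑[ z ← B k ] 𝟙 (R x y z) * 𝟙 (not (dense k x y)))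
      ≡⟨ cong (K *_) (∑₂-cong (B i) (B j) (λ x y → ∑-*ʳ (𝟙 (not (dense k x y))) (B k) _)) ⟩
    K * (∑[ x ← B i ] ∑[ y ← B j ] deg R (B k) x y * 𝟙 (not (dense k x y))) ≡⟨ sym (∑₂-* (B i) (B j) K _) ⟩
    (∑[ x ← B i ] ∑[ y ← B j ] K * (deg R (B k) x y * 𝟙 (not (dense k x y)))) ≤⟨ ∑₂-≤ (B i) (B j) (sparse k) ⟩
    length (B i) * (length (B j) * s) ≡⟨ trans (cong₂ (λ a b → a * (b * s)) (lenB i) (lenB j)) (sym (*-assoc s s s)) ⟩
    s * s * s ∎
    where open ≤-Reasoning

  module _ (NoOverlap : ∀ {p q r u} → p < q → q < r → r < u → u < M₀ →
      k₀ * innerDeg R (B q) (B r) (B p) (B u) < s ⁴ × k₀ * innerDeg R (B p) (B r) (B q) (B u) < s ⁴ × k₀ * innerDeg R (B q) (B u) (B p) (B r) < s ⁴)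
    (W : ℕ → List V) (w : ℕ) (lenW : ∀ k → length (W k) ≡ w) (dom : ∀ k → Dominated F s w (W k) (B k))
    where

    private
      w³ = w * w * w

      -- Domination carries smallness from `B` to `W` at the cost of `F ^ 3`, one factor for each
      -- vertex.
      few-sparse : ∀ i j k (φ : V → V → V → ℕ) → K * (∑[ x ← B i ] ∑[ y ← B j ] ∑[ z ← B k ] φ x y z) ≤ s * s * s →
        θ * (3 * (∑[ x ← W i ] ∑[ y ← W j ] ∑[ z ← W k ] φ x y z)) ≤ w³
      few-sparse i j k φ h = cancel-* (F * F * F) (*-mono-≤ (*-mono-≤ 0<F 0<F) 0<F) (cancel-* (s * s * s) s³ (begin
        s * s * s * (F * F * F * (θ * (3 * S)))   ≡⟨ e₁ s F θ S ⟩
        θ * 3 * (F * F * F) * (s * s * s * S)     ≤⟨ *-mono-≤ K-large (dominated₃ F s w (B i) (B j) (B k) (W i) (W j) (W k) (dom i) (dom j) (dom k) φ) ⟩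
        K * (F * F * F * w³ * ∑B)                 ≡⟨ e₂ K (F * F * F * w³) ∑B ⟩
        F * F * F * w³ * (K * ∑B)                 ≤⟨ *-monoʳ-≤ (F * F * F * w³) h ⟩
        F * F * F * w³ * (s * s * s)              ≡⟨ *-comm (F * F * F * w³) (s * s * s) ⟩
        s * s * s * (F * F * F * w³)              ∎))
        where
        open ≤-Reasoning
        S = ∑[ x ← W i ] ∑[ y ← W j ] ∑[ z ← W k ] φ x y z
        ∑B = ∑[ x ← B i ] ∑[ y ← B j ] ∑[ z ← B k ] φ x y z
        e₁ : ∀ s F θ S → s * s * s * (F * F * F * (θ * (3 * S))) ≡ θ * 3 * (F * F * F) * (s * s * s * S)
        e₁ = solve-∀
        e₂ : ∀ K a b → K * (a * b) ≡ a * (K * b)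
        e₂ = solve-∀

      both : ℕ → ℕ → V → V → ℕ
      both k l x y = 𝟙 (dense k x y) * 𝟙 (dense l x y)

      few-both : ∀ i j k l → k₀ * innerDeg R (B i) (B j) (B k) (B l) < s ⁴ →
        k₀ * (∑[ x ← W i ] ∑[ y ← W j ] both k l x y) ≤ F * F * (K * K) * (w * w)
      few-both i j k l h = cancel-* (s * s) (*-mono-≤ 0<s 0<s) (cancel-* (s * s) (*-mono-≤ 0<s 0<s) (begin
        s * s * (s * s * (k₀ * S))                ≡⟨ e₁ s k₀ S ⟩
        k₀ * (s * s) * (s * s * S)                ≤⟨ *-monoʳ-≤ (k₀ * (s * s)) (dominated₂ F s w (B i) (B j) (W i) (W j) (dom i) (dom j) (both k l)) ⟩
        k₀ * (s * s) * (F * F * (w * w) * ∑B)     ≡⟨ e₂ k₀ s (F * F * (w * w)) ∑B ⟩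
        F * F * (w * w) * (k₀ * (s * s * ∑B))     ≤⟨ *-monoʳ-≤ (F * F * (w * w)) (*-monoʳ-≤ k₀ upper) ⟩
        F * F * (w * w) * (k₀ * (K * K * innerDeg R (B i) (B j) (B k) (B l))) ≡⟨ e₃ (F * F * (w * w)) k₀ (K * K) _ ⟩
        F * F * (w * w) * (K * K) * (k₀ * innerDeg R (B i) (B j) (B k) (B l)) ≤⟨ *-monoʳ-≤ (F * F * (w * w) * (K * K)) (<⇒≤ h) ⟩
        F * F * (w * w) * (K * K) * s ⁴           ≡⟨ e₄ F w K s ⟩
        s * s * (s * s * (F * F * (K * K) * (w * w))) ∎))
        where
        open ≤-Reasoning
        S = ∑[ x ← W i ] ∑[ y ← W j ] both k l x y
        ∑B = ∑[ x ← B i ] ∑[ y ← B j ] both k l x y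
        upper : s * s * ∑B ≤ K * K * innerDeg R (B i) (B j) (B k) (B l)
        upper = begin
          s * s * ∑B ≡⟨ sym (∑₂-* (B i) (B j) (s * s) _) ⟩
          (∑[ x ← B i ] ∑[ y ← B j ] s * s * both k l x y)
            ≤⟨ ∑₂-mono (B i) (B j) (λ x y → ≤-trans (≤-reflexive ([m*n]*[o*p]≡[m*o]*[n*p] s s (𝟙 (dense k x y)) (𝟙 (dense l x y))))
                 (≤-trans (*-mono-≤ (s𝟙dense k x y) (s𝟙dense l x y)) (≤-reflexive ([m*n]*[o*p]≡[m*o]*[n*p] K (deg R (B k) x y) K (deg R (B l) x y))))) ⟩
          (∑[ x ← B i ] ∑[ y ← B j ] K * K * (deg R (B k) x y * deg R (B l) x y)) ≡⟨ ∑₂-* (B i) (B j) (K * K) _ ⟩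
          K * K * innerDeg R (B i) (B j) (B k) (B l) ∎
        e₁ : ∀ s k S → s * s * (s * s * (k * S)) ≡ k * (s * s) * (s * s * S)
        e₁ = solve-∀
        e₂ : ∀ k s a b → k * (s * s) * (a * b) ≡ a * (k * (s * s * b))
        e₂ = solve-∀
        e₃ : ∀ a k c i → a * (k * (c * i)) ≡ a * c * (k * i)
        e₃ = solve-∀
        e₄ : ∀ F w K s → F * F * (w * w) * (K * K) * (s * s * (s * s)) ≡ s * s * (s * s * (F * F * (K * K) * (w * w)))
        e₄ = solve-∀

      -- A union bound over the at most `M₀` blocks that could give the pair a second colour; the
      -- factor `w` counts the free third vertex.
      few-overlaps : ∀ i j l (p : ℕ → Bool) → (∀ {k} → k < M₀ → p k ≡ true → k₀ * innerDeg R (B i) (B j) (B k) (B l) < s ⁴) →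
        θ * (3 * (w * (∑[ x ← W i ] ∑[ y ← W j ] 𝟙 (dense l x y) * 𝟙 (any (λ k → p k ∧ dense k x y) (upTo M₀))))) ≤ w³
      few-overlaps i j l p h = cancel-* Q 0<Q (begin
        Q * (θ * (3 * (w * S)))        ≡⟨ e₁ Q θ w S ⟩
        w * (θ * 3 * Q * S)            ≤⟨ *-monoʳ-≤ w (≤-trans (*-monoˡ-≤ S k₀-large) (*-monoʳ-≤ k₀ S≤)) ⟩
        w * (k₀ * (∑[ k ← upTo M₀ ] O k)) ≡⟨ cong (w *_) (sym (∑-* k₀ (upTo M₀) O)) ⟩
        w * (∑[ k ← upTo M₀ ] k₀ * O k) ≤⟨ *-monoʳ-≤ w (∑-mono-∈ (upTo M₀) (λ {k} k∈ → term k (∈-upTo⁻ k∈))) ⟩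
        w * (∑[ k ← upTo M₀ ] F * F * (K * K) * (w * w)) ≡⟨ cong (w *_) (trans (∑-const (upTo M₀) _) (cong (_* (F * F * (K * K) * (w * w))) (length-upTo M₀))) ⟩
        w * (M₀ * (F * F * (K * K) * (w * w))) ≡⟨ e₂ w M₀ (F * F * (K * K)) ⟩
        Q * w³                         ∎)
        where
        open ≤-Reasoning
        Q = M₀ * (F * F * (K * K))
        0<Q : 0 < Q
        0<Q = *-mono-≤ 0<M₀ (*-mono-≤ (*-mono-≤ 0<F 0<F) (*-mono-≤ 0<K 0<K))
        S = ∑[ x ← W i ] ∑[ y ← W j ] 𝟙 (dense l x y) * 𝟙 (any (λ k → p k ∧ dense k x y) (upTo M₀))
        O : ℕ → ℕ
        O k = ∑[ x ← W i ] ∑[ y ← W j ] 𝟙 (p k) * both k l x y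
        S≤ : S ≤ (∑[ k ← upTo M₀ ] O k)
        S≤ = begin
          S ≤⟨ ∑₂-mono (W i) (W j) (λ x y → *-monoʳ-≤ (𝟙 (dense l x y)) (𝟙-any _ (upTo M₀))) ⟩
          (∑[ x ← W i ] ∑[ y ← W j ] 𝟙 (dense l x y) * (∑[ k ← upTo M₀ ] 𝟙 (p k ∧ dense k x y)))
            ≡⟨ ∑₂-cong (W i) (W j) (λ x y → trans (sym (∑-* (𝟙 (dense l x y)) (upTo M₀) _)) (∑-cong (upTo M₀) (λ k → trans (cong (𝟙 (dense l x y) *_) (𝟙-∧ (p k) (dense k x y))) (e₀ (𝟙 (dense l x y)) (𝟙 (p k)) (𝟙 (dense k x y)))))) ⟩
          (∑[ x ← W i ] ∑[ y ← W j ] ∑[ k ← upTo M₀ ] 𝟙 (p k) * both k l x y)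
            ≡⟨ trans (∑-cong (W i) (λ x → ∑-swap (W j) (upTo M₀) _)) (∑-swap (W i) (upTo M₀) _) ⟩
          (∑[ k ← upTo M₀ ] O k) ∎
          where
          e₀ : ∀ l p k → l * (p * k) ≡ p * (k * l)
          e₀ = solve-∀
        term : ∀ k → k < M₀ → k₀ * O k ≤ F * F * (K * K) * (w * w)
        term k k<M₀ with p k in eq
        ... | true  = ≤-trans (≤-reflexive (cong (k₀ *_) (∑₂-cong (W i) (W j) (λ x y → *-identityˡ _)))) (few-both i j k l (h k<M₀ eq))
        ... | false = ≤-trans (≤-reflexive (trans (cong (k₀ *_) (trans (∑-cong (W i) (λ _ → ∑-zero (W j))) (∑-zero (W i)))) (*-zeroʳ k₀))) z≤n
        e₁ : ∀ Q θ w S → Q * (θ * (3 * (w * S))) ≡ w * (θ * 3 * Q * S)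
        e₁ = solve-∀
        e₂ : ∀ w M a → w * (M * (a * (w * w))) ≡ M * a * (w * w * w)
        e₂ = solve-∀

      -- The blocks of the edge are themselves witnesses: density on the block of `z` colours x y
      -- left, density on the block of `x` makes y z a candidate for right, and x z is top unless it
      -- qualifies for another colour. The last six summands are the ways in which this can fail.
      cover : ∀ e d₁ d₂ d₃ l₁ l₂ r₂ l₃ r₃ → (d₁ ≡ true → l₁ ≡ true) → (d₂ ≡ true → r₂ ≡ true) →
        𝟙 e ≤ 𝟙 l₁ * (𝟙 (not l₂ ∧ r₂) * 𝟙 (not l₃ ∧ not r₃)) +
          (𝟙 e * 𝟙 (not d₁) + 𝟙 e * 𝟙 (not d₂) + 𝟙 e * 𝟙 (not d₃) + (𝟙 d₂ * 𝟙 l₂ + 𝟙 d₃ * 𝟙 l₃ + 𝟙 d₃ * 𝟙 r₃))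
      cover false _     _     _     _     _     _     _     _     _  _  = z≤n
      cover true  false _     _     l₁    l₂    r₂    l₃    r₃    _  _  = ≤-trans (s≤s z≤n) (m≤n+m _ (𝟙 l₁ * (𝟙 (not l₂ ∧ r₂) * 𝟙 (not l₃ ∧ not r₃))))
      cover true  true  false _     l₁    l₂    r₂    l₃    r₃    _  _  = ≤-trans (s≤s z≤n) (m≤n+m _ (𝟙 l₁ * (𝟙 (not l₂ ∧ r₂) * 𝟙 (not l₃ ∧ not r₃))))
      cover true  true  true  false l₁    l₂    r₂    l₃    r₃    _  _  = ≤-trans (s≤s z≤n) (m≤n+m _ (𝟙 l₁ * (𝟙 (not l₂ ∧ r₂) * 𝟙 (not l₃ ∧ not r₃))))
      cover true  true  true  true  false _     _     _     _     h₁ _  = contradiction (h₁ refl) (λ ())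
      cover true  true  true  true  true  _     false _     _     _  h₂ = contradiction (h₂ refl) (λ ())
      cover true  true  true  true  true  true  true  l₃    r₃    _  _  = s≤s z≤n
      cover true  true  true  true  true  false true  true  r₃    _  _  = s≤s z≤n
      cover true  true  true  true  true  false true  false true  _  _  = s≤s z≤n
      cover true  true  true  true  true  false true  false false _  _  = s≤s z≤n

    few-exceptions : ∀ {i j k} → i < j → j < k → k < M₀ →
      θ * triples R (W i) (W j) (W k) ≤
      θ * (∑[ x ← W i ] ∑[ y ← W j ] ∑[ z ← W k ] 𝟙 (colL i j x y) * (𝟙 (colR j k y z) * 𝟙 (colT i k x z))) + 2 * w³
    few-exceptions {i} {j} {k} i<j j<k k<M₀ = *-cancelˡ-≤ 3 (begin
      3 * (θ * triples R (W i) (W j) (W k)) ≤⟨ *-monoʳ-≤ 3 (*-monoʳ-≤ θ counted) ⟩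
      3 * (θ * (N + (S₁ + S₂ + S₃ + (O₁ + O₂ + O₃)))) ≡⟨ e₁ θ N S₁ S₂ S₃ O₁ O₂ O₃ ⟩
      3 * (θ * N) + (θ * (3 * S₁) + θ * (3 * S₂) + θ * (3 * S₃) + (θ * (3 * O₁) + θ * (3 * O₂) + θ * (3 * O₃)))
        ≤⟨ +-monoʳ-≤ (3 * (θ * N)) (+-mono-≤ (+-mono-≤ (+-mono-≤ b₁ b₂) b₃) (+-mono-≤ (+-mono-≤ c₁ c₂) c₃)) ⟩
      3 * (θ * N) + (w³ + w³ + w³ + (w³ + w³ + w³)) ≡⟨ e₂ (θ * N) w³ ⟩
      3 * (θ * N + 2 * w³) ∎)
      where
      open ≤-Reasoning
      i<M₀ : i < M₀
      i<M₀ = <-trans i<j (<-trans j<k k<M₀)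
      j<M₀ : j < M₀
      j<M₀ = <-trans j<k k<M₀
      s₁ s₂ s₃ : V → V → V → ℕ
      s₁ x y z = 𝟙 (R x y z) * 𝟙 (not (dense k x y))
      s₂ x y z = 𝟙 (R x y z) * 𝟙 (not (dense i y z))
      s₃ x y z = 𝟙 (R x y z) * 𝟙 (not (dense j x z))
      o₁ o₂ o₃ : V → V → ℕ
      o₁ y z = 𝟙 (dense i y z) * 𝟙 (isL j k y z)
      o₂ x z = 𝟙 (dense j x z) * 𝟙 (isL i k x z)
      o₃ x z = 𝟙 (dense j x z) * 𝟙 (isR i k x z)
      N = ∑[ x ← W i ] ∑[ y ← W j ] ∑[ z ← W k ] 𝟙 (colL i j x y) * (𝟙 (colR j k y z) * 𝟙 (colT i k x z))
      S : (V → V → V → ℕ) → ℕ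
      S φ = ∑[ x ← W i ] ∑[ y ← W j ] ∑[ z ← W k ] φ x y z
      S-+ : ∀ φ ψ → S (λ x y z → φ x y z + ψ x y z) ≡ S φ + S ψ
      S-+ φ ψ = trans (∑-cong (W i) (λ x → ∑₂-+ (W j) (W k) (φ x) (ψ x))) (∑-+ (W i) _ _)
      S₁ = S s₁
      S₂ = S s₂
      S₃ = S s₃
      O₁ = S (λ x y z → o₁ y z)
      O₂ = S (λ x y z → o₂ x z)
      O₃ = S (λ x y z → o₃ x z)
      counted : triples R (W i) (W j) (W k) ≤ N + (S₁ + S₂ + S₃ + (O₁ + O₂ + O₃))
      counted = ≤-trans (∑-mono (W i) (λ x → ∑₂-mono (W j) (W k) (λ y z →
        cover (R x y z) (dense k x y) (dense i y z) (dense j x z) (isL i j x y) (isL j k y z) (isR j k y z) (isL i k x z) (isR i k x z)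
          (λ d → any-true {p = λ l → (j Data.Nat.<ᵇ l) ∧ dense l x y} (∈-upTo⁺ k<M₀) (cong₂ _∧_ (<ᵇ-true j<k) d))
          (λ d → any-true {p = λ l → (l Data.Nat.<ᵇ j) ∧ dense l y z} (∈-upTo⁺ i<M₀) (cong₂ _∧_ (<ᵇ-true i<j) d)))))
        (≤-reflexive (trans (S-+ _ _) (cong (N +_) (trans (S-+ _ _) (cong₂ _+_
          (trans (S-+ _ _) (cong (_+ S₃) (S-+ s₁ s₂))) (trans (S-+ _ _) (cong (_+ O₃) (S-+ _ _))))))))
      b₁ : θ * (3 * S₁) ≤ w³
      b₁ = few-sparse i j k s₁ (sparse-edges i j k)
      b₂ : θ * (3 * S₂) ≤ w³
      b₂ = few-sparse i j k s₂ (≤-trans (≤-reflexive (cong (K *_)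
        (trans (pull₂ (B i) (B j) (B k) s₂) (∑₂-cong (B j) (B k) (λ y z → ∑-cong (B i) (λ x → cong (λ t → 𝟙 t * 𝟙 (not (dense i y z))) (rotate x y z))))))) (sparse-edges j k i))
      b₃ : θ * (3 * S₃) ≤ w³
      b₃ = few-sparse i j k s₃ (≤-trans (≤-reflexive (cong (K *_)
        (∑-cong (B i) (λ x → trans (∑-swap (B j) (B k) (s₃ x)) (∑₂-cong (B k) (B j) (λ z y → cong (λ t → 𝟙 t * 𝟙 (not (dense j x z))) (flip x y z))))))) (sparse-edges i k j))
      const-outer : (∑[ x ← W i ] ∑[ y ← W j ] ∑[ z ← W k ] o₁ y z) ≡ w * (∑[ y ← W j ] ∑[ z ← W k ] o₁ y z)
      const-outer = trans (∑-const (W i) _) (cong (_* (∑[ y ← W j ] ∑[ z ← W k ] o₁ y z)) (lenW i))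
      const-middle : ∀ (o : V → V → ℕ) → S (λ x y z → o x z) ≡ w * (∑[ x ← W i ] ∑[ z ← W k ] o x z)
      const-middle o = trans (∑-cong (W i) (λ x → trans (∑-const (W j) _) (cong (_* (∑[ z ← W k ] o x z)) (lenW j)))) (∑-* w (W i) _)
      c₁ : θ * (3 * O₁) ≤ w³
      c₁ = ≤-trans (≤-reflexive (cong (λ t → θ * (3 * t)) const-outer)) (few-overlaps j k i (λ l → k Data.Nat.<ᵇ l)
        (λ {l} l<M₀ eq → subst (λ t → k₀ * t < s ⁴) (∑₂-cong (B j) (B k) (λ x y → *-comm (deg R (B i) x y) _))
          (proj₁ (NoOverlap i<j j<k (<ᵇ⇒< k l (subst Data.Bool.T (sym eq) tt)) l<M₀))))
      c₂ : θ * (3 * O₂) ≤ w³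
      c₂ = ≤-trans (≤-reflexive (cong (λ t → θ * (3 * t)) (const-middle o₂))) (few-overlaps i k j (λ l → k Data.Nat.<ᵇ l)
        (λ {l} l<M₀ eq → subst (λ t → k₀ * t < s ⁴) (∑₂-cong (B i) (B k) (λ x y → *-comm (deg R (B j) x y) _))
          (proj₁ (proj₂ (NoOverlap i<j j<k (<ᵇ⇒< k l (subst Data.Bool.T (sym eq) tt)) l<M₀)))))
      c₃ : θ * (3 * O₃) ≤ w³
      c₃ = ≤-trans (≤-reflexive (cong (λ t → θ * (3 * t)) (const-middle o₃))) (few-overlaps i k j (λ l → l Data.Nat.<ᵇ i)
        (λ {l} l<M₀ eq → proj₂ (proj₂ (NoOverlap (<ᵇ⇒< l i (subst Data.Bool.T (sym eq) tt)) i<j j<k k<M₀))))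
      e₁ : ∀ θ N a b c d e f → 3 * (θ * (N + (a + b + c + (d + e + f)))) ≡
        3 * (θ * N) + (θ * (3 * a) + θ * (3 * b) + θ * (3 * c) + (θ * (3 * d) + θ * (3 * e) + θ * (3 * f)))
      e₁ = solve-∀
      e₂ : ∀ n v → 3 * n + (v + v + v + (v + v + v)) ≡ 3 * (n + 2 * v)
      e₂ = solve-∀

-- The budget in units of `1 / (216 * q)`: the exceptions cost one unit by the choice of `θ`,
-- irregularity one by that of `Kr`, and the variation of the densities one by that of `κ`, because
-- the cube of `1 + 2 / κ` is at most `1 + 26 / κ` and 208 = 8 * 26. The excess `1 / (54 * q)`
-- amounts to four units.
colour-arithmetic : ∀ q κ Kr θ e N a b c b′ c′ v → 0 < q → κ ≡ 208 * q → Kr ≡ 648 * q → θ ≡ 432 * q → 0 < v * v * v →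
  θ * e ≤ θ * N + 2 * (v * v * v) → Kr * (v * v * v * N) ≤ Kr * (a * b * c) + 3 * (v * v * v * (v * v * v)) →
  κ * b ≤ κ * b′ + v * v → κ * c ≤ κ * c′ + v * v → a + b′ + c′ ≡ v * v →
  54 * q * e < (2 * q + 1) * (v * v * v)
colour-arithmetic q@(suc _) κ Kr θ e N a b c b′ c′ v _ refl refl refl 0<w h₁ h₂ hb hc sum = *-cancelˡ-< 4 _ _ (begin-strict
  4 * (54 * q * e)                  ≡⟨ d₁ q e ⟩
  216 * q * e                       ≤⟨ *-cancelˡ-≤ 2 (≤-trans (≤-reflexive (d₂ q e)) (≤-trans h₁ (≤-reflexive (d₃ q N w)))) ⟩
  216 * q * N + w                   ≤⟨ +-monoˡ-≤ w few ⟩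
  (8 * q + 2) * w + w               ≡⟨ d₄ q w ⟩
  (8 * q + 3) * w                   <⟨ *-monoˡ-< w (+-monoʳ-< (8 * q) (s≤s (s≤s (s≤s (s≤s z≤n))))) ⟩
  (8 * q + 4) * w                   ≡⟨ d₅ q w ⟩
  4 * ((2 * q + 1) * w)             ∎)
  where
  open ≤-Reasoning
  w = v * v * v
  n = v * v
  P = a * b * c
  instance
    nonZero : NonZero w
    nonZero = Data.Nat.>-nonZero 0<w
  d₁ : ∀ q e → 4 * (54 * q * e) ≡ 216 * q * e
  d₁ = solve-∀
  d₂ : ∀ q e → 2 * (216 * q * e) ≡ 432 * q * e
  d₂ = solve-∀
  d₃ : ∀ q N w → 432 * q * N + 2 * w ≡ 2 * (216 * q * N + w)
  d₃ = solve-∀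
  d₄ : ∀ q w → (8 * q + 2) * w + w ≡ (8 * q + 3) * w
  d₄ = solve-∀
  d₅ : ∀ q w → (8 * q + 4) * w ≡ 4 * ((2 * q + 1) * w)
  d₅ = solve-∀
  total : κ * (a + b + c) ≤ (κ + 2) * n
  total = begin
    κ * (a + b + c)                     ≡⟨ t₁ κ a b c ⟩
    κ * a + (κ * b + κ * c)             ≤⟨ +-monoʳ-≤ (κ * a) (+-mono-≤ hb hc) ⟩
    κ * a + (κ * b′ + n + (κ * c′ + n)) ≡⟨ t₂ κ a b′ c′ n ⟩
    κ * (a + b′ + c′) + 2 * n           ≡⟨ cong (λ t → κ * t + 2 * n) sum ⟩
    κ * n + 2 * n                       ≡⟨ sym (*-distribʳ-+ n κ 2) ⟩
    (κ + 2) * n                         ∎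
    where
    t₁ : ∀ κ a b c → κ * (a + b + c) ≡ κ * a + (κ * b + κ * c)
    t₁ = solve-∀
    t₂ : ∀ κ a b c n → κ * a + (κ * b + n + (κ * c + n)) ≡ κ * (a + b + c) + 2 * n
    t₂ = solve-∀
  κ-cube : κ * κ * κ * (27 * P) ≤ κ * κ * ((κ + 26) * (w * w))
  κ-cube = begin
    κ * κ * κ * (27 * P)                ≤⟨ *-monoʳ-≤ (κ * κ * κ) (27abc≤[a+b+c]³ a b c) ⟩
    κ * κ * κ * ((a + b + c) * (a + b + c) * (a + b + c)) ≡⟨ t₁ κ (a + b + c) ⟩
    κ * (a + b + c) * (κ * (a + b + c)) * (κ * (a + b + c)) ≤⟨ *-mono-≤ (*-mono-≤ total total) total ⟩
    (κ + 2) * n * ((κ + 2) * n) * ((κ + 2) * n) ≡⟨ t₂ κ v ⟩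
    (κ + 2) * (κ + 2) * (κ + 2) * (w * w) ≤⟨ *-monoˡ-≤ (w * w) expand ⟩
    κ * κ * (κ + 26) * (w * w)          ≡⟨ *-assoc (κ * κ) (κ + 26) (w * w) ⟩
    κ * κ * ((κ + 26) * (w * w))        ∎
    where
    t₁ : ∀ κ s → κ * κ * κ * (s * s * s) ≡ κ * s * (κ * s) * (κ * s)
    t₁ = solve-∀
    t₂ : ∀ κ v → (κ + 2) * (v * v) * ((κ + 2) * (v * v)) * ((κ + 2) * (v * v)) ≡ (κ + 2) * (κ + 2) * (κ + 2) * (v * v * v * (v * v * v))
    t₂ = solve-∀
    t₃ : ∀ k → (suc k + 2) * (suc k + 2) * (suc k + 2) + (20 * (k * k) + 28 * k) ≡ suc k * suc k * (suc k + 26)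
    t₃ = solve-∀
    expand : (κ + 2) * (κ + 2) * (κ + 2) ≤ κ * κ * (κ + 26)
    expand = ≤-trans (m≤m+n _ _) (≤-reflexive (t₃ (Data.Nat.pred κ)))
  few : 216 * q * N ≤ (8 * q + 2) * w
  few = *-cancelˡ-≤ w (begin
    w * (216 * q * N)                   ≤⟨ *-cancelˡ-≤ 3 (≤-trans (≤-reflexive (t₁ w q N)) (≤-trans h₂ (≤-reflexive (t₂ q P (w * w))))) ⟩
    216 * q * P + w * w                 ≤⟨ +-monoˡ-≤ (w * w) (*-cancelˡ-≤ 26 (*-cancelˡ-≤ (κ * κ) (≤-trans (≤-reflexive (t₃ q P)) (≤-trans κ-cube (≤-reflexive (t₄ q (w * w))))))) ⟩
    (8 * q + 1) * (w * w) + w * w       ≡⟨ t₅ q w ⟩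
    w * ((8 * q + 2) * w)               ∎)
    where
    t₁ : ∀ w q N → 3 * (w * (216 * q * N)) ≡ 648 * q * (w * N)
    t₁ = solve-∀
    t₂ : ∀ q P W → 648 * q * P + 3 * W ≡ 3 * (216 * q * P + W)
    t₂ = solve-∀
    t₃ : ∀ q P → 208 * q * (208 * q) * (26 * (216 * q * P)) ≡ 208 * q * (208 * q) * (208 * q) * (27 * P)
    t₃ = solve-∀
    t₄ : ∀ q W → 208 * q * (208 * q) * ((208 * q + 26) * W) ≡ 208 * q * (208 * q) * (26 * ((8 * q + 1) * W))
    t₄ = solve-∀
    t₅ : ∀ q w → (8 * q + 1) * (w * w) + w * w ≡ w * ((8 * q + 2) * w)
    t₅ = solve-∀

-- A large inner product of two different types.

module Overlap {V : Set} (R : V → V → V → Bool) (rotate : ∀ x y z → R x y z ≡ R y z x) (flip : ∀ x y z → R x y z ≡ R x z y)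
  (q M₁ κ Kr θ M₀ h F K k₀ : ℕ) (0<q : 0 < q) (κ≡ : κ ≡ 208 * q) (Kr≡ : Kr ≡ 648 * q) (θ≡ : θ ≡ 432 * q)
  (0<M₀ : 0 < M₀) (M₀-large : ramseysBound {ℕ} 2 (3 * suc κ) M₁ ≤ M₀) (h-large : suc (Kr * Kr * (M₀ * (M₀ * 6))) ≤ h)
  (F≡ : F ≡ Kr ^ h) (0<K : 0 < K) (K-large : θ * 3 * (F * F * F) ≤ K) (k₀-large : θ * 3 * (M₀ * (F * F * (K * K))) ≤ k₀)
  (B : ℕ → List V) (s : ℕ) (0<s : 0 < s) (lenB : ∀ k → length (B k) ≡ s)
  where

  private
    1≤Kr : 1 ≤ Kr
    1≤Kr = subst (1 ≤_) (sym Kr≡) (*-mono-≤ (s≤s (z≤n {647})) 0<q)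

    0<F : 0 < F
    0<F = subst (0 <_) (sym F≡) (m^n>0 Kr {{Data.Nat.>-nonZero 1≤Kr}} h)

    open Colours R rotate flip M₀ F K k₀ θ B s 0<s lenB 0<F 0<K 0<M₀ K-large k₀-large

    -- Block `M₀` lies outside the range in use and serves as the ignored middle block. Each colour
    -- is regularised in both directions, as the triangle count tests subsets on either side.
    colourTasks : (ℕ → ℕ → V → V → Bool) → ∀ {i j} → i < j → j < M₀ → List (Task {V})
    colourTasks c {i} {j} i<j j<M₀ =
      task i M₀ j (λ x _ y → c i j x y) (<⇒≢ (<-trans i<j j<M₀)) (<⇒≢ i<j) (>⇒≢ j<M₀) ∷
      task j M₀ i (λ y _ x → c i j x y) (<⇒≢ j<M₀) (>⇒≢ i<j) (>⇒≢ (<-trans i<j j<M₀)) ∷ []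

    pairTasks : ∀ i j → Dec (i < j) → Dec (j < M₀) → List (Task {V})
    pairTasks i j (yes i<j) (yes j<M₀) = colourTasks colL i<j j<M₀ ++ colourTasks colR i<j j<M₀ ++ colourTasks colT i<j j<M₀
    pairTasks i j (yes _)   (no _)     = []
    pairTasks i j (no _)    _          = []

    length-pairTasks : ∀ i j d d′ → length (pairTasks i j d d′) ≤ 6
    length-pairTasks i j (yes _) (yes _) = ≤-refl
    length-pairTasks i j (yes _) (no _)  = z≤n
    length-pairTasks i j (no _)  _       = z≤n

    tasks : List (Task {V})
    tasks = concatMap (λ i → concatMap (λ j → pairTasks i j (i <? j) (j <? M₀)) (upTo M₀)) (upTo M₀)

    length-tasks : length tasks ≤ M₀ * (M₀ * 6)
    length-tasks = ≤-trans (length-concatMap-≤ _ (upTo M₀) (λ i → ≤-trans (length-concatMap-≤ _ (upTo M₀) (λ j → length-pairTasks i j (i <? j) (j <? M₀)))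
      (≤-reflexive (cong (_* 6) (length-upTo M₀))))) (≤-reflexive (cong (_* (M₀ * 6)) (length-upTo M₀)))

    fuel : suc (Kr * Kr * length tasks) ≤ h
    fuel = ≤-trans (s≤s (*-monoʳ-≤ (Kr * Kr) length-tasks)) h-large

  NoOverlap : Set
  NoOverlap = ∀ {p q r u} → p < q → q < r → r < u → u < M₀ →
    k₀ * innerDeg R (B q) (B r) (B p) (B u) < s ⁴ × k₀ * innerDeg R (B p) (B r) (B q) (B u) < s ⁴ × k₀ * innerDeg R (B q) (B u) (B p) (B r) < s ⁴

  module _ (noOverlap : NoOverlap) (W : ℕ → List V) (w : ℕ) (0<w : 0 < w) (lenW : ∀ k → length (W k) ≡ w)
    (dom : ∀ k → Dominated F s w (W k) (B k)) (reg : ∀ {τ} → τ ∈ tasks → Regular Kr w W τ) where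

    private
      data Colour : (ℕ → ℕ → V → V → Bool) → Set where
        left  : Colour colL
        right : Colour colR
        top   : Colour colT

      regular-pair : ∀ {c} → Colour c → ∀ {i j} → i < j → j < M₀ →
        (∀ u → Kr * discrepancy (λ x _ y → c i j x y) (W i) (W M₀) (W j) u ≤ w ⁴) ×
        (∀ u → Kr * discrepancy (λ y _ x → c i j x y) (W j) (W M₀) (W i) u ≤ w ⁴)
      regular-pair {c} colour {i} {j} i<j j<M₀ = pick colour (i <? j) (j <? M₀) (λ τ∈ → reg (∈-concatMap (∈-upTo⁺ (<-trans i<j j<M₀)) (∈-concatMap (∈-upTo⁺ j<M₀) τ∈)))
        where
        pick : ∀ {c} → Colour c → (d : Dec (i < j)) (d′ : Dec (j < M₀)) → (∀ {τ} → τ ∈ pairTasks i j d d′ → Regular Kr w W τ) →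
          (∀ u → Kr * discrepancy (λ x _ y → c i j x y) (W i) (W M₀) (W j) u ≤ w ⁴) ×
          (∀ u → Kr * discrepancy (λ y _ x → c i j x y) (W j) (W M₀) (W i) u ≤ w ⁴)
        pick left  (yes _) (yes _) r = r (here refl) , r (there (here refl))
        pick right (yes _) (yes _) r = r (there (there (here refl))) , r (there (there (there (here refl))))
        pick top   (yes _) (yes _) r = r (there (there (there (there (here refl))))) , r (there (there (there (there (there (here refl))))))
        pick _     (no ¬p) _       r = contradiction i<j ¬p
        pick _     (yes _) (no ¬p) r = contradiction j<M₀ ¬p

      spreadˡ : ∀ {c} → Colour c → ∀ {i j} → i < j → j < M₀ → PairSpread Kr w (W i) (W j) (c i j)
      spreadˡ {c} col {i} {j} i<j j<M₀ = regular-pairSpread {K = Kr} (W i) (W M₀) (W j) (c i j) (lenW M₀) (lenW j) 0<w (proj₁ (regular-pair col i<j j<M₀))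

      spreadʳ : ∀ {c} → Colour c → ∀ {i j} → i < j → j < M₀ → PairSpread Kr w (W j) (W i) (λ y x → c i j x y)
      spreadʳ {c} col {i} {j} i<j j<M₀ = regular-pairSpread {K = Kr} (W j) (W M₀) (W i) (λ y x → c i j x y) (lenW M₀) (lenW i) 0<w (proj₂ (regular-pair col i<j j<M₀))

      density : (ℕ → ℕ → V → V → Bool) → List ℕ → ℕ
      density c (i ∷ j ∷ []) = pairs₂ (W i) (W j) (c i j)
      density c _            = 0

      density≤ : ∀ c zs → density c zs ≤ w * w
      density≤ c []              = z≤n
      density≤ c (_ ∷ [])        = z≤n
      density≤ c (i ∷ j ∷ [])    = ≤-trans (∑₂-≤ (W i) (W j) (λ x y → 𝟙≤1 (c i j x y))) (≤-reflexive (cong₂ _*_ (lenW i) (trans (*-identityʳ _) (lenW j))))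
      density≤ c (_ ∷ _ ∷ _ ∷ _) = z≤n

      partition : ∀ i j → density colL (i ∷ j ∷ []) + density colR (i ∷ j ∷ []) + density colT (i ∷ j ∷ []) ≡ w * w
      partition i j = begin
        density colL (i ∷ j ∷ []) + density colR (i ∷ j ∷ []) + density colT (i ∷ j ∷ [])
          ≡⟨ sym (trans (∑₂-+ (W i) (W j) _ _) (cong (_+ density colT (i ∷ j ∷ [])) (∑₂-+ (W i) (W j) _ _))) ⟩
        (∑[ x ← W i ] ∑[ y ← W j ] 𝟙 (colL i j x y) + 𝟙 (colR i j x y) + 𝟙 (colT i j x y)) ≡⟨ ∑₂-cong (W i) (W j) (colours-partition i j) ⟩
        (∑[ x ← W i ] ∑[ y ← W j ] 1) ≡⟨ trans (∑-const (W i) _) (cong₂ _*_ (lenW i) (trans (∑-const (W j) 1) (trans (*-identityʳ _) (lenW j)))) ⟩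
        w * w ∎
        where open ≡-Reasoning

    -- The three colour densities in a triangle belong to three different pairs of blocks. They add
    -- up to one, as AM-GM requires, only if the density of a colour hardly depends on the pair;
    -- Ramsey's theorem for pairs is invoked for this.
    homogeneous-blocks : ∃[ e ] (∀ {i j} → i < j → j < M₁ → e i < e j × e j < M₀) ×
      (∀ {i j k} → i < j → j < k → k < M₁ → 54 * q * triples R (W (e i)) (W (e j)) (W (e k)) < (2 * q + 1) * (w * w * w))
    homogeneous-blocks = build (ramsey-nearlyConstant 2 M₁ κ (w * w) {{Data.Nat.>-nonZero (*-mono-≤ 0<w 0<w)}} (density colL ∷ density colR ∷ density colT ∷ []) (upTo M₀)
      (density≤ colL ∷ density≤ colR ∷ density≤ colT ∷ []) (≤-trans M₀-large (≤-reflexive (sym (length-upTo M₀)))))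
      where
      build : (∃[ ys ] ys ⊆ upTo M₀ × length ys ≡ M₁ × All (λ f → NearlyConstant 2 κ (w * w) f ys) (density colL ∷ density colR ∷ density colT ∷ [])) →
        ∃[ e ] (∀ {i j} → i < j → j < M₁ → e i < e j × e j < M₀) ×
        (∀ {i j k} → i < j → j < k → k < M₁ → 54 * q * triples R (W (e i)) (W (e j)) (W (e k)) < (2 * q + 1) * (w * w * w))
      build (ys , ys⊆ , len , (_ ∷ nearR ∷ nearT ∷ [])) = nth ys , (λ i<j j<M₁ → increasing i<j j<M₁ , bounded j<M₁) , few
        where
        pair : ∀ {i j} → i < j → j < M₁ → nth ys i ∷ nth ys j ∷ [] ⊆ ys
        pair {i} {j} i<j j<M₁ = nths-⊆ ys 0 (i ∷ j ∷ []) (z≤n , subst (i <_) (sym len) (<-trans i<j j<M₁) , i<j , subst (j <_) (sym len) j<M₁ , tt)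
        increasing : ∀ {i j} → i < j → j < M₁ → nth ys i < nth ys j
        increasing i<j j<M₁ = increasing-⊆-upTo (⊆-trans (pair i<j j<M₁) ys⊆)
        bounded : ∀ {j} → j < M₁ → nth ys j < M₀
        bounded {j} j<M₁ = bounded-⊆-upTo (⊆-trans (nths-⊆ ys 0 (j ∷ []) (z≤n , subst (j <_) (sym len) j<M₁ , tt)) ys⊆)
        few : ∀ {i j k} → i < j → j < k → k < M₁ → 54 * q * triples R (W (nth ys i)) (W (nth ys j)) (W (nth ys k)) < (2 * q + 1) * (w * w * w)
        few {i} {j} {k} i<j j<k k<M₁ = colour-arithmetic q κ Kr θ _ N (density colL (a ∷ b ∷ [])) (density colR (b ∷ c ∷ [])) (density colT (a ∷ c ∷ []))
            (density colR (a ∷ b ∷ [])) (density colT (a ∷ b ∷ [])) w 0<q κ≡ Kr≡ θ≡ (*-mono-≤ (*-mono-≤ 0<w 0<w) 0<w)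
            (few-exceptions noOverlap W w lenW dom a<b b<c c<M₀)
            (triangles-≤ Kr w (W a) (W b) (W c) (lenW a) (lenW b) (lenW c) 0<w (colL a b) (colR b c) (colT a c)
              (spreadˡ right b<c c<M₀) (spreadʳ right b<c c<M₀) (spreadʳ left a<b b<M₀))
            (nearR _ _ (pair j<k k<M₁) (pair i<j j<M₁) refl refl)
            (nearT _ _ (pair (<-trans i<j j<k) k<M₁) (pair i<j j<M₁) refl refl)
            (partition a b)
          where
          a = nth ys i
          b = nth ys j
          c = nth ys k
          j<M₁ : j < M₁
          j<M₁ = <-trans j<k k<M₁
          a<b : a < b
          a<b = increasing i<j j<M₁
          b<c : b < c
          b<c = increasing j<k k<M₁
          c<M₀ : c < M₀
          c<M₀ = bounded k<M₁
          b<M₀ : b < M₀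
          b<M₀ = <-trans b<c c<M₀
          N = ∑[ x ← W a ] ∑[ y ← W b ] ∑[ z ← W c ] 𝟙 (colL a b x y) * (𝟙 (colR b c y z) * 𝟙 (colT a c x z))

  -- It isolates what the density hypothesis has to provide. The bound `1 / 27 + 1 / (54 * q)`
  -- leaves half of the excess `1 / (27 * q)` for errors.
  Hereditary : Set
  Hereditary = ∀ (W : ℕ → List V) (w : ℕ) → 0 < w → (∀ k → length (W k) ≡ w) → (∀ k → Dominated F s w (W k) (B k)) →
    (e : ℕ → ℕ) → (∀ {i j} → i < j → j < M₁ → e i < e j × e j < M₀) →
    (∀ {i j k} → i < j → j < k → k < M₁ → 54 * q * triples R (W (e i)) (W (e j)) (W (e k)) < (2 * q + 1) * (w * w * w)) → ⊥

  overlaps : Hereditary → NoOverlap → ⊥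
  overlaps hereditary noOverlap = regularise-from Kr 1≤Kr tasks h 0 B s 0<s lenB z≤n fuel λ W w 0<w lenW dom reg →
    contradict W w 0<w lenW (λ k → subst (λ F → Dominated F s w (W k) (B k)) (sym F≡) (dom k)) reg
    where
    contradict : ∀ (W : ℕ → List V) (w : ℕ) → 0 < w → (∀ k → length (W k) ≡ w) → (∀ k → Dominated F s w (W k) (B k)) → (∀ {τ} → τ ∈ tasks → Regular Kr w W τ) → ⊥
    contradict W w 0<w lenW dom reg = finish (homogeneous-blocks (λ {p} {q} {r} {u} → noOverlap {p} {q} {r} {u}) W w 0<w lenW dom (λ {τ} → reg {τ}))
      where
      finish : ∃[ e ] (∀ {i j} → i < j → j < M₁ → e i < e j × e j < M₀) ×
        (∀ {i j k} → i < j → j < k → k < M₁ → 54 * q * triples R (W (e i)) (W (e j)) (W (e k)) < (2 * q + 1) * (w * w * w)) → ⊥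
      finish (e , e-inc , few) = hereditary W w 0<w lenW dom e (λ {i} {j} → e-inc {i} {j}) (λ {i} {j} {k} → few {i} {j} {k})

-- Edges of a 3-graph as sums over pairs and triples.

module _ {A : Set} where

  duo : (A → A → ℕ) → List A → ℕ
  duo f []       = 0
  duo f (x ∷ xs) = duo f xs + ∑ xs (f x)

  tri : (A → A → A → ℕ) → List A → ℕ
  tri f []       = 0
  tri f (x ∷ xs) = tri f xs + duo (f x) xs

  duo-mono : ∀ {f g} xs → (∀ x y → f x y ≤ g x y) → duo f xs ≤ duo g xs
  duo-mono []       h = z≤n
  duo-mono (x ∷ xs) h = +-mono-≤ (duo-mono xs h) (∑-mono xs (h x))

  tri-mono : ∀ {f g} xs → (∀ x y z → f x y z ≤ g x y z) → tri f xs ≤ tri g xs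
  tri-mono []       h = z≤n
  tri-mono (x ∷ xs) h = +-mono-≤ (tri-mono xs h) (duo-mono xs (h x))

  duo-cong : ∀ {f g} xs → (∀ x y → f x y ≡ g x y) → duo f xs ≡ duo g xs
  duo-cong []       h = refl
  duo-cong (x ∷ xs) h = cong₂ _+_ (duo-cong xs h) (∑-cong xs (h x))

  tri-cong : ∀ {f g} xs → (∀ x y z → f x y z ≡ g x y z) → tri f xs ≡ tri g xs
  tri-cong []       h = refl
  tri-cong (x ∷ xs) h = cong₂ _+_ (tri-cong xs h) (duo-cong xs (h x))

  duo-* : ∀ c f xs → duo (λ x y → c * f x y) xs ≡ c * duo f xs
  duo-* c f []       = sym (*-zeroʳ c)
  duo-* c f (x ∷ xs) = trans (cong₂ _+_ (duo-* c f xs) (∑-* c xs (f x))) (sym (*-distribˡ-+ c _ _))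

  tri-* : ∀ c f xs → tri (λ x y z → c * f x y z) xs ≡ c * tri f xs
  tri-* c f []       = sym (*-zeroʳ c)
  tri-* c f (x ∷ xs) = trans (cong₂ _+_ (tri-* c f xs) (duo-* c (f x) xs)) (sym (*-distribˡ-+ c _ _))

  ∑₂≡2duo : ∀ f xs → (∀ x y → f x y ≡ f y x) → (∀ x → f x x ≡ 0) → (∑[ x ← xs ] ∑[ y ← xs ] f x y) ≡ 2 * duo f xs
  ∑₂≡2duo f []       sy dg = refl
  ∑₂≡2duo f (x ∷ xs) sy dg = begin
    f x x + s + (∑[ y ← xs ] f y x + ∑ xs (f y)) ≡⟨ cong (f x x + s +_) (∑-+ xs _ _) ⟩
    f x x + s + ((∑[ y ← xs ] f y x) + (∑[ y ← xs ] ∑ xs (f y)))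
      ≡⟨ cong₂ (λ d t → d + s + t) (dg x) (cong₂ _+_ (∑-cong xs (λ y → sy y x)) (∑₂≡2duo f xs sy dg)) ⟩
    s + (s + 2 * duo f xs) ≡⟨ e s (duo f xs) ⟩
    2 * (duo f xs + s) ∎
    where
    open ≡-Reasoning
    s = ∑ xs (f x)
    e : ∀ s d → s + (s + 2 * d) ≡ 2 * (d + s)
    e = solve-∀

  ∑₃≡6tri : ∀ f xs → (∀ x y z → f x y z ≡ f y x z) → (∀ x y z → f x y z ≡ f x z y) → (∀ x z → f x x z ≡ 0) →
    (∑[ x ← xs ] ∑[ y ← xs ] ∑[ z ← xs ] f x y z) ≡ 6 * tri f xs
  ∑₃≡6tri f []       s₁ s₂ dg = refl
  ∑₃≡6tri f (x ∷ xs) s₁ s₂ dg = begin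
    (∑[ y ← x ∷ xs ] ∑[ z ← x ∷ xs ] f x y z) + (∑[ y ← xs ] (∑ (x ∷ xs) (f y x) + (∑[ z ← xs ] ∑ (x ∷ xs) (f y z))))
      ≡⟨ cong₂ _+_ head (trans (∑-+ xs _ _) (cong₂ _+_ middle (trans (∑-cong xs (λ y → ∑-+ xs _ _)) (∑-+ xs _ _)))) ⟩
    D + (D + ((∑[ y ← xs ] ∑[ z ← xs ] f y z x) + (∑[ y ← xs ] ∑[ z ← xs ] ∑ xs (f y z))))
      ≡⟨ cong (λ t → D + (D + t)) (cong₂ _+_ (∑₂-cong xs xs (λ y z → trans (s₂ y z x) (s₁ y x z))) (∑₃≡6tri f xs s₁ s₂ dg)) ⟩
    D + (D + (D + 6 * tri f xs)) ≡⟨ cong (λ D → D + (D + (D + 6 * tri f xs))) (∑₂≡2duo (f x) xs (s₂ x) (diag′ x)) ⟩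
    2 * duo (f x) xs + (2 * duo (f x) xs + (2 * duo (f x) xs + 6 * tri f xs)) ≡⟨ e (duo (f x) xs) (tri f xs) ⟩
    6 * (tri f xs + duo (f x) xs) ∎
    where
    open ≡-Reasoning
    D = ∑[ y ← xs ] ∑[ z ← xs ] f x y z
    diag′ : ∀ x y → f x y y ≡ 0
    diag′ x y = trans (s₁ x y y) (trans (s₂ y x y) (dg y x))
    row : ∀ y → ∑ (x ∷ xs) (f x y) ≡ ∑ xs (f x y)
    row y = cong (_+ ∑ xs (f x y)) (trans (s₂ x y x) (dg x y))
    head : (∑[ y ← x ∷ xs ] ∑ (x ∷ xs) (f x y)) ≡ D
    head = cong₂ _+_ (trans (row x) (trans (∑-cong xs (λ z → dg x z)) (∑-zero xs))) (∑-cong xs row)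
    middle : (∑[ y ← xs ] ∑ (x ∷ xs) (f y x)) ≡ D
    middle = ∑-cong xs (λ y → trans (∑-cong (x ∷ xs) (λ z → s₁ y x z)) (row y))
    e : ∀ d t → 2 * d + (2 * d + (2 * d + 6 * t)) ≡ 6 * (t + d)
    e = solve-∀

duo-map : {A B : Set} (h : A → B) (f : B → B → ℕ) (xs : List A) → duo f (map h xs) ≡ duo (λ x y → f (h x) (h y)) xs
duo-map h f []       = refl
duo-map h f (x ∷ xs) = cong₂ _+_ (duo-map h f xs) (∑-map h xs (f (h x)))

tri-map : {A B : Set} (h : A → B) (f : B → B → B → ℕ) (xs : List A) → tri f (map h xs) ≡ tri (λ x y z → f (h x) (h y) (h z)) xs
tri-map h f []       = refl
tri-map h f (x ∷ xs) = cong₂ _+_ (tri-map h f xs) (duo-map h (f (h x)) xs)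

duo-1 : {A : Set} (xs : List A) → duo (λ _ _ → 1) xs ≡ length xs choose 2
duo-1 []       = refl
duo-1 (x ∷ xs) = begin
  duo (λ _ _ → 1) xs + (∑[ y ← xs ] 1) ≡⟨ cong₂ _+_ (duo-1 xs) (trans (∑-const xs 1) (trans (*-identityʳ _) (sym (nC1≡n (length xs))))) ⟩
  length xs choose 2 + length xs choose 1        ≡⟨ +-comm (length xs choose 2) _ ⟩
  length xs choose 1 + length xs choose 2        ≡⟨ nCk+nC[k+1]≡[n+1]C[k+1] (length xs) 1 ⟩
  suc (length xs) choose 2                  ∎
  where open ≡-Reasoning

tri-1 : {A : Set} (xs : List A) → tri (λ _ _ _ → 1) xs ≡ length xs choose 3
tri-1 []       = refl
tri-1 (x ∷ xs) = begin
  tri (λ _ _ _ → 1) xs + duo (λ _ _ → 1) xs ≡⟨ cong₂ _+_ (tri-1 xs) (duo-1 xs) ⟩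
  length xs choose 3 + length xs choose 2             ≡⟨ +-comm (length xs choose 3) _ ⟩
  length xs choose 2 + length xs choose 3             ≡⟨ nCk+nC[k+1]≡[n+1]C[k+1] (length xs) 2 ⟩
  suc (length xs) choose 3                       ∎
  where open ≡-Reasoning

elements : ∀ {n} → Subset n → List (Fin n)
elements Vec.[]            = []
elements (inside Vec.∷ X)  = zero ∷ map suc (elements X)
elements (outside Vec.∷ X) = map suc (elements X)

length-elements : ∀ {n} (X : Subset n) → length (elements X) ≡ card X
length-elements Vec.[]            = refl
length-elements (inside Vec.∷ X)  = cong suc (trans (length-map suc (elements X)) (length-elements X))
length-elements (outside Vec.∷ X) = trans (length-map suc (elements X)) (length-elements X)

length-filter : {A : Set} {P : A → Set} (P? : Decidable P) (xs : List A) → length (filter P? xs) ≡ ∑[ x ← xs ] 𝟙 (does (P? x))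
length-filter P? []       = refl
length-filter P? (x ∷ xs) with does (P? x)
... | true  = cong suc (length-filter P? xs)
... | false = length-filter P? xs

∑-filter : {A : Set} {P : A → Set} (P? : Decidable P) (xs : List A) (f : A → ℕ) → ∑ (filter P? xs) f ≡ ∑[ x ← xs ] 𝟙 (does (P? x)) * f x
∑-filter P? []       f = refl
∑-filter P? (x ∷ xs) f with does (P? x)
... | true  = cong₂ _+_ (sym (+-identityʳ (f x))) (∑-filter P? xs f)
... | false = ∑-filter P? xs f

subsetSum : ∀ {n} → ℕ → Subset n → (Subset n → ℕ) → ℕ
subsetSum {n} k W h = ∑[ S ← allSubsets n ] 𝟙 (does ((S ⊆? W) ×-dec (card S ≟ k))) * h S

module _ {n : ℕ} where

  private
    split : ∀ (φ : Subset (suc n) → ℕ) → ∑ (allSubsets (suc n)) φ ≡ ∑ (allSubsets n) (λ S → φ (outside Vec.∷ S)) + ∑ (allSubsets n) (λ S → φ (inside Vec.∷ S))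
    split φ = trans (∑-++ (map (outside Vec.∷_) (allSubsets n)) _ φ) (cong₂ _+_ (∑-map (outside Vec.∷_) (allSubsets n) φ) (∑-map (inside Vec.∷_) (allSubsets n) φ))

  subsetSum-outside : ∀ k (W : Subset n) h → subsetSum k (outside Vec.∷ W) h ≡ subsetSum k W (λ S → h (outside Vec.∷ S))
  subsetSum-outside k W h = trans (split _) (trans (cong (subsetSum k W (λ S → h (outside Vec.∷ S)) +_) (∑-zero (allSubsets n))) (+-identityʳ _))

  subsetSum-inside : ∀ k (W : Subset n) h → subsetSum (suc k) (inside Vec.∷ W) h ≡ subsetSum (suc k) W (λ S → h (outside Vec.∷ S)) + subsetSum k W (λ S → h (inside Vec.∷ S))
  subsetSum-inside k W h = split _

  subsetSum-inside-0 : ∀ (W : Subset n) h → subsetSum 0 (inside Vec.∷ W) h ≡ subsetSum 0 W (λ S → h (outside Vec.∷ S))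
  subsetSum-inside-0 W h = trans (split _) (trans (cong (subsetSum 0 W (λ S → h (outside Vec.∷ S)) +_)
    (trans (∑-cong (allSubsets n) (λ S → cong (λ b → 𝟙 b * h (inside Vec.∷ S)) (∧-zeroʳ (does (S ⊆? W))))) (∑-zero (allSubsets n)))) (+-identityʳ _))

subsetSum-0 : ∀ {n} (W : Subset n) h → subsetSum 0 W h ≡ h ∅
subsetSum-0 Vec.[]            h = trans (+-identityʳ _) (+-identityʳ _)
subsetSum-0 (inside Vec.∷ W)  h = trans (subsetSum-inside-0 W h) (subsetSum-0 W _)
subsetSum-0 (outside Vec.∷ W) h = trans (subsetSum-outside 0 W h) (subsetSum-0 W _)

subsetSum-1 : ∀ {n} (W : Subset n) h → subsetSum 1 W h ≡ ∑[ z ← elements W ] h ⁅ z ⁆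
subsetSum-1 Vec.[]            h = refl
subsetSum-1 (inside Vec.∷ W)  h = trans (subsetSum-inside 0 W h) (trans (cong₂ _+_ (subsetSum-1 W _) (subsetSum-0 W _))
  (trans (+-comm _ (h (inside Vec.∷ ∅))) (cong (h (inside Vec.∷ ∅) +_) (sym (∑-map suc (elements W) _)))))
subsetSum-1 (outside Vec.∷ W) h = trans (subsetSum-outside 1 W h) (trans (subsetSum-1 W _) (sym (∑-map suc (elements W) _)))

subsetSum-2 : ∀ {n} (W : Subset n) h → subsetSum 2 W h ≡ duo (λ y z → h (⁅ y ⁆ ∪ ⁅ z ⁆)) (elements W)
subsetSum-2 Vec.[]            h = refl
subsetSum-2 (inside Vec.∷ W)  h = trans (subsetSum-inside 1 W h) (cong₂ _+_ (trans (subsetSum-2 W _) (sym (duo-map suc _ (elements W))))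
  (trans (subsetSum-1 W _) (trans (∑-cong (elements W) (λ z → cong (λ S → h (inside Vec.∷ S)) (sym (∪-identityˡ ⁅ z ⁆)))) (sym (∑-map suc (elements W) _)))))
subsetSum-2 (outside Vec.∷ W) h = trans (subsetSum-outside 2 W h) (trans (subsetSum-2 W _) (sym (duo-map suc _ (elements W))))

subsetSum-3 : ∀ {n} (W : Subset n) h → subsetSum 3 W h ≡ tri (λ x y z → h (triple x y z)) (elements W)
subsetSum-3 Vec.[]            h = refl
subsetSum-3 (inside Vec.∷ W)  h = trans (subsetSum-inside 2 W h) (cong₂ _+_ (trans (subsetSum-3 W _) (sym (tri-map suc _ (elements W))))
  (trans (subsetSum-2 W _) (trans (duo-cong (elements W) (λ y z → cong (λ S → h (inside Vec.∷ S)) (sym (∪-identityˡ (⁅ y ⁆ ∪ ⁅ z ⁆))))) (sym (duo-map suc _ (elements W))))))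
subsetSum-3 (outside Vec.∷ W) h = trans (subsetSum-outside 3 W h) (trans (subsetSum-3 W _) (sym (tri-map suc _ (elements W))))

-- The test of cardinality makes triples with a repeated vertex non-edges, whatever `G` says about
-- smaller sets.
edge : ∀ {n} → ThreeGraph n → Fin n → Fin n → Fin n → Bool
edge G x y z = G (triple x y z) ∧ does (card (triple x y z) ≟ 3)

edgesIn≡tri : ∀ {n} (G : ThreeGraph n) (W : Subset n) → edgesIn G W ≡ tri (λ x y z → 𝟙 (edge G x y z)) (elements W)
edgesIn≡tri {n} G W = begin
  edgesIn G W
    ≡⟨ length-filter (λ S → (S ⊆? W) ×-dec (card S ≟ 3)) (filter (λ S → G S Data.Bool.≟ true) (allSubsets n)) ⟩
  (∑[ S ← filter (λ S → G S Data.Bool.≟ true) (allSubsets n) ] 𝟙 (does ((S ⊆? W) ×-dec (card S ≟ 3))))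
    ≡⟨ ∑-filter (λ S → G S Data.Bool.≟ true) (allSubsets n) _ ⟩
  (∑[ S ← allSubsets n ] 𝟙 (does (G S Data.Bool.≟ true)) * 𝟙 (does ((S ⊆? W) ×-dec (card S ≟ 3))))
    ≡⟨ ∑-cong (allSubsets n) (λ S → regroup (G S) (does (S ⊆? W)) (does (card S ≟ 3))) ⟩
  subsetSum 3 W (λ S → 𝟙 (G S ∧ does (card S ≟ 3)))
    ≡⟨ subsetSum-3 W _ ⟩
  tri (λ x y z → 𝟙 (edge G x y z)) (elements W) ∎
  where
  open ≡-Reasoning
  regroup : ∀ g s c → 𝟙 (does (g Data.Bool.≟ true)) * 𝟙 (s ∧ c) ≡ 𝟙 (s ∧ c) * 𝟙 (g ∧ c)
  regroup true  true  true  = refl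
  regroup true  true  false = refl
  regroup true  false c     = refl
  regroup false true  true  = refl
  regroup false true  false = refl
  regroup false false c     = refl

card-∪ : ∀ {n} (p q : Subset n) → card (p ∪ q) ≤ card p + card q
card-∪ Vec.[]            Vec.[]            = z≤n
card-∪ (inside Vec.∷ p)  (inside Vec.∷ q)  = s≤s (≤-trans (card-∪ p q) (+-monoʳ-≤ (card p) (n≤1+n (card q))))
card-∪ (inside Vec.∷ p)  (outside Vec.∷ q) = s≤s (card-∪ p q)
card-∪ (outside Vec.∷ p) (inside Vec.∷ q)  = ≤-trans (s≤s (card-∪ p q)) (≤-reflexive (sym (+-suc (card p) (card q))))
card-∪ (outside Vec.∷ p) (outside Vec.∷ q) = card-∪ p q

module _ {n : ℕ} where

  triple-swapˡ : ∀ (x y z : Fin n) → triple x y z ≡ triple y x z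
  triple-swapˡ x y z = trans (sym (∪-assoc ⁅ x ⁆ ⁅ y ⁆ ⁅ z ⁆)) (trans (cong (_∪ ⁅ z ⁆) (∪-comm ⁅ x ⁆ ⁅ y ⁆)) (∪-assoc ⁅ y ⁆ ⁅ x ⁆ ⁅ z ⁆))

  triple-swapʳ : ∀ (x y z : Fin n) → triple x y z ≡ triple x z y
  triple-swapʳ x y z = cong (⁅ x ⁆ ∪_) (∪-comm ⁅ y ⁆ ⁅ z ⁆)

  triple-diagonal : ∀ (x z : Fin n) → card (triple x x z) ≤ 2
  triple-diagonal x z = begin
    card (triple x x z)             ≡⟨ cong card (sym (∪-assoc ⁅ x ⁆ ⁅ x ⁆ ⁅ z ⁆)) ⟩
    card ((⁅ x ⁆ ∪ ⁅ x ⁆) ∪ ⁅ z ⁆)    ≡⟨ cong (λ s → card (s ∪ ⁅ z ⁆)) (∪-idem ⁅ x ⁆) ⟩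
    card (⁅ x ⁆ ∪ ⁅ z ⁆)             ≤⟨ card-∪ ⁅ x ⁆ ⁅ z ⁆ ⟩
    card ⁅ x ⁆ + card ⁅ z ⁆          ≡⟨ cong₂ _+_ (∣⁅x⁆∣≡1 x) (∣⁅x⁆∣≡1 z) ⟩
    2                               ∎
    where open ≤-Reasoning

  module _ (G : ThreeGraph n) where

    edge-swapˡ : ∀ x y z → edge G x y z ≡ edge G y x z
    edge-swapˡ x y z = cong (λ S → G S ∧ does (card S ≟ 3)) (triple-swapˡ x y z)

    edge-swapʳ : ∀ x y z → edge G x y z ≡ edge G x z y
    edge-swapʳ x y z = cong (λ S → G S ∧ does (card S ≟ 3)) (triple-swapʳ x y z)

    edge-rotate : ∀ x y z → edge G x y z ≡ edge G y z x
    edge-rotate x y z = trans (edge-swapˡ x y z) (edge-swapʳ y x z)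

    edge⇒IsEdge : ∀ x y z → edge G x y z ≡ true → IsEdge G (triple x y z)
    edge⇒IsEdge x y z = both (G (triple x y z)) (card (triple x y z) ≟ 3)
      where
      both : ∀ {P : Set} b (p? : Dec P) → b ∧ does p? ≡ true → P × b ≡ true
      both true (yes p) _ = p , refl

    edge-diagonal : ∀ x z → edge G x x z ≡ false
    edge-diagonal x z with edge G x x z in eq
    ... | false = refl
    ... | true  = contradiction (proj₁ (edge⇒IsEdge x x z eq)) (<⇒≢ (s≤s (triple-diagonal x z)))

-- Weighted triples and the passage from sets to measures.

module Weighted {V : Set} where

  private
    P = ℕ × V

  -- The contribution of an element `p` standing between `pre` and `post`. For the kernel `weigh` it
  -- is linear in the weight of `p`, since no position is used twice.
  δduo : (P → P → ℕ) → List P → P → List P → ℕ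
  δduo k []        p post = ∑ post (k p)
  δduo k (r ∷ pre) p post = δduo k pre p post + k r p

  δtri : (P → P → P → ℕ) → List P → P → List P → ℕ
  δtri k []        p post = duo (k p) post
  δtri k (r ∷ pre) p post = δtri k pre p post + δduo (k r) pre p post

  private
    e₁ : ∀ a b c d → a + b + (c + d) ≡ a + c + (b + d)
    e₁ = solve-∀

  ∑-insert : ∀ (φ : P → ℕ) pre p post → ∑ (pre ++ p ∷ post) φ ≡ ∑ (pre ++ post) φ + φ p
  ∑-insert φ []        p post = +-comm (φ p) _
  ∑-insert φ (r ∷ pre) p post = trans (cong (φ r +_) (∑-insert φ pre p post)) (sym (+-assoc (φ r) _ _))

  duo-insert : ∀ k pre p post → duo k (pre ++ p ∷ post) ≡ duo k (pre ++ post) + δduo k pre p post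
  duo-insert k []        p post = refl
  duo-insert k (r ∷ pre) p post = trans (cong₂ _+_ (duo-insert k pre p post) (∑-insert (k r) pre p post))
    (e₁ (duo k (pre ++ post)) (δduo k pre p post) _ (k r p))

  tri-insert : ∀ k pre p post → tri k (pre ++ p ∷ post) ≡ tri k (pre ++ post) + δtri k pre p post
  tri-insert k []        p post = refl
  tri-insert k (r ∷ pre) p post = trans (cong₂ _+_ (tri-insert k pre p post) (duo-insert (k r) pre p post))
    (e₁ (tri k (pre ++ post)) (δtri k pre p post) _ (δduo (k r) pre p post))

  weigh : (V → V → V → ℕ) → P → P → P → ℕ
  weigh f (a , x) (b , y) (c , z) = a * (b * (c * f x y z))

  private
    e₂ : ∀ a b c f → a * (b * (c * f)) ≡ c * (a * (b * (1 * f)))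
    e₂ = solve-∀
    e₃ : ∀ a c d f → a * (c * (d * f)) ≡ c * (a * (1 * (d * f)))
    e₃ = solve-∀
    e₄ : ∀ c b d f → c * (b * (d * f)) ≡ c * (1 * (b * (d * f)))
    e₄ = solve-∀

  δduo-affine : ∀ f r pre c x post → δduo (weigh f r) pre (c , x) post ≡ c * δduo (weigh f r) pre (1 , x) post
  δduo-affine f (a , y) []              c x post = trans (∑-cong post (λ { (d , z) → e₃ a c d (f y x z) })) (∑-* c post _)
  δduo-affine f (a , y) ((b , z) ∷ pre) c x post = trans (cong₂ _+_ (δduo-affine f (a , y) pre c x post) (e₂ a b c (f y z x))) (sym (*-distribˡ-+ c _ _))

  δtri-affine : ∀ f pre c x post → δtri (weigh f) pre (c , x) post ≡ c * δtri (weigh f) pre (1 , x) post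
  δtri-affine f []        c x post = trans (duo-cong post (λ { (b , y) (d , z) → e₄ c b d (f x y z) })) (duo-* c _ post)
  δtri-affine f (r ∷ pre) c x post = trans (cong₂ _+_ (δtri-affine f pre c x post) (δduo-affine f r pre c x post)) (sym (*-distribˡ-+ c _ _))

  tri-affine : ∀ f pre c x post → tri (weigh f) (pre ++ (c , x) ∷ post) ≡ tri (weigh f) (pre ++ post) + c * δtri (weigh f) pre (1 , x) post
  tri-affine f pre c x post = trans (tri-insert (weigh f) pre (c , x) post) (cong (tri (weigh f) (pre ++ post) +_) (δtri-affine f pre c x post))

  module _ (f g : V → V → V → ℕ) (c₁ c₂ err A : ℕ) (0<A : 0 < A) where

    Good : List P → Set
    Good l = c₁ * tri (weigh g) l ≤ c₂ * tri (weigh f) l + err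

    -- An inequality between affine functions need only be checked at the end points.
    good-between : ∀ pre c x post → c ≤ A → Good (pre ++ post) → Good (pre ++ (A , x) ∷ post) → Good (pre ++ (c , x) ∷ post)
    good-between pre c x post c≤A h₀ hA = cancel-* A 0<A (begin
      A * (c₁ * tri (weigh g) (pre ++ (c , x) ∷ post)) ≡⟨ cong (λ t → A * (c₁ * t)) (tri-affine g pre c x post) ⟩
      A * (c₁ * (α + c * β))                           ≡⟨ cong (_* (c₁ * (α + c * β))) (sym A≡) ⟩
      (c + d) * (c₁ * (α + c * β))                     ≡⟨ d₁ c d c₁ α β ⟩
      d * (c₁ * α) + c * (c₁ * (α + (c + d) * β))      ≡⟨ cong (λ t → d * (c₁ * α) + c * (c₁ * (α + t * β))) A≡ ⟩
      d * (c₁ * α) + c * (c₁ * (α + A * β))            ≡⟨ cong (λ t → d * (c₁ * α) + c * (c₁ * t)) (sym (tri-affine g pre A x post)) ⟩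
      d * (c₁ * α) + c * (c₁ * tri (weigh g) (pre ++ (A , x) ∷ post)) ≤⟨ +-mono-≤ (*-monoʳ-≤ d h₀) (*-monoʳ-≤ c hA) ⟩
      d * (c₂ * α′ + err) + c * (c₂ * tri (weigh f) (pre ++ (A , x) ∷ post) + err)
        ≡⟨ cong (λ t → d * (c₂ * α′ + err) + c * (c₂ * t + err)) (tri-affine f pre A x post) ⟩
      d * (c₂ * α′ + err) + c * (c₂ * (α′ + A * β′) + err) ≡⟨ cong (λ t → d * (c₂ * α′ + err) + c * (c₂ * (α′ + t * β′) + err)) (sym A≡) ⟩
      d * (c₂ * α′ + err) + c * (c₂ * (α′ + (c + d) * β′) + err) ≡⟨ d₂ c d c₂ α′ β′ err ⟩
      (c + d) * (c₂ * (α′ + c * β′) + err)             ≡⟨ cong₂ (λ s t → s * (c₂ * t + err)) A≡ (sym (tri-affine f pre c x post)) ⟩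
      A * (c₂ * tri (weigh f) (pre ++ (c , x) ∷ post) + err) ∎)
      where
      open ≤-Reasoning
      d = A ∸ c
      A≡ : c + d ≡ A
      A≡ = m+[n∸m]≡n c≤A
      α = tri (weigh g) (pre ++ post)
      β = δtri (weigh g) pre (1 , x) post
      α′ = tri (weigh f) (pre ++ post)
      β′ = δtri (weigh f) pre (1 , x) post
      d₁ : ∀ c d k α β → (c + d) * (k * (α + c * β)) ≡ d * (k * α) + c * (k * (α + (c + d) * β))
      d₁ = solve-∀
      d₂ : ∀ c d k α β e → d * (k * α + e) + c * (k * (α + (c + d) * β) + e) ≡ (c + d) * (k * (α + c * β) + e)
      d₂ = solve-∀

vertices : ∀ n → List (Fin n)
vertices zero    = []
vertices (suc n) = zero ∷ map suc (vertices n)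

module _ {V : Set} where
  open Weighted {V}

  -- The weights are moved to an end point one vertex at a time. Weight 0 amounts to absence from
  -- the list, so the extreme weightings are the lists of elements of sets.
  good-extreme : ∀ (f g : V → V → V → ℕ) c₁ c₂ err A (0<A : 0 < A) n (ι : Fin n → V) (a : Fin n → ℕ) → (∀ i → a i ≤ A) → ∀ pre →
    (∀ (X : Subset n) → Good f g c₁ c₂ err A 0<A (pre ++ map (λ i → A , ι i) (elements X))) →
    Good f g c₁ c₂ err A 0<A (pre ++ map (λ i → a i , ι i) (vertices n))
  good-extreme f g c₁ c₂ err A 0<A zero    ι a a≤A pre h = h Vec.[]
  good-extreme f g c₁ c₂ err A 0<A (suc n) ι a a≤A pre h =
    good-between f g c₁ c₂ err A 0<A pre (a zero) (ι zero) _ (a≤A zero)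
      (subst G (cong (pre ++_) (tail a)) (good-extreme f g c₁ c₂ err A 0<A n (ι ∘ suc) (a ∘ suc) (a≤A ∘ suc) pre
        (λ X → subst G (cong (pre ++_) (sym (shift X))) (h (outside Vec.∷ X)))))
      (subst G (trans (++-assoc pre _ _) (cong (λ l → pre ++ (A , ι zero) ∷ l) (tail a)))
        (good-extreme f g c₁ c₂ err A 0<A n (ι ∘ suc) (a ∘ suc) (a≤A ∘ suc) (pre ++ (A , ι zero) ∷ [])
          (λ X → subst G (trans (cong (λ l → pre ++ (A , ι zero) ∷ l) (sym (shift X))) (sym (++-assoc pre _ _))) (h (inside Vec.∷ X)))))
    where
    G = Good f g c₁ c₂ err A 0<A
    tail : ∀ (a : Fin (suc n) → ℕ) → map (λ i → a (suc i) , ι (suc i)) (vertices n) ≡ map (λ i → a i , ι i) (map suc (vertices n))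
    tail a = map-∘ (vertices n)
    shift : ∀ X → map (λ i → A , ι (suc i)) (elements X) ≡ map (λ i → A , ι i) (map suc (elements X))
    shift X = map-∘ (elements X)

equal distinct : ∀ {n} → Fin n → Fin n → Bool
equal x y = does (x Fin.≟ y)
distinct x y = not (equal x y)

count : ∀ {n} → List (Fin n) → Fin n → ℕ
count Y v = ∑[ y ← Y ] 𝟙 (equal v y)

∑-vertices-equal : ∀ {n} (y : Fin n) (φ : Fin n → ℕ) → (∑[ v ← vertices n ] 𝟙 (equal v y) * φ v) ≡ φ y
∑-vertices-equal {suc n} zero    φ = trans (cong (φ zero + 0 +_) (trans (∑-map suc (vertices n) _) (∑-zero (vertices n)))) (trans (+-identityʳ _) (+-identityʳ _))
∑-vertices-equal {suc n} (suc y) φ = trans (∑-map suc (vertices n) _) (∑-vertices-equal y (φ ∘ suc))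

∑-count : ∀ {n} (Y : List (Fin n)) (φ : Fin n → ℕ) → (∑[ v ← vertices n ] count Y v * φ v) ≡ ∑ Y φ
∑-count {n} Y φ = begin
  (∑[ v ← vertices n ] count Y v * φ v)                     ≡⟨ ∑-cong (vertices n) (λ v → sym (∑-*ʳ (φ v) Y _)) ⟩
  (∑[ v ← vertices n ] ∑[ y ← Y ] 𝟙 (equal v y) * φ v)      ≡⟨ ∑-swap (vertices n) Y _ ⟩
  (∑[ y ← Y ] ∑[ v ← vertices n ] 𝟙 (equal v y) * φ v)      ≡⟨ ∑-cong Y (λ y → ∑-vertices-equal y φ) ⟩
  ∑ Y φ                                                     ∎
  where open ≡-Reasoning

equal-refl : ∀ {n} (x : Fin n) → equal x x ≡ true
equal-refl x with x Fin.≟ x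
... | yes _   = refl
... | no x≢x  = contradiction refl x≢x

equal-sym : ∀ {n} (x y : Fin n) → equal x y ≡ equal y x
equal-sym x y with x Fin.≟ y | y Fin.≟ x
... | yes _   | yes _   = refl
... | no _    | no _    = refl
... | yes x≡y | no y≢x  = contradiction (sym x≡y) y≢x
... | no x≢y  | yes y≡x = contradiction (sym y≡x) x≢y

-- Triples with a repeated vertex are left out because they would bring in squares of weights and
-- destroy affinity.
distinct₃ : ∀ {n} → Fin n → Fin n → Fin n → ℕ
distinct₃ x y z = 𝟙 (distinct x y) * (𝟙 (distinct y z) * 𝟙 (distinct x z))

-- Density passes from sets to measures: both counts are multi-affine in the weights, so weights
-- in {0, A}, that is sets, are the extreme case.
module _ {n : ℕ} (G : ThreeGraph n) (c₁ c₂ err : ℕ) (dense : ∀ X → c₁ * (card X choose 3) ≤ c₂ * edgesIn G X + err) where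

  private
    f : Fin n → Fin n → Fin n → ℕ
    f x y z = 𝟙 (edge G x y z)

  open Weighted {Fin n}

  weighted-density : ∀ A → 0 < A → (a : Fin n → ℕ) → (∀ v → a v ≤ A) →
    c₁ * (∑[ x ← vertices n ] ∑[ y ← vertices n ] ∑[ z ← vertices n ] a x * (a y * (a z * distinct₃ x y z))) ≤
    c₂ * (∑[ x ← vertices n ] ∑[ y ← vertices n ] ∑[ z ← vertices n ] a x * (a y * (a z * f x y z))) + 6 * (A * A * A * err)
  weighted-density A 0<A a a≤A = begin
    c₁ * ∑³ distinct₃              ≡⟨ cong (c₁ *_) (six distinct₃ distinct-swapˡ distinct-swapʳ distinct-diagonal) ⟩
    c₁ * (6 * tri (weigh distinct₃) L) ≡⟨ x∙yz≈y∙xz c₁ 6 _ ⟩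
    6 * (c₁ * tri (weigh distinct₃) L) ≤⟨ *-monoʳ-≤ 6 (good-extreme f distinct₃ c₁ c₂ (A * A * A * err) A 0<A n id a a≤A [] sets) ⟩
    6 * (c₂ * tri (weigh f) L + A * A * A * err) ≡⟨ trans (*-distribˡ-+ 6 (c₂ * tri (weigh f) L) _) (cong (_+ 6 * (A * A * A * err)) (x∙yz≈y∙xz 6 c₂ _)) ⟩
    c₂ * (6 * tri (weigh f) L) + 6 * (A * A * A * err)
      ≡⟨ cong (λ t → c₂ * t + 6 * (A * A * A * err)) (sym (six f (λ x y z → cong 𝟙 (edge-swapˡ G x y z)) (λ x y z → cong 𝟙 (edge-swapʳ G x y z)) (λ x z → cong 𝟙 (edge-diagonal G x z)))) ⟩
    c₂ * ∑³ f + 6 * (A * A * A * err) ∎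
    where
    open ≤-Reasoning
    vs = vertices n
    L : List (ℕ × Fin n)
    L = map (λ v → a v , v) vs
    ∑³ : (Fin n → Fin n → Fin n → ℕ) → ℕ
    ∑³ h = ∑[ x ← vs ] ∑[ y ← vs ] ∑[ z ← vs ] a x * (a y * (a z * h x y z))
    x∙yz≈y∙xz : ∀ x y z → x * (y * z) ≡ y * (x * z)
    x∙yz≈y∙xz = solve-∀
    zero₃ : ∀ a b c → a * (b * (c * 0)) ≡ 0
    zero₃ = solve-∀
    distinct-swapˡ : ∀ x y z → distinct₃ x y z ≡ distinct₃ y x z
    distinct-swapˡ x y z = cong₂ _*_ (cong (λ b → 𝟙 (not b)) (equal-sym x y)) (*-comm (𝟙 (distinct y z)) _)
    distinct-swapʳ : ∀ x y z → distinct₃ x y z ≡ distinct₃ x z y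
    distinct-swapʳ x y z = trans (e (𝟙 (distinct x y)) (𝟙 (distinct y z)) (𝟙 (distinct x z))) (cong (λ b → 𝟙 (distinct x z) * (𝟙 (not b) * 𝟙 (distinct x y))) (equal-sym y z))
      where
      e : ∀ a b c → a * (b * c) ≡ c * (b * a)
      e = solve-∀
    distinct-diagonal : ∀ x z → distinct₃ x x z ≡ 0
    distinct-diagonal x z = cong (λ b → 𝟙 (not b) * (𝟙 (distinct x z) * 𝟙 (distinct x z))) (equal-refl x)
    six : ∀ h → (∀ x y z → h x y z ≡ h y x z) → (∀ x y z → h x y z ≡ h x z y) → (∀ x z → h x x z ≡ 0) → ∑³ h ≡ 6 * tri (weigh h) L
    six h s₁ s₂ dg = trans flat (∑₃≡6tri (weigh h) L
      (λ { (a , x) (b , y) (c , z) → trans (cong (λ t → a * (b * (c * t))) (s₁ x y z)) (x∙yz≈y∙xz a b _) })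
      (λ { (a , x) (b , y) (c , z) → cong (a *_) (trans (cong (λ t → b * (c * t)) (s₂ x y z)) (x∙yz≈y∙xz b c _)) })
      (λ { (a , x) (c , z) → trans (cong (λ t → a * (a * (c * t))) (dg x z)) (zero₃ a a c) }))
      where
      flat : ∑³ h ≡ (∑[ p ← L ] ∑[ q ← L ] ∑[ r ← L ] weigh h p q r)
      flat = sym (trans (∑-map _ vs _) (∑-cong vs (λ x → trans (∑-map _ vs _) (∑-cong vs (λ y → ∑-map _ vs _)))))
    sets : ∀ (X : Subset n) → Good f distinct₃ c₁ c₂ (A * A * A * err) A 0<A (map (A ,_) (elements X))
    sets X = begin
      c₁ * tri (weigh distinct₃) (map (A ,_) (elements X)) ≤⟨ *-monoʳ-≤ c₁ (≤-trans (≤-reflexive (uniform distinct₃)) (*-monoʳ-≤ (A * (A * A)) at-most-C)) ⟩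
      c₁ * (A * (A * A) * (card X choose 3)) ≡⟨ e₁ c₁ A (card X choose 3) ⟩
      A * (A * A) * (c₁ * (card X choose 3)) ≤⟨ *-monoʳ-≤ (A * (A * A)) (dense X) ⟩
      A * (A * A) * (c₂ * edgesIn G X + err) ≡⟨ e₂ A c₂ (edgesIn G X) err ⟩
      c₂ * (A * (A * A) * edgesIn G X) + A * A * A * err ≡⟨ cong (λ t → c₂ * t + A * A * A * err) (trans (cong (A * (A * A) *_) (edgesIn≡tri G X)) (sym (uniform f))) ⟩
      c₂ * tri (weigh f) (map (A ,_) (elements X)) + A * A * A * err ∎
      where
      uniform : ∀ h → tri (weigh h) (map (A ,_) (elements X)) ≡ A * (A * A) * tri h (elements X)
      uniform h = trans (tri-map (A ,_) (weigh h) (elements X)) (trans (tri-cong (elements X) (λ x y z → e A (h x y z))) (tri-* (A * (A * A)) h (elements X)))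
        where
        e : ∀ A t → A * (A * (A * t)) ≡ A * (A * A) * t
        e = solve-∀
      at-most-C : tri distinct₃ (elements X) ≤ card X choose 3
      at-most-C = ≤-trans (tri-mono (elements X) (λ x y z → *-mono-≤ (𝟙≤1 (distinct x y)) (*-mono-≤ (𝟙≤1 (distinct y z)) (𝟙≤1 (distinct x z)))))
        (≤-reflexive (trans (tri-1 (elements X)) (cong (_choose 3) (length-elements X))))
      e₁ : ∀ c A t → c * (A * (A * A) * t) ≡ A * (A * A) * (c * t)
      e₁ = solve-∀
      e₂ : ∀ A c e r → A * (A * A) * (c * e + r) ≡ c * (A * (A * A) * e) + A * A * A * r
      e₂ = solve-∀

-- Density on a dominated family of blocks.

atMostOnce : ∀ {ks} → AllPairs _<_ ks → ∀ k → ∑ ks (same k) ≤ 1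
atMostOnce []           k = z≤n
atMostOnce {l ∷ ks} (l< ∷ sorted) k with k Data.Nat.≡ᵇ l in eq
... | false = atMostOnce sorted k
... | true  = s≤s (≤-reflexive (none ks (subst (λ m → All (m <_) ks) (sym (≡ᵇ⇒≡ k l (subst Data.Bool.T (sym eq) tt))) l<)))
  where
  none : ∀ ks → All (k <_) ks → ∑ ks (same k) ≡ 0
  none []       []         = refl
  none (m ∷ ks) (k<m ∷ ps) with k Data.Nat.≡ᵇ m in eq
  ... | false = none ks ps
  ... | true  = contradiction (≡ᵇ⇒≡ k m (subst Data.Bool.T (sym eq) tt)) (<⇒≢ k<m)

-- The union of the blocks, weighted by multiplicity, has density at least `1 / 27 + 1 / (27 * q)`
-- up to errors, whereas triples of distinct blocks reach less than half of this excess. The lower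
-- bounds on `M`, `r` and `n` control the three errors: repeated blocks, the error term of the
-- density hypothesis, and repeated vertices.
module Hereditary {n : ℕ} (G : ThreeGraph n) (q r M F w : ℕ) (0<q : 0 < q) (0<F : 0 < F) (0<w : 0 < w)
  (M-large : 648 * q ≤ M) (r-large : 1296 * q * (F * F * F) ≤ r) (n-large : 24 * (q + 1) * F ≤ n)
  (dense : ∀ X → (q + 1) * r * (card X choose 3) ≤ 27 * q * r * edgesIn G X + 27 * q * (n * n * n))
  (W : ℕ → List (Fin n)) (lenW : ∀ k → length (W k) ≡ w) (dom : ∀ k → Dominated F n w (W k) (vertices n))
  (few : ∀ {i j k} → i < j → j < k → k < M → 54 * q * triples (edge G) (W i) (W j) (W k) < (2 * q + 1) * (w * w * w))
  where

  private
    0<M : 0 < M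
    0<M = ≤-trans (*-mono-≤ (s≤s (z≤n {647})) 0<q) M-large
    0<n : 0 < n
    0<n = ≤-trans (*-mono-≤ (*-mono-≤ (s≤s (z≤n {23})) (m≤n+m 1 q)) 0<F) n-large
    0<r : 0 < r
    0<r = ≤-trans (*-mono-≤ (*-mono-≤ (s≤s (z≤n {1295})) 0<q) (*-mono-≤ (*-mono-≤ 0<F 0<F) 0<F)) r-large

    Y : List (Fin n)
    Y = concatMap W (upTo M)
    A m w³ : ℕ
    A = M * (F * w)
    m = M * w
    w³ = w * w * w

    ∑Y : ∀ φ → ∑ Y φ ≡ (∑[ i ← upTo M ] ∑ (W i) φ)
    ∑Y φ = ∑-concatMap W (upTo M) φ

    lenY : length Y ≡ m
    lenY = trans (trans (sym (trans (∑-const Y 1) (*-identityʳ _))) (∑Y (λ _ → 1)))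
      (trans (∑-cong (upTo M) (λ i → trans (∑-const (W i) 1) (trans (*-identityʳ _) (lenW i)))) (trans (∑-const (upTo M) w) (cong (_* w) (length-upTo M))))

    -- Domination, tested on the indicator of `v`, bounds its multiplicity. This makes the
    -- multiplicities admissible weights for `weighted-density`.
    light : ∀ v → n * count Y v ≤ A
    light v = begin
      n * count Y v                              ≡⟨ trans (cong (n *_) (∑Y _)) (sym (∑-* n (upTo M) _)) ⟩
      (∑[ i ← upTo M ] n * count (W i) v)        ≤⟨ ∑-≤ (upTo M) (λ i → ≤-trans (dom i (λ u → 𝟙 (equal v u))) (≤-reflexive (cong (λ t → F * t) (trans (cong (w *_) once) (*-identityʳ w))))) ⟩
      length (upTo M) * (F * w)                  ≡⟨ cong (_* (F * w)) (length-upTo M) ⟩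
      A                                          ∎
      where
      open ≤-Reasoning
      once : (∑[ u ← vertices n ] 𝟙 (equal v u)) ≡ 1
      once = trans (∑-cong (vertices n) (λ u → trans (cong 𝟙 (equal-sym v u)) (sym (*-identityʳ _)))) (∑-vertices-equal v (λ _ → 1))

    ∑³ : (Fin n → Fin n → Fin n → ℕ) → ℕ
    ∑³ h = ∑[ x ← Y ] ∑[ y ← Y ] ∑[ z ← Y ] h x y z

    f : Fin n → Fin n → Fin n → ℕ
    f x y z = 𝟙 (edge G x y z)

    weighted : ∀ h → (∑[ x ← vertices n ] ∑[ y ← vertices n ] ∑[ z ← vertices n ] n * count Y x * (n * count Y y * (n * count Y z * h x y z))) ≡ n * n * n * ∑³ h
    weighted h = begin
      (∑[ x ← vs ] ∑[ y ← vs ] ∑[ z ← vs ] n * count Y x * (n * count Y y * (n * count Y z * h x y z)))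
        ≡⟨ ∑-cong vs (λ x → trans (∑-cong vs (λ y → trans (∑-* (n * count Y x) vs _) (cong (n * count Y x *_) (trans (∑-* (n * count Y y) vs _) (cong (n * count Y y *_) (scaled (h x y))))))) (∑-* (n * count Y x) vs _)) ⟩
      (∑[ x ← vs ] n * count Y x * (∑[ y ← vs ] n * count Y y * (n * ∑ Y (h x y))))
        ≡⟨ ∑-cong vs (λ x → cong (n * count Y x *_) (trans (scaled (λ y → n * ∑ Y (h x y))) (cong (n *_) (∑-* n Y _)))) ⟩
      (∑[ x ← vs ] n * count Y x * (n * (n * (∑[ y ← Y ] ∑ Y (h x y)))))
        ≡⟨ trans (scaled (λ x → n * (n * (∑[ y ← Y ] ∑ Y (h x y))))) (cong (n *_) (trans (∑-* n Y _) (cong (n *_) (∑-* n Y _)))) ⟩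
      n * (n * (n * ∑³ h)) ≡⟨ e n (∑³ h) ⟩
      n * n * n * ∑³ h ∎
      where
      open ≡-Reasoning
      vs = vertices n
      e : ∀ n t → n * (n * (n * t)) ≡ n * n * n * t
      e = solve-∀
      scaled : ∀ φ → (∑[ v ← vs ] n * count Y v * φ v) ≡ n * ∑ Y φ
      scaled φ = trans (∑-cong vs (λ v → *-assoc n (count Y v) (φ v))) (trans (∑-* n vs _) (cong (n *_) (∑-count Y φ)))

    density : (q + 1) * r * ∑³ distinct₃ ≤ 27 * q * r * ∑³ f + 162 * q * (A * A * A)
    density = cancel-* (n * n * n) (*-mono-≤ (*-mono-≤ 0<n 0<n) 0<n) (begin
      n * n * n * ((q + 1) * r * ∑³ distinct₃)    ≡⟨ trans (e₀ (n * n * n) ((q + 1) * r) _) (cong ((q + 1) * r *_) (sym (weighted distinct₃))) ⟩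
      (q + 1) * r * _                            ≤⟨ weighted-density G ((q + 1) * r) (27 * q * r) (27 * q * (n * n * n)) dense A (*-mono-≤ 0<M (*-mono-≤ 0<F 0<w)) (λ v → n * count Y v) light ⟩
      27 * q * r * _ + 6 * (A * A * A * (27 * q * (n * n * n))) ≡⟨ cong (λ t → 27 * q * r * t + 6 * (A * A * A * (27 * q * (n * n * n)))) (weighted f) ⟩
      27 * q * r * (n * n * n * ∑³ f) + 6 * (A * A * A * (27 * q * (n * n * n))) ≡⟨ e₁ (n * n * n) (27 * q * r) (∑³ f) (A * A * A) q ⟩
      n * n * n * (27 * q * r * ∑³ f + 162 * q * (A * A * A)) ∎)
      where
      open ≤-Reasoning
      e₀ : ∀ a b c → a * (b * c) ≡ b * (a * c)
      e₀ = solve-∀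
      e₁ : ∀ N c t a q → c * (N * t) + 6 * (a * (27 * q * N)) ≡ N * (c * t + 162 * q * a)
      e₁ = solve-∀

    -- The number of coinciding pairs is the sum of the multiplicities over `Y`, which `light`
    -- bounds; the third vertex is free.
    collisions : n * (m * m * m) ≤ n * ∑³ distinct₃ + 3 * (m * m * A)
    collisions = begin
      n * (m * m * m) ≡⟨ cong (n *_) (sym (trans (∑-const Y _) (trans (cong₂ _*_ lenY (trans (∑-const Y _) (cong₂ _*_ lenY (trans (∑-const Y 1) (trans (*-identityʳ _) lenY))))) (sym (*-assoc m m m))))) ⟩
      n * (∑[ x ← Y ] ∑[ y ← Y ] ∑[ z ← Y ] 1) ≤⟨ *-monoʳ-≤ n (∑-mono Y (λ x → ∑₂-mono Y Y (λ y z → distinct-or-equal (equal x y) (equal y z) (equal x z)))) ⟩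
      n * (∑[ x ← Y ] ∑[ y ← Y ] ∑[ z ← Y ] distinct₃ x y z + (𝟙 (equal x y) + 𝟙 (equal y z) + 𝟙 (equal x z)))
        ≡⟨ cong (n *_) (trans (∑³-+ _ _) (cong (∑³ distinct₃ +_) (trans (∑³-+ _ _) (cong (_+ ∑³ (λ x y z → 𝟙 (equal x z))) (∑³-+ _ _))))) ⟩
      n * (∑³ distinct₃ + (∑³ (λ x y z → 𝟙 (equal x y)) + ∑³ (λ x y z → 𝟙 (equal y z)) + ∑³ (λ x y z → 𝟙 (equal x z))))
        ≡⟨ trans (*-distribˡ-+ n _ _) (cong (n * ∑³ distinct₃ +_) (trans (*-distribˡ-+ n _ _) (cong (_+ n * ∑³ (λ x y z → 𝟙 (equal x z))) (*-distribˡ-+ n _ _)))) ⟩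
      n * ∑³ distinct₃ + (n * ∑³ (λ x y z → 𝟙 (equal x y)) + n * ∑³ (λ x y z → 𝟙 (equal y z)) + n * ∑³ (λ x y z → 𝟙 (equal x z)))
        ≤⟨ +-monoʳ-≤ (n * ∑³ distinct₃) (+-mono-≤ (+-mono-≤ c₁ c₂) c₃) ⟩
      n * ∑³ distinct₃ + (m * m * A + m * m * A + m * m * A) ≡⟨ cong (n * ∑³ distinct₃ +_) (e (m * m * A)) ⟩
      n * ∑³ distinct₃ + 3 * (m * m * A) ∎
      where
      open ≤-Reasoning
      e : ∀ a → a + a + a ≡ 3 * a
      e = solve-∀
      ∑³-+ : ∀ φ ψ → ∑³ (λ x y z → φ x y z + ψ x y z) ≡ ∑³ φ + ∑³ ψ
      ∑³-+ φ ψ = trans (∑-cong Y (λ x → ∑₂-+ Y Y (φ x) (ψ x))) (∑-+ Y _ _)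
      distinct-or-equal : ∀ a b c → 1 ≤ 𝟙 (not a) * (𝟙 (not b) * 𝟙 (not c)) + (𝟙 a + 𝟙 b + 𝟙 c)
      distinct-or-equal true  _     _     = s≤s z≤n
      distinct-or-equal false true  _     = s≤s z≤n
      distinct-or-equal false false true  = s≤s z≤n
      distinct-or-equal false false false = s≤s z≤n
      pairs-bound : n * (∑[ x ← Y ] ∑[ y ← Y ] 𝟙 (equal x y)) ≤ m * A
      pairs-bound = ≤-trans (≤-reflexive (sym (∑-* n Y _))) (≤-trans (∑-≤ Y light) (≤-reflexive (cong (_* A) lenY)))
      e₁ : ∀ n m t → n * (m * t) ≡ m * (n * t)
      e₁ = solve-∀
      times : ∀ {t} → t ≡ m * (∑[ x ← Y ] ∑[ y ← Y ] 𝟙 (equal x y)) → n * t ≤ m * m * A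
      times refl = ≤-trans (≤-reflexive (e₁ n m _)) (≤-trans (*-monoʳ-≤ m pairs-bound) (≤-reflexive (sym (*-assoc m m A))))
      c₁ : n * ∑³ (λ x y z → 𝟙 (equal x y)) ≤ m * m * A
      c₁ = times (trans (∑₂-cong Y Y (λ x y → trans (∑-const Y _) (cong (_* 𝟙 (equal x y)) lenY))) (∑₂-* Y Y m _))
      c₂ : n * ∑³ (λ x y z → 𝟙 (equal y z)) ≤ m * m * A
      c₂ = times (trans (∑-const Y _) (cong (_* (∑[ x ← Y ] ∑[ y ← Y ] 𝟙 (equal x y))) lenY))
      c₃ : n * ∑³ (λ x y z → 𝟙 (equal x z)) ≤ m * m * A
      c₃ = times (trans (∑-cong Y (λ x → trans (∑-const Y _) (cong (_* (∑[ z ← Y ] 𝟙 (equal x z))) lenY))) (∑-* m Y _))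

    tr : ℕ → ℕ → ℕ → ℕ
    tr i j k = triples (edge G) (W i) (W j) (W k)

    tr-swapˡ : ∀ i j k → tr i j k ≡ tr j i k
    tr-swapˡ i j k = trans (∑-swap (W i) (W j) _) (∑₂-cong (W j) (W i) (λ y x → ∑-cong (W k) (λ z → cong 𝟙 (edge-swapˡ G x y z))))

    tr-swapʳ : ∀ i j k → tr i j k ≡ tr i k j
    tr-swapʳ i j k = ∑-cong (W i) (λ x → trans (∑-swap (W j) (W k) _) (∑₂-cong (W k) (W j) (λ z y → cong 𝟙 (edge-swapʳ G x y z))))

    Few : ℕ → ℕ → ℕ → Set
    Few i j k = 54 * q * tr i j k ≤ (2 * q + 1) * w³

    few-increasing : ∀ {i j k} → i < j → j < M → k < M → j ≢ k → i ≢ k → Few i j k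
    few-increasing {i} {j} {k} i<j j<M k<M j≢k i≢k with <-cmp j k | <-cmp i k
    ... | tri< j<k _ _   | _              = <⇒≤ (few i<j j<k k<M)
    ... | tri≈ _ j≡k _   | _              = contradiction j≡k j≢k
    ... | tri> _ _ k<j   | tri< i<k _ _   = subst (λ t → 54 * q * t ≤ (2 * q + 1) * w³) (tr-swapʳ i k j) (<⇒≤ (few i<k k<j j<M))
    ... | tri> _ _ _     | tri≈ _ i≡k _   = contradiction i≡k i≢k
    ... | tri> _ _ _     | tri> _ _ k<i   = subst (λ t → 54 * q * t ≤ (2 * q + 1) * w³) (trans (tr-swapˡ k i j) (tr-swapʳ i k j)) (<⇒≤ (few k<i i<j j<M))

    few-distinct : ∀ {i j k} → i < M → j < M → k < M → i ≢ j → j ≢ k → i ≢ k → Few i j k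
    few-distinct {i} {j} {k} i<M j<M k<M i≢j j≢k i≢k with <-cmp i j
    ... | tri< i<j _ _ = few-increasing i<j j<M k<M j≢k i≢k
    ... | tri≈ _ i≡j _ = contradiction i≡j i≢j
    ... | tri> _ _ j<i = subst (λ t → 54 * q * t ≤ (2 * q + 1) * w³) (tr-swapˡ j i k) (few-increasing j<i i<M k<M i≢k j≢k)

    trivially : ∀ i j k {c} → 1 ≤ c → 54 * q * tr i j k ≤ (2 * q + 1) * w³ + 54 * q * w³ * c
    trivially i j k {c} 1≤c = ≤-trans (*-monoʳ-≤ (54 * q) (∑-≤ (W i) (λ x → ∑₂-≤ (W j) (W k) (λ y z → 𝟙≤1 (edge G x y z)))))
      (≤-trans (≤-reflexive (trans (cong (54 * q *_) (trans (cong₂ _*_ (lenW i) (cong₂ _*_ (lenW j) (trans (*-identityʳ _) (lenW k)))) (sym (*-assoc w w w)))) (sym (*-identityʳ _))))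
        (≤-trans (*-monoʳ-≤ (54 * q * w³) 1≤c) (m≤n+m _ _)))

    -- Triples with a repeated block get the trivial bound; only about `3 * M * M` of the `M ^ 3`
    -- triples are of this sort.
    few-all : ∀ {i j k} → i < M → j < M → k < M → 54 * q * tr i j k ≤ (2 * q + 1) * w³ + 54 * q * w³ * (same i j + same j k + same i k)
    few-all {i} {j} {k} i<M j<M k<M with i Data.Nat.≡ᵇ j in eqij | j Data.Nat.≡ᵇ k in eqjk | i Data.Nat.≡ᵇ k in eqik
    ... | true  | _     | _     = trivially i j k (s≤s z≤n)
    ... | false | true  | _     = trivially i j k (s≤s z≤n)
    ... | false | false | true  = trivially i j k (s≤s z≤n)
    ... | false | false | false = ≤-trans (few-distinct i<M j<M k<M (differ eqij) (differ eqjk) (differ eqik)) (m≤m+n _ _)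
      where
      differ : ∀ {a b} → (a Data.Nat.≡ᵇ b) ≡ false → a ≢ b
      differ {a} eq refl = subst Data.Bool.T eq (≡⇒≡ᵇ a a refl)

    ∑tr : ∑³ f ≡ (∑[ i ← upTo M ] ∑[ j ← upTo M ] ∑[ k ← upTo M ] tr i j k)
    ∑tr = begin
      ∑³ f ≡⟨ ∑Y _ ⟩
      (∑[ i ← U ] ∑[ x ← W i ] ∑[ y ← Y ] ∑[ z ← Y ] f x y z) ≡⟨ ∑-cong U (λ i → ∑-cong (W i) (λ x → ∑Y _)) ⟩
      (∑[ i ← U ] ∑[ x ← W i ] ∑[ j ← U ] ∑[ y ← W j ] ∑[ z ← Y ] f x y z) ≡⟨ ∑-cong U (λ i → ∑-swap (W i) U _) ⟩
      (∑[ i ← U ] ∑[ j ← U ] ∑[ x ← W i ] ∑[ y ← W j ] ∑[ z ← Y ] f x y z) ≡⟨ ∑₂-cong U U (λ i j → ∑₂-cong (W i) (W j) (λ x y → ∑Y _)) ⟩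
      (∑[ i ← U ] ∑[ j ← U ] ∑[ x ← W i ] ∑[ y ← W j ] ∑[ k ← U ] ∑[ z ← W k ] f x y z)
        ≡⟨ ∑₂-cong U U (λ i j → trans (∑-cong (W i) (λ x → ∑-swap (W j) U _)) (∑-swap (W i) U _)) ⟩
      (∑[ i ← U ] ∑[ j ← U ] ∑[ k ← U ] tr i j k) ∎
      where
      open ≡-Reasoning
      U = upTo M

    once : ∀ i → ∑ (upTo M) (same i) ≤ 1
    once = atMostOnce (AllPairs.applyUpTo⁺₁ id M (λ i<j _ → i<j))

    few-total : 54 * q * ∑³ f ≤ M * M * M * ((2 * q + 1) * w³) + 162 * q * (M * M * w³)
    few-total = begin
      54 * q * ∑³ f ≡⟨ trans (cong (54 * q *_) ∑tr) (sym (trans (∑-cong U (λ i → ∑₂-* U U (54 * q) _)) (∑-* (54 * q) U _))) ⟩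
      (∑[ i ← U ] ∑[ j ← U ] ∑[ k ← U ] 54 * q * tr i j k)
        ≤⟨ ∑-mono-∈ U (λ i∈ → ∑-mono-∈ U (λ j∈ → ∑-mono-∈ U (λ k∈ → few-all (∈-upTo⁻ i∈) (∈-upTo⁻ j∈) (∈-upTo⁻ k∈)))) ⟩
      (∑[ i ← U ] ∑[ j ← U ] ∑[ k ← U ] B + C * (same i j + same j k + same i k))
        ≤⟨ ∑-mono U (λ i → ∑-mono U (λ j → ≤-trans (≤-reflexive (trans (∑-+ U _ _) (cong₂ _+_ (lenU B) (trans (∑-* C U _) (cong (C *_) (trans (∑-+ U _ _) (cong (_+ ∑ U (same i)) (trans (∑-+ U _ _) (cong (_+ ∑ U (same j)) (lenU (same i j))))))))))) 
             (+-monoʳ-≤ (M * B) (*-monoʳ-≤ C (+-mono-≤ (+-monoʳ-≤ (M * same i j) (once j)) (once i)))))) ⟩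
      (∑[ i ← U ] ∑[ j ← U ] M * B + C * (M * same i j + 1 + 1))
        ≤⟨ ∑-mono U (λ i → ≤-trans (≤-reflexive (trans (∑-+ U _ _) (cong₂ _+_ (lenU (M * B)) (trans (∑-* C U _) (cong (C *_) (trans (∑-+ U _ _) (cong₂ _+_ (trans (∑-+ U _ _) (cong₂ _+_ (∑-* M U (same i)) (lenU 1))) (lenU 1)))))))) 
             (+-monoʳ-≤ (M * (M * B)) (*-monoʳ-≤ C (+-monoˡ-≤ (M * 1) (+-monoˡ-≤ (M * 1) (*-monoʳ-≤ M (once i))))))) ⟩
      (∑[ i ← U ] M * (M * B) + C * (M * 1 + M * 1 + M * 1)) ≡⟨ lenU _ ⟩
      M * (M * (M * B) + C * (M * 1 + M * 1 + M * 1)) ≡⟨ e M B q w³ ⟩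
      M * M * M * B + 162 * q * (M * M * w³) ∎
      where
      open ≤-Reasoning
      U = upTo M
      B = (2 * q + 1) * w³
      C = 54 * q * w³
      lenU : ∀ c → (∑[ k ← U ] c) ≡ M * c
      lenU c = trans (∑-const U c) (cong (_* c) (length-upTo M))
      e : ∀ M B q v → M * (M * (M * B) + 54 * q * v * (M * 1 + M * 1 + M * 1)) ≡ M * M * M * B + 162 * q * (M * M * v)
      e = solve-∀

    X = r * n * (M * M * M)

    -- All counts are multiples of w³; the three error terms are at most X / 4 each.
    total : X * w³ ≤ 162 * q * (r * n * (M * M)) * w³ + 324 * q * (n * (M * M * M * (F * F * F))) * w³ + 6 * (q + 1) * (r * (M * M * M * F)) * w³
    total = +-cancelˡ-≤ ((2 * q + 1) * X * w³) _ _ (begin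
      (2 * q + 1) * X * w³ + X * w³               ≡⟨ d₁ q r n M w ⟩
      2 * (q + 1) * r * (n * (m * m * m))          ≤⟨ *-monoʳ-≤ (2 * (q + 1) * r) collisions ⟩
      2 * (q + 1) * r * (n * ∑³ distinct₃ + 3 * (m * m * A)) ≡⟨ d₂ q r n (∑³ distinct₃) (3 * (m * m * A)) ⟩
      2 * n * ((q + 1) * r * ∑³ distinct₃) + 2 * (q + 1) * r * (3 * (m * m * A)) ≤⟨ +-monoˡ-≤ _ (*-monoʳ-≤ (2 * n) density) ⟩
      2 * n * (27 * q * r * ∑³ f + 162 * q * (A * A * A)) + 2 * (q + 1) * r * (3 * (m * m * A)) ≡⟨ d₃ n q r (∑³ f) (A * A * A) (2 * (q + 1) * r * (3 * (m * m * A))) ⟩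
      r * n * (54 * q * ∑³ f) + (324 * q * n * (A * A * A) + 2 * (q + 1) * r * (3 * (m * m * A))) ≤⟨ +-monoˡ-≤ _ (*-monoʳ-≤ (r * n) few-total) ⟩
      r * n * (M * M * M * ((2 * q + 1) * w³) + 162 * q * (M * M * w³)) + (324 * q * n * (A * A * A) + 2 * (q + 1) * r * (3 * (m * m * A))) ≡⟨ d₄ q r n M F w ⟩
      (2 * q + 1) * X * w³ + (162 * q * (r * n * (M * M)) * w³ + 324 * q * (n * (M * M * M * (F * F * F))) * w³ + 6 * (q + 1) * (r * (M * M * M * F)) * w³) ∎)
      where
      open ≤-Reasoning
      d₁ : ∀ q r n M w → (2 * q + 1) * (r * n * (M * M * M)) * (w * w * w) + r * n * (M * M * M) * (w * w * w) ≡ 2 * (q + 1) * r * (n * (M * w * (M * w) * (M * w)))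
      d₁ = solve-∀
      d₂ : ∀ q r n t a → 2 * (q + 1) * r * (n * t + a) ≡ 2 * n * ((q + 1) * r * t) + 2 * (q + 1) * r * a
      d₂ = solve-∀
      d₃ : ∀ n q r t a b → 2 * n * (27 * q * r * t + 162 * q * a) + b ≡ r * n * (54 * q * t) + (324 * q * n * a + b)
      d₃ = solve-∀
      d₄ : ∀ q r n M F w → r * n * (M * M * M * ((2 * q + 1) * (w * w * w)) + 162 * q * (M * M * (w * w * w)))
          + (324 * q * n * (M * (F * w) * (M * (F * w)) * (M * (F * w))) + 2 * (q + 1) * r * (3 * (M * w * (M * w) * (M * (F * w))))) ≡
        (2 * q + 1) * (r * n * (M * M * M)) * (w * w * w) + (162 * q * (r * n * (M * M)) * (w * w * w) + 324 * q * (n * (M * M * M * (F * F * F))) * (w * w * w) + 6 * (q + 1) * (r * (M * M * M * F)) * (w * w * w))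
      d₄ = solve-∀

  impossible : ⊥
  impossible = <-irrefl refl (begin-strict
    3 * (X * w³)        <⟨ *-monoˡ-< (X * w³) {{Data.Nat.>-nonZero 0<Xw³}} {3} {4} ≤-refl ⟩
    4 * (X * w³)        ≤⟨ *-monoʳ-≤ 4 total ⟩
    4 * (162 * q * (r * n * (M * M)) * w³ + 324 * q * (n * (M * M * M * (F * F * F))) * w³ + 6 * (q + 1) * (r * (M * M * M * F)) * w³) ≡⟨ d q r n M F w³ ⟩
    648 * q * (r * n * (M * M) * w³) + (1296 * q * (F * F * F) * (n * (M * M * M) * w³) + 24 * (q + 1) * F * (r * (M * M * M) * w³))
      ≤⟨ +-mono-≤ (*-monoˡ-≤ _ M-large) (+-mono-≤ (*-monoˡ-≤ _ r-large) (*-monoˡ-≤ _ n-large)) ⟩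
    M * (r * n * (M * M) * w³) + (r * (n * (M * M * M) * w³) + n * (r * (M * M * M) * w³)) ≡⟨ d′ r n M w³ ⟩
    3 * (X * w³)        ∎)
    where
    open ≤-Reasoning
    0<Xw³ : 0 < X * w³
    0<Xw³ = *-mono-≤ (*-mono-≤ (*-mono-≤ 0<r 0<n) (*-mono-≤ (*-mono-≤ 0<M 0<M) 0<M)) (*-mono-≤ (*-mono-≤ 0<w 0<w) 0<w)
    d : ∀ q r n M F v → 4 * (162 * q * (r * n * (M * M)) * v + 324 * q * (n * (M * M * M * (F * F * F))) * v + 6 * (q + 1) * (r * (M * M * M * F)) * v) ≡
      648 * q * (r * n * (M * M) * v) + (1296 * q * (F * F * F) * (n * (M * M * M) * v) + 24 * (q + 1) * F * (r * (M * M * M) * v))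
    d = solve-∀
    d′ : ∀ r n M v → M * (r * n * (M * M) * v) + (r * (n * (M * M * M) * v) + n * (r * (M * M * M) * v)) ≡ 3 * (r * n * (M * M * M) * v)
    d′ = solve-∀

-- Consecutive blocks of vertices.

∑-take-drop : {A : Set} (m : ℕ) (xs : List A) (φ : A → ℕ) → ∑ (take m xs) φ + ∑ (drop m xs) φ ≡ ∑ xs φ
∑-take-drop zero    xs       φ = refl
∑-take-drop (suc m) []       φ = refl
∑-take-drop (suc m) (x ∷ xs) φ = trans (+-assoc (φ x) _ _) (cong (φ x +_) (∑-take-drop m xs φ))

∑-drop-≤ : {A : Set} (m : ℕ) (xs : List A) (φ : A → ℕ) → ∑ (drop m xs) φ ≤ ∑ xs φ
∑-drop-≤ m xs φ = ≤-trans (m≤n+m _ (∑ (take m xs) φ)) (≤-reflexive (∑-take-drop m xs φ))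

∑-take-≤ : {A : Set} (m : ℕ) (xs : List A) (φ : A → ℕ) → ∑ (take m xs) φ ≤ ∑ xs φ
∑-take-≤ m xs φ = ≤-trans (m≤m+n _ (∑ (drop m xs) φ)) (≤-reflexive (∑-take-drop m xs φ))

length-vertices : ∀ n → length (vertices n) ≡ n
length-vertices zero    = refl
length-vertices (suc n) = cong suc (trans (length-map suc (vertices n)) (length-vertices n))

count-vertices : ∀ {n} (v : Fin n) → (∑[ u ← vertices n ] 𝟙 (equal v u)) ≡ 1
count-vertices {n} v = trans (∑-cong (vertices n) (λ u → trans (cong 𝟙 (equal-sym v u)) (sym (*-identityʳ _)))) (∑-vertices-equal v (λ _ → 1))

∈⇒count : ∀ {n} {v : Fin n} {xs} → v ∈ xs → 1 ≤ count xs v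
∈⇒count {v = v} v∈ = ≤-trans (≤-reflexive (sym (cong 𝟙 (equal-refl v)))) (∑-∈ (λ u → 𝟙 (equal v u)) v∈)

module Blocks (n N b : ℕ) {{_ : NonZero N}} (fits : N * b ≤ n) where

  -- The index is reduced modulo `N` because families of blocks are indexed by all of ℕ and must
  -- have constant length throughout; disjointness is claimed below `N` only.
  block : ℕ → List (Fin n)
  block k = take b (drop (k % N * b) (vertices n))

  length-block : ∀ k → length (block k) ≡ b
  length-block k = trans (length-take b (drop (k % N * b) (vertices n))) (m≤n⇒m⊓n≡m (≤-trans room
    (≤-reflexive (sym (trans (length-drop (k % N * b) (vertices n)) (cong (_∸ k % N * b) (length-vertices n)))))))
    where
    room : b ≤ n ∸ k % N * b
    room = m+n≤o⇒n≤o∸m (k % N * b) (≤-trans (≤-reflexive (+-comm (k % N * b) b)) (≤-trans (*-monoˡ-≤ b (m%n<n k N)) fits))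
      where
      m+n≤o⇒n≤o∸m : ∀ m {n o} → m + n ≤ o → n ≤ o ∸ m
      m+n≤o⇒n≤o∸m m {n} le = ≤-trans (≤-reflexive (sym (m+n∸m≡n m n))) (∸-monoˡ-≤ m le)

  dominated-block : ∀ F → n ≤ F * b → ∀ k → Dominated F n b (block k) (vertices n)
  dominated-block F n≤ k φ = ≤-trans (*-mono-≤ n≤ (≤-trans (∑-take-≤ b (drop (k % N * b) (vertices n)) φ) (∑-drop-≤ (k % N * b) (vertices n) φ))) (≤-reflexive (*-assoc F b _))

  blocks-disjoint : ∀ {i j} → i < j → j < N → ∀ v → count (block i) v + count (block j) v ≤ 1
  blocks-disjoint {i} {j} i<j j<N v = begin
    count (block i) v + count (block j) v
      ≡⟨ cong₂ (λ k l → ∑ (take b (drop (k * b) vs)) φ + ∑ (take b (drop (l * b) vs)) φ) (m<n⇒m%n≡m (<-trans i<j j<N)) (m<n⇒m%n≡m j<N) ⟩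
    ∑ (take b (drop (i * b) vs)) φ + ∑ (take b (drop (j * b) vs)) φ ≤⟨ +-monoʳ-≤ _ (∑-take-≤ b (drop (j * b) vs) φ) ⟩
    ∑ (take b (drop (i * b) vs)) φ + ∑ (drop (j * b) vs) φ ≡⟨ cong (λ xs → ∑ (take b (drop (i * b) vs)) φ + ∑ xs φ) later ⟩
    ∑ (take b (drop (i * b) vs)) φ + ∑ (drop (j * b ∸ (i * b + b)) (drop b (drop (i * b) vs))) φ ≤⟨ +-monoʳ-≤ _ (∑-drop-≤ (j * b ∸ (i * b + b)) _ φ) ⟩
    ∑ (take b (drop (i * b) vs)) φ + ∑ (drop b (drop (i * b) vs)) φ ≡⟨ ∑-take-drop b (drop (i * b) vs) φ ⟩
    ∑ (drop (i * b) vs) φ ≤⟨ ∑-drop-≤ (i * b) vs φ ⟩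
    ∑ vs φ ≡⟨ count-vertices v ⟩
    1 ∎
    where
    open ≤-Reasoning
    vs = vertices n
    φ : Fin n → ℕ
    φ u = 𝟙 (equal v u)
    later : drop (j * b) vs ≡ drop (j * b ∸ (i * b + b)) (drop b (drop (i * b) vs))
    later = sym (trans (cong (drop (j * b ∸ (i * b + b))) (drop-drop (i * b) b vs)) (trans (drop-drop (i * b + b) (j * b ∸ (i * b + b)) vs)
      (cong (λ m → drop m vs) (m+[n∸m]≡n (≤-trans (≤-reflexive (+-comm (i * b) b)) (*-monoˡ-≤ b i<j))))))

-- Sides, layouts and the assembly of a copy.

data Side : Set where
  left right top : Side

-- The name tells where the pair is: a left pair has its third vertex to the right of both, and a
-- top pair has it in between.
Role : Side → ℕ → ℕ → ℕ → Set
Role left  i j k = i < k × j < k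
Role right i j k = k < i × k < j
Role top   i j k = (i < k × k < j) ⊎ (j < k × k < i)

role-swap : ∀ ρ {i j k} → Role ρ i j k → Role ρ j i k
role-swap left  (h , h′) = h′ , h
role-swap right (h , h′) = h′ , h
role-swap top   (inj₁ h) = inj₂ h
role-swap top   (inj₂ h) = inj₁ h

role-≢ : ∀ ρ {i j k} → Role ρ i j k → i ≢ k × j ≢ k
role-≢ left  (h , h′)        = <⇒≢ h , <⇒≢ h′
role-≢ right (h , h′)        = >⇒≢ h , >⇒≢ h′
role-≢ top   (inj₁ (h , h′)) = <⇒≢ h , >⇒≢ h′
role-≢ top   (inj₂ (h , h′)) = >⇒≢ h′ , <⇒≢ h

same-sym : ∀ k l → same k l ≡ same l k
same-sym zero    zero    = refl
same-sym zero    (suc l) = refl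
same-sym (suc k) zero    = refl
same-sym (suc k) (suc l) = same-sym k l

same-refl : ∀ k → same k k ≡ 1
same-refl zero    = refl
same-refl (suc k) = same-refl k

chunk : ℕ → ℕ → List ℕ
chunk t α = applyUpTo (λ x → α * t + x) t

chunk-bounds : ∀ {t α k} → k ∈ chunk t α → α * t ≤ k × k < suc α * t
chunk-bounds {t} {α} k∈ with ∈-applyUpTo⁻ (λ x → α * t + x) k∈
... | x , x<t , refl = m≤m+n (α * t) x , ≤-trans (+-monoʳ-< (α * t) x<t) (≤-reflexive (+-comm (α * t) t))

chunk-< : ∀ {t α β k l} → α < β → k ∈ chunk t α → l ∈ chunk t β → k < l
chunk-< {t} {α} {β} α<β k∈ l∈ = <-≤-trans (proj₂ (chunk-bounds {t} {α} k∈)) (≤-trans (*-monoˡ-≤ t α<β) (proj₁ (chunk-bounds {t} {β} l∈)))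

chunk-once : ∀ t α k → ∑ (chunk t α) (same k) ≤ 1
chunk-once t α = atMostOnce (AllPairs.applyUpTo⁺₁ (λ x → α * t + x) t (λ i<j _ → +-monoʳ-< (α * t) i<j))

chunk-role : ∀ {t} ρ {α β γ i j k} → Role ρ α β γ → i ∈ chunk t α → j ∈ chunk t β → k ∈ chunk t γ → Role ρ i j k
chunk-role {t} left  {α} {β} {γ} (h , h′) i∈ j∈ k∈ = chunk-< {t} {α} {γ} h i∈ k∈ , chunk-< {t} {β} {γ} h′ j∈ k∈
chunk-role {t} right {α} {β} {γ} (h , h′) i∈ j∈ k∈ = chunk-< {t} {γ} {α} h k∈ i∈ , chunk-< {t} {γ} {β} h′ k∈ j∈
chunk-role {t} top {α} {β} {γ} (inj₁ (h , h′)) i∈ j∈ k∈ = inj₁ (chunk-< {t} {α} {γ} h i∈ k∈ , chunk-< {t} {γ} {β} h′ k∈ j∈)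
chunk-role {t} top {α} {β} {γ} (inj₂ (h , h′)) i∈ j∈ k∈ = inj₂ (chunk-< {t} {β} {γ} h j∈ k∈ , chunk-< {t} {γ} {α} h′ k∈ i∈)

chunk-≢ : ∀ {t α β k l} → α ≢ β → k ∈ chunk t α → l ∈ chunk t β → k ≢ l
chunk-≢ {t} {α} {β} α≢β k∈ l∈ with <-cmp α β
... | tri< α<β _ _ = <⇒≢ (chunk-< {t} {α} {β} α<β k∈ l∈)
... | tri≈ _ α≡β _ = contradiction α≡β α≢β
... | tri> _ _ β<α = >⇒≢ (chunk-< {t} {β} {α} β<α l∈ k∈)

data Kind : Set where
  LL RR TT LR LT RT : Kind

kind : Side → Kind
kind left  = LL
kind right = RR
kind top   = TT

module Products {V : Set} (R : V → V → V → Bool) (B : ℕ → List V) where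

  D : ℕ → ℕ → ℕ → ℕ → ℕ
  D i j k l = innerDeg R (B i) (B j) (B k) (B l)

  -- The inner product of two degree functions, for a pair and two further blocks at positions p < q < r < u.
  product : Kind → ℕ → ℕ → ℕ → ℕ → ℕ
  product LL p q r u = D p q r u
  product RR p q r u = D r u p q
  product TT p q r u = D p u q r
  product LR p q r u = D q r p u
  product LT p q r u = D p r q u
  product RT p q r u = D q u p r

module Assembly {V : Set} (R : V → V → V → Bool) (rotate : ∀ x y z → R x y z ≡ R y z x) (swap : ∀ x y z → R x y z ≡ R y x z)
  (B : ℕ → List V) (s : ℕ) (0<s : 0 < s) (lenB : ∀ k → length (B k) ≡ s)
  (κ t K N : ℕ) (0<t : 0 < t) (κ≤t : κ ≤ t) (room : 7 * t ≤ N) (precise : 8 * (2 * K * (2 * K)) ≤ κ)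
  where

  open Products R B

  D-swapˡ : ∀ i j k l → D i j k l ≡ D j i k l
  D-swapˡ i j k l = trans (∑-swap (B i) (B j) _) (∑₂-cong (B j) (B i) (λ y x → cong₂ _*_ (∑-cong (B k) (λ z → cong 𝟙 (swap x y z))) (∑-cong (B l) (λ z → cong 𝟙 (swap x y z)))))

  D-swapʳ : ∀ i j k l → D i j k l ≡ D i j l k
  D-swapʳ i j k l = ∑₂-cong (B i) (B j) (λ x y → *-comm (deg R (B k) x y) (deg R (B l) x y))

  D≤ : ∀ i j k l → D i j k l ≤ s ⁴
  D≤ i j k l = ≤-trans (∑₂-≤ (B i) (B j) (λ x y → *-mono-≤ (deg≤ k x y) (deg≤ l x y)))
    (≤-reflexive (trans (cong₂ (λ a b → a * (b * (s * s))) (lenB i) (lenB j)) (sym (*-assoc s s (s * s)))))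
    where
    deg≤ : ∀ k x y → deg R (B k) x y ≤ s
    deg≤ k x y = ≤-trans (deg≤length R (B k) x y) (≤-reflexive (lenB k))

  product≤ : ∀ τ p q r u → product τ p q r u ≤ s ⁴
  product≤ LL p q r u = D≤ p q r u
  product≤ RR p q r u = D≤ r u p q
  product≤ TT p q r u = D≤ p u q r
  product≤ LR p q r u = D≤ q r p u
  product≤ LT p q r u = D≤ p r q u
  product≤ RT p q r u = D≤ q u p r

  module _ (near : ∀ τ {p q r u p′ q′ r′ u′} → p < q → q < r → r < u → u < N → p′ < q′ → q′ < r′ → r′ < u′ → u′ < N →
      κ * product τ p q r u ≤ κ * product τ p′ q′ r′ u′ + s ⁴)
    (spreadB : ∀ {i j k} → i < N → j < N → k < N → i ≢ j → i ≢ k → j ≢ k → ∀ u → 2 * K * discrepancy R (B i) (B j) (B k) u ≤ s ⁴)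
    where

    private
      open Merging R B s lenB κ t κ≤t

      -- Positions 0, 1, 2, 3 serve as a reference; products of one kind are nearly the same at all
      -- positions.
      level : Side → ℕ
      level ρ = product (kind ρ) 0 1 2 3

      Level₂ : Side → ℕ → ℕ → ℕ → ℕ → Set
      Level₂ ρ i j k l = κ * D i j k l ≤ κ * level ρ + s ⁴ + κ * (s ⁴ * same k l) × κ * level ρ ≤ κ * D i j k l + s ⁴ + κ * (s ⁴ * same k l)

      3<N : 3 < N
      3<N = ≤-trans (s≤s (s≤s (s≤s (s≤s z≤n)))) (≤-trans (*-monoʳ-≤ 7 0<t) room)

      level₂-near : ∀ ρ {i j k l p q r u} → D i j k l ≡ product (kind ρ) p q r u → p < q → q < r → r < u → u < N → Level₂ ρ i j k l
      level₂-near ρ {i} {j} {k} {l} eq p<q q<r r<u u<N = subst (λ d → κ * d ≤ κ * level ρ + s ⁴ + e × κ * level ρ ≤ κ * d + s ⁴ + e) (sym eq)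
        (≤-trans (near (kind ρ) p<q q<r r<u u<N z<s (s≤s z<s) (s≤s (s≤s z<s)) 3<N) (m≤m+n _ e) ,
         ≤-trans (near (kind ρ) z<s (s≤s z<s) (s≤s (s≤s z<s)) 3<N p<q q<r r<u u<N) (m≤m+n _ e))
        where
        e = κ * (s ⁴ * same k l)

      -- The slack granted on the diagonal is as large as any inner product can be.
      level₂-same : ∀ ρ i j k → Level₂ ρ i j k k
      level₂-same ρ i j k = bound (D≤ i j k k) , bound (product≤ (kind ρ) 0 1 2 3)
        where
        bound : ∀ {d c} → d ≤ s ⁴ → κ * d ≤ κ * c + s ⁴ + κ * (s ⁴ * same k k)
        bound {d} {c} d≤ = ≤-trans (*-monoʳ-≤ κ (≤-trans d≤ (≤-reflexive (sym (trans (cong (s ⁴ *_) (same-refl k)) (*-identityʳ (s ⁴))))))) (m≤n+m _ (κ * c + s ⁴))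

      level₂-swapˡ : ∀ ρ {i j k l} → Level₂ ρ i j k l → Level₂ ρ j i k l
      level₂-swapˡ ρ {i} {j} {k} {l} = subst (λ d → κ * d ≤ κ * level ρ + s ⁴ + κ * (s ⁴ * same k l) × κ * level ρ ≤ κ * d + s ⁴ + κ * (s ⁴ * same k l)) (D-swapˡ i j k l)

      level₂-swapʳ : ∀ ρ {i j k l} → Level₂ ρ i j k l → Level₂ ρ i j l k
      level₂-swapʳ ρ {i} {j} {k} {l} = subst₂ (λ d e → κ * d ≤ κ * level ρ + s ⁴ + κ * (s ⁴ * e) × κ * level ρ ≤ κ * d + s ⁴ + κ * (s ⁴ * e)) (D-swapʳ i j k l) (same-sym k l)

      level₂-sorted : ∀ ρ {i j k l} → i < j → k < l → j < N → l < N → Role ρ i j k → Role ρ i j l → Level₂ ρ i j k l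
      level₂-sorted left  i<j k<l j<N l<N (_ , j<k) _ = level₂-near left refl i<j j<k k<l l<N
      level₂-sorted right i<j k<l j<N l<N _ (l<i , _) = level₂-near right refl k<l l<i i<j j<N
      level₂-sorted top   i<j k<l j<N l<N (inj₁ (i<k , _)) (inj₁ (_ , l<j)) = level₂-near top refl i<k k<l l<j j<N
      level₂-sorted top   i<j k<l j<N l<N (inj₂ (j<k , k<i)) _ = contradiction i<j (<⇒≯ (<-trans j<k k<i))
      level₂-sorted top   i<j k<l j<N l<N _ (inj₂ (j<l , l<i)) = contradiction i<j (<⇒≯ (<-trans j<l l<i))

      level₂-half : ∀ ρ {i j k l} → i < j → j < N → k < N → l < N → Role ρ i j k → Role ρ i j l → Level₂ ρ i j k l
      level₂-half ρ {i} {j} {k} {l} i<j j<N k<N l<N rk rl with <-cmp k l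
      ... | tri< k<l _ _ = level₂-sorted ρ i<j k<l j<N l<N rk rl
      ... | tri≈ _ refl _ = level₂-same ρ i j k
      ... | tri> _ _ l<k = level₂-swapʳ ρ (level₂-sorted ρ i<j l<k j<N k<N rl rk)

      level₂ : ∀ ρ {i j k l} → i ≢ j → i < N → j < N → k < N → l < N → Role ρ i j k → Role ρ i j l → Level₂ ρ i j k l
      level₂ ρ {i} {j} i≢j i<N j<N k<N l<N rk rl with <-cmp i j
      ... | tri< i<j _ _ = level₂-half ρ i<j j<N k<N l<N rk rl
      ... | tri≈ _ i≡j _ = contradiction i≡j i≢j
      ... | tri> _ _ j<i = level₂-swapˡ ρ (level₂-half ρ j<i i<N k<N l<N (role-swap ρ rk) (role-swap ρ rl))

      chunk-<N : ∀ {α k} → α < 7 → k ∈ chunk t α → k < N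
      chunk-<N {α} α<7 k∈ = <-≤-trans (proj₂ (chunk-bounds {t} {α} k∈)) (≤-trans (*-monoˡ-≤ t α<7) room)

      length-chunk : ∀ α → length (chunk t α) ≡ t
      length-chunk α = length-applyUpTo (λ x → α * t + x) t

      blockLevel : ∀ ρ {α β γ δ} → α ≢ β → α < 7 → β < 7 → γ < 7 → δ < 7 → Role ρ α β γ → Role ρ α β δ →
        ∀ {i j} → i ∈ chunk t α → j ∈ chunk t β → BlockLevel (level ρ) i j (chunk t γ) (chunk t δ)
      blockLevel ρ {α} {β} {γ} {δ} α≢β α< β< γ< δ< rγ rδ {i} {j} i∈ j∈ {k} {l} k∈ l∈ =
        subst (λ d → κ * d ≤ κ * level ρ + s ⁴ + κ * (s ⁴ * same k l) × κ * level ρ ≤ κ * d + s ⁴ + κ * (s ⁴ * same k l)) (sym (∑-⊗ (B i) (B j) _))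
          (level₂ ρ (chunk-≢ {t} {α} {β} α≢β i∈ j∈) (chunk-<N α< i∈) (chunk-<N β< j∈) (chunk-<N γ< k∈) (chunk-<N δ< l∈)
            (chunk-role {t} ρ {α} {β} {γ} rγ i∈ j∈ k∈) (chunk-role {t} ρ {α} {β} {δ} rδ i∈ j∈ l∈))

    merged : ℕ → List V
    merged α = merge (chunk t α)

    private
      length-merged : ∀ α → length (merged α) ≡ t * s
      length-merged α = length-merge (chunk t α) (length-chunk α)

      K-precise : 8 * (K * K) ≤ κ
      K-precise = ≤-trans (*-monoʳ-≤ 8 (*-mono-≤ (m≤n*m K 2) (m≤n*m K 2))) precise

      close : ∀ ρ {α β γ δ} → α ≢ β → α < 7 → β < 7 → γ < 7 → δ < 7 → Role ρ α β γ → Role ρ α β δ →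
        Close R (t * s) K (merged α) (merged β) (merged γ) (merged δ)
      close ρ {α} {β} {γ} {δ} α≢β α< β< γ< δ< rγ rδ = merge-close {K} {level ρ} (chunk t α) (chunk t β) (chunk t γ) (chunk t δ)
        (length-chunk α) (length-chunk β) (length-chunk γ) (length-chunk δ) K-precise (chunk-once t γ) (chunk-once t δ)
        (λ i∈ j∈ → blockLevel ρ {γ = γ} {γ} α≢β α< β< γ< γ< rγ rγ i∈ j∈ , blockLevel ρ {γ = δ} {δ} α≢β α< β< δ< δ< rδ rδ i∈ j∈ , blockLevel ρ {γ = γ} {δ} α≢β α< β< γ< δ< rγ rδ i∈ j∈)

      spread : ∀ ρ {α β γ} → α ≢ β → α < 7 → β < 7 → γ < 7 → Role ρ α β γ → Spread R (t * s) K (merged α) (merged β) (merged γ)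
      spread ρ {α} {β} {γ} α≢β α< β< γ< rγ = merge-spread {K} {level ρ} (chunk t α) (chunk t β) (chunk t γ)
        (length-chunk α) (length-chunk β) (length-chunk γ) precise (chunk-once t γ)
        (λ i∈ j∈ → blockLevel ρ {γ = γ} {γ} α≢β α< β< γ< γ< rγ rγ i∈ j∈)
        (λ i∈ j∈ k∈ → spreadB (chunk-<N α< i∈) (chunk-<N β< j∈) (chunk-<N γ< k∈) (chunk-≢ {t} {α} {β} α≢β i∈ j∈)
          (chunk-≢ {t} {α} {γ} (proj₁ (role-≢ ρ rγ)) i∈ k∈) (chunk-≢ {t} {β} {γ} (proj₂ (role-≢ ρ rγ)) j∈ k∈))

    -- The conditions on the order of the seven places. All neighbours of bc, of cd, of de and of ef
    -- lie on one side, so that the degrees over these pairs can be exchanged. For ab there is no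
    -- condition: the overlap of the degrees into `c` and `g` over it is a separate hypothesis of
    -- `embed`.
    record Layout (a b c d e f g : ℕ) : Set where
      field
        ρ σ : Side
        a<7 : a < 7
        b<7 : b < 7
        c<7 : c < 7
        d<7 : d < 7
        e<7 : e < 7
        f<7 : f < 7
        g<7 : g < 7
        b≢c : b ≢ c
        c≢d : c ≢ d
        d≢e : d ≢ e
        e≢f : e ≢ f
        bc-a : Role top b c a
        bc-d : Role top b c d
        bc-f : Role top b c f
        cd-b : Role ρ c d b
        cd-e : Role ρ c d e
        cd-g : Role ρ c d g
        de-a : Role σ d e a
        de-c : Role σ d e c
        de-f : Role σ d e f
        ef-d : Role top e f d
        ef-g : Role top e f g

    embed : ∀ {a b c d e f g} → Layout a b c d e f g → ∀ k₁ → embeddingPrecision k₁ ≤ K →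
      (∀ {i j k l} → i ∈ chunk t a → j ∈ chunk t b → k ∈ chunk t c → l ∈ chunk t g → s ⁴ ≤ k₁ * D i j k l) →
      Copy R (merged a) (merged b) (merged c) (merged d) (merged e) (merged f) (merged g)
    embed {a} {b} {c} {d} {e} {f} {g} layout k₁ k₁-precise heavy =
      Embedding.copy R rotate (t * s) (*-mono-≤ 0<t 0<s) K (merged a) (merged b) (merged c) (merged d) (merged e) (merged f) (merged g)
        (length-merged a) (length-merged b) (length-merged c) (length-merged d) (length-merged e) (length-merged f) (length-merged g)
        (spread ρ c≢d c<7 d<7 g<7 cd-g) (spread top e≢f e<7 f<7 g<7 ef-g)
        (spread σ d≢e d<7 e<7 a<7 de-a) (spread top b≢c b<7 c<7 f<7 bc-f)
        (close top b≢c b<7 c<7 a<7 d<7 bc-a bc-d) (close top b≢c b<7 c<7 a<7 f<7 bc-a bc-f)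
        (close ρ c≢d c<7 d<7 b<7 e<7 cd-b cd-e) (close ρ c≢d c<7 d<7 b<7 g<7 cd-b cd-g)
        (close σ d≢e d<7 e<7 c<7 f<7 de-c de-f) (close σ d≢e d<7 e<7 c<7 a<7 de-c de-a)
        (close top e≢f e<7 f<7 d<7 g<7 ef-d ef-g)
        k₁ k₁-precise
        (merge-overlap {k₁} (chunk t a) (chunk t b) (chunk t c) (chunk t g) (length-chunk a) (length-chunk b) (length-chunk c) (length-chunk g)
          (λ {i} {j} i∈ j∈ k∈ l∈ → ≤-trans (heavy i∈ j∈ k∈ l∈) (≤-reflexive (cong (k₁ *_) (sym (∑-⊗ (B i) (B j) _))))))
      where open Layout layout

    module _ (k₀ : ℕ) (k₀-precise : embeddingPrecision (2 * k₀) ≤ K) (k₀≤κ : 2 * k₀ ≤ κ) (0<κ : 0 < κ) where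

      -- Moving to other positions loses at most `S / κ`, which is no more than half of the lower
      -- bound `S / k₀` because `2 * k₀ ≤ κ`.
      heavy-everywhere : ∀ τ {p q r u p′ q′ r′ u′} → p < q → q < r → r < u → u < N → p′ < q′ → q′ < r′ → r′ < u′ → u′ < N →
        s ⁴ ≤ k₀ * product τ p q r u → s ⁴ ≤ 2 * k₀ * product τ p′ q′ r′ u′
      heavy-everywhere τ {p} {q} {r} {u} {p′} {q′} {r′} {u′} p<q q<r r<u u<N p<q′ q<r′ r<u′ u<N′ heavy =
        cancel-* κ 0<κ (+-cancelʳ-≤ (κ * S) _ _ (begin
          κ * S + κ * S                        ≤⟨ +-mono-≤ h h ⟩
          κ * (k₀ * I) + κ * (k₀ * I)          ≡⟨ e₁ κ k₀ I ⟩
          2 * k₀ * (κ * I)                     ≤⟨ *-monoʳ-≤ (2 * k₀) (near τ p<q q<r r<u u<N p<q′ q<r′ r<u′ u<N′) ⟩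
          2 * k₀ * (κ * I′ + S)                ≡⟨ e₂ k₀ κ I′ S ⟩
          κ * (2 * k₀ * I′) + 2 * k₀ * S       ≤⟨ +-monoʳ-≤ _ (*-monoˡ-≤ S k₀≤κ) ⟩
          κ * (2 * k₀ * I′) + κ * S            ∎))
        where
        open ≤-Reasoning
        S = s ⁴
        I = product τ p q r u
        I′ = product τ p′ q′ r′ u′
        h : κ * S ≤ κ * (k₀ * I)
        h = *-monoʳ-≤ κ heavy
        e₁ : ∀ κ k I → κ * (k * I) + κ * (k * I) ≡ 2 * k * (κ * I)
        e₁ = solve-∀
        e₂ : ∀ k κ I S → 2 * k * (κ * I + S) ≡ κ * (2 * k * I) + 2 * k * S
        e₂ = solve-∀

      embed-LR : ∀ {p q r u} → p < q → q < r → r < u → u < N → s ⁴ ≤ k₀ * product LR p q r u →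
        Copy R (merged 1) (merged 4) (merged 0) (merged 3) (merged 6) (merged 2) (merged 5)
      embed-LR p<q q<r r<u u<N heavy = embed layout (2 * k₀) k₀-precise
        (λ i∈ j∈ k∈ l∈ → heavy-everywhere LR p<q q<r r<u u<N (chunk-< {t} {0} {1} (<ᵇ⇒< 0 1 tt) k∈ i∈) (chunk-< {t} {1} {4} (<ᵇ⇒< 1 4 tt) i∈ j∈) (chunk-< {t} {4} {5} (<ᵇ⇒< 4 5 tt) j∈ l∈) (chunk-<N {5} (<ᵇ⇒< 5 7 tt) l∈) heavy)
        where
        layout : Layout 1 4 0 3 6 2 5
        layout = record
          { ρ = left ; σ = right
          ; a<7 = <ᵇ⇒< 1 7 tt ; b<7 = <ᵇ⇒< 4 7 tt ; c<7 = <ᵇ⇒< 0 7 tt ; d<7 = <ᵇ⇒< 3 7 tt ; e<7 = <ᵇ⇒< 6 7 tt ; f<7 = <ᵇ⇒< 2 7 tt ; g<7 = <ᵇ⇒< 5 7 tt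
          ; b≢c = λ () ; c≢d = λ () ; d≢e = λ () ; e≢f = λ ()
          ; bc-a = inj₂ (<ᵇ⇒< 0 1 tt , <ᵇ⇒< 1 4 tt) ; bc-d = inj₂ (<ᵇ⇒< 0 3 tt , <ᵇ⇒< 3 4 tt) ; bc-f = inj₂ (<ᵇ⇒< 0 2 tt , <ᵇ⇒< 2 4 tt)
          ; cd-b = <ᵇ⇒< 0 4 tt , <ᵇ⇒< 3 4 tt ; cd-e = <ᵇ⇒< 0 6 tt , <ᵇ⇒< 3 6 tt ; cd-g = <ᵇ⇒< 0 5 tt , <ᵇ⇒< 3 5 tt
          ; de-a = <ᵇ⇒< 1 3 tt , <ᵇ⇒< 1 6 tt ; de-c = <ᵇ⇒< 0 3 tt , <ᵇ⇒< 0 6 tt ; de-f = <ᵇ⇒< 2 3 tt , <ᵇ⇒< 2 6 tt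
          ; ef-d = inj₂ (<ᵇ⇒< 2 3 tt , <ᵇ⇒< 3 6 tt) ; ef-g = inj₂ (<ᵇ⇒< 2 5 tt , <ᵇ⇒< 5 6 tt) }

      -- The layout of `embed-LR` with the places of `b` and `g` interchanged: `g` now lies between
      -- `a` and `b`, and no other side changes.
      embed-RT : ∀ {p q r u} → p < q → q < r → r < u → u < N → s ⁴ ≤ k₀ * product RT p q r u →
        Copy R (merged 1) (merged 5) (merged 0) (merged 3) (merged 6) (merged 2) (merged 4)
      embed-RT p<q q<r r<u u<N heavy = embed layout (2 * k₀) k₀-precise
        (λ i∈ j∈ k∈ l∈ → heavy-everywhere RT p<q q<r r<u u<N (chunk-< {t} {0} {1} (<ᵇ⇒< 0 1 tt) k∈ i∈) (chunk-< {t} {1} {4} (<ᵇ⇒< 1 4 tt) i∈ l∈) (chunk-< {t} {4} {5} (<ᵇ⇒< 4 5 tt) l∈ j∈) (chunk-<N {5} (<ᵇ⇒< 5 7 tt) j∈) heavy)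
        where
        layout : Layout 1 5 0 3 6 2 4
        layout = record
          { ρ = left ; σ = right
          ; a<7 = <ᵇ⇒< 1 7 tt ; b<7 = <ᵇ⇒< 5 7 tt ; c<7 = <ᵇ⇒< 0 7 tt ; d<7 = <ᵇ⇒< 3 7 tt ; e<7 = <ᵇ⇒< 6 7 tt ; f<7 = <ᵇ⇒< 2 7 tt ; g<7 = <ᵇ⇒< 4 7 tt
          ; b≢c = λ () ; c≢d = λ () ; d≢e = λ () ; e≢f = λ ()
          ; bc-a = inj₂ (<ᵇ⇒< 0 1 tt , <ᵇ⇒< 1 5 tt) ; bc-d = inj₂ (<ᵇ⇒< 0 3 tt , <ᵇ⇒< 3 5 tt) ; bc-f = inj₂ (<ᵇ⇒< 0 2 tt , <ᵇ⇒< 2 5 tt)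
          ; cd-b = <ᵇ⇒< 0 5 tt , <ᵇ⇒< 3 5 tt ; cd-e = <ᵇ⇒< 0 6 tt , <ᵇ⇒< 3 6 tt ; cd-g = <ᵇ⇒< 0 4 tt , <ᵇ⇒< 3 4 tt
          ; de-a = <ᵇ⇒< 1 3 tt , <ᵇ⇒< 1 6 tt ; de-c = <ᵇ⇒< 0 3 tt , <ᵇ⇒< 0 6 tt ; de-f = <ᵇ⇒< 2 3 tt , <ᵇ⇒< 2 6 tt
          ; ef-d = inj₂ (<ᵇ⇒< 2 3 tt , <ᵇ⇒< 3 6 tt) ; ef-g = inj₂ (<ᵇ⇒< 2 4 tt , <ᵇ⇒< 4 6 tt) }

      -- The mirror image of the previous layout.
      embed-LT : ∀ {p q r u} → p < q → q < r → r < u → u < N → s ⁴ ≤ k₀ * product LT p q r u →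
        Copy R (merged 5) (merged 1) (merged 6) (merged 3) (merged 0) (merged 4) (merged 2)
      embed-LT p<q q<r r<u u<N heavy = embed layout (2 * k₀) k₀-precise
        (λ {i} {j} {k} {l} i∈ j∈ k∈ l∈ → subst (λ d → s ⁴ ≤ 2 * k₀ * d) (trans (D-swapˡ j i l k) (D-swapʳ i j l k))
          (heavy-everywhere LT p<q q<r r<u u<N (chunk-< {t} {1} {2} (<ᵇ⇒< 1 2 tt) j∈ l∈) (chunk-< {t} {2} {5} (<ᵇ⇒< 2 5 tt) l∈ i∈) (chunk-< {t} {5} {6} (<ᵇ⇒< 5 6 tt) i∈ k∈) (chunk-<N {6} (<ᵇ⇒< 6 7 tt) k∈) heavy))
        where
        layout : Layout 5 1 6 3 0 4 2
        layout = record
          { ρ = right ; σ = left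
          ; a<7 = <ᵇ⇒< 5 7 tt ; b<7 = <ᵇ⇒< 1 7 tt ; c<7 = <ᵇ⇒< 6 7 tt ; d<7 = <ᵇ⇒< 3 7 tt ; e<7 = <ᵇ⇒< 0 7 tt ; f<7 = <ᵇ⇒< 4 7 tt ; g<7 = <ᵇ⇒< 2 7 tt
          ; b≢c = λ () ; c≢d = λ () ; d≢e = λ () ; e≢f = λ ()
          ; bc-a = inj₁ (<ᵇ⇒< 1 5 tt , <ᵇ⇒< 5 6 tt) ; bc-d = inj₁ (<ᵇ⇒< 1 3 tt , <ᵇ⇒< 3 6 tt) ; bc-f = inj₁ (<ᵇ⇒< 1 4 tt , <ᵇ⇒< 4 6 tt)
          ; cd-b = <ᵇ⇒< 1 6 tt , <ᵇ⇒< 1 3 tt ; cd-e = <ᵇ⇒< 0 6 tt , <ᵇ⇒< 0 3 tt ; cd-g = <ᵇ⇒< 2 6 tt , <ᵇ⇒< 2 3 tt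
          ; de-a = <ᵇ⇒< 3 5 tt , <ᵇ⇒< 0 5 tt ; de-c = <ᵇ⇒< 3 6 tt , <ᵇ⇒< 0 6 tt ; de-f = <ᵇ⇒< 3 4 tt , <ᵇ⇒< 0 4 tt
          ; ef-d = inj₁ (<ᵇ⇒< 0 3 tt , <ᵇ⇒< 3 4 tt) ; ef-g = inj₁ (<ᵇ⇒< 0 2 tt , <ᵇ⇒< 2 4 tt) }

-- From seven places to an injective copy.

∑>0′ : {A : Set} (xs : List A) (f : A → ℕ) → 1 ≤ ∑ xs f → ∃[ x ] x ∈ xs × 1 ≤ f x
∑>0′ xs f = ∑>0 xs

-- Injectivity comes from the places: `γ` lists seven different indices of pairwise disjoint lists.
copy⇒ContainsH : ∀ {n} (G : ThreeGraph n) {A B C D E F Z : List (Fin n)} (γ : Vec.Vec ℕ 7) →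
  (∀ i j → Vec.lookup γ i ≡ Vec.lookup γ j → i ≡ j) →
  (M : ℕ → List (Fin n)) → (∀ {α β v} → α ≢ β → v ∈ M α → v ∈ M β → ⊥) →
  (A Vec.∷ B Vec.∷ C Vec.∷ D Vec.∷ E Vec.∷ F Vec.∷ Z Vec.∷ Vec.[]) ≡ Vec.map M γ →
  Copy (edge G) A B C D E F Z → ContainsH G
copy⇒ContainsH {n} G {A} {B} {C} {D} {E} {F} {Z} γ γ-injective M disjoint eq κ = φ , injective ,
  edge⇒IsEdge G _ _ _ abc ∷
  edge⇒IsEdge G _ _ _ (trans (sym (trans (edge-rotate G d e a) (edge-rotate G e a d))) dea) ∷
  edge⇒IsEdge G _ _ _ bcd ∷ edge⇒IsEdge G _ _ _ bcf ∷ edge⇒IsEdge G _ _ _ cde ∷ edge⇒IsEdge G _ _ _ def ∷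
  edge⇒IsEdge G _ _ _ abg ∷ edge⇒IsEdge G _ _ _ cdg ∷ edge⇒IsEdge G _ _ _ efg ∷ []
  where
  open Copy κ
  φ : Fin 7 → Fin n
  φ = Vec.lookup (a Vec.∷ b Vec.∷ c Vec.∷ d Vec.∷ e Vec.∷ f Vec.∷ g Vec.∷ Vec.[])
  member′ : ∀ i → φ i ∈ Vec.lookup (A Vec.∷ B Vec.∷ C Vec.∷ D Vec.∷ E Vec.∷ F Vec.∷ Z Vec.∷ Vec.[]) i
  member′ zero = a∈
  member′ (suc zero) = b∈
  member′ (suc (suc zero)) = c∈
  member′ (suc (suc (suc zero))) = d∈
  member′ (suc (suc (suc (suc zero)))) = e∈
  member′ (suc (suc (suc (suc (suc zero))))) = f∈
  member′ (suc (suc (suc (suc (suc (suc zero)))))) = g∈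
  member : ∀ i → φ i ∈ M (Vec.lookup γ i)
  member i = subst (φ i ∈_) (trans (cong (λ ls → Vec.lookup ls i) eq) (Vec.lookup-map i M γ)) (member′ i)
  injective : ∀ {i j} → φ i ≡ φ j → i ≡ j
  injective {i} {j} φi≡φj = γ-injective i j (decidable-stable (Vec.lookup γ i ≟ Vec.lookup γ j)
    (λ γi≢γj → disjoint γi≢γj (member i) (subst (_∈ M (Vec.lookup γ j)) (sym φi≡φj) (member j))))

allDistinct : ∀ γ → Dec (∀ i j → Vec.lookup {n = 7} γ i ≡ Vec.lookup γ j → i ≡ j)
allDistinct γ = Fin.all? (λ i → Fin.all? (λ j → (Vec.lookup γ i ≟ Vec.lookup γ j) →-dec (i Fin.≟ j)))

layoutLR layoutLT layoutRT : Vec.Vec ℕ 7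
layoutLR = 1 Vec.∷ 4 Vec.∷ 0 Vec.∷ 3 Vec.∷ 6 Vec.∷ 2 Vec.∷ 5 Vec.∷ Vec.[]
layoutLT = 5 Vec.∷ 1 Vec.∷ 6 Vec.∷ 3 Vec.∷ 0 Vec.∷ 4 Vec.∷ 2 Vec.∷ Vec.[]
layoutRT = 1 Vec.∷ 5 Vec.∷ 0 Vec.∷ 3 Vec.∷ 6 Vec.∷ 2 Vec.∷ 4 Vec.∷ Vec.[]

layoutLR-distinct : ∀ i j → Vec.lookup layoutLR i ≡ Vec.lookup layoutLR j → i ≡ j
layoutLR-distinct = from-yes (allDistinct layoutLR)

layoutLT-distinct : ∀ i j → Vec.lookup layoutLT i ≡ Vec.lookup layoutLT j → i ≡ j
layoutLT-distinct = from-yes (allDistinct layoutLT)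

layoutRT-distinct : ∀ i j → Vec.lookup layoutRT i ≡ Vec.lookup layoutRT j → i ≡ j
layoutRT-distinct = from-yes (allDistinct layoutRT)

increasing⇒≢ : ∀ {N} (e : ℕ → ℕ) → (∀ {p p′} → p < p′ → p′ < N → e p < e p′) → ∀ {p p′} → p < N → p′ < N → p ≢ p′ → e p ≢ e p′
increasing⇒≢ e inc {p} {p′} p<N p′<N p≢p′ with <-cmp p p′
... | tri< p<p′ _ _ = <⇒≢ (inc p<p′ p′<N)
... | tri≈ _ p≡p′ _ = contradiction p≡p′ p≢p′
... | tri> _ _ p′<p = >⇒≢ (inc p′<p p<N)

-- From index `m` on the lists are made empty, so that disjointness can be stated for all indices.
restrict : {A : Set} → ℕ → (ℕ → List A) → ℕ → List A
restrict m M α with α <? m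
... | yes _ = M α
... | no _  = []

restrict-disjoint : ∀ {A : Set} m (M : ℕ → List A) → (∀ {α β v} → α < β → β < m → v ∈ M α → v ∈ M β → ⊥) →
  ∀ {α β v} → α ≢ β → v ∈ restrict m M α → v ∈ restrict m M β → ⊥
restrict-disjoint m M h {α} {β} α≢β v∈α v∈β with α <? m | β <? m | <-cmp α β
... | yes α<m | yes β<m | tri< α<β _ _ = h α<β β<m v∈α v∈β
... | yes α<m | yes β<m | tri≈ _ p _   = α≢β p
... | yes α<m | yes β<m | tri> _ _ β<α = h β<α α<m v∈β v∈α
restrict-disjoint m M h α≢β () v∈β | no _  | _    | _
restrict-disjoint m M h α≢β v∈α () | yes _ | no _ | _

-- The upper bound for a single 3-graph.

module Upper {n : ℕ} (G : ThreeGraph n) (noH : ¬ ContainsH G)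
  (q M₁ κ₂ Kr θ M₀ h₂ F₂ K₂ k₀ K κ N N₀ h F r b : ℕ) {{N₀≢0 : NonZero N₀}} (0<q : 0 < q)
  (κ₂≡ : κ₂ ≡ 208 * q) (Kr≡ : Kr ≡ 648 * q) (θ≡ : θ ≡ 432 * q) (M₁-large : 648 * q ≤ M₁)
  (0<M₀ : 0 < M₀) (M₀-large : ramseysBound {ℕ} 2 (3 * suc κ₂) M₁ ≤ M₀) (h₂-large : suc (Kr * Kr * (M₀ * (M₀ * 6))) ≤ h₂)
  (F₂≡ : F₂ ≡ Kr ^ h₂) (0<K₂ : 0 < K₂) (K₂-large : θ * 3 * (F₂ * F₂ * F₂) ≤ K₂) (k₀-large : θ * 3 * (M₀ * (F₂ * F₂ * (K₂ * K₂))) ≤ k₀)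
  (0<K : 0 < K) (K-large : embeddingPrecision (2 * k₀) ≤ K) (κ-large : 8 * (2 * K * (2 * K)) ≤ κ) (k₀≤κ : 2 * k₀ ≤ κ) (0<κ : 0 < κ)
  (M₀≤N : M₀ ≤ N) (N-large : 7 * κ ≤ N) (N₀-large : ramseysBound {ℕ} 4 (6 * suc κ) N ≤ N₀)
  (h-large : suc (2 * K * (2 * K) * (N₀ * (N₀ * (N₀ * 1)))) ≤ h) (F≡ : F ≡ (2 * K) ^ h)
  (0<b : 0 < b) (fits : N₀ * b ≤ n) (n≤ : n ≤ 2 * N₀ * b)
  (0<F₂ : 0 < F₂) (r-large : 1296 * q * ((2 * N₀ * F * F₂) * (2 * N₀ * F * F₂) * (2 * N₀ * F * F₂)) ≤ r) (n-large : 24 * (q + 1) * (2 * N₀ * F * F₂) ≤ n)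
  (dense : ∀ X → (q + 1) * r * (card X choose 3) ≤ 27 * q * r * edgesIn G X + 27 * q * (n * n * n))
  where

  private
    open Blocks n N₀ b fits

    R : Fin n → Fin n → Fin n → Bool
    R = edge G

    tripleTask : ∀ i j k → Dec (i ≡ j) → Dec (i ≡ k) → Dec (j ≡ k) → List (Task {Fin n})
    tripleTask i j k (no i≢j) (no i≢k) (no j≢k) = task i j k R i≢j i≢k j≢k ∷ []
    tripleTask i j k _        _        _        = []

    length-tripleTask : ∀ i j k p p′ p″ → length (tripleTask i j k p p′ p″) ≤ 1
    length-tripleTask i j k (no _)  (no _)  (no _)  = ≤-refl
    length-tripleTask i j k (no _)  (no _)  (yes _) = z≤n
    length-tripleTask i j k (no _)  (yes _) _       = z≤n
    length-tripleTask i j k (yes _) _       _       = z≤n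

    tasks : List (Task {Fin n})
    tasks = concatMap (λ i → concatMap (λ j → concatMap (λ k → tripleTask i j k (i ≟ j) (i ≟ k) (j ≟ k)) (upTo N₀)) (upTo N₀)) (upTo N₀)

    length-tasks : length tasks ≤ N₀ * (N₀ * (N₀ * 1))
    length-tasks = each _ (λ i → each _ (λ j → each _ (λ k → length-tripleTask i j k (i ≟ j) (i ≟ k) (j ≟ k))))
      where
      each : ∀ (f : ℕ → List (Task {Fin n})) {c} → (∀ i → length (f i) ≤ c) → length (concatMap f (upTo N₀)) ≤ N₀ * c
      each f {c} h = ≤-trans (length-concatMap-≤ f (upTo N₀) h) (≤-reflexive (cong (_* c) (length-upTo N₀)))

    fuel : suc (2 * K * (2 * K) * length tasks) ≤ h
    fuel = ≤-trans (s≤s (*-monoʳ-≤ (2 * K * (2 * K)) length-tasks)) h-large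

    1≤2K : 1 ≤ 2 * K
    1≤2K = *-mono-≤ (s≤s (z≤n {1})) 0<K

    0<F : 0 < F
    0<F = subst (0 <_) (sym F≡) (m^n>0 (2 * K) {{Data.Nat.>-nonZero 1≤2K}} h)

    0<N₀ : 0 < N₀
    0<N₀ = Data.Nat.>-nonZero⁻¹ N₀

    module Regularised (V : ℕ → List (Fin n)) (s : ℕ) (0<s : 0 < s) (lenV : ∀ k → length (V k) ≡ s)
      (domV : ∀ k → Dominated F b s (V k) (block k)) (regV : ∀ {τ} → τ ∈ tasks → Regular (2 * K) s V τ) where

      spreadV : ∀ {i j k} → i < N₀ → j < N₀ → k < N₀ → i ≢ j → i ≢ k → j ≢ k → ∀ u → 2 * K * discrepancy R (V i) (V j) (V k) u ≤ s ⁴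
      spreadV {i} {j} {k} i< j< k< i≢j i≢k j≢k = pick (i ≟ j) (i ≟ k) (j ≟ k) (λ τ∈ → regV (∈-concatMap (∈-upTo⁺ i<) (∈-concatMap (∈-upTo⁺ j<) (∈-concatMap (∈-upTo⁺ k<) τ∈))))
        where
        pick : ∀ p p′ p″ → (∀ {τ} → τ ∈ tripleTask i j k p p′ p″ → Regular (2 * K) s V τ) → ∀ u → 2 * K * discrepancy R (V i) (V j) (V k) u ≤ s ⁴
        pick (no _)  (no _)  (no _)  reg = reg (here refl)
        pick (yes p) _       _       reg = contradiction p i≢j
        pick (no _)  (yes p) _       reg = contradiction p i≢k
        pick (no _)  (no _)  (yes p) reg = contradiction p j≢k

      -- Ramsey's theorem is stated for functions of lists. Lists of other lengths get the default
      -- 0, which keeps the bound `s ⁴` valid for all lists.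
      productList : Kind → List ℕ → ℕ
      productList τ (p ∷ q ∷ r ∷ u ∷ []) = Products.product R V τ p q r u
      productList τ _                    = 0

      productList≤ : ∀ τ zs → productList τ zs ≤ s ⁴
      productList≤ τ []                        = z≤n
      productList≤ τ (_ ∷ [])                  = z≤n
      productList≤ τ (_ ∷ _ ∷ [])              = z≤n
      productList≤ τ (_ ∷ _ ∷ _ ∷ [])          = z≤n
      productList≤ τ (p ∷ q ∷ r ∷ u ∷ [])      = Assembly.product≤ R (edge-rotate G) (edge-swapˡ G) V s 0<s lenV κ κ K N 0<κ ≤-refl N-large κ-large τ p q r u
      productList≤ τ (_ ∷ _ ∷ _ ∷ _ ∷ _ ∷ _)   = z≤n

      kinds : List (List ℕ → ℕ)
      kinds = productList LL ∷ productList RR ∷ productList TT ∷ productList LR ∷ productList LT ∷ productList RT ∷ []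

      module Positions (ys : List ℕ) (ys⊆ : ys ⊆ upTo N₀) (lenys : length ys ≡ N)
        (nearly : ∀ τ → NearlyConstant 4 κ (s ⁴) (productList τ) ys) where

        e : ℕ → ℕ
        e = nth ys

        e-increasing : ∀ {p p′} → p < p′ → p′ < N → e p < e p′
        e-increasing {p} {p′} p<p′ p′<N = increasing-⊆-upTo (⊆-trans (nths-⊆ ys 0 (p ∷ p′ ∷ []) (z≤n , subst (p <_) (sym lenys) (<-trans p<p′ p′<N) , p<p′ , subst (p′ <_) (sym lenys) p′<N , tt)) ys⊆)

        e-bounded : ∀ {p} → p < N → e p < N₀
        e-bounded {p} p<N = bounded-⊆-upTo (⊆-trans (nths-⊆ ys 0 (p ∷ []) (z≤n , subst (p <_) (sym lenys) p<N , tt)) ys⊆)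

        e-injective : ∀ {p p′} → p < N → p′ < N → p ≢ p′ → e p ≢ e p′
        e-injective = increasing⇒≢ e e-increasing

        B : ℕ → List (Fin n)
        B p = V (e p)

        four : ∀ {p q r u} → p < q → q < r → r < u → u < N → e p ∷ e q ∷ e r ∷ e u ∷ [] ⊆ ys
        four {p} {q} {r} {u} p<q q<r r<u u<N = nths-⊆ ys 0 (p ∷ q ∷ r ∷ u ∷ [])
          (z≤n , below (<-trans p<q (<-trans q<r (<-trans r<u u<N))) , p<q , below (<-trans q<r (<-trans r<u u<N)) , q<r , below (<-trans r<u u<N) , r<u , below u<N , tt)
          where
          below : ∀ {x} → x < N → x < length ys
          below {x} = subst (x <_) (sym lenys)

        product-B : ∀ τ p q r u → Products.product R B τ p q r u ≡ Products.product R V τ (e p) (e q) (e r) (e u)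
        product-B LL p q r u = refl
        product-B RR p q r u = refl
        product-B TT p q r u = refl
        product-B LR p q r u = refl
        product-B LT p q r u = refl
        product-B RT p q r u = refl

        near : ∀ τ {p q r u p′ q′ r′ u′} → p < q → q < r → r < u → u < N → p′ < q′ → q′ < r′ → r′ < u′ → u′ < N →
          κ * Products.product R B τ p q r u ≤ κ * Products.product R B τ p′ q′ r′ u′ + s ⁴
        near τ {p} {q} {r} {u} {p′} {q′} {r′} {u′} a b c d a′ b′ c′ d′ =
          subst₂ (λ x y → κ * x ≤ κ * y + s ⁴) (sym (product-B τ p q r u)) (sym (product-B τ p′ q′ r′ u′))
            (nearly τ _ _ (four a b c d) (four a′ b′ c′ d′) refl refl)

        spreadB : ∀ {i j k} → i < N → j < N → k < N → i ≢ j → i ≢ k → j ≢ k → ∀ u → 2 * K * discrepancy R (B i) (B j) (B k) u ≤ s ⁴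
        spreadB i< j< k< i≢j i≢k j≢k = spreadV (e-bounded i<) (e-bounded j<) (e-bounded k<) (e-injective i< j< i≢j) (e-injective i< k< i≢k) (e-injective j< k< j≢k)

        open Assembly R (edge-rotate G) (edge-swapˡ G) B s 0<s (λ k → lenV (e k)) κ κ K N 0<κ ≤-refl N-large κ-large

        M : ℕ → List (Fin n)
        M = merged near spreadB

        -- Domination by `block (e k)`, tested on the indicator of `v`, excludes vertices outside
        -- that block from `B k`. Hence merged blocks inherit the disjointness of the original ones.
        count-block : ∀ {α v} → v ∈ M α → ∃[ k ] k ∈ chunk κ α × 1 ≤ count (block (e k)) v
        count-block {α} {v} v∈ = find-block (∑>0′ (chunk κ α) (λ k → count (B k) v) (≤-trans (∈⇒count v∈) (≤-reflexive (∑-concatMap B (chunk κ α) _))))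
          where
          find-block : (∃[ k ] k ∈ chunk κ α × 1 ≤ count (B k) v) → ∃[ k ] k ∈ chunk κ α × 1 ≤ count (block (e k)) v
          find-block (k , k∈ , hit) = k , k∈ , n≢0⇒n>0 λ none → contradiction
            (≤-trans (*-mono-≤ 0<b hit) (≤-trans (domV (e k) (λ u → 𝟙 (equal v u))) (≤-reflexive (trans (cong (λ t → F * (s * t)) none) (trans (cong (F *_) (*-zeroʳ s)) (*-zeroʳ F)))))) (λ ())

        M-disjoint< : ∀ {α β v} → α < β → β < 7 → v ∈ M α → v ∈ M β → ⊥
        M-disjoint< {α} {β} {v} α<β β<7 v∈α v∈β = clash (count-block {α} v∈α) (count-block {β} v∈β)
          where
          clash : (∃[ k ] k ∈ chunk κ α × 1 ≤ count (block (e k)) v) → (∃[ l ] l ∈ chunk κ β × 1 ≤ count (block (e l)) v) → ⊥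
          clash (k , k∈ , pk) (l , l∈ , pl) = contradiction (≤-trans (+-mono-≤ pk pl) (blocks-disjoint (e-increasing (chunk-< {κ} {α} {β} α<β k∈ l∈) l<N) (e-bounded l<N) v)) (λ { (s≤s ()) })
            where
            l<N : l < N
            l<N = <-≤-trans (proj₂ (chunk-bounds {κ} {β} l∈)) (≤-trans (*-monoˡ-≤ κ β<7) N-large)

        M₇ : ℕ → List (Fin n)
        M₇ = restrict 7 M

        M₇-disjoint : ∀ {α β v} → α ≢ β → v ∈ M₇ α → v ∈ M₇ β → ⊥
        M₇-disjoint = restrict-disjoint 7 M (λ {α} {β} → M-disjoint< {α} {β})

        noOverlap : ∀ {p q r u} → p < q → q < r → r < u → u < M₀ →
          k₀ * innerDeg R (B q) (B r) (B p) (B u) < s ⁴ × k₀ * innerDeg R (B p) (B r) (B q) (B u) < s ⁴ × k₀ * innerDeg R (B q) (B u) (B p) (B r) < s ⁴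
        noOverlap p<q q<r r<u u<M₀ =
          ≰⇒> (λ heavy → noH (copy⇒ContainsH G layoutLR layoutLR-distinct M₇ M₇-disjoint refl
            (embed-LR near spreadB k₀ K-large k₀≤κ 0<κ p<q q<r r<u u<N heavy))) ,
          ≰⇒> (λ heavy → noH (copy⇒ContainsH G layoutLT layoutLT-distinct M₇ M₇-disjoint refl
            (embed-LT near spreadB k₀ K-large k₀≤κ 0<κ p<q q<r r<u u<N heavy))) ,
          ≰⇒> (λ heavy → noH (copy⇒ContainsH G layoutRT layoutRT-distinct M₇ M₇-disjoint refl
            (embed-RT near spreadB k₀ K-large k₀≤κ 0<κ p<q q<r r<u u<N heavy)))
          where
          u<N = <-≤-trans u<M₀ M₀≤N

        open Overlap R (edge-rotate G) (edge-swapʳ G) q M₁ κ₂ Kr θ M₀ h₂ F₂ K₂ k₀ 0<q κ₂≡ Kr≡ θ≡ 0<M₀ M₀-large h₂-large F₂≡ 0<K₂ K₂-large k₀-large B s 0<s (λ k → lenV (e k))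

        hereditary : Hereditary
        hereditary W w 0<w lenW dom e′ e′-inc few = Hereditary.impossible G q r M₁ (2 * N₀ * F * F₂) w 0<q
          (*-mono-≤ (*-mono-≤ (*-mono-≤ (s≤s (z≤n {1})) 0<N₀) 0<F) 0<F₂) 0<w M₁-large r-large n-large dense (λ k → W (e′ k)) (λ k → lenW (e′ k))
          -- The domination factors of three stages multiply: a block among all vertices, `B` in the
          -- blocks, and `W` in `B`.
          (λ k → dominated-trans (2 * N₀ * F) F₂ n s w (W (e′ k)) (B (e′ k)) (vertices n) 0<s
            (dominated-trans (2 * N₀) F n b s (B (e′ k)) (block (e (e′ k))) (vertices n) 0<b (dominated-block (2 * N₀) n≤ (e (e′ k))) (domV (e (e′ k))))
            (dom (e′ k)))
          (λ {i} {j} {k} → few {i} {j} {k})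

        absurd : ⊥
        absurd = overlaps hereditary (λ {p} {q} {r} {u} → noOverlap {p} {q} {r} {u})

      absurd : ⊥
      absurd = start (ramsey-nearlyConstant 4 N κ (s ⁴) {{Data.Nat.>-nonZero (*-mono-≤ (*-mono-≤ 0<s 0<s) (*-mono-≤ 0<s 0<s))}} kinds (upTo N₀)
          (productList≤ LL ∷ productList≤ RR ∷ productList≤ TT ∷ productList≤ LR ∷ productList≤ LT ∷ productList≤ RT ∷ [])
          (≤-trans N₀-large (≤-reflexive (sym (length-upTo N₀)))))
        where
        start : (∃[ ys ] ys ⊆ upTo N₀ × length ys ≡ N × All (λ f → NearlyConstant 4 κ (s ⁴) f ys) kinds) → ⊥
        start (ys , ys⊆ , lenys , (nLL ∷ nRR ∷ nTT ∷ nLR ∷ nLT ∷ nRT ∷ [])) = Positions.absurd ys ys⊆ lenys nearly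
          where
          nearly : ∀ τ → NearlyConstant 4 κ (s ⁴) (productList τ) ys
          nearly LL = nLL
          nearly RR = nRR
          nearly TT = nTT
          nearly LR = nLR
          nearly LT = nLT
          nearly RT = nRT

  impossible : ⊥
  impossible = regularise-from (2 * K) 1≤2K tasks h 0 block b 0<b length-block z≤n fuel
    λ V s 0<s lenV domV regV → Regularised.absurd V s 0<s lenV (λ k → subst (λ F → Dominated F b s (V k) (block k)) (sym F≡) (domV k)) (λ {τ} → regV {τ})

-- From rational to integral inequalities.

module _ where

  private
    ℚᵘ-of : ℕ → ℚᵘ.ℚᵘ
    ℚᵘ-of m = ℚᵘ.mkℚᵘ (pos m) 0

    toℚᵘ-ℕ : ∀ m → ℚ.toℚᵘ (ℕtoℚ m) ℚᵘ.≃ ℚᵘ-of m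
    toℚᵘ-ℕ m = ℚ.toℚᵘ-fromℚᵘ (ℚᵘ-of m)

    difference : ∀ δ ε m N → ℚ.toℚᵘ (δ ℚ.* ℕtoℚ m ℚ.- ε ℚ.* ℕtoℚ N) ℚᵘ.≃ ℚ.toℚᵘ δ ℚᵘ.* ℚᵘ-of m ℚᵘ.+ ℚᵘ.- (ℚ.toℚᵘ ε ℚᵘ.* ℚᵘ-of N)
    difference δ ε m N = ℚᵘ.≃-trans (ℚ.toℚᵘ-homo-+ (δ ℚ.* ℕtoℚ m) (ℚ.- (ε ℚ.* ℕtoℚ N)))
      (ℚᵘ.+-cong (scaled δ m) (ℚᵘ.≃-trans (ℚ.toℚᵘ-homo‿- (ε ℚ.* ℕtoℚ N)) (ℚᵘ.-‿cong (scaled ε N))))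
      where
      scaled : ∀ x k → ℚ.toℚᵘ (x ℚ.* ℕtoℚ k) ℚᵘ.≃ ℚ.toℚᵘ x ℚᵘ.* ℚᵘ-of k
      scaled x k = ℚᵘ.≃-trans (ℚ.toℚᵘ-homo-* x (ℕtoℚ k)) (ℚᵘ.*-cong (ℚᵘ.≃-refl {ℚ.toℚᵘ x}) (toℚᵘ-ℕ k))

    restore : ∀ a b → (pos a ℤ.+ ℤ.- (pos b)) ℤ.+ pos b ≡ pos a
    restore a b = trans (ℤ.+-assoc (pos a) (ℤ.- (pos b)) (pos b)) (trans (cong (λ t → pos a ℤ.+ t) (ℤ.+-inverseˡ (pos b))) (ℤ.+-identityʳ (pos a)))

    minus-≤ : ∀ a b c → pos a ℤ.+ ℤ.- (pos b) ℤ.≤ pos c → a ≤ c + b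
    minus-≤ a b c h = ℤ.drop‿+≤+ (subst (ℤ._≤ pos (c + b)) (restore a b) (ℤ.+-monoˡ-≤ (pos b) h))

    ≤-minus : ∀ a b c → a ≤ c + b → pos a ℤ.+ ℤ.- (pos b) ℤ.≤ pos c
    ≤-minus a b c h = ≤-by (ℤ.+-monoˡ-≤ (ℤ.- (pos b)) (ℤ.+≤+ h))
      where
      ≤-by : pos a ℤ.+ ℤ.- (pos b) ℤ.≤ pos (c + b) ℤ.+ ℤ.- (pos b) → pos a ℤ.+ ℤ.- (pos b) ℤ.≤ pos c
      ≤-by = subst (pos a ℤ.+ ℤ.- (pos b) ℤ.≤_) (trans (ℤ.+-assoc (pos c) (pos b) (ℤ.- (pos b))) (trans (cong (λ t → pos c ℤ.+ t) (ℤ.+-inverseʳ (pos b))) (ℤ.+-identityʳ (pos c))))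

    product₃ : ∀ a b c → (pos a ℤ.* pos b) ℤ.* pos c ≡ pos (a * b * c)
    product₃ a b c = trans (cong (ℤ._* pos c) (sym (ℤ.pos-* a b))) (sym (ℤ.pos-* (a * b) c))

    module _ (P d p r m N E : ℕ) where

      R₁ D₁ : ℕ
      R₁ = suc r * 1
      D₁ = suc d * 1

      numerator : ((pos P ℤ.* pos m) ℤ.* pos R₁ ℤ.+ (ℤ.- (pos p ℤ.* pos N)) ℤ.* pos D₁) ℤ.* pos 1 ≡ pos (P * m * R₁) ℤ.+ ℤ.- (pos (p * N * D₁))
      numerator = trans (ℤ.*-identityʳ _) (cong₂ ℤ._+_ (product₃ P m R₁) (trans (sym (ℤ.neg-distribˡ-* (pos p ℤ.* pos N) (pos D₁))) (cong ℤ.-_ (product₃ p N D₁))))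

      unnormalised⇒ℕ : ℚᵘ.mkℚᵘ (pos P) d ℚᵘ.* ℚᵘ-of m ℚᵘ.+ ℚᵘ.- (ℚᵘ.mkℚᵘ (pos p) r ℚᵘ.* ℚᵘ-of N) ℚᵘ.≤ ℚᵘ-of E → P * m * R₁ ≤ E * (D₁ * R₁) + p * N * D₁
      unnormalised⇒ℕ h = minus-≤ (P * m * R₁) (p * N * D₁) (E * (D₁ * R₁)) (subst₂ ℤ._≤_ numerator (sym (ℤ.pos-* E (D₁ * R₁))) (ℚᵘ.drop-*≤* h))

      ℕ⇒unnormalised : P * m * R₁ ≤ E * (D₁ * R₁) + p * N * D₁ → ℚᵘ.mkℚᵘ (pos P) d ℚᵘ.* ℚᵘ-of m ℚᵘ.+ ℚᵘ.- (ℚᵘ.mkℚᵘ (pos p) r ℚᵘ.* ℚᵘ-of N) ℚᵘ.≤ ℚᵘ-of E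
      ℕ⇒unnormalised h = ℚᵘ.*≤* (subst₂ ℤ._≤_ (sym numerator) (ℤ.pos-* E (D₁ * R₁)) (≤-minus (P * m * R₁) (p * N * D₁) (E * (D₁ * R₁)) h))

  density⇒ℕ : ∀ P d .(cδ : Coprime P (suc d)) p r .(cε : Coprime p (suc r)) m N E →
    mkℚ (pos P) d cδ ℚ.* ℕtoℚ m ℚ.- mkℚ (pos p) r cε ℚ.* ℕtoℚ N ℚ.≤ ℕtoℚ E → P * m * suc r ≤ E * (suc d * suc r) + p * N * suc d
  density⇒ℕ P d cδ p r cε m N E h = subst₂ (λ R D → P * m * R ≤ E * (D * R) + p * N * D) (*-identityʳ (suc r)) (*-identityʳ (suc d))
    (unnormalised⇒ℕ P d p r m N E (ℚᵘ.≤-respˡ-≃ (difference (mkℚ (pos P) d cδ) (mkℚ (pos p) r cε) m N) (ℚᵘ.≤-respʳ-≃ (toℚᵘ-ℕ E) (ℚ.toℚᵘ-mono-≤ h))))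

  ℕ⇒density : ∀ P d .(cδ : Coprime P (suc d)) p r .(cε : Coprime p (suc r)) m N E →
    P * m * suc r ≤ E * (suc d * suc r) + p * N * suc d → mkℚ (pos P) d cδ ℚ.* ℕtoℚ m ℚ.- mkℚ (pos p) r cε ℚ.* ℕtoℚ N ℚ.≤ ℕtoℚ E
  ℕ⇒density P d cδ p r cε m N E h = ℚ.toℚᵘ-cancel-≤ (ℚᵘ.≤-respˡ-≃ (ℚᵘ.≃-sym (difference (mkℚ (pos P) d cδ) (mkℚ (pos p) r cε) m N)) (ℚᵘ.≤-respʳ-≃ (ℚᵘ.≃-sym (toℚᵘ-ℕ E))
    (ℕ⇒unnormalised P d p r m N E (subst₂ (λ R D → P * m * R ≤ E * (D * R) + p * N * D) (sym (*-identityʳ (suc r))) (sym (*-identityʳ (suc d))) h))))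

-- Bound variables for the constants of the argument, so that they are never evaluated.
constant : ∀ {A : Set} (x : ℕ) → (∀ y → y ≡ x → A) → A
constant x k = k x refl

-- The hypothesis has density `1 / 27 + 1 / (27 * q)` and error `1 / r`. The constants are chosen
-- against the order of their use: the triangle count determines the size `k₀` of a large overlap,
-- this determines the precision `K` of the embedding and `κ` for Ramsey's theorem, these the number
-- of blocks, and all of them `r` and the least size of the 3-graph.
dense-family⇒⊥ : ∀ q → 0 < q → (∀ r N → 0 < r → ∃[ n ] N ≤ n × Σ (ThreeGraph n) λ G →
  (∀ X → (q + 1) * r * (card X choose 3) ≤ 27 * q * r * edgesIn G X + 27 * q * (n * n * n)) × ¬ ContainsH G) → ⊥
dense-family⇒⊥ q 0<q family =
  constant (208 * q) λ κ₂ κ₂≡ → constant (648 * q) λ Kr Kr≡ → constant (432 * q) λ θ θ≡ → constant (648 * q) λ M₁ M₁≡ →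
  constant (suc (ramseysBound {ℕ} 2 (3 * suc κ₂) M₁)) λ M₀ M₀≡ → constant (suc (Kr * Kr * (M₀ * (M₀ * 6)))) λ h₂ h₂≡ → constant (Kr ^ h₂) λ F₂ F₂≡ →
  constant (suc (θ * 3 * (F₂ * F₂ * F₂))) λ K₂ K₂≡ → constant (θ * 3 * (M₀ * (F₂ * F₂ * (K₂ * K₂)))) λ k₀ k₀≡ →
  constant (suc (embeddingPrecision (2 * k₀))) λ K K≡ → constant (suc (8 * (2 * K * (2 * K)) + 2 * k₀)) λ κ κ≡ → constant (M₀ + 7 * κ) λ N N≡ →
  constant (ramseysBound {ℕ} 4 (6 * suc κ) N) λ N₀-1 N₀≡ → constant (suc (2 * K * (2 * K) * (suc N₀-1 * (suc N₀-1 * (suc N₀-1 * 1))))) λ h h≡ → constant ((2 * K) ^ h) λ F F≡ →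
  constant (2 * suc N₀-1 * F * F₂) λ F₃ F₃≡ → constant (suc (1296 * q * (F₃ * F₃ * F₃))) λ r r≡ →
  finish κ₂ Kr θ M₁ M₀ h₂ F₂ K₂ k₀ K κ N N₀-1 h F F₃ r κ₂≡ Kr≡ θ≡ M₁≡ M₀≡ h₂≡ F₂≡ K₂≡ k₀≡ K≡ κ≡ N≡ N₀≡ h≡ F≡ F₃≡ r≡
    (family r (suc N₀-1 + 24 * (q + 1) * F₃) (subst (0 <_) (sym r≡) z<s))
  where
  finish : ∀ κ₂ Kr θ M₁ M₀ h₂ F₂ K₂ k₀ K κ N N₀-1 h F F₃ r → κ₂ ≡ 208 * q → Kr ≡ 648 * q → θ ≡ 432 * q → M₁ ≡ 648 * q →
    M₀ ≡ suc (ramseysBound {ℕ} 2 (3 * suc κ₂) M₁) → h₂ ≡ suc (Kr * Kr * (M₀ * (M₀ * 6))) → F₂ ≡ Kr ^ h₂ →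
    K₂ ≡ suc (θ * 3 * (F₂ * F₂ * F₂)) → k₀ ≡ θ * 3 * (M₀ * (F₂ * F₂ * (K₂ * K₂))) →
    K ≡ suc (embeddingPrecision (2 * k₀)) → κ ≡ suc (8 * (2 * K * (2 * K)) + 2 * k₀) → N ≡ M₀ + 7 * κ →
    N₀-1 ≡ ramseysBound {ℕ} 4 (6 * suc κ) N → h ≡ suc (2 * K * (2 * K) * (suc N₀-1 * (suc N₀-1 * (suc N₀-1 * 1)))) → F ≡ (2 * K) ^ h →
    F₃ ≡ 2 * suc N₀-1 * F * F₂ → r ≡ suc (1296 * q * (F₃ * F₃ * F₃)) →
    (∃[ n ] suc N₀-1 + 24 * (q + 1) * F₃ ≤ n × Σ (ThreeGraph n) λ G →
      (∀ X → (q + 1) * r * (card X choose 3) ≤ 27 * q * r * edgesIn G X + 27 * q * (n * n * n)) × ¬ ContainsH G) → ⊥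
  finish κ₂ Kr θ M₁ M₀ h₂ F₂ K₂ k₀ K κ N N₀-1 h F F₃ r κ₂≡ Kr≡ θ≡ M₁≡ M₀≡ h₂≡ F₂≡ K₂≡ k₀≡ K≡ κ≡ N≡ N₀≡ h≡ F≡ F₃≡ r≡ (n , n≥ , G , dense , noH) =
    Upper.impossible G noH q M₁ κ₂ Kr θ M₀ h₂ F₂ K₂ k₀ K κ N N₀ h F r b 0<q κ₂≡ Kr≡ θ≡ (≤-reflexive (sym M₁≡))
      (positive M₀≡) (below M₀≡ (n≤1+n _)) (≤-reflexive (sym h₂≡)) F₂≡ (positive K₂≡) (below K₂≡ (n≤1+n _)) (≤-reflexive (sym k₀≡))
      (positive K≡) (below K≡ (n≤1+n _)) (below κ≡ (≤-trans (m≤m+n _ (2 * k₀)) (n≤1+n _))) (below κ≡ (≤-trans (m≤n+m (2 * k₀) (8 * (2 * K * (2 * K)))) (n≤1+n _))) (positive κ≡)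
      (below N≡ (m≤m+n M₀ (7 * κ))) (below N≡ (m≤n+m (7 * κ) M₀)) (≤-trans (≤-reflexive (sym N₀≡)) (n≤1+n N₀-1))
      (≤-reflexive (sym h≡)) F≡ 0<b fits n≤2N₀b
      (subst (0 <_) (sym F₂≡) (m^n>0 Kr {{Data.Nat.>-nonZero (subst (0 <_) (sym Kr≡) (*-mono-≤ (s≤s (z≤n {647})) 0<q))}} h₂))
      (subst (λ f → 1296 * q * (f * f * f) ≤ r) F₃≡ (below r≡ (n≤1+n _)))
      (subst (λ f → 24 * (q + 1) * f ≤ n) F₃≡ (≤-trans (m≤n+m _ N₀) n≥))
      dense
    where
    N₀ = suc N₀-1
    b = n / N₀
    positive : ∀ {x y} → x ≡ suc y → 0 < x
    positive eq = subst (0 <_) (sym eq) z<s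
    below : ∀ {x y z} → x ≡ y → z ≤ y → z ≤ x
    below eq h = ≤-trans h (≤-reflexive (sym eq))
    fits : N₀ * b ≤ n
    fits = ≤-trans (≤-reflexive (*-comm N₀ b)) (m/n*n≤m n N₀)
    0<b : 0 < b
    0<b = m≥n⇒m/n>0 {n} {N₀} (≤-trans (m≤m+n N₀ _) n≥)
    -- The remainder is less than `N₀`, hence at most `N₀ * b`, as `b` is positive.
    n≤2N₀b : n ≤ 2 * N₀ * b
    n≤2N₀b = begin
      n                   ≡⟨ m≡m%n+[m/n]*n n N₀ ⟩
      n % N₀ + b * N₀     ≤⟨ +-monoˡ-≤ (b * N₀) (<⇒≤ (m%n<n n N₀)) ⟩
      N₀ + b * N₀         ≤⟨ +-monoˡ-≤ (b * N₀) (≤-trans (≤-reflexive (sym (*-identityˡ N₀))) (*-monoˡ-≤ N₀ 0<b)) ⟩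
      b * N₀ + b * N₀     ≡⟨ twice b N₀ ⟩
      2 * N₀ * b          ∎
      where
      open ≤-Reasoning
      twice : ∀ b N → b * N + b * N ≡ 2 * N * b
      twice = solve-∀

-- Take the denominator of `δ` as `q`. By integrality of the numerators, a density above `1 / 27` is
-- at least `1 / 27 + 1 / (27 * q)`, which is a fixed excess.
upper-bound : ∀ δ → Achievable δ → δ ℚ.≤ (pos 1) ℚ./ 27
upper-bound δ@(mkℚ (pos P) d c) (_ , _ , family) = decidable-stable (δ ℚ.≤? (pos 1) ℚ./ 27) λ δ≰ →
  dense-family⇒⊥ (suc d) z<s λ { r@(suc r-1) N _ → convert r-1 (ℤ.drop‿+<+ (subst₂ ℤ._<_ (sym (ℤ.pos-* 1 (suc d))) (sym (ℤ.pos-* P 27)) (ℚ.drop-*<* (ℚ.≰⇒> δ≰)))) (family (mkℚ (pos 1) r-1 (1-coprimeTo r)) (ℚ.*<* (ℤ.+<+ z<s)) N) }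
  where
  convert : ∀ r-1 {N} → 1 * suc d < P * 27 →
    (∃[ n ] N ≤ n × Σ (ThreeGraph n) λ G → Dense (mkℚ (pos P) d c) (mkℚ (pos 1) r-1 (1-coprimeTo (suc r-1))) G × ¬ ContainsH G) →
    ∃[ n ] N ≤ n × Σ (ThreeGraph n) λ G →
      (∀ X → (suc d + 1) * suc r-1 * (card X choose 3) ≤ 27 * suc d * suc r-1 * edgesIn G X + 27 * suc d * (n * n * n)) × ¬ ContainsH G
  convert r-1 {N} large (n , N≤n , G , dense , noH) = n , N≤n , G , (λ X → begin
    (suc d + 1) * suc r-1 * (card X choose 3)  ≤⟨ *-monoˡ-≤ (card X choose 3) (*-monoˡ-≤ (suc r-1) (≤-trans (≤-reflexive (e₀ d)) large)) ⟩
    P * 27 * suc r-1 * (card X choose 3)       ≡⟨ e₁ P (suc r-1) (card X choose 3) ⟩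
    27 * (P * (card X choose 3) * suc r-1)     ≤⟨ *-monoʳ-≤ 27 (density⇒ℕ P d c 1 r-1 (1-coprimeTo (suc r-1)) (card X choose 3) (n ^ 3) (edgesIn G X) (dense X)) ⟩
    27 * (edgesIn G X * (suc d * suc r-1) + 1 * n ^ 3 * suc d) ≡⟨ e₂ (edgesIn G X) (suc d) (suc r-1) n ⟩
    27 * suc d * suc r-1 * edgesIn G X + 27 * suc d * (n * n * n) ∎) , noH
    where
    open ≤-Reasoning
    e₀ : ∀ d → suc d + 1 ≡ suc (1 * suc d)
    e₀ = solve-∀
    e₁ : ∀ P r m → P * 27 * r * m ≡ 27 * (P * m * r)
    e₁ = solve-∀
    e₂ : ∀ E d r n → 27 * (E * (d * r) + 1 * (n * (n * (n * 1))) * d) ≡ 27 * d * r * E + 27 * d * (n * n * n)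
    e₂ = solve-∀
upper-bound (mkℚ -[1+ P ] d c) (ℚ.*≤* () , _)

-- Moments of a random function from points to colours.

colours : List (Fin 3)
colours = vertices 3

functions : ∀ m → List (Vec.Vec (Fin 3) m)
functions zero    = Vec.[] ∷ []
functions (suc m) = concatMap (λ c → map (c Vec.∷_) (functions m)) colours

∑-functions : ∀ m (φ : Vec.Vec (Fin 3) (suc m) → ℕ) → ∑ (functions (suc m)) φ ≡ (∑[ c ← colours ] ∑[ f ← functions m ] φ (c Vec.∷ f))
∑-functions m φ = trans (∑-concatMap (λ c → map (c Vec.∷_) (functions m)) colours φ) (∑-cong colours (λ c → ∑-map (c Vec.∷_) (functions m) φ))

length-functions : ∀ m → length (functions m) ≡ 3 ^ m
length-functions zero    = refl
length-functions (suc m) = begin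
  length (functions (suc m))                ≡⟨ ones (functions (suc m)) ⟩
  (∑[ f ← functions (suc m) ] 1)            ≡⟨ ∑-functions m (λ _ → 1) ⟩
  (∑[ c ← colours ] ∑[ f ← functions m ] 1) ≡⟨ ∑-cong colours (λ _ → trans (sym (ones (functions m))) (length-functions m)) ⟩
  (∑[ c ← colours ] 3 ^ m)                  ≡⟨ ∑-const colours (3 ^ m) ⟩
  3 ^ suc m                                 ∎
  where
  open ≡-Reasoning
  ones : ∀ {A : Set} (xs : List A) → length xs ≡ ∑ xs (λ _ → 1)
  ones xs = sym (trans (∑-const xs 1) (*-identityʳ _))

∑-colours : ∀ (k : Fin 3) (g : ℕ → ℕ) → (∑[ c ← colours ] g (𝟙 (equal c k))) ≡ g 1 + 2 * g 0
∑-colours zero             g = cong (g 1 +_) refl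
∑-colours (suc zero)       g = e (g 0) (g 1)
  where
  e : ∀ a b → a + (b + (a + 0)) ≡ b + 2 * a
  e = solve-∀
∑-colours (suc (suc zero)) g = e (g 0) (g 1)
  where
  e : ∀ a b → a + (a + (b + 0)) ≡ b + 2 * a
  e = solve-∀

module _ (k : Fin 3) where

  -- For random `f` this is a sum of independent variables, each equal to `a p` with probability
  -- `1 / 3` and to 0 otherwise.
  hits : ∀ {m} → (Fin m → ℕ) → Vec.Vec (Fin 3) m → ℕ
  hits {m} a f = ∑[ p ← vertices m ] a p * 𝟙 (equal (Vec.lookup f p) k)

  hits-∷ : ∀ {m} (a : Fin (suc m) → ℕ) c f → hits a (c Vec.∷ f) ≡ a zero * 𝟙 (equal c k) + hits (a ∘ suc) f
  hits-∷ {m} a c f = cong (a zero * 𝟙 (equal c k) +_) (∑-map suc (vertices m) _)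

  ∑-hits : ∀ {m} (a : Fin (suc m) → ℕ) (g : ℕ → ℕ) →
    (∑[ f ← functions (suc m) ] g (hits a f)) ≡ (∑[ f ← functions m ] g (a zero + hits (a ∘ suc) f)) + 2 * (∑[ f ← functions m ] g (hits (a ∘ suc) f))
  ∑-hits {m} a g = begin
    (∑[ f ← functions (suc m) ] g (hits a f)) ≡⟨ ∑-functions m _ ⟩
    (∑[ c ← colours ] ∑[ f ← functions m ] g (hits a (c Vec.∷ f))) ≡⟨ ∑₂-cong colours (functions m) (λ c f → cong g (hits-∷ a c f)) ⟩
    (∑[ c ← colours ] ∑[ f ← functions m ] g (a zero * 𝟙 (equal c k) + hits (a ∘ suc) f))
      ≡⟨ ∑-colours k (λ t → ∑[ f ← functions m ] g (a zero * t + hits (a ∘ suc) f)) ⟩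
    (∑[ f ← functions m ] g (a zero * 1 + hits (a ∘ suc) f)) + 2 * (∑[ f ← functions m ] g (a zero * 0 + hits (a ∘ suc) f))
      ≡⟨ cong₂ (λ s t → s + 2 * t) (∑-cong (functions m) (λ f → cong (λ t → g (t + hits (a ∘ suc) f)) (*-identityʳ (a zero)))) (∑-cong (functions m) (λ f → cong (λ t → g (t + hits (a ∘ suc) f)) (*-zeroʳ (a zero)))) ⟩
    (∑[ f ← functions m ] g (a zero + hits (a ∘ suc) f)) + 2 * (∑[ f ← functions m ] g (hits (a ∘ suc) f)) ∎
    where open ≡-Reasoning

  ∑-const-functions : ∀ m c → (∑[ f ← functions m ] c) ≡ 3 ^ m * c
  ∑-const-functions m c = trans (∑-const (functions m) c) (cong (_* c) (length-functions m))

  first-moment : ∀ m (a : Fin m → ℕ) → 3 * (∑[ f ← functions m ] hits a f) ≡ 3 ^ m * ∑ (vertices m) a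
  first-moment zero    a = refl
  first-moment (suc m) a = begin
    3 * (∑[ f ← functions (suc m) ] hits a f) ≡⟨ cong (3 *_) (∑-hits a id) ⟩
    3 * ((∑[ f ← functions m ] a zero + hits a′ f) + 2 * S) ≡⟨ cong (λ t → 3 * (t + 2 * S)) (trans (∑-+ (functions m) _ _) (cong (_+ S) (∑-const-functions m (a zero)))) ⟩
    3 * (N * a zero + S + 2 * S)              ≡⟨ e₁ N (a zero) S ⟩
    3 * (N * a zero) + 3 * (3 * S)            ≡⟨ cong (λ t → 3 * (N * a zero) + 3 * t) (first-moment m a′) ⟩
    3 * (N * a zero) + 3 * (N * A′)           ≡⟨ e₂ N (a zero) A′ ⟩
    3 * N * (a zero + A′)                     ≡⟨ cong (λ t → 3 * N * (a zero + t)) (sym (∑-map suc (vertices m) a)) ⟩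
    3 ^ suc m * ∑ (vertices (suc m)) a        ∎
    where
    open ≡-Reasoning
    N = 3 ^ m
    a′ = a ∘ suc
    S = ∑[ f ← functions m ] hits a′ f
    A′ = ∑ (vertices m) a′
    e₁ : ∀ N x S → 3 * (N * x + S + 2 * S) ≡ 3 * (N * x) + 3 * (3 * S)
    e₁ = solve-∀
    e₂ : ∀ N x A → 3 * (N * x) + 3 * (N * A) ≡ 3 * N * (x + A)
    e₂ = solve-∀

  -- For different points the product of the two indicators has mean `1 / 9`, on the diagonal it has
  -- mean `1 / 3`; this excess is the origin of the coefficient 2. The induction adds one point at a
  -- time.
  second-moment : ∀ m (a : Fin m → ℕ) → let A = ∑ (vertices m) a in
    9 * (∑[ f ← functions m ] hits a f * hits a f) ≡ 3 ^ m * (A * A + 2 * (∑[ p ← vertices m ] a p * a p))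
  second-moment zero    a = refl
  second-moment (suc m) a = begin
    9 * (∑[ f ← functions (suc m) ] hits a f * hits a f) ≡⟨ cong (9 *_) (∑-hits a (λ t → t * t)) ⟩
    9 * ((∑[ f ← functions m ] (x + hits a′ f) * (x + hits a′ f)) + 2 * S₂) ≡⟨ cong (λ t → 9 * (t + 2 * S₂)) square ⟩
    9 * (N * (x * x) + 2 * x * S + S₂ + 2 * S₂) ≡⟨ e₁ N x S S₂ ⟩
    9 * (N * (x * x)) + 6 * x * (3 * S) + 3 * (9 * S₂) ≡⟨ cong₂ (λ s t → 9 * (N * (x * x)) + 6 * x * s + 3 * t) (first-moment m a′) (second-moment m a′) ⟩
    9 * (N * (x * x)) + 6 * x * (N * A′) + 3 * (N * (A′ * A′ + 2 * Q′)) ≡⟨ e₂ N x A′ Q′ ⟩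
    3 * N * ((x + A′) * (x + A′) + 2 * (x * x + Q′))
      ≡⟨ cong₂ (λ s t → 3 * N * ((x + s) * (x + s) + 2 * (x * x + t))) (sym (∑-map suc (vertices m) a)) (sym (∑-map suc (vertices m) (λ p → a p * a p))) ⟩
    _ ∎
    where
    open ≡-Reasoning
    N = 3 ^ m
    x = a zero
    a′ = a ∘ suc
    S = ∑[ f ← functions m ] hits a′ f
    S₂ = ∑[ f ← functions m ] hits a′ f * hits a′ f
    A′ = ∑ (vertices m) a′
    Q′ = ∑[ p ← vertices m ] a′ p * a′ p
    d : ∀ x h → (x + h) * (x + h) ≡ x * x + 2 * x * h + h * h
    d = solve-∀
    square : (∑[ f ← functions m ] (x + hits a′ f) * (x + hits a′ f)) ≡ N * (x * x) + 2 * x * S + S₂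
    square = trans (∑-cong (functions m) (λ f → d x (hits a′ f))) (trans (∑-+ (functions m) _ _) (cong (_+ S₂) (trans (∑-+ (functions m) _ _) (cong₂ _+_ (∑-const-functions m (x * x)) (∑-* (2 * x) (functions m) _)))))
    e₁ : ∀ N x S T → 9 * (N * (x * x) + 2 * x * S + T + 2 * T) ≡ 9 * (N * (x * x)) + 6 * x * (3 * S) + 3 * (9 * T)
    e₁ = solve-∀
    e₂ : ∀ N x A Q → 9 * (N * (x * x)) + 6 * x * (N * A) + 3 * (N * (A * A + 2 * Q)) ≡ 3 * N * ((x + A) * (x + A) + 2 * (x * x + Q))
    e₂ = solve-∀

  deviation : ∀ {m} → (Fin m → ℕ) → Vec.Vec (Fin 3) m → ℕ
  deviation {m} a f = ∣ 3 * hits a f - ∑ (vertices m) a ∣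

  deviation² : ∀ m (a : Fin m → ℕ) → (∑[ f ← functions m ] deviation a f * deviation a f) ≡ 2 * 3 ^ m * (∑[ p ← vertices m ] a p * a p)
  deviation² m a = +-cancelʳ-≡ (2 * A * (N * A)) _ _ (begin
    D + 2 * A * (N * A)          ≡⟨ cong (λ t → D + 2 * A * t) (sym (first-moment m a)) ⟩
    D + 2 * A * (3 * S)          ≡⟨ cong (D +_) (trans (e₁ A S) (sym (∑-* (6 * A) (functions m) _))) ⟩
    D + (∑[ f ← functions m ] 6 * A * hits a f) ≡⟨ sym (∑-+ (functions m) _ _) ⟩
    (∑[ f ← functions m ] deviation a f * deviation a f + 6 * A * hits a f)
      ≡⟨ ∑-cong (functions m) (λ f → trans (cong (deviation a f * deviation a f +_) (e₂ A (hits a f))) (trans (∣-∣² (3 * hits a f) A) (cong (_+ A * A) (e₃ (hits a f))))) ⟩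
    (∑[ f ← functions m ] 9 * (hits a f * hits a f) + A * A) ≡⟨ trans (∑-+ (functions m) _ _) (cong₂ _+_ (trans (∑-* 9 (functions m) _) (second-moment m a)) (∑-const-functions m (A * A))) ⟩
    N * (A * A + 2 * Q) + N * (A * A) ≡⟨ e₄ N A Q ⟩
    2 * N * Q + 2 * A * (N * A)  ∎)
    where
    open ≡-Reasoning
    N = 3 ^ m
    A = ∑ (vertices m) a
    Q = ∑[ p ← vertices m ] a p * a p
    S = ∑[ f ← functions m ] hits a f
    D = ∑[ f ← functions m ] deviation a f * deviation a f
    e₁ : ∀ A S → 2 * A * (3 * S) ≡ 6 * A * S
    e₁ = solve-∀
    e₂ : ∀ A h → 6 * A * h ≡ 2 * (3 * h * A)
    e₂ = solve-∀
    e₃ : ∀ h → 3 * h * (3 * h) ≡ 9 * (h * h)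
    e₃ = solve-∀
    e₄ : ∀ N A Q → N * (A * A + 2 * Q) + N * (A * A) ≡ 2 * N * Q + 2 * A * (N * A)
    e₄ = solve-∀

  -- By the Cauchy-Schwarz inequality the mean deviation is at most the square root of `2 * m` times
  -- the largest possible weight `3 ^ m`, and `2 * (r * r) ≤ m` makes this root at most `m / r`.
  deviation-small : ∀ r m (a : Fin m → ℕ) → 2 * (r * r) ≤ m → (∀ p → a p ≤ 3 ^ m) → r * (∑[ f ← functions m ] deviation a f) ≤ m * (3 ^ m * 3 ^ m)
  deviation-small r m a large a≤ = m²≤n²⇒m≤n (begin
    r * D * (r * D)          ≡⟨ e₁ r D ⟩
    r * r * (D * D)          ≤⟨ *-monoʳ-≤ (r * r) (cauchy (functions m) (deviation a)) ⟩
    r * r * (length (functions m) * (∑[ f ← functions m ] deviation a f * deviation a f)) ≡⟨ cong₂ (λ l t → r * r * (l * t)) (length-functions m) (deviation² m a) ⟩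
    r * r * (N * (2 * N * Q)) ≤⟨ *-monoʳ-≤ (r * r) (*-monoʳ-≤ N (*-monoʳ-≤ (2 * N) Q≤)) ⟩
    r * r * (N * (2 * N * (m * (N * N)))) ≡⟨ e₂ r N m ⟩
    2 * (r * r) * (m * (N * N * (N * N))) ≤⟨ *-monoˡ-≤ (m * (N * N * (N * N))) large ⟩
    m * (m * (N * N * (N * N))) ≡⟨ e₃ m (N * N) ⟩
    m * (N * N) * (m * (N * N)) ∎)
    where
    open ≤-Reasoning
    N = 3 ^ m
    Q = ∑[ p ← vertices m ] a p * a p
    D = ∑[ f ← functions m ] deviation a f
    Q≤ : Q ≤ m * (N * N)
    Q≤ = ≤-trans (∑-≤ (vertices m) (λ p → *-mono-≤ (a≤ p) (a≤ p))) (≤-reflexive (cong (_* (N * N)) (length-vertices m)))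
    e₁ : ∀ r D → r * D * (r * D) ≡ r * r * (D * D)
    e₁ = solve-∀
    e₂ : ∀ r N m → r * r * (N * (2 * N * (m * (N * N)))) ≡ 2 * (r * r) * (m * (N * N * (N * N)))
    e₂ = solve-∀
    e₃ : ∀ m k → m * (m * (k * k)) ≡ m * k * (m * k)
    e₃ = solve-∀

-- A quasirandom colouring of ordered pairs.

module Construction (B m : ℕ) where

  Vertex : Set
  Vertex = Fin B × Fin m × Vec.Vec (Fin 3) m

  allVertices : List Vertex
  allVertices = vertices B ⊗ vertices m ⊗ functions m

  blockOf : Vertex → Fin B
  blockOf = proj₁

  pointOf : Vertex → Fin m
  pointOf = proj₁ ∘ proj₂

  functionOf : Vertex → Vec.Vec (Fin 3) m
  functionOf = proj₂ ∘ proj₂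

  earlier : Vertex → Vertex → Bool
  earlier x y = toℕ (blockOf x) Data.Nat.<ᵇ toℕ (blockOf y)

  coloured : Fin 3 → Vertex → Vertex → Bool
  coloured c x y = equal (Vec.lookup (functionOf y) (pointOf x)) c

  private
    N b n : ℕ
    N = 3 ^ m
    b = m * N
    n = B * b

    E : Vertex → Vertex → ℕ
    E x y = 𝟙 (earlier x y)

    χ : Fin 3 → Vertex → Vertex → ℕ
    χ c x y = 𝟙 (coloured c x y)

  ∑-allVertices : ∀ (φ : Vertex → ℕ) → ∑ allVertices φ ≡ (∑[ i ← vertices B ] ∑[ p ← vertices m ] ∑[ f ← functions m ] φ (i , p , f))
  ∑-allVertices φ = trans (∑-⊗ (vertices B) (vertices m ⊗ functions m) φ) (∑-cong (vertices B) (λ i → ∑-⊗ (vertices m) (functions m) _))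

  length-allVertices : length allVertices ≡ B * (m * 3 ^ m)
  length-allVertices = trans (length-⊗ (vertices B) (vertices m ⊗ functions m)) (cong₂ _*_ (length-vertices B) (trans (length-⊗ (vertices m) (functions m)) (cong₂ _*_ (length-vertices m) (length-functions m))))

  module _ (Y : List Vertex) (Y≤ : ∀ φ → ∑ Y φ ≤ ∑ allVertices φ) (r : ℕ) (m-large : 2 * (r * r) ≤ m) where

    private
      lengthY≤ : length Y ≤ n
      lengthY≤ = begin
        length Y             ≡⟨ sym (trans (∑-const Y 1) (*-identityʳ _)) ⟩
        (∑[ y ← Y ] 1)       ≤⟨ Y≤ (λ _ → 1) ⟩
        ∑ allVertices (λ _ → 1) ≡⟨ trans (∑-const allVertices 1) (trans (*-identityʳ _) length-allVertices) ⟩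
        n                    ∎
        where open ≤-Reasoning

    module _ (c : Fin 3) (u w : Vertex → ℕ) (u≤1 : ∀ y → u y ≤ 1) (w≤1 : ∀ x → w x ≤ 1) where

      private
        weight : Fin B → Fin m → ℕ
        weight i p = ∑[ x ← Y ] w x * (𝟙 (equal i (blockOf x)) * 𝟙 (equal p (pointOf x)))

        weight≤ : ∀ i p → weight i p ≤ N
        weight≤ i p = begin
          weight i p ≤⟨ ∑-mono Y (λ x → ≤-trans (*-monoˡ-≤ _ (w≤1 x)) (≤-reflexive (*-identityˡ _))) ⟩
          (∑[ x ← Y ] 𝟙 (equal i (blockOf x)) * 𝟙 (equal p (pointOf x))) ≤⟨ Y≤ _ ⟩
          ∑ allVertices (λ x → 𝟙 (equal i (blockOf x)) * 𝟙 (equal p (pointOf x))) ≡⟨ ∑-allVertices _ ⟩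
          (∑[ j ← vertices B ] ∑[ q ← vertices m ] ∑[ f ← functions m ] 𝟙 (equal i j) * 𝟙 (equal p q))
            ≡⟨ ∑₂-cong (vertices B) (vertices m) (λ j q → trans (∑-const-functions c m _) (*-comm N _)) ⟩
          (∑[ j ← vertices B ] ∑[ q ← vertices m ] 𝟙 (equal i j) * 𝟙 (equal p q) * N)
            ≡⟨ ∑-cong (vertices B) (λ j → trans (∑-*ʳ N (vertices m) _) (cong (_* N) (trans (∑-* (𝟙 (equal i j)) (vertices m) _) (trans (cong (𝟙 (equal i j) *_) (count-vertices p)) (*-identityʳ (𝟙 (equal i j))))))) ⟩
          (∑[ j ← vertices B ] 𝟙 (equal i j) * N) ≡⟨ trans (∑-*ʳ N (vertices B) _) (trans (cong (_* N) (count-vertices i)) (*-identityˡ N)) ⟩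
          N ∎
          where open ≤-Reasoning

        decompose : ∀ (ψ : Fin B → ℕ) (θ : Fin m → ℕ) →
          (∑[ x ← Y ] ψ (blockOf x) * (w x * θ (pointOf x))) ≡ (∑[ i ← vertices B ] ψ i * (∑[ p ← vertices m ] weight i p * θ p))
        decompose ψ θ = sym (begin
          (∑[ i ← vertices B ] ψ i * (∑[ p ← vertices m ] weight i p * θ p))
            ≡⟨ ∑-cong (vertices B) (λ i → trans (sym (∑-* (ψ i) (vertices m) _)) (∑-cong (vertices m) (λ p → trans (cong (ψ i *_) (sym (∑-*ʳ (θ p) Y _))) (sym (∑-* (ψ i) Y _))))) ⟩
          (∑[ i ← vertices B ] ∑[ p ← vertices m ] ∑[ x ← Y ] ψ i * (w x * (𝟙 (equal i (blockOf x)) * 𝟙 (equal p (pointOf x))) * θ p))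
            ≡⟨ trans (∑-cong (vertices B) (λ i → ∑-swap (vertices m) Y _)) (∑-swap (vertices B) Y _) ⟩
          (∑[ x ← Y ] ∑[ i ← vertices B ] ∑[ p ← vertices m ] ψ i * (w x * (𝟙 (equal i (blockOf x)) * 𝟙 (equal p (pointOf x))) * θ p))
            ≡⟨ ∑-cong Y (λ x → trans (∑₂-cong (vertices B) (vertices m) (λ i p → d (ψ i) (w x) (𝟙 (equal i (blockOf x))) (𝟙 (equal p (pointOf x))) (θ p)))
                 (trans (∑-cong (vertices B) (λ i → trans (∑-* (𝟙 (equal i (blockOf x)) * (ψ i * w x)) (vertices m) _) (cong (𝟙 (equal i (blockOf x)) * (ψ i * w x) *_) (∑-vertices-equal (pointOf x) θ))))
                 (trans (∑-*ʳ (θ (pointOf x)) (vertices B) _) (trans (cong (_* θ (pointOf x)) (∑-vertices-equal (blockOf x) (λ i → ψ i * w x))) (*-assoc (ψ (blockOf x)) (w x) (θ (pointOf x))))))) ⟩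
          (∑[ x ← Y ] ψ (blockOf x) * (w x * θ (pointOf x))) ∎)
          where
          open ≡-Reasoning
          d : ∀ ψ w a b θ → ψ * (w * (a * b) * θ) ≡ a * (ψ * w) * (b * θ)
          d = solve-∀

        S S′ Δ : Vertex → ℕ
        S y  = ∑[ x ← Y ] E x y * w x
        S′ y = ∑[ x ← Y ] E x y * (w x * χ c x y)
        Δ y  = ∑[ i ← vertices B ] deviation c (weight i) (functionOf y)

        single : ∀ y → S y ≤ 3 * S′ y + Δ y
        single y = begin
          S y ≡⟨ ∑-cong Y (λ x → cong (E x y *_) (sym (*-identityʳ (w x)))) ⟩
          (∑[ x ← Y ] E x y * (w x * 1)) ≡⟨ decompose ψ (λ _ → 1) ⟩
          (∑[ i ← vertices B ] ψ i * (∑[ p ← vertices m ] weight i p * 1)) ≤⟨ ∑-mono (vertices B) each ⟩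
          (∑[ i ← vertices B ] 3 * (ψ i * X i) + dev i) ≡⟨ trans (∑-+ (vertices B) _ _) (cong (_+ Δ y) (∑-* 3 (vertices B) _)) ⟩
          3 * (∑[ i ← vertices B ] ψ i * X i) + Δ y ≡⟨ cong (λ t → 3 * t + Δ y) (sym (decompose ψ (λ p → 𝟙 (equal (Vec.lookup (functionOf y) p) c)))) ⟩
          3 * S′ y + Δ y ∎
          where
          open ≤-Reasoning
          ψ X dev : Fin B → ℕ
          ψ i = 𝟙 (toℕ i Data.Nat.<ᵇ toℕ (blockOf y))
          X i = hits c (weight i) (functionOf y)
          dev i = deviation c (weight i) (functionOf y)
          d : ∀ p x → p * (3 * x) ≡ 3 * (p * x)
          d = solve-∀
          each : ∀ i → ψ i * (∑[ p ← vertices m ] weight i p * 1) ≤ 3 * (ψ i * X i) + dev i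
          each i = begin
            ψ i * (∑[ p ← vertices m ] weight i p * 1) ≡⟨ cong (ψ i *_) (∑-cong (vertices m) (λ p → *-identityʳ (weight i p))) ⟩
            ψ i * ∑ (vertices m) (weight i) ≤⟨ *-monoʳ-≤ (ψ i) (m≤n+∣n-m∣ (∑ (vertices m) (weight i)) (3 * X i)) ⟩
            ψ i * (3 * X i + dev i) ≡⟨ *-distribˡ-+ (ψ i) (3 * X i) (dev i) ⟩
            ψ i * (3 * X i) + ψ i * dev i ≤⟨ +-mono-≤ (≤-reflexive (d (ψ i) (X i))) (≤-trans (*-monoˡ-≤ (dev i) (𝟙≤1 (toℕ i Data.Nat.<ᵇ toℕ (blockOf y)))) (≤-reflexive (*-identityˡ (dev i)))) ⟩
            3 * (ψ i * X i) + dev i ∎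

        total-deviation : r * (∑[ y ← Y ] u y * Δ y) ≤ n * n
        total-deviation = begin
          r * (∑[ y ← Y ] u y * Δ y) ≤⟨ *-monoʳ-≤ r (≤-trans (∑-mono Y (λ y → ≤-trans (*-monoˡ-≤ (Δ y) (u≤1 y)) (≤-reflexive (*-identityˡ (Δ y))))) (Y≤ Δ)) ⟩
          r * ∑ allVertices Δ ≡⟨ cong (r *_) (trans (∑-allVertices Δ) (trans (∑-const (vertices B) _) (cong₂ _*_ (length-vertices B) (trans (∑-const (vertices m) _) (cong₂ _*_ (length-vertices m) (∑-swap (functions m) (vertices B) _)))))) ⟩
          r * (B * (m * (∑[ i ← vertices B ] D i))) ≡⟨ d r B m _ ⟩
          B * (m * (r * (∑[ i ← vertices B ] D i))) ≡⟨ cong (λ t → B * (m * t)) (sym (∑-* r (vertices B) D)) ⟩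
          B * (m * (∑[ i ← vertices B ] r * D i)) ≤⟨ *-monoʳ-≤ B (*-monoʳ-≤ m (≤-trans (∑-≤ (vertices B) (λ i → deviation-small c r m (weight i) m-large (weight≤ i))) (≤-reflexive (cong (_* (m * (N * N))) (length-vertices B))))) ⟩
          B * (m * (B * (m * (N * N)))) ≡⟨ d′ B m N ⟩
          n * n ∎
          where
          open ≤-Reasoning
          D : Fin B → ℕ
          D i = ∑[ f ← functions m ] deviation c (weight i) f
          d : ∀ r B m t → r * (B * (m * t)) ≡ B * (m * (r * t))
          d = solve-∀
          d′ : ∀ B m N → B * (m * (B * (m * (N * N)))) ≡ B * (m * N) * (B * (m * N))
          d′ = solve-∀

      -- Given `y`, the relation of `x` to `y` depends on `x` only through its block and its point.
      -- In each block the vertices of the right colour are therefore counted by `hits` at the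
      -- function of `y`, with weights at most `3 ^ m`. As `u` is at most 1, the deviations may be
      -- summed over all vertices `y`, hence over all functions.
      quasirandom : r * (∑[ y ← Y ] u y * (∑[ x ← Y ] E x y * w x)) ≤ 3 * (r * (∑[ y ← Y ] u y * (∑[ x ← Y ] E x y * (w x * χ c x y)))) + n * n
      quasirandom = begin
        r * (∑[ y ← Y ] u y * S y) ≤⟨ *-monoʳ-≤ r (∑-mono Y (λ y → *-monoʳ-≤ (u y) (single y))) ⟩
        r * (∑[ y ← Y ] u y * (3 * S′ y + Δ y)) ≡⟨ cong (r *_) (trans (∑-cong Y (λ y → d (u y) (S′ y) (Δ y))) (trans (∑-+ Y _ _) (cong (_+ (∑[ y ← Y ] u y * Δ y)) (∑-* 3 Y _)))) ⟩
        r * (3 * (∑[ y ← Y ] u y * S′ y) + (∑[ y ← Y ] u y * Δ y)) ≡⟨ d′ r _ _ ⟩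
        3 * (r * (∑[ y ← Y ] u y * S′ y)) + r * (∑[ y ← Y ] u y * Δ y) ≤⟨ +-monoʳ-≤ (3 * (r * (∑[ y ← Y ] u y * S′ y))) total-deviation ⟩
        3 * (r * (∑[ y ← Y ] u y * S′ y)) + n * n ∎
        where
        open ≤-Reasoning
        d : ∀ u s δ → u * (3 * s + δ) ≡ 3 * (u * s) + u * δ
        d = solve-∀
        d′ : ∀ r s t → r * (3 * s + t) ≡ 3 * (r * s) + r * t
        d′ = solve-∀

    private
      ∑³ : (Vertex → Vertex → Vertex → ℕ) → ℕ
      ∑³ h = ∑[ x ← Y ] ∑[ y ← Y ] ∑[ z ← Y ] h x y z

      ∑³-+ : ∀ h h′ → ∑³ (λ x y z → h x y z + h′ x y z) ≡ ∑³ h + ∑³ h′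
      ∑³-+ h h′ = trans (∑-cong Y (λ x → ∑₂-+ Y Y (h x) (h′ x))) (∑-+ Y _ _)

      lift : ∀ (φ ψ : Vertex → ℕ) → (∀ y → r * φ y ≤ 3 * (r * ψ y) + n * n) → r * ∑ Y φ ≤ 3 * (r * ∑ Y ψ) + n * n * n
      lift φ ψ h = begin
        r * ∑ Y φ                              ≡⟨ sym (∑-* r Y φ) ⟩
        (∑[ y ← Y ] r * φ y)                   ≤⟨ ∑-mono Y h ⟩
        (∑[ y ← Y ] 3 * (r * ψ y) + n * n)     ≡⟨ trans (∑-+ Y _ _) (cong₂ _+_ (trans (∑-* 3 Y _) (cong (3 *_) (∑-* r Y ψ))) (∑-const Y (n * n))) ⟩
        3 * (r * ∑ Y ψ) + length Y * (n * n)   ≤⟨ +-monoʳ-≤ (3 * (r * ∑ Y ψ)) (*-monoˡ-≤ (n * n) lengthY≤) ⟩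
        3 * (r * ∑ Y ψ) + n * (n * n)          ≡⟨ cong (3 * (r * ∑ Y ψ) +_) (sym (*-assoc n n n)) ⟩
        3 * (r * ∑ Y ψ) + n * n * n            ∎
        where open ≤-Reasoning

      earlier-trans : ∀ x y z → E x y * E y z ≡ E y z * (E x z * E x y)
      earlier-trans x y z with earlier x y in xy | earlier y z in yz | earlier x z in xz
      ... | false | false | _     = refl
      ... | false | true  | false = refl
      ... | false | true  | true  = refl
      ... | true  | false | _     = refl
      ... | true  | true  | true  = refl
      ... | true  | true  | false = ⊥-elim (subst Data.Bool.T xz (<⇒<ᵇ (<-trans (<ᵇ⇒< (toℕ (blockOf x)) (toℕ (blockOf y)) (subst Data.Bool.T (sym xy) tt)) (<ᵇ⇒< (toℕ (blockOf y)) (toℕ (blockOf z)) (subst Data.Bool.T (sym yz) tt)))))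

      -- The colour conditions are imposed on x z, y z and x y in turn. Each time the third vertex
      -- is held fixed and the remaining factors split into one for either end of the pair, as
      -- `quasirandom` requires; transitivity adds or removes the factor that orders the pair.
      τ₀ τ₁ τ₂ τ₃ : Vertex → Vertex → Vertex → ℕ
      τ₀ x y z = E x y * E y z
      τ₁ x y z = E y z * (E x z * (E x y * χ (suc (suc zero)) x z))
      τ₂ x y z = χ (suc (suc zero)) x z * (E y z * (E x y * χ (suc zero) y z))
      τ₃ x y z = E y z * χ (suc zero) y z * (E x y * (χ (suc (suc zero)) x z * χ zero x y))

      step₁ : r * ∑³ τ₀ ≤ 3 * (r * ∑³ τ₁) + n * n * n
      step₁ = subst₂ (λ s t → r * s ≤ 3 * (r * t) + n * n * n)
        (trans (∑-cong Y (λ y → ∑-cong Y (λ z → trans (sym (∑-* (E y z) Y _)) (∑-cong Y (λ x → sym (earlier-trans x y z)))))) (sym (pull₂ Y Y Y τ₀)))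
        (trans (∑-cong Y (λ y → ∑-cong Y (λ z → sym (∑-* (E y z) Y _)))) (sym (pull₂ Y Y Y τ₁)))
        (lift _ _ (λ y → quasirandom (suc (suc zero)) (λ z → E y z) (λ x → E x y) (λ z → 𝟙≤1 _) (λ x → 𝟙≤1 _)))

      step₂ : r * ∑³ τ₁ ≤ 3 * (r * ∑³ τ₂) + n * n * n
      step₂ = subst₂ (λ s t → r * s ≤ 3 * (r * t) + n * n * n)
        (∑-cong Y (λ x → trans (∑-cong Y (λ z → trans (sym (∑-* (χ (suc (suc zero)) x z) Y _)) (∑-cong Y (λ y → trans (cong (χ (suc (suc zero)) x z *_) (trans (*-comm (E y z) (E x y)) (earlier-trans x y z))) (d (χ (suc (suc zero)) x z) (E y z) (E x z) (E x y)))))) (∑-swap Y Y _)))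
        (∑-cong Y (λ x → trans (∑-cong Y (λ z → sym (∑-* (χ (suc (suc zero)) x z) Y _))) (∑-swap Y Y _)))
        (lift _ _ (λ x → quasirandom (suc zero) (λ z → χ (suc (suc zero)) x z) (λ y → E x y) (λ z → 𝟙≤1 _) (λ y → 𝟙≤1 _)))
        where
        d : ∀ c a b e → c * (a * (b * e)) ≡ a * (b * (e * c))
        d = solve-∀

      step₃ : r * ∑³ τ₂ ≤ 3 * (r * ∑³ τ₃) + n * n * n
      step₃ = subst₂ (λ s t → r * s ≤ 3 * (r * t) + n * n * n)
        (trans (∑-cong Y (λ z → ∑-cong Y (λ y → trans (sym (∑-* (E y z * χ (suc zero) y z) Y _)) (∑-cong Y (λ x → d (E y z) (χ (suc zero) y z) (E x y) (χ (suc (suc zero)) x z)))))) (sym (reorder τ₂)))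
        (trans (∑-cong Y (λ z → ∑-cong Y (λ y → sym (∑-* (E y z * χ (suc zero) y z) Y _)))) (sym (reorder τ₃)))
        (lift _ _ (λ z → quasirandom zero (λ y → E y z * χ (suc zero) y z) (λ x → χ (suc (suc zero)) x z) (λ y → *-mono-≤ (𝟙≤1 (earlier y z)) (𝟙≤1 (coloured (suc zero) y z))) (λ x → 𝟙≤1 _)))
        where
        reorder : ∀ h → ∑³ h ≡ (∑[ z ← Y ] ∑[ y ← Y ] ∑[ x ← Y ] h x y z)
        reorder h = trans (pull₂ Y Y Y h) (∑-swap Y Y _)
        d : ∀ a b e c → a * b * (e * c) ≡ c * (a * (e * b))
        d = solve-∀

    orders : Vertex → Vertex → Vertex → ℕ
    orders x y z = E x y * E y z + E x z * E z y + (E y x * E x z + E y z * E z x) + (E z x * E x y + E z y * E y x)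

    tripleCount : ℕ
    tripleCount = ∑³ τ₃

    private
      ties : Vertex → Vertex → ℕ
      ties x y = 𝟙 (equal (blockOf x) (blockOf y))

      orders-exhaust : ∀ x y z → 1 ≤ orders x y z + (ties x y + ties y z + ties x z)
      orders-exhaust x y z = cases (compare x y) (compare y z) (compare x z)
        where
        compare : ∀ x y → E x y ≡ 1 ⊎ E y x ≡ 1 ⊎ ties x y ≡ 1
        compare x y with <-cmp (toℕ (blockOf x)) (toℕ (blockOf y))
        ... | tri< x<y _ _ = inj₁ (cong 𝟙 (<ᵇ-true x<y))
        ... | tri> _ _ y<x = inj₂ (inj₁ (cong 𝟙 (<ᵇ-true y<x)))
        ... | tri≈ _ x≈y _ = inj₂ (inj₂ (trans (cong (λ i → 𝟙 (equal (blockOf x) i)) (sym (Fin.toℕ-injective x≈y))) (cong 𝟙 (equal-refl (blockOf x)))))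
        hit : ∀ {a b c} → a ≡ 1 → b ≡ 1 → a * b ≤ c → 1 ≤ c
        hit refl refl h = h
        late : ∀ {t c} → t ≡ 1 → t ≤ c → 1 ≤ c
        late refl h = h
        m≤n+m+o : ∀ m n o → m ≤ n + m + o
        m≤n+m+o m n o = ≤-trans (m≤n+m m n) (m≤m+n (n + m) o)
        cases : (E x y ≡ 1 ⊎ E y x ≡ 1 ⊎ ties x y ≡ 1) → (E y z ≡ 1 ⊎ E z y ≡ 1 ⊎ ties y z ≡ 1) → (E x z ≡ 1 ⊎ E z x ≡ 1 ⊎ ties x z ≡ 1) →
          1 ≤ orders x y z + (ties x y + ties y z + ties x z)
        cases (inj₂ (inj₂ t)) _ _ = late t (≤-trans (m≤m+n (ties x y) (ties y z)) (≤-trans (m≤m+n _ (ties x z)) (m≤n+m _ (orders x y z))))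
        cases _ (inj₂ (inj₂ t)) _ = late t (≤-trans (m≤n+m+o (ties y z) (ties x y) (ties x z)) (m≤n+m _ (orders x y z)))
        cases _ _ (inj₂ (inj₂ t)) = late t (≤-trans (m≤n+m (ties x z) _) (m≤n+m _ (orders x y z)))
        cases (inj₁ xy) (inj₁ yz) _ = hit xy yz (≤-trans (m≤m+n _ (E x z * E z y)) (≤-trans (m≤m+n _ (E y x * E x z + E y z * E z x)) (≤-trans (m≤m+n _ (E z x * E x y + E z y * E y x)) (m≤m+n _ _))))
        cases (inj₁ xy) (inj₂ (inj₁ zy)) (inj₁ xz) = hit xz zy (≤-trans (m≤n+m _ (E x y * E y z)) (≤-trans (m≤m+n _ (E y x * E x z + E y z * E z x)) (≤-trans (m≤m+n _ (E z x * E x y + E z y * E y x)) (m≤m+n _ _))))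
        cases (inj₁ xy) (inj₂ (inj₁ zy)) (inj₂ (inj₁ zx)) = hit zx xy (≤-trans (m≤m+n _ (E z y * E y x)) (≤-trans (m≤n+m _ (E x y * E y z + E x z * E z y + (E y x * E x z + E y z * E z x))) (m≤m+n _ _)))
        cases (inj₂ (inj₁ yx)) (inj₂ (inj₁ zy)) _ = hit zy yx (≤-trans (m≤n+m _ (E z x * E x y)) (≤-trans (m≤n+m _ (E x y * E y z + E x z * E z y + (E y x * E x z + E y z * E z x))) (m≤m+n _ _)))
        cases (inj₂ (inj₁ yx)) (inj₁ yz) (inj₁ xz) = hit yx xz (≤-trans (m≤m+n _ (E y z * E z x)) (≤-trans (m≤n+m _ (E x y * E y z + E x z * E z y)) (≤-trans (m≤m+n _ (E z x * E x y + E z y * E y x)) (m≤m+n _ _))))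
        cases (inj₂ (inj₁ yx)) (inj₁ yz) (inj₂ (inj₁ zx)) = hit yz zx (≤-trans (m≤n+m _ (E y x * E x z)) (≤-trans (m≤n+m _ (E x y * E y z + E x z * E z y)) (≤-trans (m≤m+n _ (E z x * E x y + E z y * E y x)) (m≤m+n _ _))))

      ∑orders : ∑³ orders ≡ 6 * ∑³ τ₀
      ∑orders = begin
        ∑³ orders ≡⟨ trans (∑³-+ _ _) (cong₂ _+_ (trans (∑³-+ _ _) (cong₂ _+_ (∑³-+ _ _) (∑³-+ _ _))) (∑³-+ _ _)) ⟩
        ∑³ τ₀ + ∑³ (λ x y z → τ₀ x z y) + (∑³ (λ x y z → τ₀ y x z) + ∑³ (λ x y z → τ₀ y z x)) + (∑³ (λ x y z → τ₀ z x y) + ∑³ (λ x y z → τ₀ z y x))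
          ≡⟨ cong₂ _+_ (cong₂ _+_ (cong (∑³ τ₀ +_) (swapʳ τ₀)) (cong₂ _+_ (swapˡ τ₀) (trans (swapˡ (λ x y z → τ₀ x z y)) (swapʳ τ₀)))) (cong₂ _+_ (trans (swapʳ (λ x y z → τ₀ y x z)) (swapˡ τ₀)) (trans (swapˡ (λ x y z → τ₀ z x y)) (trans (swapʳ (λ x y z → τ₀ y x z)) (swapˡ τ₀)))) ⟩
        ∑³ τ₀ + ∑³ τ₀ + (∑³ τ₀ + ∑³ τ₀) + (∑³ τ₀ + ∑³ τ₀) ≡⟨ d (∑³ τ₀) ⟩
        6 * ∑³ τ₀ ∎
        where
        open ≡-Reasoning
        swapʳ : ∀ h → ∑³ (λ x y z → h x z y) ≡ ∑³ h
        swapʳ h = ∑-cong Y (λ x → ∑-swap Y Y _)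
        swapˡ : ∀ h → ∑³ (λ x y z → h y x z) ≡ ∑³ h
        swapˡ h = ∑-swap Y Y _
        d : ∀ t → t + t + (t + t) + (t + t) ≡ 6 * t
        d = solve-∀

      few-ties : (∑[ x ← Y ] ∑[ y ← Y ] ties x y) ≤ n * b
      few-ties = ≤-trans (∑-≤ Y (λ x → ≤-trans (Y≤ (ties x)) (≤-reflexive (block-size (blockOf x))))) (*-monoˡ-≤ b lengthY≤)
        where
        block-size : ∀ i → ∑ allVertices (λ y → 𝟙 (equal i (blockOf y))) ≡ b
        block-size i = trans (∑-allVertices _) (trans (∑-cong (vertices B) (λ j → trans (∑-const (vertices m) _) (trans (cong₂ _*_ (length-vertices m) (∑-const-functions zero m _)) (d m N (𝟙 (equal i j))))))
          (trans (∑-*ʳ b (vertices B) _) (trans (cong (_* b) (count-vertices i)) (*-identityˡ b))))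
          where
          d : ∀ m N t → m * (N * t) ≡ t * (m * N)
          d = solve-∀

      ordered-triples : length Y * length Y * length Y ≤ 6 * ∑³ τ₀ + 3 * (n * (n * b))
      ordered-triples = begin
        l * l * l ≡⟨ trans (*-assoc l l l) (sym (trans (∑-const Y _) (cong (l *_) (trans (∑-const Y _) (cong (l *_) (trans (∑-const Y 1) (*-identityʳ l))))))) ⟩
        ∑³ (λ x y z → 1) ≤⟨ ∑-mono Y (λ x → ∑₂-mono Y Y (orders-exhaust x)) ⟩
        ∑³ (λ x y z → orders x y z + (ties x y + ties y z + ties x z)) ≡⟨ trans (∑³-+ _ _) (cong₂ _+_ ∑orders (trans (∑³-+ _ _) (cong (_+ ∑³ (λ x y z → ties x z)) (∑³-+ _ _)))) ⟩
        6 * ∑³ τ₀ + (∑³ (λ x y z → ties x y) + ∑³ (λ x y z → ties y z) + ∑³ (λ x y z → ties x z))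
          ≤⟨ +-monoʳ-≤ (6 * ∑³ τ₀) (+-mono-≤ (+-mono-≤
               (bound (trans (∑₂-cong Y Y (λ x y → ∑-const Y (ties x y))) (∑₂-* Y Y l ties)))
               (bound (∑-const Y _)))
               (bound (trans (∑-cong Y (λ x → ∑-const Y _)) (∑-* l Y _)))) ⟩
        6 * ∑³ τ₀ + (n * (n * b) + n * (n * b) + n * (n * b)) ≡⟨ cong (6 * ∑³ τ₀ +_) (d (n * (n * b))) ⟩
        6 * ∑³ τ₀ + 3 * (n * (n * b)) ∎
        where
        open ≤-Reasoning
        l = length Y
        d : ∀ t → t + t + t ≡ 3 * t
        d = solve-∀
        bound : ∀ {t} → t ≡ l * (∑[ x ← Y ] ∑[ y ← Y ] ties x y) → t ≤ n * (n * b)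
        bound refl = *-mono-≤ lengthY≤ few-ties

    -- Six orders and three colours of probability `1 / 3` each give 162 = 6 * 27. Pairs in a common
    -- block have share at most `1 / B` and are absorbed by `r ≤ B`; the errors add up to 6 * (9 + 3
    -- + 1) + 3 = 81.
    many-triples : r ≤ B → r * (length Y * length Y * length Y) ≤ 162 * (r * tripleCount) + 81 * (n * n * n)
    many-triples r≤B = begin
      r * (length Y * length Y * length Y) ≤⟨ *-monoʳ-≤ r ordered-triples ⟩
      r * (6 * ∑³ τ₀ + 3 * (n * (n * b))) ≡⟨ d₁ r (∑³ τ₀) n b ⟩
      6 * (r * ∑³ τ₀) + 3 * (n * n * (r * b)) ≤⟨ +-mono-≤ (*-monoʳ-≤ 6 chain) (*-monoʳ-≤ 3 (*-monoʳ-≤ (n * n) (*-monoˡ-≤ b r≤B))) ⟩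
      6 * (3 * (3 * (3 * (r * ∑³ τ₃) + n³) + n³) + n³) + 3 * n³ ≡⟨ d₂ (r * ∑³ τ₃) n³ ⟩
      162 * (r * ∑³ τ₃) + 81 * n³ ∎
      where
      open ≤-Reasoning
      n³ = n * n * n
      chain : r * ∑³ τ₀ ≤ 3 * (3 * (3 * (r * ∑³ τ₃) + n³) + n³) + n³
      chain = ≤-trans step₁ (+-monoˡ-≤ n³ (*-monoʳ-≤ 3 (≤-trans step₂ (+-monoˡ-≤ n³ (*-monoʳ-≤ 3 step₃)))))
      d₁ : ∀ r t n b → r * (6 * t + 3 * (n * (n * b))) ≡ 6 * (r * t) + 3 * (n * n * (r * b))
      d₁ = solve-∀
      d₂ : ∀ t c → 6 * (3 * (3 * (3 * t + c) + c) + c) + 3 * c ≡ 162 * t + 81 * c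
      d₂ = solve-∀

-- Incompatibility of `H` with every order.

Place : {A : Set} (_≺_ : A → A → Set) → Side → A → A → A → Set
Place _≺_ left  i j k = i ≺ k × j ≺ k
Place _≺_ right i j k = k ≺ i × k ≺ j
Place _≺_ top   i j k = (i ≺ k × k ≺ j) ⊎ (j ≺ k × k ≺ i)

place-swap : ∀ {A : Set} {_≺_ : A → A → Set} ρ {i j k} → Place _≺_ ρ i j k → Place _≺_ ρ j i k
place-swap left  (h , h′) = h′ , h
place-swap right (h , h′) = h′ , h
place-swap top   (inj₁ h) = inj₂ h
place-swap top   (inj₂ h) = inj₁ h

mirror : Side → Side
mirror left  = right
mirror right = left
mirror top   = top

-- Reversing the order exchanges left and right. Since `Place` is defined for any relation, the
-- reversed order is just another instance.
place-mirror : ∀ ρ {i j k} → Place _<_ ρ i j k → Place (λ x y → y < x) (mirror ρ) i j k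
place-mirror left  h              = h
place-mirror right h              = h
place-mirror top   (inj₁ (h , h′)) = inj₂ (h′ , h)
place-mirror top   (inj₂ (h , h′)) = inj₁ (h′ , h)

-- In each of the five pairs of H with several neighbours, all neighbours are on the same side.
module Sides {A : Set} (_≺_ : A → A → Set) (≺-trans : ∀ {x y z} → x ≺ y → y ≺ z → x ≺ z) (≺-irrefl : ∀ {x} → ¬ x ≺ x)
  (ab bc cd de ef : Side) {a b c d e f g : A}
  (abc : Place _≺_ ab a b c) (abg : Place _≺_ ab a b g)
  (bca : Place _≺_ bc b c a) (bcd : Place _≺_ bc b c d) (bcf : Place _≺_ bc b c f)
  (cdb : Place _≺_ cd c d b) (cde : Place _≺_ cd c d e) (cdg : Place _≺_ cd c d g)
  (dea : Place _≺_ de d e a) (dec : Place _≺_ de d e c) (def : Place _≺_ de d e f)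
  (efd : Place _≺_ ef e f d) (efg : Place _≺_ ef e f g) where

  private
    clash : ∀ {X : Set} {x y} → x ≺ y → y ≺ x → X
    clash p q = ⊥-elim (≺-irrefl (≺-trans p q))

    between : ∀ {x y z} → x ≺ y → Place _≺_ top x y z → x ≺ z × z ≺ y
    between x≺y (inj₁ h)         = h
    between x≺y (inj₂ (p , q)) = clash x≺y (≺-trans p q)

    between′ : ∀ {x y z} → y ≺ x → Place _≺_ top x y z → y ≺ z × z ≺ x
    between′ y≺x p = between y≺x (place-swap {_≺_ = _≺_} top p)

  -- The opposite case is this one for the reversed order. Once the side of cd is given, each side
  -- proposed for a further pair either contradicts the order known so far or forces new
  -- comparisons, until none is left.
  module _ (c≺d : c ≺ d) where

    private
      cd-top : Place _≺_ top c d b → Place _≺_ top c d e → Place _≺_ top c d g → ⊥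
      cd-top pb pe pg = step-bc bc bca bcd bcf
        where
        c≺b = proj₁ (between c≺d pb)
        b≺d = proj₂ (between c≺d pb)
        c≺e = proj₁ (between c≺d pe)
        e≺d = proj₂ (between c≺d pe)
        step-ef : ∀ ef → b ≺ a → a ≺ e → f ≺ e → g ≺ b → Place _≺_ ef e f d → Place _≺_ ef e f g → ⊥
        step-ef left  b≺a a≺e f≺e g≺b _        (e≺g , _) = clash (≺-trans b≺a (≺-trans a≺e e≺g)) g≺b
        step-ef right b≺a a≺e f≺e g≺b (d≺e , _) _        = clash d≺e e≺d
        step-ef top   b≺a a≺e f≺e g≺b p        _        = clash (proj₂ (between′ f≺e p)) e≺d
        step-ab : ∀ ab → b ≺ a → a ≺ e → f ≺ e → Place _≺_ ab a b c → Place _≺_ ab a b g → ⊥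
        step-ab left  b≺a a≺e f≺e (_ , b≺c) _        = clash b≺c c≺b
        step-ab right b≺a a≺e f≺e _        (_ , g≺b) = step-ef ef b≺a a≺e f≺e g≺b efd efg
        step-ab top   b≺a a≺e f≺e p        _        = clash (proj₁ (between′ b≺a p)) c≺b
        step-de : ∀ de → b ≺ a → Place _≺_ de d e a → Place _≺_ de d e c → Place _≺_ de d e f → ⊥
        step-de left  b≺a _         (d≺c , _) _         = clash d≺c c≺d
        step-de right b≺a (_ , a≺e) _         (_ , f≺e) = step-ab ab b≺a a≺e f≺e abc abg
        step-de top   b≺a _         p         _         = clash (proj₁ (between′ e≺d p)) c≺e
        step-bc : ∀ bc → Place _≺_ bc b c a → Place _≺_ bc b c d → Place _≺_ bc b c f → ⊥
        step-bc left  (b≺a , _) _         _ = step-de de b≺a dea dec def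
        step-bc right _         (_ , d≺c) _ = clash d≺c c≺d
        step-bc top   _         p         _ = clash (proj₂ (between′ c≺b p)) b≺d

      cd-left : c ≺ b × d ≺ b → d ≺ e → d ≺ g → ⊥
      cd-left (c≺b , d≺b) d≺e d≺g = step-bc bc bca bcd
        where
        step-ab : ∀ ab → c ≺ a → a ≺ b → a ≺ d → Place _≺_ ab a b c → Place _≺_ ab a b g → ⊥
        step-ab left  c≺a a≺b a≺d (a≺c , _) _         = clash a≺c c≺a
        step-ab right c≺a a≺b a≺d _         (g≺a , _) = clash g≺a (≺-trans a≺d d≺g)
        step-ab top   c≺a a≺b a≺d p         _         = clash (proj₁ (between a≺b p)) c≺a
        step-de : ∀ de → c ≺ a → a ≺ b → Place _≺_ de d e a → Place _≺_ de d e c → ⊥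
        step-de left  c≺a a≺b _         (d≺c , _) = clash d≺c c≺d
        step-de right c≺a a≺b (a≺d , _) _         = step-ab ab c≺a a≺b a≺d abc abg
        step-de top   c≺a a≺b _         p         = clash (proj₁ (between d≺e p)) c≺d
        step-bc : ∀ bc → Place _≺_ bc b c a → Place _≺_ bc b c d → ⊥
        step-bc left  _ (b≺d , _) = clash b≺d d≺b
        step-bc right _ (_ , d≺c) = clash d≺c c≺d
        step-bc top   p _         = step-de de (proj₁ (between′ c≺b p)) (proj₂ (between′ c≺b p)) dea dec

      cd-right : b ≺ c × b ≺ d → e ≺ c × e ≺ d → g ≺ c → ⊥
      cd-right (b≺c , b≺d) (e≺c , e≺d) g≺c = step-bc bc bcd bcf
        where
        step-ef : ∀ ef → c ≺ f → e ≺ f → f ≺ d → Place _≺_ ef e f d → Place _≺_ ef e f g → ⊥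
        step-ef left  c≺f e≺f f≺d _         (_ , f≺g) = clash f≺g (≺-trans g≺c c≺f)
        step-ef right c≺f e≺f f≺d (d≺e , _) _         = clash d≺e e≺d
        step-ef top   c≺f e≺f f≺d p         _         = clash (proj₂ (between e≺f p)) f≺d
        step-de : ∀ de → c ≺ f → Place _≺_ de d e c → Place _≺_ de d e f → ⊥
        step-de left  c≺f (d≺c , _) _ = clash d≺c c≺d
        step-de right c≺f (_ , c≺e) _ = clash c≺e e≺c
        step-de top   c≺f _         p = step-ef ef c≺f (proj₁ (between′ e≺d p)) (proj₂ (between′ e≺d p)) efd efg
        step-bc : ∀ bc → Place _≺_ bc b c d → Place _≺_ bc b c f → ⊥
        step-bc left  _         (_ , c≺f) = step-de de c≺f dec def
        step-bc right (d≺b , _) _         = clash d≺b b≺d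
        step-bc top   p         _         = clash (proj₂ (between b≺c p)) c≺d

      by-cd : ∀ cd → Place _≺_ cd c d b → Place _≺_ cd c d e → Place _≺_ cd c d g → ⊥
      by-cd left  pb pe pg = cd-left pb (proj₂ pe) (proj₂ pg)
      by-cd right pb pe pg = cd-right pb pe (proj₁ pg)
      by-cd top   pb pe pg = cd-top pb pe pg

    impossible : ⊥
    impossible = by-cd cd cdb cde cdg

-- The 3-graph of the colouring contains no copy of `H`.

any-witness : {A : Set} (p : A → Bool) (xs : List A) → any p xs ≡ true → ∃[ x ] p x ≡ true
any-witness p (x ∷ xs) eq with p x in px
... | true  = x , px
... | false = any-witness p xs eq

∈-vertices : ∀ {n} (v : Fin n) → v ∈ vertices n
∈-vertices zero    = here refl
∈-vertices (suc v) = there (∈-map⁺ suc (∈-vertices v))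

∈-⊗ : {A B : Set} {x : A} {y : B} {xs : List A} {ys : List B} → x ∈ xs → y ∈ ys → (x , y) ∈ xs ⊗ ys
∈-⊗ {x = x} x∈ y∈ = ∈-concatMap x∈ (∈-map⁺ (x ,_) y∈)

∧-split : ∀ {b c} → b ∧ c ≡ true → b ≡ true × c ≡ true
∧-split {true} {true} _ = refl , refl

does-true : {P : Set} (p? : Dec P) → does p? ≡ true → P
does-true (yes p) _ = p

∈-triple : ∀ {n} {v x y z : Fin n} → v Subset.∈ triple x y z → v ≡ x ⊎ v ≡ y ⊎ v ≡ z
∈-triple {x = x} {y} {z} v∈ with x∈p∪q⁻ ⁅ x ⁆ (⁅ y ⁆ ∪ ⁅ z ⁆) v∈
... | inj₁ v∈x = inj₁ (x∈⁅y⁆⇒x≡y _ v∈x)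
... | inj₂ v∈yz with x∈p∪q⁻ ⁅ y ⁆ ⁅ z ⁆ v∈yz
...   | inj₁ v∈y = inj₂ (inj₁ (x∈⁅y⁆⇒x≡y _ v∈y))
...   | inj₂ v∈z = inj₂ (inj₂ (x∈⁅y⁆⇒x≡y _ v∈z))

triple-∋ : ∀ {n} (x y z : Fin n) → x Subset.∈ triple x y z × y Subset.∈ triple x y z × z Subset.∈ triple x y z
triple-∋ x y z = x∈p∪q⁺ (inj₁ (x∈⁅x⁆ x)) , x∈p∪q⁺ (inj₂ (x∈p∪q⁺ (inj₁ (x∈⁅x⁆ y)))) , x∈p∪q⁺ (inj₂ (x∈p∪q⁺ (inj₂ (x∈⁅x⁆ z))))

module PaletteGraph (B m : ℕ) where

  open Construction B m

  n : ℕ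
  n = length allVertices

  vertexAt : Fin n → Vertex
  vertexAt = List.lookup allVertices

  oriented : Vertex → Vertex → Vertex → Bool
  oriented x y z = (earlier x y ∧ earlier y z) ∧ (coloured zero x y ∧ (coloured (suc zero) y z ∧ coloured (suc (suc zero)) x z))

  -- A 3-graph judges sets without an order, so ordered triples spanning the set have to be searched
  -- for.
  spans : Subset n → Fin n × Fin n × Fin n → Bool
  spans S (u , v , w) = does (Vec.≡-dec Data.Bool._≟_ S (triple u v w)) ∧ oriented (vertexAt u) (vertexAt v) (vertexAt w)

  graph : ThreeGraph n
  graph S = any (spans S) (vertices n ⊗ vertices n ⊗ vertices n)

  graph-intro : ∀ u v w → oriented (vertexAt u) (vertexAt v) (vertexAt w) ≡ true → graph (triple u v w) ≡ true
  graph-intro u v w o = any-true {p = spans (triple u v w)} (∈-⊗ (∈-vertices u) (∈-⊗ (∈-vertices v) (∈-vertices w)))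
    (cong₂ _∧_ (does-refl (Vec.≡-dec Data.Bool._≟_ (triple u v w) (triple u v w))) o)
    where
    does-refl : ∀ {S : Subset n} (d : Dec (S ≡ S)) → does d ≡ true
    does-refl (yes _) = refl
    does-refl (no ¬p) = contradiction refl ¬p

  position : Vertex → ℕ
  position = toℕ ∘ blockOf

  -- In accordance with `oriented`, colour 0 belongs to the first two vertices of an edge, 1 to the
  -- last two and 2 to the outer two.
  sideOf : Fin 3 → Side
  sideOf zero             = left
  sideOf (suc zero)       = right
  sideOf (suc (suc zero)) = top

  pairSide′ : Bool → Vertex → Vertex → Side
  pairSide′ true  x y = sideOf (Vec.lookup (functionOf y) (pointOf x))
  pairSide′ false x y = sideOf (Vec.lookup (functionOf x) (pointOf y))

  pairSide : Vertex → Vertex → Side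
  pairSide x y = pairSide′ (earlier x y) x y

  Sided : Vertex → Vertex → Vertex → Set
  Sided x y z = Place _<_ (pairSide x y) (position x) (position y) (position z) × (position x < position y ⊎ position y < position x)

  private
    <ᵇ-false : ∀ {i j} → j < i → (i Data.Nat.<ᵇ j) ≡ false
    <ᵇ-false {i} {j} j<i with i Data.Nat.<ᵇ j in eq
    ... | false = refl
    ... | true  = contradiction (<ᵇ⇒< i j (subst Data.Bool.T (sym eq) tt)) (<⇒≯ j<i)

    pairSide-< : ∀ c {x y} → position x < position y → coloured c x y ≡ true → pairSide x y ≡ sideOf c
    pairSide-< c {x} {y} x<y col = trans (cong (λ b → pairSide′ b x y) (<ᵇ-true x<y)) (cong sideOf (does-true (Vec.lookup (functionOf y) (pointOf x) Fin.≟ c) col))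

    pairSide-> : ∀ c {x y} → position x < position y → coloured c x y ≡ true → pairSide y x ≡ sideOf c
    pairSide-> c {x} {y} x<y col = trans (cong (λ b → pairSide′ b y x) (<ᵇ-false x<y)) (cong sideOf (does-true (Vec.lookup (functionOf y) (pointOf x) Fin.≟ c) col))

    sided-< : ∀ c {x y z} → position x < position y → coloured c x y ≡ true → Place _<_ (sideOf c) (position x) (position y) (position z) → Sided x y z
    sided-< c {x} {y} {z} x<y col p = subst (λ ρ → Place _<_ ρ (position x) (position y) (position z)) (sym (pairSide-< c x<y col)) p , inj₁ x<y

    sided-> : ∀ c {x y z} → position x < position y → coloured c x y ≡ true → Place _<_ (sideOf c) (position x) (position y) (position z) → Sided y x z
    sided-> c {x} {y} {z} x<y col p = subst (λ ρ → Place _<_ ρ (position y) (position x) (position z)) (sym (pairSide-> c x<y col)) (place-swap {_≺_ = _<_} (sideOf c) p) , inj₂ x<y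

  record AllSided (u v w : Vertex) : Set where
    field
      uvw : Sided u v w
      vuw : Sided v u w
      vwu : Sided v w u
      wvu : Sided w v u
      uwv : Sided u w v
      wuv : Sided w u v

  oriented⇒sided : ∀ u v w → oriented u v w ≡ true → AllSided u v w
  oriented⇒sided u v w o = record
    { uvw = sided-< zero {u} {v} {w} u<v c₀ (u<w , v<w) ; vuw = sided-> zero {u} {v} {w} u<v c₀ (u<w , v<w)
    ; vwu = sided-< (suc zero) {v} {w} {u} v<w c₁ (u<v , u<w) ; wvu = sided-> (suc zero) {v} {w} {u} v<w c₁ (u<v , u<w)
    ; uwv = sided-< (suc (suc zero)) {u} {w} {v} u<w c₂ (inj₁ (u<v , v<w)) ; wuv = sided-> (suc (suc zero)) {u} {w} {v} u<w c₂ (inj₁ (u<v , v<w)) }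
    where
    ordered = ∧-split {earlier u v} {earlier v w} (proj₁ (∧-split o))
    colour₁ = ∧-split {coloured zero u v} (proj₂ (∧-split {earlier u v ∧ earlier v w} o))
    c₀ = proj₁ colour₁
    c₁ = proj₁ (∧-split {coloured (suc zero) v w} (proj₂ colour₁))
    c₂ = proj₂ (∧-split {coloured (suc zero) v w} (proj₂ colour₁))
    u<v : position u < position v
    u<v = <ᵇ⇒< (position u) (position v) (subst Data.Bool.T (sym (proj₁ ordered)) tt)
    v<w : position v < position w
    v<w = <ᵇ⇒< (position v) (position w) (subst Data.Bool.T (sym (proj₂ ordered)) tt)
    u<w : position u < position w
    u<w = <-trans u<v v<w

  Sided′ : Fin n → Fin n → Fin n → Set
  Sided′ x y z = Sided (vertexAt x) (vertexAt y) (vertexAt z)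

  -- Being distinct, the three vertices are a permutation of the ordered triple that witnesses the
  -- edge, and `AllSided` covers all six arrangements. The two rotations returned are enough for
  -- every pair considered in `H`.
  edge-sided : ∀ x y z → x ≢ y → y ≢ z → x ≢ z → IsEdge graph (triple x y z) → Sided′ x y z × Sided′ y z x
  edge-sided x y z x≢y y≢z x≢z (_ , inGraph) = from (any-witness (spans (triple x y z)) (vertices n ⊗ vertices n ⊗ vertices n) inGraph)
    where
    from : (∃[ t ] spans (triple x y z) t ≡ true) → Sided′ x y z × Sided′ y z x
    from ((u , v , w) , eq) = match (∈-triple (moved (proj₁ ∋xyz))) (∈-triple (moved (proj₁ (proj₂ ∋xyz)))) (∈-triple (moved (proj₂ (proj₂ ∋xyz))))
      where
      same-triple : triple x y z ≡ triple u v w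
      same-triple = does-true (Vec.≡-dec Data.Bool._≟_ (triple x y z) (triple u v w)) (proj₁ (∧-split eq))
      ∋xyz = triple-∋ x y z
      moved : ∀ {t} → t Subset.∈ triple x y z → t Subset.∈ triple u v w
      moved {t} = subst (t Subset.∈_) same-triple
      open AllSided (oriented⇒sided (vertexAt u) (vertexAt v) (vertexAt w) (proj₂ (∧-split {does (Vec.≡-dec Data.Bool._≟_ (triple x y z) (triple u v w))} eq)))
      match : x ≡ u ⊎ x ≡ v ⊎ x ≡ w → y ≡ u ⊎ y ≡ v ⊎ y ≡ w → z ≡ u ⊎ z ≡ v ⊎ z ≡ w → Sided′ x y z × Sided′ y z x
      match (inj₁ p)        (inj₁ q)        _               = contradiction (trans p (sym q)) x≢y
      match (inj₁ p)        (inj₂ (inj₁ q)) (inj₁ r)        = contradiction (trans p (sym r)) x≢z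
      match (inj₁ p)        (inj₂ (inj₁ q)) (inj₂ (inj₁ r)) = contradiction (trans q (sym r)) y≢z
      match (inj₁ refl)     (inj₂ (inj₁ refl)) (inj₂ (inj₂ refl)) = uvw , vwu
      match (inj₁ p)        (inj₂ (inj₂ q)) (inj₁ r)        = contradiction (trans p (sym r)) x≢z
      match (inj₁ refl)     (inj₂ (inj₂ refl)) (inj₂ (inj₁ refl)) = uwv , wvu
      match (inj₁ p)        (inj₂ (inj₂ q)) (inj₂ (inj₂ r)) = contradiction (trans q (sym r)) y≢z
      match (inj₂ (inj₁ p)) (inj₂ (inj₁ q)) _               = contradiction (trans p (sym q)) x≢y
      match (inj₂ (inj₁ p)) (inj₁ q)        (inj₁ r)        = contradiction (trans q (sym r)) y≢z
      match (inj₂ (inj₁ p)) (inj₁ q)        (inj₂ (inj₁ r)) = contradiction (trans p (sym r)) x≢z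
      match (inj₂ (inj₁ refl)) (inj₁ refl)  (inj₂ (inj₂ refl)) = vuw , uwv
      match (inj₂ (inj₁ refl)) (inj₂ (inj₂ refl)) (inj₁ refl) = vwu , wuv
      match (inj₂ (inj₁ p)) (inj₂ (inj₂ q)) (inj₂ (inj₁ r)) = contradiction (trans p (sym r)) x≢z
      match (inj₂ (inj₁ p)) (inj₂ (inj₂ q)) (inj₂ (inj₂ r)) = contradiction (trans q (sym r)) y≢z
      match (inj₂ (inj₂ p)) (inj₂ (inj₂ q)) _               = contradiction (trans p (sym q)) x≢y
      match (inj₂ (inj₂ p)) (inj₁ q)        (inj₁ r)        = contradiction (trans q (sym r)) y≢z
      match (inj₂ (inj₂ refl)) (inj₁ refl)  (inj₂ (inj₁ refl)) = wuv , uvw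
      match (inj₂ (inj₂ p)) (inj₁ q)        (inj₂ (inj₂ r)) = contradiction (trans p (sym r)) x≢z
      match (inj₂ (inj₂ refl)) (inj₂ (inj₁ refl)) (inj₁ refl) = wvu , vuw
      match (inj₂ (inj₂ p)) (inj₂ (inj₁ q)) (inj₂ (inj₁ r)) = contradiction (trans q (sym r)) y≢z
      match (inj₂ (inj₂ p)) (inj₂ (inj₁ q)) (inj₂ (inj₂ r)) = contradiction (trans p (sym r)) x≢z

  graph-H-free : ¬ ContainsH graph
  graph-H-free (φ , injective , (abc ∷ ade ∷ bcd ∷ bcf ∷ cde ∷ def ∷ abg ∷ cdg ∷ efg ∷ [])) = [ forwards , backwards ]′ (proj₂ (proj₁ s-cde))
    where
    𝐚 𝐛 𝐜 𝐝 𝐞 𝐟 𝐠 : Fin 7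
    𝐚 = zero
    𝐛 = suc zero
    𝐜 = suc (suc zero)
    𝐝 = suc (suc (suc zero))
    𝐞 = suc (suc (suc (suc zero)))
    𝐟 = suc (suc (suc (suc (suc zero))))
    𝐠 = suc (suc (suc (suc (suc (suc zero)))))
    sided : ∀ i j k → i ≢ j → j ≢ k → i ≢ k → IsEdge graph (triple (φ i) (φ j) (φ k)) → Sided′ (φ i) (φ j) (φ k) × Sided′ (φ j) (φ k) (φ i)
    sided i j k i≢j j≢k i≢k = edge-sided (φ i) (φ j) (φ k) (i≢j ∘ injective) (j≢k ∘ injective) (i≢k ∘ injective)
    s-abc = sided 𝐚 𝐛 𝐜 (λ ()) (λ ()) (λ ()) abc
    s-ade = sided 𝐚 𝐝 𝐞 (λ ()) (λ ()) (λ ()) ade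
    s-bcd = sided 𝐛 𝐜 𝐝 (λ ()) (λ ()) (λ ()) bcd
    s-bcf = sided 𝐛 𝐜 𝐟 (λ ()) (λ ()) (λ ()) bcf
    s-cde = sided 𝐜 𝐝 𝐞 (λ ()) (λ ()) (λ ()) cde
    s-def = sided 𝐝 𝐞 𝐟 (λ ()) (λ ()) (λ ()) def
    s-abg = sided 𝐚 𝐛 𝐠 (λ ()) (λ ()) (λ ()) abg
    s-cdg = sided 𝐜 𝐝 𝐠 (λ ()) (λ ()) (λ ()) cdg
    s-efg = sided 𝐞 𝐟 𝐠 (λ ()) (λ ()) (λ ()) efg
    at : Fin 7 → ℕ
    at i = position (vertexAt (φ i))
    side : Fin 7 → Fin 7 → Side
    side i j = pairSide (vertexAt (φ i)) (vertexAt (φ j))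
    forwards : at 𝐜 < at 𝐝 → ⊥
    forwards = Sides.impossible _<_ <-trans (<-irrefl refl) (side 𝐚 𝐛) (side 𝐛 𝐜) (side 𝐜 𝐝) (side 𝐝 𝐞) (side 𝐞 𝐟)
      (proj₁ (proj₁ s-abc)) (proj₁ (proj₁ s-abg)) (proj₁ (proj₂ s-abc)) (proj₁ (proj₁ s-bcd)) (proj₁ (proj₁ s-bcf))
      (proj₁ (proj₂ s-bcd)) (proj₁ (proj₁ s-cde)) (proj₁ (proj₁ s-cdg)) (proj₁ (proj₂ s-ade)) (proj₁ (proj₂ s-cde)) (proj₁ (proj₁ s-def))
      (proj₁ (proj₂ s-def)) (proj₁ (proj₁ s-efg))
    flipped : ∀ i j {k} → Place _<_ (side i j) (at i) (at j) k → Place (λ x y → y < x) (mirror (side i j)) (at i) (at j) k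
    flipped i j = place-mirror (side i j)
    backwards : at 𝐝 < at 𝐜 → ⊥
    backwards = Sides.impossible (λ x y → y < x) (λ p q → <-trans q p) (<-irrefl refl)
      (mirror (side 𝐚 𝐛)) (mirror (side 𝐛 𝐜)) (mirror (side 𝐜 𝐝)) (mirror (side 𝐝 𝐞)) (mirror (side 𝐞 𝐟))
      (flipped 𝐚 𝐛 (proj₁ (proj₁ s-abc))) (flipped 𝐚 𝐛 (proj₁ (proj₁ s-abg))) (flipped 𝐛 𝐜 (proj₁ (proj₂ s-abc))) (flipped 𝐛 𝐜 (proj₁ (proj₁ s-bcd))) (flipped 𝐛 𝐜 (proj₁ (proj₁ s-bcf)))
      (flipped 𝐜 𝐝 (proj₁ (proj₂ s-bcd))) (flipped 𝐜 𝐝 (proj₁ (proj₁ s-cde))) (flipped 𝐜 𝐝 (proj₁ (proj₁ s-cdg))) (flipped 𝐝 𝐞 (proj₁ (proj₂ s-ade))) (flipped 𝐝 𝐞 (proj₁ (proj₂ s-cde))) (flipped 𝐝 𝐞 (proj₁ (proj₁ s-def)))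
      (flipped 𝐞 𝐟 (proj₁ (proj₂ s-def))) (flipped 𝐞 𝐟 (proj₁ (proj₁ s-efg)))

-- Density of the construction.

∑-elements-≤ : ∀ {n} (W : Subset n) (φ : Fin n → ℕ) → ∑ (elements W) φ ≤ ∑ (vertices n) φ
∑-elements-≤ Vec.[]              φ = z≤n
∑-elements-≤ {suc n} (inside Vec.∷ W)  φ = +-monoʳ-≤ (φ zero) (subst₂ _≤_ (sym (∑-map suc (elements W) φ)) (sym (∑-map suc (vertices n) φ)) (∑-elements-≤ W (φ ∘ suc)))
∑-elements-≤ {suc n} (outside Vec.∷ W) φ = ≤-trans (subst₂ _≤_ (sym (∑-map suc (elements W) φ)) (sym (∑-map suc (vertices n) φ)) (∑-elements-≤ W (φ ∘ suc))) (m≤n+m _ (φ zero))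

∑-lookup : {A : Set} (xs : List A) (φ : A → ℕ) → (∑[ v ← vertices (length xs) ] φ (List.lookup xs v)) ≡ ∑ xs φ
∑-lookup []       φ = refl
∑-lookup (x ∷ xs) φ = cong (φ x +_) (trans (∑-map suc (vertices (length xs)) _) (∑-lookup xs φ))

card-insert : ∀ {n} (x : Fin n) (S : Subset n) → ¬ x Subset.∈ S → card (⁅ x ⁆ ∪ S) ≡ suc (card S)
card-insert zero    (inside Vec.∷ S)  x∉ = contradiction Vec.here x∉
card-insert zero    (outside Vec.∷ S) x∉ = cong (suc ∘ card) (∪-identityˡ S)
card-insert (suc x) (inside Vec.∷ S)  x∉ = cong suc (card-insert x S (x∉ ∘ Vec.there))
card-insert (suc x) (outside Vec.∷ S) x∉ = card-insert x S (x∉ ∘ Vec.there)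

card-triple : ∀ {n} (x y z : Fin n) → x ≢ y → y ≢ z → x ≢ z → card (triple x y z) ≡ 3
card-triple x y z x≢y y≢z x≢z = trans (card-insert x (⁅ y ⁆ ∪ ⁅ z ⁆) ([ x≢y ∘ x∈⁅y⁆⇒x≡y _ , x≢z ∘ x∈⁅y⁆⇒x≡y _ ]′ ∘ x∈p∪q⁻ ⁅ y ⁆ ⁅ z ⁆))
  (cong suc (trans (card-insert y ⁅ z ⁆ (y≢z ∘ x∈⁅y⁆⇒x≡y _)) (cong suc (∣⁅x⁆∣≡1 z))))

2duo≤ : {A : Set} (xs : List A) → 2 * duo (λ _ _ → 1) xs ≤ length xs * length xs
2duo≤ []       = z≤n
2duo≤ (x ∷ xs) = begin
  2 * (duo (λ _ _ → 1) xs + (∑[ y ← xs ] 1)) ≡⟨ cong (λ t → 2 * (duo (λ _ _ → 1) xs + t)) (trans (∑-const xs 1) (*-identityʳ l)) ⟩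
  2 * (duo (λ _ _ → 1) xs + l)               ≡⟨ *-distribˡ-+ 2 (duo (λ _ _ → 1) xs) l ⟩
  2 * duo (λ _ _ → 1) xs + 2 * l             ≤⟨ +-monoˡ-≤ (2 * l) (2duo≤ xs) ⟩
  l * l + 2 * l                              ≤⟨ n≤1+n _ ⟩
  suc (l * l + 2 * l)                        ≡⟨ e l ⟩
  suc l * suc l                              ∎
  where
  open ≤-Reasoning
  l = length xs
  e : ∀ l → suc (l * l + 2 * l) ≡ suc l * suc l
  e = solve-∀

6tri≤ : {A : Set} (xs : List A) → 6 * tri (λ _ _ _ → 1) xs ≤ length xs * length xs * length xs
6tri≤ []       = z≤n
6tri≤ (x ∷ xs) = begin
  6 * (tri (λ _ _ _ → 1) xs + duo (λ _ _ → 1) xs)       ≡⟨ e₁ (tri (λ _ _ _ → 1) xs) (duo (λ _ _ → 1) xs) ⟩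
  6 * tri (λ _ _ _ → 1) xs + 3 * (2 * duo (λ _ _ → 1) xs) ≤⟨ +-mono-≤ (6tri≤ xs) (*-monoʳ-≤ 3 (2duo≤ xs)) ⟩
  l * l * l + 3 * (l * l)                                ≤⟨ m≤m+n _ (3 * l + 1) ⟩
  l * l * l + 3 * (l * l) + (3 * l + 1)                  ≡⟨ e₂ l ⟩
  suc l * suc l * suc l                                  ∎
  where
  open ≤-Reasoning
  l = length xs
  e₁ : ∀ t d → 6 * (t + d) ≡ 6 * t + 3 * (2 * d)
  e₁ = solve-∀
  e₂ : ∀ l → l * l * l + 3 * (l * l) + (3 * l + 1) ≡ suc l * suc l * suc l
  e₂ = solve-∀

module PaletteDensity (B m r : ℕ) (r≤B : r ≤ B) (m-large : 2 * (r * r) ≤ m) where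

  open Construction B m
  open PaletteGraph B m

  private
    O : Fin n → Fin n → Fin n → ℕ
    O x y z = 𝟙 (oriented (vertexAt x) (vertexAt y) (vertexAt z))

    six : Fin n → Fin n → Fin n → ℕ
    six x y z = O x y z + O x z y + (O y x z + O y z x) + (O z x y + O z y x)

    earlier-irrefl : ∀ {x y} → earlier (vertexAt x) (vertexAt y) ≡ true → x ≢ y
    earlier-irrefl {x} e refl = <-irrefl refl (<ᵇ⇒< (position (vertexAt x)) (position (vertexAt x)) (subst Data.Bool.T (sym e) tt))

    oriented-edge : ∀ x y z → O x y z ≤ 𝟙 (edge graph x y z)
    oriented-edge x y z with oriented (vertexAt x) (vertexAt y) (vertexAt z) in o
    ... | false = z≤n
    ... | true  = ≤-reflexive (sym (cong 𝟙 (cong₂ _∧_ (graph-intro x y z o) (three (card-triple x y z (earlier-irrefl x<y) (earlier-irrefl y<z) x≢z)))))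
      where
      ordered = ∧-split {earlier (vertexAt x) (vertexAt y)} {earlier (vertexAt y) (vertexAt z)} (proj₁ (∧-split o))
      x<y = proj₁ ordered
      y<z = proj₂ ordered
      pos< : ∀ u v → earlier (vertexAt u) (vertexAt v) ≡ true → position (vertexAt u) < position (vertexAt v)
      pos< u v e = <ᵇ⇒< (position (vertexAt u)) (position (vertexAt v)) (subst Data.Bool.T (sym e) tt)
      x≢z : x ≢ z
      x≢z refl = <-asym (pos< x y x<y) (pos< y x y<z)
      three : ∀ {k} → k ≡ 3 → does (k ≟ 3) ≡ true
      three refl = refl

    -- The hypotheses exclude mutual precedence and both cyclic orders; a check of the truth values
    -- shows that at most one of the six linear orders remains.
    exclusive : ∀ xy yx yz zy xz zx → (xy ≡ true → yx ≡ true → ⊥) → (yz ≡ true → zy ≡ true → ⊥) → (xz ≡ true → zx ≡ true → ⊥) →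
      (xy ≡ true → yz ≡ true → zx ≡ true → ⊥) → (yx ≡ true → zy ≡ true → xz ≡ true → ⊥) →
      𝟙 xy * 𝟙 yz + 𝟙 xz * 𝟙 zy + (𝟙 yx * 𝟙 xz + 𝟙 yz * 𝟙 zx) + (𝟙 zx * 𝟙 xy + 𝟙 zy * 𝟙 yx) ≤ 1
    exclusive true  true  _     _     _     _     h _ _ _ _ = ⊥-elim (h refl refl)
    exclusive _     _     true  true  _     _     _ h _ _ _ = ⊥-elim (h refl refl)
    exclusive _     _     _     _     true  true  _ _ h _ _ = ⊥-elim (h refl refl)
    exclusive true  false true  false _     true  _ _ _ h _ = ⊥-elim (h refl refl refl)
    exclusive true  false true  false true  false _ _ _ _ _ = s≤s z≤n
    exclusive true  false true  false false false _ _ _ _ _ = s≤s z≤n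
    exclusive true  false false true  true  false _ _ _ _ _ = s≤s z≤n
    exclusive true  false false true  false true  _ _ _ _ _ = s≤s z≤n
    exclusive true  false false true  false false _ _ _ _ _ = z≤n
    exclusive true  false false false true  false _ _ _ _ _ = z≤n
    exclusive true  false false false false true  _ _ _ _ _ = s≤s z≤n
    exclusive true  false false false false false _ _ _ _ _ = z≤n
    exclusive false true  false true  true  _     _ _ _ _ h = ⊥-elim (h refl refl refl)
    exclusive false true  false true  false true  _ _ _ _ _ = s≤s z≤n
    exclusive false true  false true  false false _ _ _ _ _ = s≤s z≤n
    exclusive false true  true  false true  false _ _ _ _ _ = s≤s z≤n
    exclusive false true  true  false false true  _ _ _ _ _ = s≤s z≤n
    exclusive false true  true  false false false _ _ _ _ _ = z≤n
    exclusive false true  false false true  false _ _ _ _ _ = s≤s z≤n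
    exclusive false true  false false false true  _ _ _ _ _ = z≤n
    exclusive false true  false false false false _ _ _ _ _ = z≤n
    exclusive false false true  false true  false _ _ _ _ _ = z≤n
    exclusive false false true  false false true  _ _ _ _ _ = s≤s z≤n
    exclusive false false true  false false false _ _ _ _ _ = z≤n
    exclusive false false false true  true  false _ _ _ _ _ = s≤s z≤n
    exclusive false false false true  false true  _ _ _ _ _ = z≤n
    exclusive false false false true  false false _ _ _ _ _ = z≤n
    exclusive false false false false true  false _ _ _ _ _ = z≤n
    exclusive false false false false false true  _ _ _ _ _ = z≤n
    exclusive false false false false false false _ _ _ _ _ = z≤n

    oriented≤order : ∀ x y z → O x y z ≤ 𝟙 (earlier (vertexAt x) (vertexAt y)) * 𝟙 (earlier (vertexAt y) (vertexAt z))
    oriented≤order x y z = ≤-trans (≤-reflexive (𝟙-∧ (earlier X Y ∧ earlier Y Z) _)) (≤-trans (*-monoʳ-≤ (𝟙 (earlier X Y ∧ earlier Y Z)) (𝟙≤1 _)) (≤-reflexive (trans (*-identityʳ _) (𝟙-∧ (earlier X Y) (earlier Y Z)))))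
      where
      X = vertexAt x
      Y = vertexAt y
      Z = vertexAt z

    six≤1 : ∀ x y z → six x y z ≤ 1
    six≤1 x y z = ≤-trans
      (+-mono-≤ (+-mono-≤ (+-mono-≤ (oriented≤order x y z) (oriented≤order x z y)) (+-mono-≤ (oriented≤order y x z) (oriented≤order y z x))) (+-mono-≤ (oriented≤order z x y) (oriented≤order z y x)))
      (exclusive (before x y) (before y x) (before y z) (before z y) (before x z) (before z x)
        (λ p q → <-asym (lt x y p) (lt y x q)) (λ p q → <-asym (lt y z p) (lt z y q)) (λ p q → <-asym (lt x z p) (lt z x q))
        (λ p q s → <-asym (<-trans (lt x y p) (lt y z q)) (lt z x s)) (λ p q s → <-asym (<-trans (lt z y q) (lt y x p)) (lt x z s)))
      where
      before : Fin n → Fin n → Bool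
      before u v = earlier (vertexAt u) (vertexAt v)
      lt : ∀ u v → before u v ≡ true → position (vertexAt u) < position (vertexAt v)
      lt u v e = <ᵇ⇒< (position (vertexAt u)) (position (vertexAt v)) (subst Data.Bool.T (sym e) tt)

    -- Only one arrangement of an edge can be properly coloured. Hence a properly coloured ordered
    -- triple is worth a whole edge, and the factor 6 cancels in `many-edges`.
    six≤edge : ∀ x y z → six x y z ≤ 𝟙 (edge graph x y z)
    six≤edge x y z = bound (edge graph x y z) refl
      where
      at-most : ∀ u v w → edge graph u v w ≡ edge graph x y z → edge graph x y z ≡ false → O u v w ≤ 0
      at-most u v w eq none = ≤-trans (oriented-edge u v w) (≤-reflexive (cong 𝟙 (trans eq none)))
      bound : ∀ b → edge graph x y z ≡ b → six x y z ≤ 𝟙 b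
      bound true  _  = six≤1 x y z
      bound false none = +-mono-≤ (+-mono-≤ (+-mono-≤ (at-most x y z refl none) (at-most x z y (edge-swapʳ graph x z y) none))
        (+-mono-≤ (at-most y x z (edge-swapˡ graph y x z) none) (at-most y z x (trans (edge-swapʳ graph y z x) (edge-swapˡ graph y x z)) none)))
        (+-mono-≤ (at-most z x y (trans (edge-swapˡ graph z x y) (edge-swapʳ graph x z y)) none) (at-most z y x (trans (edge-rotate graph z y x) (edge-swapˡ graph y x z)) none))

  module _ (W : Subset n) where

    private
      ws : List (Fin n)
      ws = elements W

      Y : List Vertex
      Y = map vertexAt ws

      Y≤ : ∀ φ → ∑ Y φ ≤ ∑ allVertices φ
      Y≤ φ = ≤-trans (≤-reflexive (∑-map vertexAt ws φ)) (≤-trans (∑-elements-≤ W (φ ∘ vertexAt)) (≤-reflexive (∑-lookup allVertices φ)))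

      total : (Fin n → Fin n → Fin n → ℕ) → ℕ
      total h = ∑[ x ← ws ] ∑[ y ← ws ] ∑[ z ← ws ] h x y z

      total-+ : ∀ h h′ → total (λ x y z → h x y z + h′ x y z) ≡ total h + total h′
      total-+ h h′ = trans (∑-cong ws (λ x → ∑₂-+ ws ws (h x) (h′ x))) (∑-+ ws _ _)

      count-oriented : tripleCount Y Y≤ r m-large ≡ total O
      count-oriented = trans (∑-map vertexAt ws _) (∑-cong ws (λ x → trans (∑-map vertexAt ws _) (∑-cong ws (λ y → trans (∑-map vertexAt ws _) (∑-cong ws (λ z → indicator (vertexAt x) (vertexAt y) (vertexAt z)))))))
        where
        product : ∀ a b c d e → 𝟙 b * 𝟙 d * (𝟙 a * (𝟙 e * 𝟙 c)) ≡ 𝟙 ((a ∧ b) ∧ (c ∧ (d ∧ e)))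
        product a b c d e = sym (trans (𝟙-∧ (a ∧ b) (c ∧ (d ∧ e))) (trans (cong₂ _*_ (𝟙-∧ a b) (trans (𝟙-∧ c (d ∧ e)) (cong (𝟙 c *_) (𝟙-∧ d e)))) (arrange (𝟙 a) (𝟙 b) (𝟙 c) (𝟙 d) (𝟙 e))))
          where
          arrange : ∀ a b c d e → a * b * (c * (d * e)) ≡ b * d * (a * (e * c))
          arrange = solve-∀
        indicator : ∀ x y z → 𝟙 (earlier y z) * 𝟙 (coloured (suc zero) y z) * (𝟙 (earlier x y) * (𝟙 (coloured (suc (suc zero)) x z) * 𝟙 (coloured zero x y))) ≡ 𝟙 (oriented x y z)
        indicator x y z = product (earlier x y) (earlier y z) (coloured zero x y) (coloured (suc zero) y z) (coloured (suc (suc zero)) x z)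

      total-six : total six ≡ 6 * total O
      total-six = trans (trans (total-+ _ _) (cong₂ _+_ (trans (total-+ _ _) (cong₂ _+_ (total-+ _ _) (total-+ _ _))) (total-+ _ _)))
        (trans (cong₂ _+_ (cong₂ _+_ (cong (total O +_) (swapʳ O)) (cong₂ _+_ (swapˡ O) (trans (swapˡ (λ x y z → O x z y)) (swapʳ O)))) (cong₂ _+_ (trans (swapʳ (λ x y z → O y x z)) (swapˡ O)) (trans (swapˡ (λ x y z → O z x y)) (trans (swapʳ (λ x y z → O y x z)) (swapˡ O)))))
          (d (total O)))
        where
        swapʳ : ∀ h → total (λ x y z → h x z y) ≡ total h
        swapʳ h = ∑-cong ws (λ x → ∑-swap ws ws _)
        swapˡ : ∀ h → total (λ x y z → h y x z) ≡ total h
        swapˡ h = ∑-swap ws ws _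
        d : ∀ t → t + t + (t + t) + (t + t) ≡ 6 * t
        d = solve-∀

      many-edges : tripleCount Y Y≤ r m-large ≤ edgesIn graph W
      many-edges = *-cancelˡ-≤ 6 (begin
        6 * tripleCount Y Y≤ r m-large ≡⟨ cong (6 *_) count-oriented ⟩
        6 * total O           ≡⟨ sym total-six ⟩
        total six             ≤⟨ ∑-mono ws (λ x → ∑₂-mono ws ws (six≤edge x)) ⟩
        total (λ x y z → 𝟙 (edge graph x y z))
          ≡⟨ ∑₃≡6tri _ ws (λ x y z → cong 𝟙 (edge-swapˡ graph x y z)) (λ x y z → cong 𝟙 (edge-swapʳ graph x y z)) (λ x z → cong 𝟙 (edge-diagonal graph x z)) ⟩
        6 * tri (λ x y z → 𝟙 (edge graph x y z)) ws ≡⟨ cong (6 *_) (sym (edgesIn≡tri graph W)) ⟩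
        6 * edgesIn graph W   ∎)
        where open ≤-Reasoning

    density : r * (card W choose 3) ≤ 27 * (r * edgesIn graph W) + 27 * (n * n * n)
    density = combine (tripleCount Y Y≤ r m-large) (edgesIn graph W) (card W choose 3) (length ws) (length Y) six-tri (sym (length-map vertexAt ws)) (many-triples Y Y≤ r m-large r≤B) many-edges length-allVertices
      where
      six-tri : 6 * (card W choose 3) ≤ length ws * length ws * length ws
      six-tri = subst (λ k → 6 * k ≤ length ws * length ws * length ws) (trans (tri-1 ws) (cong (_choose 3) (length-elements W))) (6tri≤ ws)
      combine : ∀ t e c l l′ {s k} → 6 * c ≤ l * l * l → l ≡ l′ → r * (l′ * l′ * l′) ≤ 162 * (r * t) + 81 * (s * s * s) → t ≤ e → k ≡ s →
        r * c ≤ 27 * (r * e) + 27 * (k * k * k)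
      combine t e c l .l {s} six refl triples t≤e refl = *-cancelˡ-≤ 6 (begin
        6 * (r * c)                                ≡⟨ d₁ r c ⟩
        r * (6 * c)                                ≤⟨ *-monoʳ-≤ r six ⟩
        r * (l * l * l)                            ≤⟨ triples ⟩
        162 * (r * t) + 81 * (s * s * s)           ≤⟨ +-mono-≤ (*-monoʳ-≤ 162 (*-monoʳ-≤ r t≤e)) (*-monoˡ-≤ (s * s * s) (m≤m+n 81 81)) ⟩
        162 * (r * e) + 162 * (s * s * s)          ≡⟨ d₂ (r * e) (s * s * s) ⟩
        6 * (27 * (r * e) + 27 * (s * s * s))      ∎)
        where
        open ≤-Reasoning
        d₁ : ∀ r c → 6 * (r * c) ≡ r * (6 * c)
        d₁ = solve-∀
        d₂ : ∀ e c → 162 * e + 162 * c ≡ 6 * (27 * e + 27 * c)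
        d₂ = solve-∀

-- The value of the uniform Turán density.

achievable-1/27 : Achievable ((pos 1) ℚ./ 27)
achievable-1/27 = from-yes (0ℚ ℚ.≤? (pos 1) ℚ./ 27) , from-yes ((pos 1) ℚ./ 27 ℚ.≤? 1ℚ) , construct
  where
  -- A positive `ε` is at least the reciprocal of its denominator, so an error `1 / r` with this
  -- denominator as `r` is good enough.
  bound⇒Dense : ∀ p r-1 .(c : Coprime (suc p) (suc r-1)) {n} (G : ThreeGraph n) →
    (∀ W → suc r-1 * (card W choose 3) ≤ 27 * (suc r-1 * edgesIn G W) + 27 * (n * n * n)) → Dense ((pos 1) ℚ./ 27) (mkℚ (pos (suc p)) r-1 c) G
  bound⇒Dense p r-1 c {n} G bound W = ℕ⇒density 1 26 (1-coprimeTo 27) (suc p) r-1 c (card W choose 3) (n ^ 3) (edgesIn G W) (scale (card W choose 3) (edgesIn G W) (bound W))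
    where
    r = suc r-1
    d₁ : ∀ c r → 1 * c * r ≡ r * c
    d₁ = solve-∀
    d₂ : ∀ r e p n → 27 * (r * e) + 27 * (p * (n * n * n)) ≡ e * (27 * r) + p * (n * (n * (n * 1))) * 27
    d₂ = solve-∀
    open ≤-Reasoning
    scale : ∀ t e → r * t ≤ 27 * (r * e) + 27 * (n * n * n) → 1 * t * r ≤ e * (27 * r) + suc p * n ^ 3 * 27
    scale t e h = begin
      1 * t * r                                  ≡⟨ d₁ t r ⟩
      r * t                                      ≤⟨ h ⟩
      27 * (r * e) + 27 * (n * n * n)            ≤⟨ +-monoʳ-≤ (27 * (r * e)) (*-monoʳ-≤ 27 (m≤n*m (n * n * n) (suc p))) ⟩
      27 * (r * e) + 27 * (suc p * (n * n * n))  ≡⟨ d₂ r e (suc p) n ⟩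
      e * (27 * r) + suc p * n ^ 3 * 27          ∎
  witness : ∀ p r-1 .(c : Coprime (suc p) (suc r-1)) N {n} (G : ThreeGraph n) → N ≤ n →
    (∀ W → suc r-1 * (card W choose 3) ≤ 27 * (suc r-1 * edgesIn G W) + 27 * (n * n * n)) → ¬ ContainsH G →
    ∃[ n ] N ≤ n × Σ (ThreeGraph n) λ G → Dense ((pos 1) ℚ./ 27) (mkℚ (pos (suc p)) r-1 c) G × ¬ ContainsH G
  witness p r-1 c N {n} G large bound free = n , large , G , bound⇒Dense p r-1 c G bound , free
  family : ∀ p r-1 .(c : Coprime (suc p) (suc r-1)) N B m → N ≤ B → suc r-1 ≤ B → 2 * (suc r-1 * suc r-1) ≤ m → 1 ≤ m →
    ∃[ n ] N ≤ n × Σ (ThreeGraph n) λ G → Dense ((pos 1) ℚ./ 27) (mkℚ (pos (suc p)) r-1 c) G × ¬ ContainsH G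
  family p r-1 c N B m N≤B r≤B m-large 1≤m = witness p r-1 c N graph large (PaletteDensity.density B m (suc r-1) r≤B m-large) graph-H-free
    where
    open PaletteGraph B m
    open Construction B m using (length-allVertices)
    large : N ≤ n
    large = begin
      N                   ≤⟨ N≤B ⟩
      B                   ≡⟨ sym (*-identityʳ B) ⟩
      B * 1               ≤⟨ *-monoʳ-≤ B (*-mono-≤ {1} {m} 1≤m (m^n>0 3 m)) ⟩
      B * (m * 3 ^ m)     ≡⟨ sym length-allVertices ⟩
      n                   ∎
      where open ≤-Reasoning
  construct : ∀ ε → 0ℚ ℚ.< ε → ∀ N → ∃[ n ] N ≤ n × Σ (ThreeGraph n) λ G → Dense ((pos 1) ℚ./ 27) ε G × ¬ ContainsH G
  construct (mkℚ (pos zero)    r-1 c) (ℚ.*<* (ℤ.+<+ ())) N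
  -- The number of blocks exceeds `r` to make ties rare and `N` to make the 3-graph large; the
  -- number of points is what `deviation-small` demands.
  construct (mkℚ (pos (suc p)) r-1 c) _                  N = family p r-1 c N (suc r-1 + N) (2 * (suc r-1 * suc r-1)) (m≤n+m N (suc r-1)) (m≤m+n (suc r-1) N) ≤-refl (s≤s z≤n)
  construct (mkℚ -[1+ p ]      r-1 c) (ℚ.*<* ())         N

theorem5p3 : UniformTuranDensityH≡ ((pos 1) ℚ./ 27)
theorem5p3 = upper-bound , λ t t<1/27 → (pos 1) ℚ./ 27 , achievable-1/27 , t<1/27
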